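{- Let $0\le k\le n$, $n\ge1$. For Young diagrams $\lambda,\mu$ in the $k\times(n-k)$ rectangle, let $c_{\lambda,\mu}^{\,\,\nu}(\vec y)$ be the coefficients defined by the identity in $K_T(Gr(k,n))$ $$G_\lambda(\bar x;\vec y)\,G_\mu(\bar x;\vec y)=\sum_\nu c_{\lambda,\mu}^{\,\,\nu}(\vec y)\,G_\nu(\bar x;\vec y),$$ where $\nu$ runs over Young diagrams in the $k\times(n-k)$ rectangle. Then for all such $\lambda,\mu,\nu$, $c_{\lambda,\mu}^{\,\,\nu}(\vec y)$ equals the sum of the weights of all equivariant puzzles in a down-pointing equilateral triangle of side $n$ whose boundary is as follows: the left side, read from the top-left corner to the bottom corner, encodes $\lambda$; the right side, read from the bottom corner to the top-right corner, encodes $\mu$; the top horizontal side, read from left to right, encodes $\nu$. Here the parameter of an elementary lozenge is $w=y_i/y_j$, where, numbering the unit edges of the top side $1,\dots,n$ from left to right, $i$ is the number of the top edge reached from the centre of the lozenge by going straight up-left (direction $120^\circ$), and $j$ is the number of the top edge reached from the centre by going straight up-right (direction $60^\circ$); thus $1\le i<j\le n$.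
   Context: **Young diagrams.** Fix $0\le k\le n$. A Young diagram $\lambda$ (English convention) in the $k\times(n-k)$ rectangle ($k$ rows, $n-k$ columns) is encoded by its frame, a $k$-subset of $\{1,\dots,n\}$: follow the border of $\lambda$ from the bottom-left to the top-right corner of the rectangle in $n$ unit steps (up or right), and record $i$ if the $i$-th step is up. So $\varnothing$ has frame $\{1,\dots,k\}$ and the full rectangle has frame $\{n-k+1,\dots,n\}$. Write $i\in\lambda$ if $i$ is in the frame of $\lambda$; $\lambda^\ast$ is the diagram with frame $\{n+1-i: i\in\lambda\}$. **Polynomials.** Let $\bar x=(x_1,\dots,x_k)$, $\vec y=(y_1,\dots,y_n)$, $\overleftarrow{y}=(y_n,\dots,y_1)$. The double Grothendieck polynomials $G^\lambda(\bar x;\vec y)$ are defined inductively by $G^{\{n-k+1,\dots,n\}}(\bar x;\vec y)=\prod_{i=1}^k\prod_{j=1}^{n-k}(1-x_i/y_j)$ and $G^\mu=D_iG^\lambda$ whenever the frame of $\mu$ is obtained from that of $\lambda$ by replacing $i+1$ with $i$, where $D_if=\dfrac{y_if(\ldots,y_i,y_{i+1},\ldots)-y_{i+1}f(\ldots,y_{i+1},y_i,\ldots)}{y_i-y_{i+1}}$ acts on the $y$ variables. The dual polynomials are $G_\lambda(\bar x;\vec y)=\prod_{i=1}^kx_i\prod_{i\in\lambda}y_i^{ -1}\,G^{\lambda^\ast}(\bar x;\overleftarrow{y})$. **Ring.** $K_T(Gr(k,n))$ is the quotient of $\mathbb Z[x_1^{\pm1},\dots,x_k^{\pm1},y_1^{\pm1},\dots,y_n^{\pm1}]^{\mathcal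 S_k}$ ($\mathcal S_k$ permuting the $x_i$) by the ideal of elements that vanish whenever $(x_1,\dots,x_k)$ is specialized to $(y_{i_1},\dots,y_{i_k})$ for any $i_1<\dots<i_k$. It is known that the classes of the $G_\lambda(\bar x;\vec y)$ form a $\mathbb Z[y_1^{\pm1},\dots,y_n^{\pm1}]$-basis. **Equivariant puzzles.** Consider the triangular lattice of unit equilateral triangles with horizontal edges. Each unit triangle has a horizontal edge $h$, an edge $a$ in direction $60^\circ/240^\circ$ and an edge $b$ in direction $120^\circ/300^\circ$; for an up-pointing triangle $a$ is the left and $b$ the right edge; for a down-pointing triangle $a$ is the right and $b$ the left edge. Each edge has a state, a subset of $\{R,G\}$ (red, green), written $\emptyset,R,G,RG$. The allowed tiles, given by the states $(h,a,b)$, are $E=(\emptyset,\emptyset,\emptyset)$, $G_1=(G,G,\emptyset)$, $G_2=(G,RG,R)$, $R_1=(R,\emptyset,R)$, $R_2=(R,G,RG)$, $Q=(RG,G,R)$ (equivariant tile), for both up- and down-pointing triangles, and the $K$-tile $K=(\emptyset,RG,RG)$ for up-pointing triangles only. An equivariant puzzle in a domain is an assignment of an allowed tile to every unit triangle of the domain such that triangles sharing an edge assign it the same state. **Boundary conditions.** Horizontal boundary edges must be in state $R$ or $G$; boundary edges in direction $60^\circ/240^\circ$ in state $G$ or $\emptyset$; boundary edges in direction $120^\circ/300^\circ$ in state $R$ or $\emptyset$. A side of length $n$, read in a given direction, encodes the Young diagram whose frame is the set of positions (numbered $1,\dots,n$ along the reading direction) of the $G$ edges for horizontal and $60^\circ/240^\circ$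 sides, and of the $\emptyset$ edges for $120^\circ/300^\circ$ sides. **Weights.** An elementary lozenge is the union of an up-pointing unit triangle and the down-pointing unit triangle just below it, sharing a horizontal edge, both in the domain. Its weight depends on a parameter $w$ (depending on its location) and on its (upper tile, lower tile): $(G_2,G_1)$ has weight $w$; $(R_2,R_1)$ has weight $w$; $(Q,Q)$ has weight $1-w$; $(K,E)$ has weight $-w$; all the others, $(G_1,G_1),(G_1,G_2),(G_2,G_2),(R_1,R_1),(R_1,R_2),(R_2,R_2),(E,E)$, have weight $1$. The weight of an equivariant puzzle is the product of the weights of all its elementary lozenges (unit triangles not belonging to an elementary lozenge contribute no factor). -}

module Defs where

open import Data.Bool using (if_then_else_; true; false)
import Data.Bool.Properties as Bool
open import Data.Fin as Fin using (Fin; zero; suc; toℕ)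
open import Data.Fin.Permutation using (Permutation′; _⟨$⟩ʳ_)
open import Data.Fin.Subset using (Subset; Side; inside; outside; ∣_∣; ∁)
open import Data.Integer as ℤ using (ℤ; +_; -[1+_]; 0ℤ; 1ℤ; -1ℤ; _+_; _*_; _-_; -_)
import Data.Integer.Properties as ℤ
open import Data.Integer.Tactic.RingSolver using (solve-∀)
open import Data.List as List using (List; []; _∷_; _++_; foldr; cartesianProductWith)
open import Data.List.Relation.Unary.All as ListAll using ([]; _∷_)
open import Data.Nat as ℕ using (ℕ; zero; suc)
import Data.Nat.Properties as ℕ
open import Data.Product as Product using (_×_; _,_; proj₁; proj₂)
import Data.Product.Properties as Product
open import Data.Vec as Vec using (Vec; []; _∷_; lookup; _[_]≔_; _[_]%=_; replicate; zipWith)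
import Data.Vec.Properties as Vec
open import Data.Vec.Relation.Unary.All as VecAll using ([]; _∷_)
open import Data.Vec.Relation.Unary.AllPairs using (AllPairs; []; _∷_)
open import Data.Vec.Relation.Unary.Unique.Propositional using (Unique)
open import Data.Vec.Relation.Unary.Unique.Propositional.Properties using (tabulate⁺)
open import Function using (id; _∘_)
open import Relation.Binary using (DecidableEquality)
open import Relation.Binary.PropositionalEquality
open import Relation.Nullary using (Dec; does; yes; no)
open import Relation.Nullary.Decidable using (_×-dec_)

------------------------------------------------------------------------
-- Laurent polynomials

-- Formal ℤ-linear combinations.  The same basis element may be listed more
-- than once, so these are compared with _≈_ below and not with _≡_.
Combination : Set → Set
Combination A = List (ℤ × A)

scale : {A : Set} → ℤ → Combination A → Combination A
scale z = List.map (Product.map₁ (z *_))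

single : {A : Set} → A → Combination A
single a = (1ℤ , a) ∷ []

linear : {A B : Set} → (A → Combination B) → Combination A → Combination B
linear φ []            = []
linear φ ((z , a) ∷ f) = scale z (φ a) ++ linear φ f

-- The exponents of x₁,…,xₖ and those of y₁,…,yₙ.
Monomial : ℕ → ℕ → Set
Monomial k n = Vec ℤ k × Vec ℤ n

_≟ₘ_ : ∀ {k n} → DecidableEquality (Monomial k n)
_≟ₘ_ = Product.≡-dec (Vec.≡-dec ℤ._≟_) (Vec.≡-dec ℤ._≟_)

infixl 7 _·_
_·_ : ∀ {k n} → Monomial k n → Monomial k n → Monomial k n
(a , b) · (a′ , b′) = zipWith _+_ a a′ , zipWith _+_ b b′

-- ℤ[x₁^±1,…,xₖ^±1,y₁^±1,…,yₙ^±1]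
Laurent : ℕ → ℕ → Set
Laurent k n = Combination (Monomial k n)

coeff : ∀ {k n} → Laurent k n → Monomial k n → ℤ
coeff []            e = 0ℤ
coeff ((z , d) ∷ f) e = (if does (d ≟ₘ e) then z else 0ℤ) + coeff f e

infix 4 _≈_
record _≈_ {k n} (f g : Laurent k n) : Set where
  constructor mk≈
  field
    coeff-≡ : ∀ e → coeff f e ≡ coeff g e

infixl 6 _⊕_ _⊖_
infixl 7 _⊗_

0ᴸ 1ᴸ : ∀ {k n} → Laurent k n
0ᴸ = []
1ᴸ = single (replicate _ 0ℤ , replicate _ 0ℤ)

_⊕_ _⊖_ _⊗_ : ∀ {k n} → Laurent k n → Laurent k n → Laurent k n
f ⊕ g = f ++ g
f ⊖ g = f ++ scale -1ℤ g
f ⊗ g = linear (λ d → linear (λ e → single (d · e)) g) f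

x : ∀ {k n} → Fin k → Laurent k n
x i = single (replicate _ 0ℤ [ i ]≔ 1ℤ , replicate _ 0ℤ)

y y⁻¹ : ∀ {k n} → Fin n → Laurent k n
y   i = single (replicate _ 0ℤ , replicate _ 0ℤ [ i ]≔ 1ℤ)
y⁻¹ i = single (replicate _ 0ℤ , replicate _ 0ℤ [ i ]≔ -1ℤ)

∑ ∏ : ∀ {k n} {A : Set} → List A → (A → Laurent k n) → Laurent k n
∑ as f = foldr (λ a → f a ⊕_) 0ᴸ as
∏ as f = foldr (λ a → f a ⊗_) 1ᴸ as

-- The inclusion of ℤ[y^±1].
ι : ∀ {k n} → Laurent 0 n → Laurent k n
ι = linear (λ (_ , b) → single (replicate _ 0ℤ , b))

permuteX : ∀ {k n} → Permutation′ k → Laurent k n → Laurent k n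
permuteX σ = linear (λ (a , b) → single (Vec.tabulate (λ i → lookup a (σ ⟨$⟩ʳ i)) , b))

reverseY : ∀ {k n} → Laurent k n → Laurent k n
reverseY = linear (λ (a , b) → single (a , Vec.reverse b))

swapY : ∀ {k n} → Fin n → Fin n → Laurent k n → Laurent k n
swapY i j = linear (λ (a , b) → single (a , b [ i ]≔ lookup b j [ j ]≔ lookup b i))

-- xⱼ ↦ y_{I j}
specialise : ∀ {k n} → Vec (Fin n) k → Laurent k n → Laurent 0 n
specialise {n = n} I = linear (λ (a , b) → single ([] , substitute I a b))
  where
  substitute : ∀ {k} → Vec (Fin n) k → Vec ℤ k → Vec ℤ n → Vec ℤ n
  substitute []      []      b = b
  substitute (i ∷ I) (z ∷ a) b = substitute I a b [ i ]%= (λ z′ → z + z′)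

------------------------------------------------------------------------
-- K_T(Gr(k,n))

Symmetric : ∀ {k n} → Laurent k n → Set
Symmetric f = ∀ σ → permuteX σ f ≈ f

-- Both sides lie in the ring of 𝒮ₖ-invariants and have the same class in the
-- quotient by the ideal of elements with vanishing specialisations.
infix 4 _≈ᴷ_
record _≈ᴷ_ {k n} (f g : Laurent k n) : Set where
  constructor mk≈ᴷ
  field
    symmetricˡ : Symmetric f
    symmetricʳ : Symmetric g
    vanishes   : ∀ (I : Vec (Fin n) k) → AllPairs Fin._<_ I → specialise I (f ⊖ g) ≈ 0ᴸ

------------------------------------------------------------------------
-- Young diagrams in the k × (n-k) rectangle, encoded by their frames

-- Position i ∈ {1,…,n} is the element i-1 of Fin n.
record Frame (k n : ℕ) : Set where
  constructor frame
  field
    subset : Subset n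
    size   : ∣ subset ∣ ≡ k

open Frame public

∣∷ʳ∣ : ∀ {n} (S : Subset n) s → ∣ S Vec.∷ʳ s ∣ ≡ ∣ s ∷ S ∣
∣∷ʳ∣ []            s       = refl
∣∷ʳ∣ (inside  ∷ S) inside  = cong suc (∣∷ʳ∣ S inside)
∣∷ʳ∣ (inside  ∷ S) outside = cong suc (∣∷ʳ∣ S outside)
∣∷ʳ∣ (outside ∷ S) inside  = ∣∷ʳ∣ S inside
∣∷ʳ∣ (outside ∷ S) outside = ∣∷ʳ∣ S outside

∣reverse∣ : ∀ {n} (S : Subset n) → ∣ Vec.reverse S ∣ ≡ ∣ S ∣
∣reverse∣ []            = refl
∣reverse∣ (inside  ∷ S) rewrite Vec.reverse-∷ inside S =
  trans (∣∷ʳ∣ (Vec.reverse S) inside) (cong suc (∣reverse∣ S))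
∣reverse∣ (outside ∷ S) rewrite Vec.reverse-∷ outside S =
  trans (∣∷ʳ∣ (Vec.reverse S) outside) (∣reverse∣ S)

infix 8 _*ᶠ
_*ᶠ : ∀ {k n} → Frame k n → Frame k n
(frame S size) *ᶠ = frame (Vec.reverse S) (trans (∣reverse∣ S) size)

frames : ∀ k n → List (Frame k n)
frames zero    zero    = frame [] refl ∷ []
frames (suc k) zero    = []
frames zero    (suc n) =
  List.map (λ (frame S p) → frame (outside ∷ S) p) (frames zero n)
frames (suc k) (suc n) =
  List.map (λ (frame S p) → frame (inside ∷ S) (cong suc p)) (frames k n) ++
  List.map (λ (frame S p) → frame (outside ∷ S) p) (frames (suc k) n)

------------------------------------------------------------------------
-- Double Grothendieck polynomials

-- u^{r-1} v^s + u^{r-2} v^{s+1} + ⋯ + u^{r-d} v^{s+d-1}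
geometric : ℕ → ℤ → ℤ → Combination (ℤ × ℤ)
geometric zero    r s = []
geometric (suc d) r s = (1ℤ , r - 1ℤ , s) ∷ geometric d (r - 1ℤ) (s + 1ℤ)

-- ∂ p q = (u^p v^q - u^q v^p) / (u - v) in ℤ[u^±1,v^±1]
∂ : ℤ → ℤ → Combination (ℤ × ℤ)
∂ p q with p - q
... | + d      = geometric d p q
... | -[1+ d ] = scale -1ℤ (geometric (suc d) q p)

-- For i ≢ j, D i j f = (yᵢ f - yⱼ f|_{yᵢ↔yⱼ}) / (yᵢ - yⱼ), see D-correct below.
-- The operator Dᵢ is D i (i+1).
D : ∀ {k n} → Fin n → Fin n → Laurent k n → Laurent k n
D i j = linear λ (a , b) →
  linear (λ (r , s) → single (a , b [ i ]≔ r [ j ]≔ s)) (∂ (1ℤ + lookup b i) (lookup b j))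

grothendieckTop : ∀ k n → Laurent k n
grothendieckTop k n =
  ∏ (List.allFin k) λ i →
  ∏ (List.filter (λ j → toℕ j ℕ.<? n ℕ.∸ k) (List.allFin n)) λ j →
  1ᴸ ⊖ x i ⊗ y⁻¹ j

-- sink v₀ (v₁ ∷ ⋯ ∷ vₘ ∷ []) = D v₀ v₁ ∘ D v₁ v₂ ∘ ⋯ ∘ D vₘ₋₁ vₘ
sink : ∀ {k n} → Fin n → List (Fin n) → Laurent k n → Laurent k n
sink v []       f = f
sink v (w ∷ ws) f = D v w (sink w ws f)

-- One way from the frame {n-k+1,…,n} down to S: the smallest element is moved
-- down one step at a time until it reaches its place, then the next one, etc.
-- A smallest element of S at position v passes the ∣ ∁ S′ ∣ positions following
-- v, where S′ is the rest of S.  grothendieck-step below shows that the choice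
-- of the path is immaterial.
descend : ∀ {k n m} → Vec (Fin n) m → Subset m → Laurent k n → Laurent k n
descend []       []            f = f
descend (v ∷ vs) (outside ∷ S) f = descend vs S f
descend (v ∷ vs) (inside  ∷ S) f =
  descend vs S (sink v (List.take ∣ ∁ S ∣ (Vec.toList vs)) f)

grothendieck : ∀ {k n} → Frame k n → Laurent k n
grothendieck {k} {n} λ′ = descend (Vec.allFin n) (subset λ′) (grothendieckTop k n)

dualGrothendieck : ∀ {k n} → Frame k n → Laurent k n
dualGrothendieck {k} {n} λ′ =
  ∏ (List.allFin k) x ⊗
  ∏ (List.filter (λ i → lookup (subset λ′) i Bool.≟ inside) (List.allFin n)) y⁻¹ ⊗
  reverseY (grothendieck (λ′ *ᶠ))

-- The coefficients c satisfy G_λ G_μ = ∑_ν c_ν G_ν in K_T(Gr(k,n)).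
IsExpansion : ∀ {k n} → Frame k n → Frame k n → (Frame k n → Laurent 0 n) → Set
IsExpansion {k} {n} λ′ μ c =
  dualGrothendieck λ′ ⊗ dualGrothendieck μ ≈ᴷ
  ∑ (frames k n) (λ ν → ι (c ν) ⊗ dualGrothendieck ν)

------------------------------------------------------------------------
-- Equivariant puzzles

-- Subsets of {R , G}.
State : Set
State = Subset 2

pattern ∅  = outside ∷ outside ∷ []
pattern R  = inside  ∷ outside ∷ []
pattern G  = outside ∷ inside  ∷ []
pattern RG = inside  ∷ inside  ∷ []

data Orientation : Set where
  △ ▽ : Orientation

data Tile : Orientation → Set where
  E G₁ G₂ R₁ R₂ Q : ∀ {o} → Tile o
  K               : Tile △

-- h is the horizontal edge, a the 60°/240° edge (left in △, right in ▽) and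
-- b the 120°/300° edge (right in △, left in ▽).
hab : ∀ {o} → Tile o → State × State × State
hab E  = ∅  , ∅  , ∅
hab G₁ = G  , G  , ∅
hab G₂ = G  , RG , R
hab R₁ = R  , ∅  , R
hab R₂ = R  , G  , RG
hab Q  = RG , G  , R
hab K  = ∅  , RG , RG

h a b : ∀ {o} → Tile o → State
h = proj₁ ∘ hab
a = proj₁ ∘ proj₂ ∘ hab
b = proj₂ ∘ proj₂ ∘ hab

-- Tiles placed in a down-pointing triangle of side n, row by row from the
-- top.  The top row of a triangle of side m + 1 has m + 1 triangles ▽, and m
-- triangles △ between them; below it is a triangle of side m.
data Tiling : ℕ → Set where
  []  : Tiling 0
  row : ∀ {m} → Vec (Tile ▽) (suc m) → Vec (Tile △) m → Tiling m → Tiling (suc m)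

topRow : ∀ {n} → Tiling n → Vec (Tile ▽) n
topRow []          = []
topRow (row d u t) = d

record Matching-row {m} (d : Vec (Tile ▽) (suc m)) (u : Vec (Tile △) m) (d′ : Vec (Tile ▽) m) : Set where
  constructor matching-row
  field
    right-of-▽ : Vec.map a (Vec.init d) ≡ Vec.map a u
    left-of-▽  : Vec.map b (Vec.tail d) ≡ Vec.map b u
    below-△    : Vec.map h u ≡ Vec.map h d′

data Matching : ∀ {n} → Tiling n → Set where
  []  : Matching []
  row : ∀ {m d u} {t : Tiling m} → Matching-row d u (topRow t) → Matching t → Matching (row d u t)

-- The sides of the triangle in the directions of reading: from the top-left
-- corner to the bottom, from the bottom to the top-right corner, and from left
-- to right.
leftSide rightSide topSide : ∀ {n} → Tiling n → Vec State n
leftSide  []          = []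
leftSide  (row d u t) = b (Vec.head d) ∷ leftSide t
rightSide []          = []
rightSide (row d u t) = rightSide t Vec.∷ʳ a (Vec.last d)
topSide t             = Vec.map h (topRow t)

-- The states of a boundary edge in each of the three directions, according to
-- whether its position belongs to the frame.
hState aState bState : Side → State
hState inside  = G
hState outside = R
aState inside  = G
aState outside = ∅
bState inside  = ∅
bState outside = R

record IsPuzzle {k n} (λ′ μ ν : Frame k n) (t : Tiling n) : Set where
  constructor isPuzzle
  field
    matching : Matching t
    left     : leftSide  t ≡ Vec.map bState (subset λ′)
    right    : rightSide t ≡ Vec.map aState (subset μ)
    top      : topSide   t ≡ Vec.map hState (subset ν)

_≟ₛ_ : ∀ {n} → DecidableEquality (Vec State n)
_≟ₛ_ = Vec.≡-dec (Vec.≡-dec Bool._≟_)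

matching? : ∀ {n} (t : Tiling n) → Dec (Matching t)
matching? [] = yes []
matching? (row d u t)
  with Vec.map a (Vec.init d) ≟ₛ Vec.map a u
     ×-dec Vec.map b (Vec.tail d) ≟ₛ Vec.map b u
     ×-dec Vec.map h u ≟ₛ Vec.map h (topRow t)
     ×-dec matching? t
... | yes (p , q , r , s) = yes (row (matching-row p q r) s)
... | no ¬p = no λ { (row (matching-row p q r) s) → ¬p (p , q , r , s) }

isPuzzle? : ∀ {k n} (λ′ μ ν : Frame k n) (t : Tiling n) → Dec (IsPuzzle λ′ μ ν t)
isPuzzle? λ′ μ ν t
  with matching? t
     ×-dec leftSide  t ≟ₛ Vec.map bState (subset λ′)
     ×-dec rightSide t ≟ₛ Vec.map aState (subset μ)
     ×-dec topSide   t ≟ₛ Vec.map hState (subset ν)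
... | yes (p , q , r , s) = yes (isPuzzle p q r s)
... | no ¬p = no λ { (isPuzzle p q r s) → ¬p (p , q , r , s) }

tiles : ∀ o → List (Tile o)
tiles △ = E ∷ G₁ ∷ G₂ ∷ R₁ ∷ R₂ ∷ Q ∷ K ∷ []
tiles ▽ = E ∷ G₁ ∷ G₂ ∷ R₁ ∷ R₂ ∷ Q ∷ []

vecs : {A : Set} → List A → ∀ n → List (Vec A n)
vecs as zero    = [] ∷ []
vecs as (suc n) = cartesianProductWith _∷_ as (vecs as n)

tilings : ∀ n → List (Tiling n)
tilings zero    = [] ∷ []
tilings (suc m) =
  cartesianProductWith (λ (d , u) → row d u)
    (cartesianProductWith _,_ (vecs (tiles ▽) (suc m)) (vecs (tiles △) m))
    (tilings m)

puzzles : ∀ {k n} → Frame k n → Frame k n → Frame k n → List (Tiling n)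
puzzles λ′ μ ν = List.filter (isPuzzle? λ′ μ ν) (tilings _)

-- The pairs that fall under the last clause and are not among those of weight
-- 1 disagree on the common edge, so they do not occur in a puzzle.
lozengeWeight : ∀ {n} → Laurent 0 n → Tile △ → Tile ▽ → Laurent 0 n
lozengeWeight w G₂ G₁ = w
lozengeWeight w R₂ R₁ = w
lozengeWeight w Q  Q  = 1ᴸ ⊖ w
lozengeWeight w K  E  = 0ᴸ ⊖ w
lozengeWeight w _  _  = 1ᴸ

-- I and J list, for the horizontal edges at the top of a triangle of side m,
-- the edges of the top side of the whole puzzle reached by going straight
-- up-left and up-right.  From the c-th edge below a row, going up-left leads to
-- the c-th edge above the row, and going up-right to the (c+1)-st one.
weightFrom : ∀ {n m} → Vec (Fin n) m → Vec (Fin n) m → Tiling m → Laurent 0 n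
weightFrom I J []          = 1ᴸ
weightFrom I J (row {m} d u t) =
  (∏ (List.allFin m) λ c →
    lozengeWeight (y (lookup (Vec.init I) c) ⊗ y⁻¹ (lookup (Vec.tail J) c))
                  (lookup u c) (lookup (topRow t) c))
  ⊗ weightFrom (Vec.init I) (Vec.tail J) t

weight : ∀ {n} → Tiling n → Laurent 0 n
weight {n} = weightFrom (Vec.allFin n) (Vec.allFin n)

puzzleSum : ∀ {k n} → Frame k n → Frame k n → Frame k n → Laurent 0 n
puzzleSum λ′ μ ν = ∑ (puzzles λ′ μ ν) weight

------------------------------------------------------------------------
-- D i j f is the quotient it should be, and grothendieck satisfies the
-- recursion that defines the double Grothendieck polynomials.

-- The linear extension of g : A → ℤ.
pair : {A : Set} → (A → ℤ) → Combination A → ℤ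
pair g []            = 0ℤ
pair g ((z , a) ∷ f) = z * g a + pair g f

private
  variable
    A B   : Set
    k n m : ℕ

  pair-++ : ∀ (g : A → ℤ) f f′ → pair g (f ++ f′) ≡ pair g f + pair g f′
  pair-++ g []            f′ = sym (ℤ.+-identityˡ _)
  pair-++ g ((z , a) ∷ f) f′ =
    trans (cong (λ t → z * g a + t) (pair-++ g f f′)) (sym (ℤ.+-assoc (z * g a) _ _))

  pair-scale : ∀ (g : A → ℤ) z f → pair g (scale z f) ≡ z * pair g f
  pair-scale g z []             = sym (ℤ.*-zeroʳ z)
  pair-scale g z ((z′ , a) ∷ f) =
    trans (cong (λ t → z * z′ * g a + t) (pair-scale g z f)) (distrib z z′ (g a) (pair g f))
    where
    distrib : ∀ z z′ u v → z * z′ * u + z * v ≡ z * (z′ * u + v)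
    distrib = solve-∀

  pair-single : ∀ (g : A → ℤ) a → pair g (single a) ≡ g a
  pair-single g a = trans (ℤ.+-identityʳ _) (ℤ.*-identityˡ _)

  pair-cong : ∀ {g g′ : A → ℤ} → (∀ a → g a ≡ g′ a) → ∀ f → pair g f ≡ pair g′ f
  pair-cong eq []            = refl
  pair-cong eq ((z , a) ∷ f) = cong₂ (λ u v → z * u + v) (eq a) (pair-cong eq f)

  pair-linear : ∀ (g : B → ℤ) (φ : A → Combination B) f →
                pair g (linear φ f) ≡ pair (λ a → pair g (φ a)) f
  pair-linear g φ []            = refl
  pair-linear g φ ((z , a) ∷ f) =
    trans (pair-++ g (scale z (φ a)) _) (cong₂ _+_ (pair-scale g z (φ a)) (pair-linear g φ f))

  pair-linear-single : ∀ (g : B → ℤ) (φ : A → B) f →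
                       pair g (linear (λ a → single (φ a)) f) ≡ pair (λ a → g (φ a)) f
  pair-linear-single g φ f =
    trans (pair-linear g (λ a → single (φ a)) f) (pair-cong (λ a → pair-single g (φ a)) f)

  pair-0 : ∀ (f : Combination A) → pair (λ _ → 0ℤ) f ≡ 0ℤ
  pair-0 []            = refl
  pair-0 ((z , a) ∷ f) = cong₂ _+_ (ℤ.*-zeroʳ z) (pair-0 f)

  pair-lincomb : ∀ (g g′ : A → ℤ) z f → pair (λ a → z * g a + g′ a) f ≡ z * pair g f + pair g′ f
  pair-lincomb g g′ z []             = sym (trans (ℤ.+-identityʳ _) (ℤ.*-zeroʳ z))
  pair-lincomb g g′ z ((z′ , a) ∷ f) =
    trans (cong (λ t → z′ * (z * g a + g′ a) + t) (pair-lincomb g g′ z f))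
          (rearrange z z′ (g a) (g′ a) (pair g f) (pair g′ f))
    where
    rearrange : ∀ z z′ u u′ v v′ →
                z′ * (z * u + u′) + (z * v + v′) ≡ z * (z′ * u + v) + (z′ * u′ + v′)
    rearrange = solve-∀

  pair-swap : ∀ (g : A → B → ℤ) f f′ →
              pair (λ a → pair (g a) f′) f ≡ pair (λ b → pair (λ a → g a b) f) f′
  pair-swap g []            f′ = sym (pair-0 f′)
  pair-swap g ((z , a) ∷ f) f′ =
    trans (cong (λ t → z * pair (g a) f′ + t) (pair-swap g f f′))
          (sym (pair-lincomb (g a) (λ b → pair (λ a → g a b) f) z f′))

  -- Equality of all linear functionals; this implies _≈_ and is evidently
  -- preserved by linear maps.
  infix 4 _~_
  record _~_ {A : Set} (f f′ : Combination A) : Set where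
    constructor mk~
    field
      on : ∀ (g : A → ℤ) → pair g f ≡ pair g f′
  open _~_

  ~-refl : {f : Combination A} → f ~ f
  ~-refl = mk~ λ g → refl

  ~-sym : {f f′ : Combination A} → f ~ f′ → f′ ~ f
  ~-sym p = mk~ λ g → sym (on p g)

  ~-trans : {f f′ f″ : Combination A} → f ~ f′ → f′ ~ f″ → f ~ f″
  ~-trans p q = mk~ λ g → trans (on p g) (on q g)

  linear-cong : (φ : A → Combination B) → ∀ {f f′} → f ~ f′ → linear φ f ~ linear φ f′
  linear-cong φ {f} {f′} p = mk~ λ g →
    trans (pair-linear g φ f) (trans (on p _) (sym (pair-linear g φ f′)))

  δ : Monomial k n → Monomial k n → ℤ
  δ e d with does (d ≟ₘ e)
  ... | true  = 1ℤ
  ... | false = 0ℤ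

  coeff-pair : ∀ (f : Laurent k n) e → coeff f e ≡ pair (δ e) f
  coeff-pair []            e = refl
  coeff-pair ((z , d) ∷ f) e with does (d ≟ₘ e)
  ... | true  = cong₂ _+_ (sym (ℤ.*-identityʳ z)) (coeff-pair f e)
  ... | false = cong₂ _+_ (sym (ℤ.*-zeroʳ z)) (coeff-pair f e)

  ~⇒≈ : {f f′ : Laurent k n} → f ~ f′ → f ≈ f′
  ~⇒≈ {f = f} {f′} p = mk≈ λ e →
    trans (coeff-pair f e) (trans (on p (δ e)) (sym (coeff-pair f′ e)))

  -- Multiplication by y i

  zipWith-+-0 : ∀ (v : Vec ℤ n) → zipWith _+_ (replicate n 0ℤ) v ≡ v
  zipWith-+-0 []      = refl
  zipWith-+-0 (z ∷ v) = cong₂ _∷_ (ℤ.+-identityˡ z) (zipWith-+-0 v)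

  zipWith-+-1 : ∀ (i : Fin n) v → zipWith _+_ (replicate n 0ℤ [ i ]≔ 1ℤ) v ≡ v [ i ]%= (λ z → 1ℤ + z)
  zipWith-+-1 zero    (z ∷ v) = cong (1ℤ + z ∷_) (zipWith-+-0 v)
  zipWith-+-1 (suc i) (z ∷ v) = cong₂ _∷_ (ℤ.+-identityˡ z) (zipWith-+-1 i v)

  raise : Fin n → Monomial k n → Monomial k n
  raise i (v , w) = v , w [ i ]%= (λ z → 1ℤ + z)

  times : Laurent k n → Monomial k n → Laurent k n
  times f d = linear (λ e → single (d · e)) f

  pair-y⊗ : ∀ (g : Monomial k n → ℤ) i f → pair g (y i ⊗ f) ≡ pair (λ e → g (raise i e)) f
  pair-y⊗ g i f =
    trans (pair-linear g (times f) (y i)) (trans (pair-single (λ d → pair g (times f d)) _)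
      (trans (pair-linear-single g (_ ·_) f)
        (pair-cong (λ (v , w) → cong₂ (λ v w → g (v , w)) (zipWith-+-0 v) (zipWith-+-1 i w)) f)))

  pair-⊖ : ∀ (g : A → ℤ) f f′ → pair g (f ++ scale -1ℤ f′) ≡ pair g f - pair g f′
  pair-⊖ g f f′ = trans (pair-++ g f _)
    (cong (λ t → pair g f + t) (trans (pair-scale g -1ℤ f′) (ℤ.-1*i≡-i _)))

  pair-diff : ∀ (g g′ : A → ℤ) f → pair (λ a → g a - g′ a) f ≡ pair g f - pair g′ f
  pair-diff g g′ f =
    trans (pair-cong (λ a → trans (ℤ.+-comm (g a) _) (cong (λ t → t + g a) (sym (ℤ.-1*i≡-i (g′ a))))) f)
      (trans (pair-lincomb g′ g -1ℤ f)
        (trans (cong (λ t → t + pair g f) (ℤ.-1*i≡-i (pair g′ f))) (ℤ.+-comm _ (pair g f))))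

  -- (u - v) ∂ p q = u^p v^q - u^q v^p

  shift-diff : (ℤ → ℤ → ℤ) → ℤ × ℤ → ℤ
  shift-diff g (r , s) = g (1ℤ + r) s - g r (1ℤ + s)

  pair-geometric : ∀ (g : ℤ → ℤ → ℤ) d r s →
    pair (shift-diff g) (geometric d r s) ≡ g r s - g (r - + d) (s + + d)
  pair-geometric g zero    r s =
    sym (trans (cong (λ z → g r s - z) (cong₂ g (ℤ.+-identityʳ r) (ℤ.+-identityʳ s)))
               (ℤ.+-inverseʳ (g r s)))
  pair-geometric g (suc d) r s =
    trans (cong (λ t → 1ℤ * (g (1ℤ + (r - 1ℤ)) s - g (r - 1ℤ) (1ℤ + s)) + t)
                (pair-geometric g d (r - 1ℤ) (s + 1ℤ)))
      (trans (cong₂ (λ r′ s′ → 1ℤ * (g r′ s - g (r - 1ℤ) s′)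
                + (g (r - 1ℤ) (s + 1ℤ) - g (r - 1ℤ - + d) (s + 1ℤ + + d)))
                (1+r-1 r) (ℤ.+-comm 1ℤ s))
        (trans (telescope (g r s) (g (r - 1ℤ) (s + 1ℤ)) _)
          (cong (λ z → g r s - z) (cong₂ g (r-1-d r (+ d)) (ℤ.+-assoc s 1ℤ (+ d))))))
    where
    1+r-1 : ∀ r → 1ℤ + (r - 1ℤ) ≡ r
    1+r-1 = solve-∀
    r-1-d : ∀ r d → r - 1ℤ - d ≡ r - (1ℤ + d)
    r-1-d = solve-∀
    telescope : ∀ u v w → 1ℤ * (u - v) + (v - w) ≡ u - w
    telescope = solve-∀

  p-[p-q] : ∀ p q → p - (p - q) ≡ q
  p-[p-q] = solve-∀

  q+[p-q] : ∀ p q → q + (p - q) ≡ p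
  q+[p-q] = solve-∀

  pair-∂ : ∀ (g : ℤ → ℤ → ℤ) p q → pair (shift-diff g) (∂ p q) ≡ g p q - g q p
  pair-∂ g p q with p - q in eq
  ... | + d = trans (pair-geometric g d p q) (cong (λ z → g p q - z)
          (cong₂ g (trans (cong (λ z → p - z) (sym eq)) (p-[p-q] p q))
                   (trans (cong (λ t → q + t) (sym eq)) (q+[p-q] p q))))
  ... | -[1+ d ] = trans (pair-scale (shift-diff g) -1ℤ (geometric (suc d) q p))
        (trans (cong (-1ℤ *_) (trans (pair-geometric g (suc d) q p)
           (cong (λ z → g q p - z) (cong₂ g
             (trans (cong (λ t → q + t) (sym eq)) (q+[p-q] p q))
             (trans (cong (λ z → p - z) (sym eq)) (p-[p-q] p q))))))
         (flip (g q p) (g p q)))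
    where
    flip : ∀ u v → -1ℤ * (u - v) ≡ v - u
    flip = solve-∀

  module _ {i j : Fin n} (i≢j : i ≢ j) (w : Vec ℤ n) where
    set : ℤ → ℤ → Vec ℤ n
    set r s = w [ i ]≔ r [ j ]≔ s

    raise-j : ∀ r s → set r s [ j ]%= (λ z → 1ℤ + z) ≡ set r (1ℤ + s)
    raise-j r s = Vec.updateAt-updateAt j (w [ i ]≔ r)

    raise-i : ∀ r s → set r s [ i ]%= (λ z → 1ℤ + z) ≡ set (1ℤ + r) s
    raise-i r s = trans (Vec.updateAt-commutes i j i≢j (w [ i ]≔ r))
      (cong (_[ j ]≔ s) (Vec.updateAt-updateAt i w))

    set-same : ∀ r → set r (lookup w j) ≡ w [ i ]≔ r
    set-same r = Vec.updateAt-id-local j (w [ i ]≔ r) (sym (Vec.lookup∘updateAt′ j i (i≢j ∘ sym) w))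

    raise-w : set (1ℤ + lookup w i) (lookup w j) ≡ w [ i ]%= (λ z → 1ℤ + z)
    raise-w = trans (set-same _) (Vec.updateAt-cong-local i w refl)

D-correct : ∀ {k n} {i j : Fin n} → i ≢ j → (f : Laurent k n) →
            (y i ⊖ y j) ⊗ D i j f ≈ y i ⊗ f ⊖ y j ⊗ swapY i j f
D-correct {i = i} {j} i≢j f = ~⇒≈ (mk~ λ g →
  trans (expand g (D i j f))
  (trans (pair-linear _ _ f)
  (trans (pair-cong (λ (v , w) → monomial g v w) f)
  (trans (pair-diff _ _ f)
  (sym (trans (pair-⊖ g (y i ⊗ f) (y j ⊗ swapY i j f))
    (cong₂ _-_ (pair-y⊗ g i f)
      (trans (pair-y⊗ g j (swapY i j f)) (pair-linear-single _ _ f)))))))))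
  where
  expand : ∀ g f → pair g ((y i ⊖ y j) ⊗ f) ≡ pair (λ e → g (raise i e) - g (raise j e)) f
  expand g f =
    trans (pair-linear g (times f) (y i ⊖ y j))
    (trans (pair-⊖ (λ d → pair g (times f d)) (y i) (y j))
    (trans (cong₂ _-_ (trans (sym (pair-linear g (times f) (y i))) (pair-y⊗ g i f))
                      (trans (sym (pair-linear g (times f) (y j))) (pair-y⊗ g j f)))
    (sym (pair-diff _ _ f))))

  monomial : ∀ g v w →
    pair (λ e → g (raise i e) - g (raise j e))
         (linear (λ (r , s) → single (v , w [ i ]≔ r [ j ]≔ s)) (∂ (1ℤ + lookup w i) (lookup w j)))
    ≡ g (raise i (v , w)) - g (raise j (v , w [ i ]≔ lookup w j [ j ]≔ lookup w i))
  monomial g v w =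
    trans (pair-linear-single _ _ (∂ (1ℤ + lookup w i) (lookup w j)))
    (trans (pair-cong (λ (r , s) → cong₂ (λ u u′ → g (v , u) - g (v , u′))
             (raise-i i≢j w r s) (raise-j i≢j w r s)) (∂ (1ℤ + lookup w i) (lookup w j)))
    (trans (pair-∂ (λ r s → g (v , set i≢j w r s)) (1ℤ + lookup w i) (lookup w j))
      (cong₂ (λ u u′ → g (v , u) - g (v , u′))
        (raise-w i≢j w) (sym (raise-j i≢j w (lookup w j) (lookup w i))))))

private
  D-cong : ∀ (i j : Fin n) {f f′ : Laurent k n} → f ~ f′ → D i j f ~ D i j f′
  D-cong i j = linear-cong _

  module _ {i j i′ j′ : Fin n} (i≢i′ : i ≢ i′) (i≢j′ : i ≢ j′) (j≢i′ : j ≢ i′) (j≢j′ : j ≢ j′) where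

    set-commutes : ∀ (w : Vec ℤ n) r s r′ s′ →
      w [ i′ ]≔ r′ [ j′ ]≔ s′ [ i ]≔ r [ j ]≔ s ≡ w [ i ]≔ r [ j ]≔ s [ i′ ]≔ r′ [ j′ ]≔ s′
    set-commutes w r s r′ s′ =
      trans (cong (_[ j ]≔ s) (trans (Vec.[]≔-commutes (w [ i′ ]≔ r′) j′ i (i≢j′ ∘ sym))
                                     (cong (_[ j′ ]≔ s′) (Vec.[]≔-commutes w i′ i (i≢i′ ∘ sym)))))
            (trans (Vec.[]≔-commutes (w [ i ]≔ r [ i′ ]≔ r′) j′ j (j≢j′ ∘ sym))
                   (cong (_[ j′ ]≔ s′) (Vec.[]≔-commutes (w [ i ]≔ r) i′ j (j≢i′ ∘ sym))))

  lookup-set : ∀ {i i′ j′ : Fin n} → i ≢ i′ → i ≢ j′ → ∀ (w : Vec ℤ n) r′ s′ →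
               lookup (w [ i′ ]≔ r′ [ j′ ]≔ s′) i ≡ lookup w i
  lookup-set {i = i} {i′} {j′} i≢i′ i≢j′ w r′ s′ =
    trans (Vec.lookup∘update′ i≢j′ (w [ i′ ]≔ r′) s′) (Vec.lookup∘update′ i≢i′ w r′)

  pair-DD : ∀ {i j i′ j′ : Fin n} → i ≢ i′ → i ≢ j′ → j ≢ i′ → j ≢ j′ →
    ∀ (g : Monomial k n → ℤ) f →
    pair g (D i j (D i′ j′ f)) ≡
    pair (λ (v , w) → pair (λ (r′ , s′) → pair (λ (r , s) →
            g (v , w [ i′ ]≔ r′ [ j′ ]≔ s′ [ i ]≔ r [ j ]≔ s))
            (∂ (1ℤ + lookup w i) (lookup w j)))
          (∂ (1ℤ + lookup w i′) (lookup w j′))) f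
  pair-DD {i = i} {j} {i′} {j′} i≢i′ i≢j′ j≢i′ j≢j′ g f =
    trans (pair-linear g _ (D i′ j′ f)) (trans (pair-linear _ _ f)
      (pair-cong (λ (v , w) → trans (pair-linear-single _ _ (∂ (1ℤ + lookup w i′) (lookup w j′)))
        (pair-cong (λ (r′ , s′) →
          trans (pair-linear-single g _ (∂ (1ℤ + lookup (w [ i′ ]≔ r′ [ j′ ]≔ s′) i) _))
                (cong₂ (λ p q → pair (λ (r , s) → g (v , w [ i′ ]≔ r′ [ j′ ]≔ s′ [ i ]≔ r [ j ]≔ s))
                                     (∂ (1ℤ + p) q))
                  (lookup-set i≢i′ i≢j′ w r′ s′) (lookup-set j≢i′ j≢j′ w r′ s′)))
          (∂ (1ℤ + lookup w i′) (lookup w j′)))) f))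

  D-commutes : ∀ {i j i′ j′ : Fin n} → i ≢ i′ → i ≢ j′ → j ≢ i′ → j ≢ j′ →
               ∀ (f : Laurent k n) → D i j (D i′ j′ f) ~ D i′ j′ (D i j f)
  D-commutes {i = i} {j} {i′} {j′} i≢i′ i≢j′ j≢i′ j≢j′ f = mk~ λ g →
    trans (pair-DD i≢i′ i≢j′ j≢i′ j≢j′ g f)
    (trans (pair-cong (λ (v , w) →
        trans (pair-swap _ (∂ (1ℤ + lookup w i′) (lookup w j′)) (∂ (1ℤ + lookup w i) (lookup w j)))
              (pair-cong (λ (r , s) → pair-cong (λ (r′ , s′) →
                 cong (λ u → g (v , u)) (set-commutes i≢i′ i≢j′ j≢i′ j≢j′ w r s r′ s′))
                 (∂ (1ℤ + lookup w i′) (lookup w j′))) (∂ (1ℤ + lookup w i) (lookup w j)))) f)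
      (sym (pair-DD (i≢i′ ∘ sym) (j≢i′ ∘ sym) (i≢j′ ∘ sym) (j≢j′ ∘ sym) g f)))

  sink-cong : ∀ (v : Fin n) vs {f f′ : Laurent k n} → f ~ f′ → sink v vs f ~ sink v vs f′
  sink-cong v []       p = p
  sink-cong v (w ∷ vs) p = D-cong v w (sink-cong w vs p)

  D-sink : ∀ {i j v : Fin n} {vs} → ListAll.All (i ≢_) (v ∷ vs) → ListAll.All (j ≢_) (v ∷ vs) →
           ∀ (f : Laurent k n) → D i j (sink v vs f) ~ sink v vs (D i j f)
  D-sink (_ ∷ [])          (_ ∷ [])          f = ~-refl
  D-sink {vs = v′ ∷ vs} (p ∷ ps@(p′ ∷ _)) (q ∷ qs@(q′ ∷ _)) f =
    ~-trans (D-commutes p p′ q q′ (sink v′ vs f)) (D-cong _ _ (D-sink ps qs f))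

  descend-cong : ∀ (vs : Vec (Fin n) m) S {f f′ : Laurent k n} → f ~ f′ →
                 descend vs S f ~ descend vs S f′
  descend-cong []       []            p = p
  descend-cong (v ∷ vs) (outside ∷ S) p = descend-cong vs S p
  descend-cong (v ∷ vs) (inside  ∷ S) p = descend-cong vs S (sink-cong v (List.take ∣ ∁ S ∣ (Vec.toList vs)) p)

  take-All : ∀ {P : Fin n → Set} {vs : Vec (Fin n) m} ℓ → VecAll.All P vs →
             ListAll.All P (List.take ℓ (Vec.toList vs))
  take-All zero    _        = []
  take-All (suc ℓ) []       = []
  take-All (suc ℓ) (p ∷ ps) = p ∷ take-All ℓ ps

  D-descend : ∀ {i j : Fin n} {vs : Vec (Fin n) m} → VecAll.All (i ≢_) vs → VecAll.All (j ≢_) vs →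
              ∀ S (f : Laurent k n) → D i j (descend vs S f) ~ descend vs S (D i j f)
  D-descend []       []       []            f = ~-refl
  D-descend (p ∷ ps) (q ∷ qs) (outside ∷ S) f = D-descend ps qs S f
  D-descend {vs = v ∷ vs} (p ∷ ps) (q ∷ qs) (inside ∷ S) f =
    ~-trans (D-descend ps qs S _)
      (descend-cong vs S (D-sink (p ∷ take-All ∣ ∁ S ∣ ps) (q ∷ take-All ∣ ∁ S ∣ qs) f))

-- S is obtained from S′ by replacing i+1 with i.
infix 4 _⟨_⋖_⟩_
_⟨_⋖_⟩_ : ∀ {n} → Subset n → Fin n → Fin n → Subset n → Set
S ⟨ i ⋖ j ⟩ S′ =
  toℕ j ≡ suc (toℕ i) × lookup S′ i ≡ outside × lookup S′ j ≡ inside ×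
  S ≡ S′ [ i ]≔ inside [ j ]≔ outside

private
  ∣∁∣-⋖ : ∀ (i j : Fin n) S S′ → S ⟨ i ⋖ j ⟩ S′ → ∣ ∁ S ∣ ≡ ∣ ∁ S′ ∣
  ∣∁∣-⋖ zero (suc zero) _ (outside ∷ inside ∷ S) (_ , _ , _ , refl) = refl
  ∣∁∣-⋖ (suc i) (suc j) (s ∷ S) (s ∷ S′) (p , q , r , refl) with s
  ... | inside  = ∣∁∣-⋖ i j S S′ (ℕ.suc-injective p , q , r , refl)
  ... | outside = cong suc (∣∁∣-⋖ i j S S′ (ℕ.suc-injective p , q , r , refl))

  descend-⋖ : ∀ {vs : Vec (Fin n) m} → Unique vs → ∀ i j S S′ → S ⟨ i ⋖ j ⟩ S′ → ∀ (f : Laurent k n) →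
              descend vs S f ~ D (lookup vs i) (lookup vs j) (descend vs S′ f)
  descend-⋖ {vs = v ∷ w ∷ vs} ((_ ∷ ps) ∷ qs ∷ _) zero (suc zero) _ (outside ∷ inside ∷ S) (_ , _ , _ , refl) f =
    ~-sym (D-descend ps qs S _)
  descend-⋖ (_ ∷ us) (suc i) (suc j) (s ∷ S) (s ∷ S′) (p , q , r , refl) f with s
  ... | outside = descend-⋖ us i j S S′ (ℕ.suc-injective p , q , r , refl) f
  ... | inside rewrite ∣∁∣-⋖ i j S S′ (ℕ.suc-injective p , q , r , refl) =
    descend-⋖ us i j S S′ (ℕ.suc-injective p , q , r , refl) _

  ∣∁inside∣ : ∀ n → ∣ ∁ (replicate n inside) ∣ ≡ 0
  ∣∁inside∣ zero    = refl
  ∣∁inside∣ (suc n) = ∣∁inside∣ n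

  descend-inside : ∀ (vs : Vec (Fin n) m) (f : Laurent k n) → descend vs (replicate m inside) f ≡ f
  descend-inside           []       f = refl
  descend-inside {m = suc m} (v ∷ vs) f rewrite ∣∁inside∣ m = descend-inside vs f

  descend-top : ∀ ℓ (vs : Vec (Fin n) (ℓ ℕ.+ m)) (f : Laurent k n) →
                descend vs (replicate ℓ outside Vec.++ replicate m inside) f ≡ f
  descend-top zero    vs       f = descend-inside vs f
  descend-top (suc ℓ) (v ∷ vs) f = descend-top ℓ vs f

grothendieck-top : ∀ {ℓ k} (λ′ : Frame k (ℓ ℕ.+ k)) →
  subset λ′ ≡ replicate ℓ outside Vec.++ replicate k inside →
  grothendieck λ′ ≡ grothendieckTop k (ℓ ℕ.+ k)
grothendieck-top {ℓ} (frame _ _) refl = descend-top ℓ (Vec.allFin _) _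

grothendieck-step : ∀ {k n} {i j : Fin n} (μ λ′ : Frame k n) →
  subset μ ⟨ i ⋖ j ⟩ subset λ′ → grothendieck μ ≈ D i j (grothendieck λ′)
grothendieck-step {k} {n} {i} {j} μ λ′ p = ~⇒≈
  (subst₂ (λ u v → grothendieck μ ~ D u v (grothendieck λ′))
    (Vec.lookup-allFin i) (Vec.lookup-allFin j)
    (descend-⋖ (tabulate⁺ id) i j (subset μ) (subset λ′) p (grothendieckTop k n)))

{-# OPTIONS --safe #-}

-- Everything is compared at the fixed points x = (y_i : i ∈ I).  The values V_I
-- there satisfy an exchange relation under yᵢ ↔ yᵢ₊₁, given by the stochastic
-- matrix Rˢ; it follows from the definition by divided differences.  The sum
-- over puzzles satisfies the corresponding relation: a puzzle is a product of
-- crossings of n lines in direction 120° with n lines in direction 60°, and by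
-- Yang–Baxter equations an R-matrix applied to two adjacent edges of the top
-- side can be moved through these lines to the left and right sides.  Hence the
-- expansion of G_λ G_μ at I follows from that at sᵢ I, and it remains to treat
-- the fixed point {n-k+1,…,n}, where all G_ν but one vanish.  Uniqueness of the
-- coefficients holds because the values G_ν at the fixed points are triangular.
module Submission where

open import Defs
open import Algebra using (CommutativeRing)
import Algebra.Properties.CommutativeMonoid.Sum as CommutativeMonoidSum
import Algebra.Solver.Ring as RingSolver
open import Algebra.Solver.Ring.AlmostCommutativeRing using (fromCommutativeRing; _-Raw-AlmostCommutative⟶_)
open import Data.Bool using (Bool; true; false; if_then_else_; not; _∧_)
import Data.Bool.Properties as Bool
open import Data.Empty using (⊥-elim)
open import Data.Fin as Fin using (Fin; zero; suc; toℕ)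
open import Data.Fin.Patterns using (0F; 1F; 2F)
open import Data.Fin.Permutation as Perm using (Permutation′; _⟨$⟩ʳ_; permutation)
import Data.Fin.Properties as Fin
open import Data.Fin.Subset using (Subset; Side; inside; outside; ∣_∣)
import Data.Fin.Subset.Properties as Subset
open import Data.Integer as ℤ using (ℤ; 0ℤ; 1ℤ; -1ℤ; _+_; _*_; _-_; -_)
import Data.Integer.Properties as ℤ
open import Data.Integer.Tactic.RingSolver using (solve-∀)
open import Data.List as List using (List; []; _∷_; _++_; length; cartesianProductWith)
import Data.List.Properties as List
open import Data.List.Relation.Unary.All as ListAll using (All; []; _∷_)
open import Data.Maybe using (Maybe; nothing; just)
open import Data.Nat as ℕ using (ℕ; zero; suc; s≤s; z≤n; _≤_)
import Data.Nat.Properties as ℕ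
open import Data.Product as Product using (_×_; _,_; proj₁; proj₂; ∃)
open import Data.Sum using (_⊎_; inj₁; inj₂)
open import Data.Vec as Vec using (Vec; []; _∷_; lookup; _[_]≔_; _[_]%=_; replicate; zipWith)
import Data.Vec.Properties as Vec
open import Data.Vec.Relation.Unary.All as VecAll using ([]; _∷_)
open import Data.Vec.Relation.Unary.AllPairs using (AllPairs; []; _∷_)
open import Function using (id; _∘_; mk⇔; _⇔_)
open import Level using (0ℓ)
open import Relation.Binary using (DecidableEquality; IsEquivalence)
open import Relation.Binary.PropositionalEquality
import Relation.Binary.Reasoning.Setoid as SetoidReasoning
open import Relation.Nullary using (Dec; does; yes; no; ¬_)
open import Relation.Nullary.Decidable using (dec-true; does-⇔; map′; _×-dec_)
open import Relation.Unary using (Decidable)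

-- There is no division in the Laurent ring, so a divided difference is handled through its equation
-- multiplied by yᵢ - yⱼ, a factor that can be cancelled. In the exchange relation the delicate case
-- is invariance when both or neither of two adjacent positions lie in the frame: it does not follow
-- from the defining step alone and needs the braid relation. On the puzzle side interior edges have
-- a third state RG, so R-matrices on three states are required; they preserve the boundary states
-- and agree with `Rˢ` there. Each local identity involves at most three lines and finitely many
-- states, so it is decided by computation in three variables and carried to arbitrary lines by
-- substitution. The rows in which a tiling is given are not the lines that an R-matrix passes
-- through, hence the sum over puzzles is first rewritten strip by strip along the left side. Frames
-- of size k are replaced by all subsets, with values extended by zero, so that R-matrices act on
-- functions of words in two letters.

private
  variable
    A B C V : Set
    k n m k′ n′ : ℕ
    f f′ g g′ : Laurent k n

-- Formal combinations tested by functionals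

pair-++ : ∀ (g : A → ℤ) f f′ → pair g (f ++ f′) ≡ pair g f + pair g f′
pair-++ g []            f′ = sym (ℤ.+-identityˡ _)
pair-++ g ((z , a) ∷ f) f′ =
  trans (cong (z * g a +_) (pair-++ g f f′)) (sym (ℤ.+-assoc (z * g a) _ _))

pair-scale : ∀ (g : A → ℤ) z f → pair g (scale z f) ≡ z * pair g f
pair-scale g z []             = sym (ℤ.*-zeroʳ z)
pair-scale g z ((z′ , a) ∷ f) =
  trans (cong₂ _+_ (ℤ.*-assoc z z′ (g a)) (pair-scale g z f)) (sym (ℤ.*-distribˡ-+ z _ _))

pair-⊝ : ∀ (g : A → ℤ) f → pair g (scale -1ℤ f) ≡ - pair g f
pair-⊝ g f = trans (pair-scale g -1ℤ f) (ℤ.-1*i≡-i _)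

pair-cong : {g g′ : A → ℤ} → (∀ a → g a ≡ g′ a) → ∀ f → pair g f ≡ pair g′ f
pair-cong eq []            = refl
pair-cong eq ((z , a) ∷ f) = cong₂ (λ u v → z * u + v) (eq a) (pair-cong eq f)

pair-single : ∀ (g : A → ℤ) a → pair g (single a) ≡ g a
pair-single g a = trans (ℤ.+-identityʳ _) (ℤ.*-identityˡ _)

pair-linear : ∀ (g : B → ℤ) (φ : A → Combination B) f →
              pair g (linear φ f) ≡ pair (λ a → pair g (φ a)) f
pair-linear g φ []            = refl
pair-linear g φ ((z , a) ∷ f) =
  trans (pair-++ g (scale z (φ a)) _) (cong₂ _+_ (pair-scale g z (φ a)) (pair-linear g φ f))

pair-map : ∀ (g : B → ℤ) (φ : A → B) f → pair g (linear (single ∘ φ) f) ≡ pair (g ∘ φ) f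
pair-map g φ f = trans (pair-linear g (single ∘ φ) f) (pair-cong (λ a → pair-single g (φ a)) f)

pair-0 : ∀ (f : Combination A) → pair (λ _ → 0ℤ) f ≡ 0ℤ
pair-0 []            = refl
pair-0 ((z , a) ∷ f) = cong₂ _+_ (ℤ.*-zeroʳ z) (pair-0 f)

pair-+ : ∀ (g g′ : A → ℤ) f → pair (λ a → g a + g′ a) f ≡ pair g f + pair g′ f
pair-+ g g′ []            = refl
pair-+ g g′ ((z , a) ∷ f) =
  trans (cong (z * (g a + g′ a) +_) (pair-+ g g′ f)) (rearrange z (g a) (g′ a) _ _)
  where
  rearrange : ∀ z u u′ v v′ → z * (u + u′) + (v + v′) ≡ z * u + v + (z * u′ + v′)
  rearrange = solve-∀

pair-* : ∀ (g : A → ℤ) z f → pair (λ a → z * g a) f ≡ z * pair g f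
pair-* g z []             = sym (ℤ.*-zeroʳ z)
pair-* g z ((z′ , a) ∷ f) =
  trans (cong (z′ * (z * g a) +_) (pair-* g z f)) (rearrange z z′ (g a) _)
  where
  rearrange : ∀ z z′ u v → z′ * (z * u) + z * v ≡ z * (z′ * u + v)
  rearrange = solve-∀

pair-swap : ∀ (g : A → B → ℤ) f f′ →
            pair (λ a → pair (g a) f′) f ≡ pair (λ b → pair (λ a → g a b) f) f′
pair-swap g []            f′ = sym (pair-0 f′)
pair-swap g ((z , a) ∷ f) f′ =
  trans (cong₂ _+_ (sym (pair-* (g a) z f′)) (pair-swap g f f′)) (sym (pair-+ _ _ f′))

coeff-++ : ∀ (f f′ : Laurent k n) e → coeff (f ++ f′) e ≡ coeff f e + coeff f′ e
coeff-++ []            f′ e = sym (ℤ.+-identityˡ _)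
coeff-++ ((z , d) ∷ f) f′ e =
  trans (cong (c +_) (coeff-++ f f′ e)) (sym (ℤ.+-assoc c _ _))
  where c = if does (d ≟ₘ e) then z else 0ℤ

indicator : Monomial k n → Monomial k n → ℤ
indicator e d = if does (d ≟ₘ e) then 1ℤ else 0ℤ

coeff-pair : ∀ (f : Laurent k n) e → coeff f e ≡ pair (indicator e) f
coeff-pair []            e = refl
coeff-pair ((z , d) ∷ f) e with does (d ≟ₘ e)
... | true  = cong₂ _+_ (sym (ℤ.*-identityʳ z)) (coeff-pair f e)
... | false = cong₂ _+_ (sym (ℤ.*-zeroʳ z)) (coeff-pair f e)

remove : Monomial k n → Laurent k n → Laurent k n
remove e []            = []
remove e ((z , d) ∷ f) = if does (d ≟ₘ e) then remove e f else (z , d) ∷ remove e f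

remove-length : ∀ e (f : Laurent k n) → length (remove e f) ℕ.≤ length f
remove-length e []            = z≤n
remove-length e ((z , d) ∷ f) with does (d ≟ₘ e)
... | true  = ℕ.m≤n⇒m≤1+n (remove-length e f)
... | false = s≤s (remove-length e f)

pair-remove : ∀ (g : Monomial k n → ℤ) e f → pair g f ≡ coeff f e * g e + pair g (remove e f)
pair-remove g e []            = refl
pair-remove g e ((z , d) ∷ f) with d ≟ₘ e
... | yes refl = trans (cong (z * g d +_) (pair-remove g e f)) (rearrange z (coeff f e) (g e) _)
  where
  rearrange : ∀ z c u v → z * u + (c * u + v) ≡ (z + c) * u + v
  rearrange = solve-∀
... | no _ = trans (cong (z * g d +_) (pair-remove g e f)) (rearrange (z * g d) (coeff f e) (g e) _)
  where
  rearrange : ∀ w c u v → w + (c * u + v) ≡ (0ℤ + c) * u + (w + v)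
  rearrange = solve-∀

coeff-remove : ∀ e (f : Laurent k n) e′ →
               coeff (remove e f) e′ ≡ (if does (e ≟ₘ e′) then 0ℤ else coeff f e′)
coeff-remove e [] e′ with does (e ≟ₘ e′)
... | true  = refl
... | false = refl
coeff-remove e ((z , d) ∷ f) e′ with d ≟ₘ e | e ≟ₘ e′ | coeff-remove e f e′
... | yes refl | yes _    | eq = eq
... | yes refl | no d≢e′  | eq with d ≟ₘ e′
...   | yes d≡e′ = ⊥-elim (d≢e′ d≡e′)
...   | no _     = trans eq (sym (ℤ.+-identityˡ _))
coeff-remove e ((z , d) ∷ f) e′ | no d≢e | yes refl | eq with d ≟ₘ e
...   | yes d≡e = ⊥-elim (d≢e d≡e)
...   | no _    = trans (ℤ.+-identityˡ _) eq
coeff-remove e ((z , d) ∷ f) e′ | no d≢e | no e≢e′ | eq =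
  cong ((if does (d ≟ₘ e′) then z else 0ℤ) +_) eq

-- Deleting every copy of the first monomial keeps all coefficients zero and strictly shortens the
-- list; N bounds the length so that the recursion is structural.
pair-vanishes : ∀ N (f : Laurent k n) → length f ℕ.≤ N → (∀ e → coeff f e ≡ 0ℤ) →
                ∀ g → pair g f ≡ 0ℤ
pair-vanishes N       []            _       f≈0 g = refl
pair-vanishes (suc N) f@((z , d) ∷ f′) (s≤s l) f≈0 g =
  trans (pair-remove g d f)
    (cong₂ (λ c v → c * g d + v) (f≈0 d)
      (pair-vanishes N (remove d f) (ℕ.≤-trans shorter l)
        (λ e → trans (coeff-remove d f e) (both e)) g))
  where
  both : ∀ e → (if does (d ≟ₘ e) then 0ℤ else coeff f e) ≡ 0ℤ
  both e = trans (cong (if does (d ≟ₘ e) then 0ℤ else_) (f≈0 e)) (Bool.if-eta (does (d ≟ₘ e)))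
  shorter : length (remove d f) ℕ.≤ length f′
  shorter with d ≟ₘ d
  ... | yes _  = remove-length d f′
  ... | no d≢d = ⊥-elim (d≢d refl)

-- Coefficients test only indicators of monomials. Testing against every g is what makes linear
-- extensions of maps of monomials respect `_≈_`.
≈⇒pair : f ≈ f′ → ∀ g → pair g f ≡ pair g f′
≈⇒pair {f = f} {f′} (mk≈ eq) g = ℤ.i-j≡0⇒i≡j _ _
  (trans (sym (trans (pair-++ g f _) (cong (λ t → pair g f + t) (pair-⊝ g f′))))
    (pair-vanishes _ (f ⊖ f′) ℕ.≤-refl vanish g))
  where
  vanish : ∀ e → coeff (f ⊖ f′) e ≡ 0ℤ
  vanish e = trans (coeff-pair (f ⊖ f′) e) (trans (pair-++ (indicator e) f _)
    (trans (cong₂ _+_ (sym (coeff-pair f e))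
                      (trans (pair-⊝ (indicator e) f′) (cong -_ (sym (coeff-pair f′ e)))))
      (ℤ.i≡j⇒i-j≡0 (eq e))))

pair⇒≈ : (∀ g → pair g f ≡ pair g f′) → f ≈ f′
pair⇒≈ {f = f} {f′} eq = mk≈ λ e →
  trans (coeff-pair f e) (trans (eq (indicator e)) (sym (coeff-pair f′ e)))

-- Laurent polynomials form a commutative ring

⊝_ : Laurent k n → Laurent k n
⊝ f = scale -1ℤ f

one : Monomial k n
one = replicate _ 0ℤ , replicate _ 0ℤ

·-comm : ∀ (d e : Monomial k n) → d · e ≡ e · d
·-comm (a , b) (a′ , b′) =
  cong₂ _,_ (Vec.zipWith-comm ℤ.+-comm a a′) (Vec.zipWith-comm ℤ.+-comm b b′)

·-assoc : ∀ (c d e : Monomial k n) → (c · d) · e ≡ c · (d · e)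
·-assoc (a , b) (a′ , b′) (a″ , b″) =
  cong₂ _,_ (Vec.zipWith-assoc ℤ.+-assoc a a′ a″) (Vec.zipWith-assoc ℤ.+-assoc b b′ b″)

·-identityˡ : ∀ (d : Monomial k n) → one · d ≡ d
·-identityˡ (a , b) =
  cong₂ _,_ (Vec.zipWith-identityˡ ℤ.+-identityˡ a) (Vec.zipWith-identityˡ ℤ.+-identityˡ b)

pair-⊗ : ∀ g (f f′ : Laurent k n) → pair g (f ⊗ f′) ≡ pair (λ d → pair (λ e → g (d · e)) f′) f
pair-⊗ g f f′ = trans (pair-linear g _ f) (pair-cong (λ d → pair-map g (d ·_) f′) f)

≈-isEquivalence : IsEquivalence (_≈_ {k} {n})
≈-isEquivalence = record
  { refl  = mk≈ λ e → refl
  ; sym   = λ (mk≈ p) → mk≈ λ e → sym (p e)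
  ; trans = λ (mk≈ p) (mk≈ q) → mk≈ λ e → trans (p e) (q e)
  }

⊗-comm : ∀ (f g : Laurent k n) → f ⊗ g ≈ g ⊗ f
⊗-comm f g = pair⇒≈ λ φ → trans (pair-⊗ φ f g) (trans (pair-swap _ f g)
  (trans (pair-cong (λ d → pair-cong (λ e → cong φ (·-comm e d)) f) g) (sym (pair-⊗ φ g f))))

⊗-cong : f ≈ f′ → g ≈ g′ → f ⊗ g ≈ f′ ⊗ g′
⊗-cong {f = f} {f′} {g} {g′} p q = pair⇒≈ λ φ →
  trans (pair-⊗ φ f g) (trans (≈⇒pair p _)
    (trans (pair-cong (λ d → ≈⇒pair q _) f′) (sym (pair-⊗ φ f′ g′))))

⊗-assoc : ∀ (f g h : Laurent k n) → (f ⊗ g) ⊗ h ≈ f ⊗ (g ⊗ h)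
⊗-assoc f g h = pair⇒≈ λ φ → trans (pair-⊗ φ (f ⊗ g) h) (trans (pair-⊗ _ f g)
  (trans (pair-cong (λ c → trans
      (pair-cong (λ d → pair-cong (λ e → cong φ (·-assoc c d e)) h) g)
      (sym (pair-⊗ _ g h))) f)
    (sym (pair-⊗ φ f (g ⊗ h)))))

⊗-identityˡ : ∀ (f : Laurent k n) → 1ᴸ ⊗ f ≈ f
⊗-identityˡ f = pair⇒≈ λ φ → trans (pair-⊗ φ 1ᴸ f) (trans (pair-single (λ d → pair (λ e → φ (d · e)) f) one)
  (pair-cong (λ e → cong φ (·-identityˡ e)) f))

⊗-distribʳ : ∀ (h f g : Laurent k n) → (f ⊕ g) ⊗ h ≈ f ⊗ h ⊕ g ⊗ h
⊗-distribʳ h f g = pair⇒≈ λ φ → trans (pair-⊗ φ (f ⊕ g) h) (trans (pair-++ _ f g)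
  (sym (trans (pair-++ φ (f ⊗ h) _) (cong₂ _+_ (pair-⊗ φ f h) (pair-⊗ φ g h)))))

⊕-cong : f ≈ f′ → g ≈ g′ → f ⊕ g ≈ f′ ⊕ g′
⊕-cong {f = f} {f′} {g} {g′} (mk≈ p) (mk≈ q) = mk≈ λ e →
  trans (coeff-++ f g e) (trans (cong₂ _+_ (p e) (q e)) (sym (coeff-++ f′ g′ e)))

⊕-comm : ∀ (f g : Laurent k n) → f ⊕ g ≈ g ⊕ f
⊕-comm f g = mk≈ λ e →
  trans (coeff-++ f g e) (trans (ℤ.+-comm (coeff f e) _) (sym (coeff-++ g f e)))

⊝-cong : f ≈ f′ → ⊝ f ≈ ⊝ f′
⊝-cong {f = f} {f′} p = pair⇒≈ λ φ →
  trans (pair-⊝ φ f) (trans (cong -_ (≈⇒pair p φ)) (sym (pair-⊝ φ f′)))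

⊝-inverseʳ : ∀ (f : Laurent k n) → f ⊖ f ≈ 0ᴸ
⊝-inverseʳ f = pair⇒≈ λ φ →
  trans (pair-++ φ f _) (trans (cong (λ t → pair φ f + t) (pair-⊝ φ f)) (ℤ.+-inverseʳ (pair φ f)))

laurentRing : ℕ → ℕ → CommutativeRing 0ℓ 0ℓ
laurentRing k n = record
  { Carrier = Laurent k n
  ; _≈_ = _≈_
  ; _+_ = _⊕_
  ; _*_ = _⊗_
  ; -_  = ⊝_
  ; 0#  = 0ᴸ
  ; 1#  = 1ᴸ
  ; isCommutativeRing = record
    { isRing = record
      { +-isAbelianGroup = record
        { isGroup = record
          { isMonoid = record
            { isSemigroup = record
              { isMagma = record { isEquivalence = ≈-isEquivalence ; ∙-cong = ⊕-cong }
              ; assoc = λ f g h → ≈-reflexive (List.++-assoc f g h)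
              }
            ; identity = (λ f → ≈-refl) , (λ f → ≈-reflexive (List.++-identityʳ f))
            }
          ; inverse = (λ f → ≈-trans (⊕-comm (⊝ f) f) (⊝-inverseʳ f)) , ⊝-inverseʳ
          ; ⁻¹-cong = ⊝-cong
          }
        ; comm = ⊕-comm
        }
      ; *-cong = ⊗-cong
      ; *-assoc = ⊗-assoc
      ; *-identity = ⊗-identityˡ , λ f → ≈-trans (⊗-comm f 1ᴸ) (⊗-identityˡ f)
      ; distrib = (λ h f g → ≈-trans (⊗-comm h (f ⊕ g)) (≈-trans (⊗-distribʳ h f g)
                    (⊕-cong (⊗-comm f h) (⊗-comm g h)))) , ⊗-distribʳ
      }
    ; *-comm = ⊗-comm
    }
  }
  where
  open IsEquivalence (≈-isEquivalence {k} {n})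
    renaming (refl to ≈-refl; trans to ≈-trans; reflexive to ≈-reflexive)

module _ {k n : ℕ} where
  open CommutativeRing (laurentRing k n) public using ()
    renaming ( setoid to ≈-setoid; refl to ≈-refl; sym to ≈-sym; trans to ≈-trans; reflexive to ≈-reflexive
             ; +-assoc to ⊕-assoc; +-identityʳ to ⊕-identityʳ; *-identityʳ to ⊗-identityʳ
             ; distribˡ to ⊗-distribˡ; zeroˡ to ⊗-zeroˡ; zeroʳ to ⊗-zeroʳ
             )

⊗-congˡ : ∀ (h : Laurent k n) → f ≈ g → h ⊗ f ≈ h ⊗ g
⊗-congˡ h eq = ⊗-cong (≈-refl {x = h}) eq

⊗-congʳ : ∀ (h : Laurent k n) → f ≈ g → f ⊗ h ≈ g ⊗ h
⊗-congʳ h eq = ⊗-cong eq (≈-refl {x = h})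

⊕-congˡ : ∀ (h : Laurent k n) → f ≈ g → h ⊕ f ≈ h ⊕ g
⊕-congˡ h eq = ⊕-cong (≈-refl {x = h}) eq

⊕-congʳ : ∀ (h : Laurent k n) → f ≈ g → f ⊕ h ≈ g ⊕ h
⊕-congʳ h eq = ⊕-cong eq (≈-refl {x = h})

constant : ℤ → Laurent k n
constant z = (z , one) ∷ []

constants : ℤ.+-*-rawRing -Raw-AlmostCommutative⟶ fromCommutativeRing (laurentRing k n)
constants = record
  { ⟦_⟧ = constant
  ; +-homo = λ z z′ → pair⇒≈ λ φ → add z z′ (φ one)
  ; *-homo = λ z z′ → pair⇒≈ λ φ →
      cong₂ (λ t d → z * t * φ d + 0ℤ) (sym (ℤ.*-identityʳ z′)) (sym (·-identityˡ one))
  ; -‿homo = λ z → pair⇒≈ λ φ → cong (λ t → t * φ one + 0ℤ) (sym (ℤ.-1*i≡-i z))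
  ; 0-homo = pair⇒≈ λ φ → refl
  ; 1-homo = ≈-refl
  }
  where
  add : ∀ z z′ u → (z + z′) * u + 0ℤ ≡ z * u + (z′ * u + 0ℤ)
  add = solve-∀

constant-≟ : ∀ {z z′} → Dec (z ≡ z′) → Maybe (constant {k} {n} z ≈ constant z′)
constant-≟ (yes refl) = just ≈-refl
constant-≟ (no _)     = nothing

module Solver {k n} = RingSolver ℤ.+-*-rawRing
  (fromCommutativeRing (laurentRing k n)) constants (λ z z′ → constant-≟ (z ℤ.≟ z′))

open Solver using (solve; _:+_; _:*_; _:-_; :-_; _:=_; con)

-- Monomial shifts and non-zero-divisors

inverse : Monomial k n → Monomial k n
inverse (a , b) = Vec.map -_ a , Vec.map -_ b

inverse-· : ∀ (c d : Monomial k n) → inverse c · (c · d) ≡ d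
inverse-· (a , b) (a′ , b′) = cong₂ _,_ (cancel a a′) (cancel b b′)
  where
  cancel : ∀ {m} (a b : Vec ℤ m) → zipWith _+_ (Vec.map -_ a) (zipWith _+_ a b) ≡ b
  cancel []      []      = refl
  cancel (z ∷ a) (w ∷ b) = cong₂ _∷_ (shift z w) (cancel a b)
    where
    shift : ∀ z w → - z + (z + w) ≡ w
    shift = solve-∀

coeff-shift : ∀ c (f : Laurent k n) e → coeff (single c ⊗ f) (c · e) ≡ coeff f e
coeff-shift c f e = trans (coeff-pair (single c ⊗ f) (c · e))
  (trans (pair-⊗ (indicator (c · e)) (single c) f)
  (trans (pair-single (λ d → pair (λ e′ → indicator (c · e) (d · e′)) f) c)
  (trans (pair-cong (λ d → cong (if_then 1ℤ else 0ℤ)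
    (does-⇔ (mk⇔ (λ eq → trans (sym (inverse-· c d)) (trans (cong (inverse c ·_) eq) (inverse-· c e)))
                 (cong (c ·_)))
            ((c · d) ≟ₘ (c · e)) (d ≟ₘ e))) f)
  (sym (coeff-pair f e)))))

i≤∣i∣ : ∀ i → i ℤ.≤ ℤ.+ ℤ.∣ i ∣
i≤∣i∣ (ℤ.+ m)    = ℤ.≤-refl
i≤∣i∣ ℤ.-[1+ m ] = ℤ.-≤+

-- A crude bound on the degree in yᵢ: absolute values are added up, which avoids reasoning about a
-- maximum.
degreeBound : Fin n → Laurent k n → ℕ
degreeBound i []                  = 0
degreeBound i ((z , (a , b)) ∷ f) = ℤ.∣ lookup b i ∣ ℕ.+ degreeBound i f

beyond-degreeBound : ∀ i (f : Laurent k n) e → ℤ.+ degreeBound i f ℤ.< lookup (proj₂ e) i → coeff f e ≡ 0ℤ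
beyond-degreeBound i []            e lt = refl
beyond-degreeBound i ((z , d) ∷ f) e lt with d ≟ₘ e
... | yes refl = ⊥-elim (ℤ.<-irrefl refl (ℤ.<-≤-trans lt
        (ℤ.≤-trans (i≤∣i∣ (lookup (proj₂ d) i)) (ℤ.+≤+ (ℕ.m≤m+n _ _)))))
... | no _ = trans (ℤ.+-identityˡ _)
        (beyond-degreeBound i f e (ℤ.≤-<-trans (ℤ.+≤+ (ℕ.m≤n+m _ _)) lt))

lookup-unit : ∀ (i : Fin n) z → lookup (replicate n 0ℤ [ i ]≔ z) i ≡ z
lookup-unit i z = Vec.lookup∘update i (replicate _ 0ℤ) z

lookup-unit-other : ∀ {i j : Fin n} → i ≢ j → ∀ z → lookup (replicate n 0ℤ [ j ]≔ z) i ≡ 0ℤ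
lookup-unit-other {i = i} i≢j z = trans (Vec.lookup∘update′ i≢j (replicate _ 0ℤ) z) (Vec.lookup-replicate i 0ℤ)

record NonZeroDivisor (c : Laurent k n) : Set where
  constructor nonZeroDivisor
  field
    annihilator : ∀ {f} → c ⊗ f ≈ 0ᴸ → f ≈ 0ᴸ

⊖≈0 : f ⊖ g ≈ 0ᴸ → f ≈ g
⊖≈0 {f = f} {g} eq = ≈-trans (solve 2 (λ f g → f := f :- g :+ g) ≈-refl f g)
  (⊕-congʳ g eq)

≈⇒⊖≈0 : f ≈ g → f ⊖ g ≈ 0ᴸ
≈⇒⊖≈0 {f = f} {g} eq = ≈-trans (⊕-congʳ (⊝ g) eq) (⊝-inverseʳ g)

cancelˡ : ∀ {c : Laurent k n} → NonZeroDivisor c → c ⊗ f ≈ c ⊗ g → f ≈ g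
cancelˡ {f = f} {g} {c} (nonZeroDivisor c-nzd) eq = ⊖≈0 (c-nzd (≈-trans
  (solve 3 (λ c f g → c :* (f :- g) := c :* f :- c :* g) ≈-refl c f g) (≈⇒⊖≈0 eq)))

-- If (yᵢ - yⱼ) f = 0, the coefficients of f are invariant under translation by
-- the exponent of yᵢ / yⱼ, and only finitely many of them are nonzero.
y⊖y-nonZeroDivisor : ∀ {i j : Fin n} → i ≢ j → NonZeroDivisor {k} (y i ⊖ y j)
y⊖y-nonZeroDivisor {n} {k} {i} {j} i≢j = nonZeroDivisor λ {f} eq → mk≈ (vanish f eq)
  where
  yᵢ yⱼ : Monomial k n
  yᵢ = replicate _ 0ℤ , replicate _ 0ℤ [ i ]≔ 1ℤ
  yⱼ = replicate _ 0ℤ , replicate _ 0ℤ [ j ]≔ 1ℤ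
  shift : Monomial k n → Monomial k n
  shift e = inverse yⱼ · (yᵢ · e)
  shift-degree : ∀ e → lookup (proj₂ (shift e)) i ≡ 1ℤ + lookup (proj₂ e) i
  shift-degree (a , b) =
    trans (Vec.lookup-zipWith _+_ i (Vec.map -_ (proj₂ yⱼ)) (zipWith _+_ (proj₂ yᵢ) b))
    (trans (cong₂ _+_
      (trans (Vec.lookup-map i -_ (proj₂ yⱼ)) (cong -_ (lookup-unit-other i≢j 1ℤ)))
      (trans (Vec.lookup-zipWith _+_ i (proj₂ yᵢ) b) (cong (_+ lookup b i) (lookup-unit i 1ℤ))))
    (ℤ.+-identityˡ _))
  module _ (f : Laurent k n) (eq : (y i ⊖ y j) ⊗ f ≈ 0ᴸ) where
    shift-coeff : ∀ e → coeff f e ≡ coeff f (shift e)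
    shift-coeff e = trans (sym (coeff-shift yᵢ f e))
      (trans (_≈_.coeff-≡ (⊖≈0 {f = y i ⊗ f} {y j ⊗ f} (≈-trans (≈-sym (distrib (y i) (y j) f)) eq)) (yᵢ · e))
        (trans (cong (coeff (y j ⊗ f)) (sym (yⱼ-inverse (yᵢ · e)))) (coeff-shift yⱼ f (shift e))))
      where
      distrib : ∀ (c d f : Laurent k n) → (c ⊖ d) ⊗ f ≈ c ⊗ f ⊖ d ⊗ f
      distrib = solve 3 (λ c d f → (c :- d) :* f := c :* f :- d :* f) ≈-refl
      yⱼ-inverse : ∀ d → yⱼ · (inverse yⱼ · d) ≡ d
      yⱼ-inverse d = trans (sym (·-assoc yⱼ (inverse yⱼ) d))
        (trans (cong (_· d) (·-comm yⱼ (inverse yⱼ)))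
          (trans (·-assoc (inverse yⱼ) yⱼ d) (inverse-· yⱼ d)))
    climb : ∀ t e → ℤ.+ degreeBound i f ℤ.< ℤ.+ t + lookup (proj₂ e) i → coeff f e ≡ 0ℤ
    climb zero    e lt = beyond-degreeBound i f e (subst (ℤ.+ degreeBound i f ℤ.<_) (ℤ.+-identityˡ _) lt)
    climb (suc t) e lt = trans (shift-coeff e) (climb t (shift e)
      (subst (ℤ.+ degreeBound i f ℤ.<_)
        (trans (rearrange (ℤ.+ t) (lookup (proj₂ e) i)) (cong (λ u → ℤ.+ t + u) (sym (shift-degree e)))) lt))
      where
      rearrange : ∀ t u → 1ℤ + t + u ≡ t + (1ℤ + u)
      rearrange = solve-∀
    vanish : ∀ e → coeff f e ≡ 0ℤ
    -- The summand ∣ z ∣ compensates a negative exponent z, so this many translations certainly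
    -- raise the degree in yᵢ above `degreeBound`.
    vanish e = climb (suc (degreeBound i f) ℕ.+ ℤ.∣ z ∣) e (ℤ.<-≤-trans
        (ℤ.+<+ ℕ.≤-refl) (ℤ.≤-trans (ℤ.≤-reflexive (rearrange (ℤ.+ suc (degreeBound i f)) (ℤ.+ ℤ.∣ z ∣)))
          (ℤ.+-monoʳ-≤ (ℤ.+ (suc (degreeBound i f) ℕ.+ ℤ.∣ z ∣)) (-∣i∣≤i z))))
      where
      z = lookup (proj₂ e) i
      rearrange : ∀ b c → b ≡ b + c + (- c)
      rearrange = solve-∀
      -∣i∣≤i : ∀ z → - (ℤ.+ ℤ.∣ z ∣) ℤ.≤ z
      -∣i∣≤i z = subst (- (ℤ.+ ℤ.∣ z ∣) ℤ.≤_) (ℤ.neg-involutive z)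
        (ℤ.neg-mono-≤ (subst (λ c → - z ℤ.≤ ℤ.+ c) (ℤ.∣-i∣≡∣i∣ z) (i≤∣i∣ (- z))))

-- Ring homomorphisms, finite sums and products

record Hom (F : Laurent k n → Laurent k′ n′) : Set where
  field
    hom-cong : f ≈ g → F f ≈ F g
    hom-⊕    : ∀ f g → F (f ⊕ g) ≈ F f ⊕ F g
    hom-⊗    : ∀ f g → F (f ⊗ g) ≈ F f ⊗ F g
    hom-⊝    : ∀ f → F (⊝ f) ≈ ⊝ F f
    hom-0    : F 0ᴸ ≈ 0ᴸ
    hom-1    : F 1ᴸ ≈ 1ᴸ

  hom-⊖ : ∀ f g → F (f ⊖ g) ≈ F f ⊖ F g
  hom-⊖ f g = ≈-trans (hom-⊕ f (⊝ g)) (⊕-congˡ (F f) (hom-⊝ g))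

  hom-∑ : ∀ (as : List A) (f : A → Laurent k n) → F (∑ as f) ≈ ∑ as (F ∘ f)
  hom-∑ []       f = hom-0
  hom-∑ (a ∷ as) f = ≈-trans (hom-⊕ (f a) (∑ as f)) (⊕-congˡ (F (f a)) (hom-∑ as f))

  hom-∏ : ∀ (as : List A) (f : A → Laurent k n) → F (∏ as f) ≈ ∏ as (F ∘ f)
  hom-∏ []       f = hom-1
  hom-∏ (a ∷ as) f = ≈-trans (hom-⊗ (f a) (∏ as f)) (⊗-congˡ (F (f a)) (hom-∏ as f))

open Hom public

linear-cong : ∀ (φ : Monomial k n → Monomial k′ n′) → f ≈ g → linear (single ∘ φ) f ≈ linear (single ∘ φ) g
linear-cong {f = f} {g} φ p = pair⇒≈ λ ψ →
  trans (pair-map ψ φ f) (trans (≈⇒pair p _) (sym (pair-map ψ φ g)))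

linear-ext : ∀ {φ ψ : Monomial k n → Monomial k′ n′} → (∀ d → φ d ≡ ψ d) →
             ∀ f → linear (single ∘ φ) f ≈ linear (single ∘ ψ) f
linear-ext {φ = φ} {ψ} eq f = pair⇒≈ λ χ →
  trans (pair-map χ φ f) (trans (pair-cong (λ d → cong χ (eq d)) f) (sym (pair-map χ ψ f)))

linear-∘ : ∀ {k″ n″} (ψ : Monomial k′ n′ → Monomial k″ n″) (φ : Monomial k n → Monomial k′ n′) f →
           linear (single ∘ ψ) (linear (single ∘ φ) f) ≈ linear (single ∘ ψ ∘ φ) f
linear-∘ ψ φ f = pair⇒≈ λ χ →
  trans (pair-map χ ψ (linear (single ∘ φ) f))
    (trans (pair-map (χ ∘ ψ) φ f) (sym (pair-map χ (ψ ∘ φ) f)))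

linear-id : ∀ {φ : Monomial k n → Monomial k n} → (∀ d → φ d ≡ d) → ∀ f → linear (single ∘ φ) f ≈ f
linear-id {φ = φ} eq f = pair⇒≈ λ χ → trans (pair-map χ φ f) (pair-cong (λ d → cong χ (eq d)) f)

module _ (φ : Monomial k n → Monomial k′ n′) (φ-· : ∀ d e → φ (d · e) ≡ φ d · φ e) where

  -- `φ one` is idempotent in the group of monomials, hence trivial; this is why multiplicativity of
  -- φ is the only condition on it.
  φ-one : φ one ≡ one
  φ-one = trans (sym (inverse-· (φ one) (φ one)))
    (trans (cong (inverse (φ one) ·_) (trans (sym (φ-· one one)) (cong φ (·-identityˡ one))))
      (trans (cong (inverse (φ one) ·_) (trans (sym (·-identityˡ (φ one))) (·-comm one _)))
        (inverse-· (φ one) one)))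

  monomialHom : Hom (linear (single ∘ φ))
  monomialHom = record
    { hom-cong = linear-cong φ
    ; hom-⊕ = λ f g → pair⇒≈ λ ψ → trans (pair-map ψ φ (f ⊕ g)) (trans (pair-++ (ψ ∘ φ) f g)
        (sym (trans (pair-++ ψ (linear (single ∘ φ) f) _) (cong₂ _+_ (pair-map ψ φ f) (pair-map ψ φ g)))))
    ; hom-⊗ = λ f g → pair⇒≈ λ ψ → trans (pair-map ψ φ (f ⊗ g)) (trans (pair-⊗ (ψ ∘ φ) f g)
        (sym (trans (pair-⊗ ψ (linear (single ∘ φ) f) (linear (single ∘ φ) g))
          (trans (pair-map _ φ f) (pair-cong (λ d → trans (pair-map _ φ g)
            (pair-cong (λ e → cong ψ (sym (φ-· d e))) g)) f)))))
    ; hom-⊝ = λ f → pair⇒≈ λ ψ → trans (pair-map ψ φ (⊝ f)) (trans (pair-⊝ (ψ ∘ φ) f)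
        (sym (trans (pair-⊝ ψ (linear (single ∘ φ) f)) (cong -_ (pair-map ψ φ f)))))
    ; hom-0 = ≈-refl
    ; hom-1 = ≈-reflexive (cong single φ-one)
    }

∑-cong : ∀ (as : List A) {f g : A → Laurent k n} → (∀ a → f a ≈ g a) → ∑ as f ≈ ∑ as g
∑-cong []       eq = ≈-refl
∑-cong (a ∷ as) eq = ⊕-cong (eq a) (∑-cong as eq)

∑-⊕ : ∀ (as : List A) (f g : A → Laurent k n) → ∑ as (λ a → f a ⊕ g a) ≈ ∑ as f ⊕ ∑ as g
∑-⊕ []       f g = ≈-refl
∑-⊕ (a ∷ as) f g = ≈-trans (⊕-congˡ (f a ⊕ g a) (∑-⊕ as f g))
  (solve 4 (λ u v w z → u :+ v :+ (w :+ z) := u :+ w :+ (v :+ z)) ≈-refl (f a) (g a) (∑ as f) (∑ as g))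

∑-⊗ˡ : ∀ (as : List A) c (f : A → Laurent k n) → c ⊗ ∑ as f ≈ ∑ as (λ a → c ⊗ f a)
∑-⊗ˡ []       c f = ⊗-zeroʳ c
∑-⊗ˡ (a ∷ as) c f = ≈-trans (⊗-distribˡ c (f a) (∑ as f)) (⊕-congˡ (c ⊗ f a) (∑-⊗ˡ as c f))

∑-⊗ʳ : ∀ (as : List A) c (f : A → Laurent k n) → ∑ as f ⊗ c ≈ ∑ as (λ a → f a ⊗ c)
∑-⊗ʳ as c f = ≈-trans (⊗-comm (∑ as f) c) (≈-trans (∑-⊗ˡ as c f) (∑-cong as λ a → ⊗-comm c (f a)))

∑-zero : ∀ (as : List A) {f : A → Laurent k n} → (∀ a → f a ≈ 0ᴸ) → ∑ as f ≈ 0ᴸ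
∑-zero []       eq = ≈-refl
∑-zero (a ∷ as) eq = ⊕-cong (eq a) (∑-zero as eq)

∑-swap : ∀ (as : List A) (bs : List B) (f : A → B → Laurent k n) →
         ∑ as (λ a → ∑ bs (f a)) ≈ ∑ bs (λ b → ∑ as (λ a → f a b))
∑-swap []       bs f = ≈-sym (∑-zero bs λ b → ≈-refl)
∑-swap (a ∷ as) bs f = ≈-trans (⊕-congˡ (∑ bs (f a)) (∑-swap as bs f)) (≈-sym (∑-⊕ bs (f a) (λ b → ∑ as (λ a → f a b))))

∑-++ : ∀ (as as′ : List A) (f : A → Laurent k n) → ∑ (as ++ as′) f ≈ ∑ as f ⊕ ∑ as′ f
∑-++ []       as′ f = ≈-refl
∑-++ (a ∷ as) as′ f = ≈-trans (⊕-congˡ (f a) (∑-++ as as′ f)) (≈-sym (⊕-assoc (f a) (∑ as f) (∑ as′ f)))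

∑-map : ∀ (φ : B → A) (bs : List B) (f : A → Laurent k n) → ∑ (List.map φ bs) f ≈ ∑ bs (f ∘ φ)
∑-map φ []       f = ≈-refl
∑-map φ (b ∷ bs) f = ⊕-congˡ (f (φ b)) (∑-map φ bs f)

∑-cartesian : ∀ {C : Set} (φ : A → B → C) as bs (f : C → Laurent k n) →
              ∑ (cartesianProductWith φ as bs) f ≈ ∑ as (λ a → ∑ bs (λ b → f (φ a b)))
∑-cartesian φ []       bs f = ≈-refl
∑-cartesian φ (a ∷ as) bs f = ≈-trans (∑-++ (List.map (φ a) bs) (cartesianProductWith φ as bs) f)
  (⊕-cong (∑-map (φ a) bs f) (∑-cartesian φ as bs f))

infixr 5 _⇒_
-- An Iverson bracket times f. Conditions remain booleans, so they can be permuted and moved through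
-- sums and products.
_⇒_ : Bool → Laurent k n → Laurent k n
c ⇒ f = if c then f else 0ᴸ

⇒-cong : ∀ c → f ≈ g → c ⇒ f ≈ c ⇒ g
⇒-cong true  eq = eq
⇒-cong false eq = ≈-refl

⇒-⊗ˡ : ∀ c (f g : Laurent k n) → (c ⇒ f) ⊗ g ≈ c ⇒ f ⊗ g
⇒-⊗ˡ true  f g = ≈-refl
⇒-⊗ˡ false f g = ⊗-zeroˡ g

⇒-⊗ʳ : ∀ c (f g : Laurent k n) → f ⊗ (c ⇒ g) ≈ c ⇒ f ⊗ g
⇒-⊗ʳ true  f g = ≈-refl
⇒-⊗ʳ false f g = ⊗-zeroʳ f

⇒-∑ : ∀ c (as : List A) (f : A → Laurent k n) → c ⇒ ∑ as f ≈ ∑ as (λ a → c ⇒ f a)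
⇒-∑ true  as f = ≈-refl
⇒-∑ false as f = ≈-sym (∑-zero as λ a → ≈-refl)

⇒-comm : ∀ c c′ (f : Laurent k n) → c ⇒ c′ ⇒ f ≈ c′ ⇒ c ⇒ f
⇒-comm true  c′    f = ≈-refl
⇒-comm false true  f = ≈-refl
⇒-comm false false f = ≈-refl

hom-⇒ : ∀ {F : Laurent k n → Laurent k′ n′} → Hom F → ∀ c f → F (c ⇒ f) ≈ c ⇒ F f
hom-⇒ H true  f = ≈-refl
hom-⇒ H false f = hom-0 H

∑-filter : ∀ {P : A → Set} (P? : Decidable P) as (f : A → Laurent k n) →
           ∑ (List.filter P? as) f ≈ ∑ as (λ a → does (P? a) ⇒ f a)
∑-filter P? []       f = ≈-refl
∑-filter P? (a ∷ as) f with does (P? a)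
... | true  = ⊕-congˡ (f a) (∑-filter P? as f)
... | false = ∑-filter P? as f

∏-cong : ∀ (as : List A) {f g : A → Laurent k n} → (∀ a → f a ≈ g a) → ∏ as f ≈ ∏ as g
∏-cong []       eq = ≈-refl
∏-cong (a ∷ as) eq = ⊗-cong (eq a) (∏-cong as eq)

∏-filter : ∀ {P : A → Set} (P? : Decidable P) as (f : A → Laurent k n) →
           ∏ (List.filter P? as) f ≈ ∏ as (λ a → if does (P? a) then f a else 1ᴸ)
∏-filter P? []       f = ≈-refl
∏-filter P? (a ∷ as) f with does (P? a)
... | true  = ⊗-congˡ (f a) (∏-filter P? as f)
... | false = ≈-trans (∏-filter P? as f) (≈-sym (⊗-identityˡ (∏ as (λ a → if does (P? a) then f a else 1ᴸ))))

module _ {k n : ℕ} where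
  open CommutativeMonoidSum (CommutativeRing.*-commutativeMonoid (laurentRing k n)) using (sum; sum-permute)

  ∏-sum : ∀ (φ : Fin m → A) (f : A → Laurent k n) → ∏ (List.tabulate φ) f ≡ sum (f ∘ φ)
  ∏-sum {zero}  φ f = refl
  ∏-sum {suc m} φ f = cong (f (φ zero) ⊗_) (∏-sum (φ ∘ suc) f)

  ∏-tabulate : ∀ (φ : Fin m → A) (f : A → Laurent k n) → ∏ (List.tabulate φ) f ≡ ∏ (List.allFin m) (f ∘ φ)
  ∏-tabulate φ f = trans (∏-sum φ f) (sym (∏-sum id (f ∘ φ)))

  ∏-permute : ∀ (π : Permutation′ m) (f : Fin m → Laurent k n) →
              ∏ (List.allFin m) (λ i → f (π ⟨$⟩ʳ i)) ≈ ∏ (List.allFin m) f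
  ∏-permute π f = ≈-trans (≈-reflexive (∏-sum id (λ i → f (π ⟨$⟩ʳ i))))
    (≈-trans (≈-sym (sum-permute f π)) (≈-reflexive (sym (∏-sum id f))))

∏-zero : ∀ (i : Fin m) (f : Fin m → Laurent k n) → f i ≈ 0ᴸ → ∏ (List.allFin m) f ≈ 0ᴸ
∏-zero {m = suc m} zero f eq = ≈-trans (⊗-congʳ (∏ (List.tabulate suc) f) eq) (⊗-zeroˡ (∏ (List.tabulate suc) f))
∏-zero {m = suc m} (suc i) f eq = ≈-trans
  (⊗-congˡ (f zero) (≈-trans (≈-reflexive (∏-tabulate suc f)) (∏-zero i (f ∘ suc) eq))) (⊗-zeroʳ (f zero))

-- Adjacent positions and simple transpositions

-- An inductive type of neighbouring pairs lets `swap`, `at` and later `actAt` be structural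
-- recursions, without arithmetic on indices.
data Adjacent : ℕ → Set where
  here  : Adjacent (suc (suc n))
  there : Adjacent n → Adjacent (suc n)

private
  variable
    p q : Adjacent n

low high : Adjacent n → Fin n
low  here      = zero
low  (there p) = suc (low p)
high here      = suc zero
high (there p) = suc (high p)

σ : Adjacent n → Fin n → Fin n
σ here      zero          = suc zero
σ here      (suc zero)    = zero
σ here      (suc (suc i)) = suc (suc i)
σ (there p) zero          = zero
σ (there p) (suc i)       = suc (σ p i)

swap : Adjacent n → Vec A n → Vec A n
swap here      (a ∷ b ∷ v) = b ∷ a ∷ v
swap (there p) (a ∷ v)     = a ∷ swap p v

at : Adjacent n → Vec A n → A × A
at here      (a ∷ b ∷ v) = a , b
at (there p) (a ∷ v)     = at p v

low≢high : ∀ (p : Adjacent n) → low p ≢ high p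
low≢high (there p) eq = low≢high p (Fin.suc-injective eq)

toℕ-high : ∀ (p : Adjacent n) → toℕ (high p) ≡ suc (toℕ (low p))
toℕ-high here      = refl
toℕ-high (there p) = cong suc (toℕ-high p)

lookup-low : ∀ (p : Adjacent n) (v : Vec A n) → lookup v (low p) ≡ proj₁ (at p v)
lookup-low here      (a ∷ b ∷ v) = refl
lookup-low (there p) (a ∷ v)     = lookup-low p v

lookup-high : ∀ (p : Adjacent n) (v : Vec A n) → lookup v (high p) ≡ proj₂ (at p v)
lookup-high here      (a ∷ b ∷ v) = refl
lookup-high (there p) (a ∷ v)     = lookup-high p v

σ-low : ∀ (p : Adjacent n) → σ p (low p) ≡ high p
σ-low here      = refl
σ-low (there p) = cong suc (σ-low p)

σ-high : ∀ (p : Adjacent n) → σ p (high p) ≡ low p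
σ-high here      = refl
σ-high (there p) = cong suc (σ-high p)

σ-other : ∀ (p : Adjacent n) i → i ≢ low p → i ≢ high p → σ p i ≡ i
σ-other here      zero          i≢l i≢h = ⊥-elim (i≢l refl)
σ-other here      (suc zero)    i≢l i≢h = ⊥-elim (i≢h refl)
σ-other here      (suc (suc i)) i≢l i≢h = refl
σ-other (there p) zero          i≢l i≢h = refl
σ-other (there p) (suc i)       i≢l i≢h = cong suc (σ-other p i (i≢l ∘ cong suc) (i≢h ∘ cong suc))

σ-involutive : ∀ (p : Adjacent n) i → σ p (σ p i) ≡ i
σ-involutive here      zero          = refl
σ-involutive here      (suc zero)    = refl
σ-involutive here      (suc (suc i)) = refl
σ-involutive (there p) zero          = refl
σ-involutive (there p) (suc i)       = cong suc (σ-involutive p i)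

swap-involutive : ∀ (p : Adjacent n) (v : Vec A n) → swap p (swap p v) ≡ v
swap-involutive here      (a ∷ b ∷ v) = refl
swap-involutive (there p) (a ∷ v)     = cong (a ∷_) (swap-involutive p v)

lookup-swap : ∀ (p : Adjacent n) (v : Vec A n) i → lookup (swap p v) i ≡ lookup v (σ p i)
lookup-swap here      (a ∷ b ∷ v) zero          = refl
lookup-swap here      (a ∷ b ∷ v) (suc zero)    = refl
lookup-swap here      (a ∷ b ∷ v) (suc (suc i)) = refl
lookup-swap (there p) (a ∷ v)     zero          = refl
lookup-swap (there p) (a ∷ v)     (suc i)       = lookup-swap p v i

swap-zipWith : ∀ (p : Adjacent n) (φ : A → B → C) u v →
               swap p (zipWith φ u v) ≡ zipWith φ (swap p u) (swap p v)
swap-zipWith here      φ (a ∷ a′ ∷ u) (b ∷ b′ ∷ v) = refl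
swap-zipWith (there p) φ (a ∷ u)      (b ∷ v)      = cong (φ a b ∷_) (swap-zipWith p φ u v)

swap-update : ∀ (p : Adjacent n) (v : Vec A n) i φ → swap p (v [ i ]%= φ) ≡ swap p v [ σ p i ]%= φ
swap-update here      (a ∷ b ∷ v) zero          φ = refl
swap-update here      (a ∷ b ∷ v) (suc zero)    φ = refl
swap-update here      (a ∷ b ∷ v) (suc (suc i)) φ = refl
swap-update (there p) (a ∷ v)     zero          φ = refl
swap-update (there p) (a ∷ v)     (suc i)       φ = cong (a ∷_) (swap-update p v i φ)

swap-replicate : ∀ (p : Adjacent n) (a : A) → swap p (replicate n a) ≡ replicate n a
swap-replicate here      a = refl
swap-replicate (there p) a = cong (a ∷_) (swap-replicate p a)

swap-≔ : ∀ (p : Adjacent n) (v : Vec A n) →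
         v [ low p ]≔ lookup v (high p) [ high p ]≔ lookup v (low p) ≡ swap p v
swap-≔ here      (a ∷ b ∷ v) = refl
swap-≔ (there p) (a ∷ v)     = cong (a ∷_) (swap-≔ p v)

lookup-extensional : ∀ {u v : Vec A n} → (∀ i → lookup u i ≡ lookup v i) → u ≡ v
lookup-extensional {u = u} {v} eq =
  trans (sym (Vec.tabulate∘lookup u)) (trans (Vec.tabulate-cong eq) (Vec.tabulate∘lookup v))

swap-allFin : ∀ (p : Adjacent n) → swap p (Vec.allFin n) ≡ Vec.map (σ p) (Vec.allFin n)
swap-allFin p = lookup-extensional λ i → trans (lookup-swap p (Vec.allFin _) i)
  (trans (Vec.lookup-allFin (σ p i)) (sym (trans (Vec.lookup-map i (σ p) (Vec.allFin _)) (cong (σ p) (Vec.lookup-allFin i)))))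

data Next : Adjacent n → Adjacent n → Set where
  here  : Next (here {suc n}) (there here)
  there : Next p q → Next (there p) (there q)

data Far : Adjacent n → Adjacent n → Set where
  here  : Far here (there (there q))
  here′ : Far (there (there p)) here
  there : Far p q → Far (there p) (there q)

data Comparison (p : Adjacent n) : Adjacent n → Set where
  same   : Comparison p p
  before : Next p q → Comparison p q
  after  : Next q p → Comparison p q
  far    : Far p q → Comparison p q

compare : ∀ (p q : Adjacent n) → Comparison p q
compare here              here              = same
compare here              (there here)      = before here
compare here              (there (there q)) = far here
compare (there here)      here              = after here
compare (there (there p)) here              = far here′
compare (there p)         (there q) with compare p q
... | same      = same
... | before pq = before (there pq)
... | after qp  = after (there qp)
... | far pq    = far (there pq)

swap-far : Far p q → ∀ (v : Vec A n) → swap p (swap q v) ≡ swap q (swap p v)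
swap-far here       (a ∷ b ∷ v) = refl
swap-far here′      (a ∷ b ∷ v) = refl
swap-far (there pq) (a ∷ v)     = cong (a ∷_) (swap-far pq v)

at-far : Far p q → ∀ (v : Vec A n) → at p (swap q v) ≡ at p v
at-far here       (a ∷ b ∷ v) = refl
at-far here′      (a ∷ b ∷ v) = refl
at-far (there pq) (a ∷ v)     = at-far pq v

σ-far-low : Far p q → σ p (low q) ≡ low q
σ-far-low here       = refl
σ-far-low here′      = refl
σ-far-low (there pq) = cong suc (σ-far-low pq)

σ-far-high : Far p q → σ p (high q) ≡ high q
σ-far-high here       = refl
σ-far-high here′      = refl
σ-far-high (there pq) = cong suc (σ-far-high pq)

swap-braid : Next p q → ∀ (v : Vec A n) → swap p (swap q (swap p v)) ≡ swap q (swap p (swap q v))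
swap-braid here       (a ∷ b ∷ c ∷ v) = refl
swap-braid (there pq) (a ∷ v)         = cong (a ∷_) (swap-braid pq v)

high≡low : Next p q → high p ≡ low q
high≡low here       = refl
high≡low (there pq) = cong suc (high≡low pq)

σ-next-high : Next p q → σ p (high q) ≡ high q
σ-next-high here       = refl
σ-next-high (there pq) = cong suc (σ-next-high pq)

σ-next-low : Next p q → σ q (low p) ≡ low p
σ-next-low here       = refl
σ-next-low (there pq) = cong suc (σ-next-low pq)

low≢high-next : Next p q → low p ≢ high q
low≢high-next (there pq) eq = low≢high-next pq (Fin.suc-injective eq)

at-next : Next p q → ∀ (v : Vec A n) → proj₂ (at p v) ≡ proj₁ (at q v)
at-next here       (a ∷ b ∷ c ∷ v) = refl
at-next (there pq) (a ∷ v)         = at-next pq v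

at-swap : ∀ (p : Adjacent n) (v : Vec A n) → at p (swap p v) ≡ Product.swap (at p v)
at-swap here      (a ∷ b ∷ v) = refl
at-swap (there p) (a ∷ v)     = at-swap p v

at-next-swap : Next p q → ∀ (v : Vec A n) → at p (swap q v) ≡ (proj₁ (at p v) , proj₂ (at q v))
at-next-swap here       (a ∷ b ∷ c ∷ v) = refl
at-next-swap (there pq) (a ∷ v)         = at-next-swap pq v

at-swap-next : Next p q → ∀ (v : Vec A n) → at q (swap p v) ≡ (proj₁ (at p v) , proj₂ (at q v))
at-swap-next here       (a ∷ b ∷ c ∷ v) = refl
at-swap-next (there pq) (a ∷ v)         = at-swap-next pq v

at-swap-swap : Next p q → ∀ (v : Vec A n) → at q (swap p (swap q v)) ≡ at p v
at-swap-swap here       (a ∷ b ∷ c ∷ v) = refl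
at-swap-swap (there pq) (a ∷ v)         = at-swap-swap pq v

at-swap-swap′ : Next p q → ∀ (v : Vec A n) → at p (swap q (swap p v)) ≡ at q v
at-swap-swap′ here       (a ∷ b ∷ c ∷ v) = refl
at-swap-swap′ (there pq) (a ∷ v)         = at-swap-swap′ pq v

adjacent : ∀ (i j : Fin n) → toℕ j ≡ suc (toℕ i) → ∃ λ p → low p ≡ i × high p ≡ j
adjacent zero    (suc zero) eq = here , refl , refl
adjacent (suc i) (suc j)    eq with adjacent i j (ℕ.suc-injective eq)
... | p , refl , refl = there p , refl , refl

∣swap∣ : ∀ (p : Adjacent n) (S : Subset n) → ∣ swap p S ∣ ≡ ∣ S ∣
∣swap∣ here (inside  ∷ inside  ∷ S) = refl
∣swap∣ here (inside  ∷ outside ∷ S) = refl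
∣swap∣ here (outside ∷ inside  ∷ S) = refl
∣swap∣ here (outside ∷ outside ∷ S) = refl
∣swap∣ (there p) (inside  ∷ S) = cong suc (∣swap∣ p S)
∣swap∣ (there p) (outside ∷ S) = ∣swap∣ p S

-- Counts the positions of the frame from the right; it decreases when a
-- diagram grows.
coheight : Subset n → ℕ
coheight []                  = 0
coheight {suc n} (inside ∷ S) = n ℕ.+ coheight S
coheight (outside ∷ S)       = coheight S

coheight-swap : ∀ (p : Adjacent n) S → at p S ≡ (inside , outside) → coheight (swap p S) ℕ.< coheight S
coheight-swap here      (inside ∷ outside ∷ S) eq = ℕ.≤-refl
coheight-swap {suc n} (there p) (inside ∷ S)   eq = ℕ.+-monoʳ-< n (coheight-swap p S eq)
coheight-swap (there p) (outside ∷ S)          eq = coheight-swap p S eq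

-- The sum of the positions, counted from 0, of the elements: an element is counted once for each
-- position before it.
height : Subset n → ℕ
height []      = 0
height (s ∷ S) = ∣ S ∣ ℕ.+ height S

height-swap : ∀ (p : Adjacent n) S → at p S ≡ (outside , inside) → height (swap p S) ℕ.< height S
height-swap here      (outside ∷ inside ∷ S) eq = ℕ.+-monoʳ-≤ (suc ∣ S ∣) (ℕ.≤-refl)
height-swap (there p) (s ∷ S)                eq rewrite ∣swap∣ p S = ℕ.+-monoʳ-< ∣ S ∣ (height-swap p S eq)

-- Permuting and identifying variables

zeros : Vec ℤ n
zeros = replicate _ 0ℤ

permute-unit : ∀ (π : Permutation′ n) (v : Vec ℤ n → Vec ℤ n) →
  (∀ b i → lookup (v b) i ≡ lookup b (π ⟨$⟩ʳ i)) →
  ∀ i z → v (zeros [ π ⟨$⟩ʳ i ]≔ z) ≡ zeros [ i ]≔ z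
permute-unit π v eq i z = lookup-extensional entry
  where
  entry : ∀ m → lookup (v (zeros [ π ⟨$⟩ʳ i ]≔ z)) m ≡ lookup (zeros [ i ]≔ z) m
  entry m with m Fin.≟ i
  ... | yes refl = trans (eq _ m) (trans (lookup-unit (π ⟨$⟩ʳ m) z) (sym (lookup-unit m z)))
  ... | no m≢i   = trans (eq _ m) (trans (lookup-unit-other (m≢i ∘ injective) z)
                     (sym (lookup-unit-other m≢i z)))
    where
    injective : π ⟨$⟩ʳ m ≡ π ⟨$⟩ʳ i → m ≡ i
    injective eq = trans (sym (Perm.inverseˡ π)) (trans (cong (π Perm.⟨$⟩ˡ_) eq) (Perm.inverseˡ π))

permute-zipWith : ∀ (π : Fin n → Fin n) (v : Vec ℤ n → Vec ℤ n) →
  (∀ b i → lookup (v b) i ≡ lookup b (π i)) →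
  ∀ b b′ → v (zipWith _+_ b b′) ≡ zipWith _+_ (v b) (v b′)
permute-zipWith π v eq b b′ = lookup-extensional λ i →
  trans (eq _ i) (trans (Vec.lookup-zipWith _+_ (π i) b b′)
    (sym (trans (Vec.lookup-zipWith _+_ i (v b) (v b′)) (cong₂ _+_ (eq b i) (eq b′ i)))))

permute-zeros : ∀ (π : Fin n → Fin n) (v : Vec ℤ n → Vec ℤ n) →
  (∀ b i → lookup (v b) i ≡ lookup b (π i)) → v zeros ≡ zeros
permute-zeros π v eq = lookup-extensional λ i →
  trans (eq _ i) (trans (Vec.lookup-replicate (π i) 0ℤ) (sym (Vec.lookup-replicate i 0ℤ)))

s : Adjacent n → Laurent k n → Laurent k n
s p = swapY (low p) (high p)

swapᵐ : Adjacent n → Monomial k n → Monomial k n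
swapᵐ p (a , b) = a , swap p b

s-linear : ∀ (p : Adjacent n) (f : Laurent k n) → s p f ≈ linear (single ∘ swapᵐ p) f
s-linear p = linear-ext λ (a , b) → cong (a ,_) (swap-≔ p b)

s-hom : ∀ (p : Adjacent n) → Hom (s {k = k} p)
s-hom p = monomialHom _ λ (a , b) (a′ , b′) → cong (_ ,_)
  (trans (swap-≔ p (zipWith _+_ b b′)) (trans (swap-zipWith p _+_ b b′)
    (sym (cong₂ (zipWith _+_) (swap-≔ p b) (swap-≔ p b′)))))

s-involutive : ∀ (p : Adjacent n) (f : Laurent k n) → s p (s p f) ≈ f
s-involutive p f = ≈-trans (hom-cong (s-hom p) (s-linear p f)) (≈-trans (s-linear p (linear (single ∘ swapᵐ p) f))
  (≈-trans (linear-∘ (swapᵐ p) (swapᵐ p) f) (linear-id (λ (a , b) → cong (a ,_) (swap-involutive p b)) f)))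

s-s : ∀ (p q : Adjacent n) (f : Laurent k n) → s p (s q f) ≈ linear (single ∘ swapᵐ p ∘ swapᵐ q) f
s-s p q f = ≈-trans (hom-cong (s-hom p) (s-linear q f))
  (≈-trans (s-linear p (linear (single ∘ swapᵐ q) f)) (linear-∘ (swapᵐ p) (swapᵐ q) f))

s-far : ∀ {p q : Adjacent n} → Far p q → ∀ (f : Laurent k n) → s p (s q f) ≈ s q (s p f)
s-far {p = p} {q} pq f = ≈-trans (s-s p q f)
  (≈-trans (linear-ext (λ (a , b) → cong (a ,_) (swap-far pq b)) f) (≈-sym (s-s q p f)))

s-braid : ∀ {p q : Adjacent n} → Next p q → ∀ (f : Laurent k n) → s p (s q (s p f)) ≈ s q (s p (s q f))
s-braid {p = p} {q} pq f = ≈-trans (sss p q)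
  (≈-trans (linear-ext (λ (a , b) → cong (a ,_) (swap-braid pq b)) f) (≈-sym (sss q p)))
  where
  sss : ∀ p q → s p (s q (s p f)) ≈ linear (single ∘ swapᵐ p ∘ swapᵐ q ∘ swapᵐ p) f
  sss p q = ≈-trans (hom-cong (s-hom p) (s-s q p f))
    (≈-trans (s-linear p (linear (single ∘ swapᵐ q ∘ swapᵐ p) f)) (linear-∘ (swapᵐ p) (swapᵐ q ∘ swapᵐ p) f))

s-single : ∀ (p : Adjacent n) (a : Vec ℤ k) {b b′} → swap p b ≡ b′ → s p (single (a , b)) ≈ single (a , b′)
s-single p a eq = ≈-reflexive (cong (λ b → single (a , b)) (trans (swap-≔ p _) eq))

swap-unit : ∀ (p : Adjacent n) i z → swap p (zeros [ i ]≔ z) ≡ zeros [ σ p i ]≔ z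
swap-unit p i z = trans (swap-update p zeros i (λ _ → z)) (cong (_[ σ p i ]≔ z) (swap-replicate p 0ℤ))

s-y : ∀ (p : Adjacent n) i → s {k = k} p (y i) ≈ y (σ p i)
s-y p i = s-single p zeros (swap-unit p i 1ℤ)

s-y⁻¹ : ∀ (p : Adjacent n) i → s {k = k} p (y⁻¹ i) ≈ y⁻¹ (σ p i)
s-y⁻¹ p i = s-single p zeros (swap-unit p i -1ℤ)

s-x : ∀ (p : Adjacent n) (i : Fin k) → s p (x i) ≈ x i
s-x p i = s-single p (zeros [ i ]≔ 1ℤ) (swap-replicate p 0ℤ)

y⊗y⁻¹ : ∀ (i : Fin n) → y {k} i ⊗ y⁻¹ i ≈ 1ᴸ
y⊗y⁻¹ i = ≈-reflexive (cong single (cong₂ _,_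
  (Vec.zipWith-identityˡ ℤ.+-identityˡ zeros) (cancel i)))
  where
  cancel : ∀ {n} (i : Fin n) → zipWith _+_ (zeros [ i ]≔ 1ℤ) (zeros [ i ]≔ -1ℤ) ≡ zeros
  cancel zero    = cong (0ℤ ∷_) (Vec.zipWith-identityˡ ℤ.+-identityˡ zeros)
  cancel (suc i) = cong (0ℤ ∷_) (cancel i)

lookup-∷ʳ-last : ∀ (v : Vec A n) a → lookup (v Vec.∷ʳ a) (Fin.fromℕ n) ≡ a
lookup-∷ʳ-last []      a = refl
lookup-∷ʳ-last (b ∷ v) a = lookup-∷ʳ-last v a

lookup-∷ʳ-inject₁ : ∀ (v : Vec A n) a i → lookup (v Vec.∷ʳ a) (Fin.inject₁ i) ≡ lookup v i
lookup-∷ʳ-inject₁ (b ∷ v) a zero    = refl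
lookup-∷ʳ-inject₁ (b ∷ v) a (suc i) = lookup-∷ʳ-inject₁ v a i

lookup-reverse-opposite : ∀ (v : Vec A n) i → lookup (Vec.reverse v) (Fin.opposite i) ≡ lookup v i
lookup-reverse-opposite (a ∷ v) zero rewrite Vec.reverse-∷ a v = lookup-∷ʳ-last (Vec.reverse v) a
lookup-reverse-opposite (a ∷ v) (suc i) rewrite Vec.reverse-∷ a v =
  trans (lookup-∷ʳ-inject₁ (Vec.reverse v) a (Fin.opposite i)) (lookup-reverse-opposite v i)

lookup-reverse : ∀ (v : Vec A n) i → lookup (Vec.reverse v) i ≡ lookup v (Fin.opposite i)
lookup-reverse v i = trans (cong (lookup (Vec.reverse v)) (sym (Fin.opposite-involutive i)))
  (lookup-reverse-opposite v (Fin.opposite i))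

-- Dual polynomials reverse both the variables y and the frame, so their relations at p are read off
-- from `poly` at this pair. Reversal also exchanges the low and the high position.
mirror : ∀ (p : Adjacent n) → ∃ λ p′ → low p′ ≡ Fin.opposite (high p) × high p′ ≡ Fin.opposite (low p)
mirror {n} p = adjacent (Fin.opposite (high p)) (Fin.opposite (low p)) (begin
  toℕ (Fin.opposite (low p))             ≡⟨ Fin.opposite-prop (low p) ⟩
  n ℕ.∸ suc (toℕ (low p))                ≡⟨ ℕ.+-∸-assoc 1 high<n ⟩
  suc (n ℕ.∸ suc (suc (toℕ (low p))))    ≡⟨ cong (λ m → suc (n ℕ.∸ suc m)) (toℕ-high p) ⟨
  suc (n ℕ.∸ suc (toℕ (high p)))         ≡⟨ cong suc (Fin.opposite-prop (high p)) ⟨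
  suc (toℕ (Fin.opposite (high p)))      ∎)
  where
  open ≡-Reasoning
  high<n : suc (suc (toℕ (low p))) ℕ.≤ n
  high<n = subst (ℕ._≤ n) (cong suc (toℕ-high p)) (Fin.toℕ<n (high p))

module _ (p : Adjacent n) where
  private
    p′ = proj₁ (mirror p)
    low′ = proj₁ (proj₂ (mirror p))
    high′ = proj₂ (proj₂ (mirror p))

  opposite-flip : ∀ {i j : Fin n} → Fin.opposite i ≡ j → i ≡ Fin.opposite j
  opposite-flip {i} eq = trans (sym (Fin.opposite-involutive i)) (cong Fin.opposite eq)

  σ-mirror : ∀ i → σ p (Fin.opposite i) ≡ Fin.opposite (σ p′ i)
  σ-mirror i with Fin.opposite i Fin.≟ low p | Fin.opposite i Fin.≟ high p
  ... | yes eq | _ = trans (cong (σ p) eq) (trans (σ-low p)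
        (opposite-flip (trans (sym low′) (trans (sym (σ-high p′)) (cong (σ p′) (trans high′ (sym (opposite-flip eq))))))))
  ... | no _ | yes eq = trans (cong (σ p) eq) (trans (σ-high p)
        (opposite-flip (trans (sym high′) (trans (sym (σ-low p′)) (cong (σ p′) (trans low′ (sym (opposite-flip eq))))))))
  ... | no i≢l | no i≢h = trans (σ-other p _ i≢l i≢h) (cong Fin.opposite (sym (σ-other p′ i
        (λ eq → i≢h (sym (opposite-flip (trans (sym low′) (sym eq)))))
        (λ eq → i≢l (sym (opposite-flip (trans (sym high′) (sym eq))))))))

  reverse-swap : ∀ (v : Vec A n) → Vec.reverse (swap p v) ≡ swap p′ (Vec.reverse v)
  reverse-swap v = lookup-extensional λ i →
    trans (lookup-reverse (swap p v) i) (trans (lookup-swap p v (Fin.opposite i))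
      (trans (cong (lookup v) (σ-mirror i))
        (sym (trans (lookup-swap p′ (Vec.reverse v) i) (lookup-reverse v (σ p′ i))))))

  at-reverse : ∀ (v : Vec A n) → at p′ (Vec.reverse v) ≡ Product.swap (at p v)
  at-reverse v = cong₂ _,_
    (trans (sym (lookup-low p′ (Vec.reverse v))) (trans (cong (lookup (Vec.reverse v)) low′)
      (trans (lookup-reverse-opposite v (high p)) (lookup-high p v))))
    (trans (sym (lookup-high p′ (Vec.reverse v))) (trans (cong (lookup (Vec.reverse v)) high′)
      (trans (lookup-reverse-opposite v (low p)) (lookup-low p v))))

reverseY-hom : Hom (reverseY {k} {n})
reverseY-hom = monomialHom _ λ (a , b) (a′ , b′) → cong (_ ,_)
  (permute-zipWith Fin.opposite Vec.reverse lookup-reverse b b′)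

reverse-unit : ∀ (i : Fin n) z → Vec.reverse (zeros [ i ]≔ z) ≡ zeros [ Fin.opposite i ]≔ z
reverse-unit i z = trans (cong (λ j → Vec.reverse (zeros [ j ]≔ z)) (sym (Fin.opposite-involutive i)))
  (permute-unit Perm.reverse Vec.reverse lookup-reverse (Fin.opposite i) z)

reverseY-y : ∀ (i : Fin n) → reverseY {k} (y i) ≈ y (Fin.opposite i)
reverseY-y i = ≈-reflexive (cong (λ b → single (zeros , b)) (reverse-unit i 1ℤ))

reverseY-y⁻¹ : ∀ (i : Fin n) → reverseY {k} (y⁻¹ i) ≈ y⁻¹ (Fin.opposite i)
reverseY-y⁻¹ i = ≈-reflexive (cong (λ b → single (zeros , b)) (reverse-unit i -1ℤ))

reverseY-x : ∀ (i : Fin k) → reverseY {n = n} (x i) ≈ x i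
reverseY-x i = ≈-reflexive (cong (λ b → single (zeros [ i ]≔ 1ℤ , b))
  (permute-zeros Fin.opposite Vec.reverse lookup-reverse))

s-reverseY : ∀ (p : Adjacent n) (f : Laurent k n) → s p (reverseY f) ≈ reverseY (s (proj₁ (mirror p)) f)
s-reverseY p f = ≈-trans (s-linear p (reverseY f)) (≈-trans (linear-∘ (swapᵐ p) _ f)
  (≈-trans (linear-ext (λ (a , b) → cong (a ,_) (reversed b)) f)
    (≈-sym (≈-trans (hom-cong reverseY-hom (s-linear p′ f)) (linear-∘ _ (swapᵐ p′) f)))))
  where
  p′ = proj₁ (mirror p)
  reversed : ∀ b → swap p (Vec.reverse b) ≡ Vec.reverse (swap p′ b)
  reversed b = lookup-extensional λ i →
    trans (lookup-swap p (Vec.reverse b) i) (trans (lookup-reverse b (σ p i))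
      (trans (cong (lookup b) (σ-opposite i))
        (sym (trans (lookup-reverse (swap p′ b) i) (lookup-swap p′ b (Fin.opposite i))))))
    where
    σ-opposite : ∀ i → Fin.opposite (σ p i) ≡ σ p′ (Fin.opposite i)
    σ-opposite i = trans (cong (Fin.opposite ∘ σ p) (sym (Fin.opposite-involutive i)))
      (trans (cong Fin.opposite (σ-mirror p (Fin.opposite i))) (Fin.opposite-involutive _))

permuteX-hom : ∀ (π : Permutation′ k) → Hom (permuteX {n = n} π)
permuteX-hom π = monomialHom _ λ (a , b) (a′ , b′) → cong (_, _)
  (permute-zipWith (π ⟨$⟩ʳ_) (λ a → Vec.tabulate (λ i → lookup a (π ⟨$⟩ʳ i))) (λ a → Vec.lookup∘tabulate _) a a′)

permuteX-y-part : ∀ (π : Permutation′ k) (b : Vec ℤ n) → permuteX π (single (zeros , b)) ≈ single (zeros , b)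
permuteX-y-part π b = ≈-reflexive (cong (λ a → single (a , b))
  (permute-zeros (π ⟨$⟩ʳ_) (λ a → Vec.tabulate (λ i → lookup a (π ⟨$⟩ʳ i))) (λ a → Vec.lookup∘tabulate _)))

permuteX-x : ∀ (π : Permutation′ k) i → permuteX {n = n} π (x (π ⟨$⟩ʳ i)) ≈ x i
permuteX-x π i = ≈-reflexive (cong (λ a → single (a , zeros))
  (permute-unit π (λ a → Vec.tabulate (λ i → lookup a (π ⟨$⟩ʳ i))) (λ a → Vec.lookup∘tabulate _) i 1ℤ))

permuteX-s : ∀ (π : Permutation′ k) (p : Adjacent n) f → permuteX π (s p f) ≈ s p (permuteX π f)
permuteX-s π p f = ≈-trans (hom-cong (permuteX-hom π) (s-linear p f)) (≈-trans (linear-∘ _ (swapᵐ p) f)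
  (≈-sym (≈-trans (s-linear p (permuteX π f)) (linear-∘ (swapᵐ p) _ f))))

permuteX-reverseY : ∀ (π : Permutation′ k) (f : Laurent k n) → permuteX π (reverseY f) ≈ reverseY (permuteX π f)
permuteX-reverseY π f = ≈-trans (linear-∘ _ _ f) (≈-sym (linear-∘ _ _ f))

-- The local function of specialise is not in scope; its value is read off from
-- the image of a monomial.
substitute : Vec (Fin n) k → Vec ℤ k → Vec ℤ n → Vec ℤ n
substitute I a b with specialise I (single (a , b))
... | []              = b
... | (_ , _ , b′) ∷ _ = b′

update-zipWith : ∀ (b b′ : Vec ℤ n) i z z′ →
  zipWith _+_ b b′ [ i ]%= (λ w → z + z′ + w) ≡
  zipWith _+_ (b [ i ]%= (λ w → z + w)) (b′ [ i ]%= (λ w → z′ + w))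
update-zipWith (w ∷ b) (w′ ∷ b′) zero    z z′ = cong (_∷ zipWith _+_ b b′) (rearrange z z′ w w′)
  where
  rearrange : ∀ z z′ w w′ → z + z′ + (w + w′) ≡ z + w + (z′ + w′)
  rearrange = solve-∀
update-zipWith (w ∷ b) (w′ ∷ b′) (suc i) z z′ = cong (w + w′ ∷_) (update-zipWith b b′ i z z′)

substitute-· : ∀ (I : Vec (Fin n) k) a a′ b b′ →
  substitute I (zipWith _+_ a a′) (zipWith _+_ b b′) ≡ zipWith _+_ (substitute I a b) (substitute I a′ b′)
substitute-· []      []      []        b b′ = refl
substitute-· (i ∷ I) (z ∷ a) (z′ ∷ a′) b b′ =
  trans (cong (_[ i ]%= (λ w → z + z′ + w)) (substitute-· I a a′ b b′))
    (update-zipWith (substitute I a b) (substitute I a′ b′) i z z′)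

update-0 : ∀ (b : Vec ℤ n) i → b [ i ]%= (λ w → 0ℤ + w) ≡ b
update-0 b i = Vec.updateAt-id-local i b (ℤ.+-identityˡ (lookup b i))

substitute-zeros : ∀ (I : Vec (Fin n) k) b → substitute I zeros b ≡ b
substitute-zeros []      b = refl
substitute-zeros (i ∷ I) b = trans (update-0 (substitute I zeros b) i) (substitute-zeros I b)

substitute-unit : ∀ (I : Vec (Fin n) k) i z → substitute I (zeros [ i ]≔ z) zeros ≡ zeros [ lookup I i ]≔ z
substitute-unit (j ∷ I) zero    z = trans (cong (_[ j ]%= (λ w → z + w)) (substitute-zeros I zeros))
  (Vec.updateAt-cong-local j zeros (trans (cong (λ w → z + w) (Vec.lookup-replicate j 0ℤ)) (ℤ.+-identityʳ z)))
substitute-unit (j ∷ I) (suc i) z = trans (update-0 (substitute I (zeros [ i ]≔ z) zeros) j) (substitute-unit I i z)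

substitute-swap : ∀ (p : Adjacent n) (I : Vec (Fin n) k) a b →
  swap p (substitute I a b) ≡ substitute (Vec.map (σ p) I) a (swap p b)
substitute-swap p []      []      b = refl
substitute-swap p (i ∷ I) (z ∷ a) b = trans (swap-update p (substitute I a b) i (λ w → z + w))
  (cong (_[ σ p i ]%= (λ w → z + w)) (substitute-swap p I a b))

specialise-hom : ∀ (I : Vec (Fin n) k) → Hom (specialise I)
specialise-hom I = monomialHom _ λ (a , b) (a′ , b′) → cong ([] ,_) (substitute-· I a a′ b b′)

specialise-y-part : ∀ (I : Vec (Fin n) k) b → specialise I (single (zeros , b)) ≈ single ([] , b)
specialise-y-part I b = ≈-reflexive (cong (λ b → single ([] , b)) (substitute-zeros I b))

specialise-x : ∀ (I : Vec (Fin n) k) i → specialise I (x i) ≈ y (lookup I i)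
specialise-x I i = ≈-reflexive (cong (λ b → single ([] , b)) (substitute-unit I i 1ℤ))

specialise-s : ∀ (p : Adjacent n) (I : Vec (Fin n) k) f →
               s p (specialise I f) ≈ specialise (Vec.map (σ p) I) (s p f)
specialise-s p I f = ≈-trans (s-linear p (specialise I f)) (≈-trans (linear-∘ (swapᵐ p) _ f)
  (≈-trans (linear-ext (λ (a , b) → cong ([] ,_) (substitute-swap p I a b)) f)
    (≈-sym (≈-trans (hom-cong (specialise-hom (Vec.map (σ p) I)) (s-linear p f)) (linear-∘ _ (swapᵐ p) f)))))

specialise-ι : ∀ (I : Vec (Fin n) k) f → specialise I (ι f) ≈ f
specialise-ι I f = ≈-trans (linear-∘ _ _ f) (linear-id (λ { ([] , b) → cong ([] ,_) (substitute-zeros I b) }) f)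

permuteX-ι : ∀ (π : Permutation′ k) (f : Laurent 0 n) → permuteX π (ι f) ≈ ι f
permuteX-ι π f = ≈-trans (linear-∘ _ _ f) (linear-ext (λ (_ , b) → cong (_, b)
  (permute-zeros (π ⟨$⟩ʳ_) (λ a → Vec.tabulate (λ i → lookup a (π ⟨$⟩ʳ i))) (λ a → Vec.lookup∘tabulate _))) f)

module ≈-Reasoning {k n} = SetoidReasoning (≈-setoid {k} {n})

⊖-cong : f ≈ f′ → g ≈ g′ → f ⊖ g ≈ f′ ⊖ g′
⊖-cong p q = ⊕-cong p (⊝-cong q)

-- Divided differences

-- g is the image of f under the isobaric divided difference in u and v, f′
-- being f with u and v exchanged.
record Divided (u v g f f′ : Laurent k n) : Set where
  constructor divided
  field
    quotient : (u ⊖ v) ⊗ g ≈ u ⊗ f ⊖ v ⊗ f′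

open Divided public

hom-Divided : ∀ {F : Laurent k n → Laurent k′ n′} → Hom F → ∀ {u v g f f′ u′ v′ h h′} →
  F u ≈ u′ → F v ≈ v′ → F f ≈ h → F f′ ≈ h′ → Divided u v g f f′ → Divided u′ v′ (F g) h h′
hom-Divided {F = F} H {u} {v} {g} {f} {f′} {u′} {v′} {h} {h′} equ eqv eq eq′ (divided fg) = divided (begin
  (u′ ⊖ v′) ⊗ F g            ≈⟨ ⊗-congʳ (F g) (⊖-cong equ eqv) ⟨
  (F u ⊖ F v) ⊗ F g          ≈⟨ ⊗-congʳ (F g) (hom-⊖ H u v) ⟨
  F (u ⊖ v) ⊗ F g            ≈⟨ hom-⊗ H (u ⊖ v) g ⟨
  F ((u ⊖ v) ⊗ g)            ≈⟨ hom-cong H fg ⟩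
  F (u ⊗ f ⊖ v ⊗ f′)         ≈⟨ hom-⊖ H (u ⊗ f) (v ⊗ f′) ⟩
  F (u ⊗ f) ⊖ F (v ⊗ f′)     ≈⟨ ⊖-cong (hom-⊗ H u f) (hom-⊗ H v f′) ⟩
  F u ⊗ F f ⊖ F v ⊗ F f′     ≈⟨ ⊖-cong (⊗-cong equ eq) (⊗-cong eqv eq′) ⟩
  u′ ⊗ h ⊖ v′ ⊗ h′           ∎)
  where open ≈-Reasoning

s-Divided : ∀ (p : Adjacent n) {i j : Fin n} {g f f′ : Laurent k n} {h h′ : Laurent k n} {i′ j′} →
  σ p i ≡ i′ → σ p j ≡ j′ → s p f ≈ h → s p f′ ≈ h′ →
  Divided (y i) (y j) g f f′ → Divided (y i′) (y j′) (s p g) h h′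
s-Divided p {i} {j} refl refl = hom-Divided (s-hom p) (s-y p i) (s-y p j)

Divided-swap : ∀ {u v g f f′ : Laurent k n} → Divided u v g f f′ → Divided v u g f′ f
Divided-swap {u = u} {v} {g} {f} {f′} (divided fg) = divided (begin
  (v ⊖ u) ⊗ g        ≈⟨ solve 3 (λ u v g → (v :- u) :* g := :- ((u :- v) :* g)) ≈-refl u v g ⟩
  ⊝ ((u ⊖ v) ⊗ g)    ≈⟨ ⊝-cong fg ⟩
  ⊝ (u ⊗ f ⊖ v ⊗ f′) ≈⟨ solve 4 (λ u v f f′ → :- (u :* f :- v :* f′) := v :* f′ :- u :* f) ≈-refl u v f f′ ⟩
  v ⊗ f′ ⊖ u ⊗ f     ∎)
  where
  open ≈-Reasoning

Divided-unique : ∀ {i j : Fin n} {g g′ f f′ : Laurent k n} → i ≢ j →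
  Divided (y i) (y j) g f f′ → Divided (y i) (y j) g′ f f′ → g ≈ g′
Divided-unique i≢j (divided eq) (divided eq′) =
  cancelˡ (y⊖y-nonZeroDivisor i≢j) (≈-trans eq (≈-sym eq′))

-- Exchanging the two variables together with f and s f only changes the sign of the defining
-- equation, so s g satisfies the same equation as g.
Divided-invariant : ∀ (p : Adjacent n) {g f : Laurent k n} →
  Divided (y (low p)) (y (high p)) g f (s p f) → s p g ≈ g
Divided-invariant p {g} {f} fg = Divided-unique (low≢high p)
  (Divided-swap (s-Divided p (σ-low p) (σ-high p) ≈-refl (s-involutive p f) fg)) fg

module _ {p q : Adjacent n} (pq : Next p q) where
  private
    i₁ = low p
    i₂ = high p
    i₃ = high q

    σq-i₂ : σ q i₂ ≡ i₃
    σq-i₂ = trans (cong (σ q) (high≡low pq)) (σ-low q)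

    σq-i₃ : σ q i₃ ≡ i₂
    σq-i₃ = trans (σ-high q) (sym (high≡low pq))

    i₂≢i₃ : i₂ ≢ i₃
    i₂≢i₃ eq = low≢high q (trans (sym (high≡low pq)) eq)

  cancel-vandermonde : ∀ {g h : Laurent k n} →
    (y i₁ ⊖ y i₂) ⊗ ((y i₁ ⊖ y i₃) ⊗ ((y i₂ ⊖ y i₃) ⊗ g)) ≈
    (y i₁ ⊖ y i₂) ⊗ ((y i₁ ⊖ y i₃) ⊗ ((y i₂ ⊖ y i₃) ⊗ h)) → g ≈ h
  cancel-vandermonde eq = cancelˡ (y⊖y-nonZeroDivisor i₂≢i₃)
    (cancelˡ (y⊖y-nonZeroDivisor (low≢high-next pq)) (cancelˡ (y⊖y-nonZeroDivisor (low≢high p)) eq))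

  -- Let D_p, D_q be the isobaric divided differences. As f is invariant under s_q, it equals D_q f,
  -- and h = D_q D_p D_q f = D_p D_q D_p f is invariant under s_p. Without division: after
  -- multiplication by the Vandermonde product, h and s p h become the same combination of f, s p f
  -- and s q (s p f).
  Divided-Divided-invariant : ∀ {f g h : Laurent k n} → s q f ≈ f →
    Divided (y i₁) (y i₂) g f (s p f) → Divided (y i₂) (y i₃) h g (s q g) → s p h ≈ h
  Divided-Divided-invariant {f = f} {g} {h} sqf≈f fg gh = cancel-vandermonde (begin
    (y₁ ⊖ y₂) ⊗ ((y₁ ⊖ y₃) ⊗ ((y₂ ⊖ y₃) ⊗ s p h))
      ≈⟨ solve 4 (λ a b c h → (a :- b) :* ((a :- c) :* ((b :- c) :* h)) := (a :- b) :* (b :- c) :* ((a :- c) :* h)) ≈-refl y₁ y₂ y₃ (s p h) ⟩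
    (y₁ ⊖ y₂) ⊗ (y₂ ⊖ y₃) ⊗ ((y₁ ⊖ y₃) ⊗ s p h)
      ≈⟨ ⊗-congˡ ((y₁ ⊖ y₂) ⊗ (y₂ ⊖ y₃)) (quotient gh′) ⟩
    (y₁ ⊖ y₂) ⊗ (y₂ ⊖ y₃) ⊗ (y₁ ⊗ g ⊖ y₃ ⊗ s p (s q g))
      ≈⟨ solve 5 (λ a b c g k → (a :- b) :* (b :- c) :* (a :* g :- c :* k) := a :* (b :- c) :* ((a :- b) :* g) :- c :* (a :- b) :* ((b :- c) :* k)) ≈-refl y₁ y₂ y₃ g (s p (s q g)) ⟩
    y₁ ⊗ (y₂ ⊖ y₃) ⊗ ((y₁ ⊖ y₂) ⊗ g) ⊖ y₃ ⊗ (y₁ ⊖ y₂) ⊗ ((y₂ ⊖ y₃) ⊗ s p (s q g))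
      ≈⟨ ⊖-cong (⊗-congˡ (y₁ ⊗ (y₂ ⊖ y₃)) (quotient fg)) (⊗-congˡ (y₃ ⊗ (y₁ ⊖ y₂)) (quotient fg″)) ⟩
    y₁ ⊗ (y₂ ⊖ y₃) ⊗ (y₁ ⊗ f ⊖ y₂ ⊗ f₂) ⊖ y₃ ⊗ (y₁ ⊖ y₂) ⊗ (y₂ ⊗ f₂ ⊖ y₃ ⊗ f₃)
      ≈⟨ solve 6 (λ a b c f f₂ f₃ → a :* (b :- c) :* (a :* f :- b :* f₂) :- c :* (a :- b) :* (b :* f₂ :- c :* f₃) :=
           b :* (a :- c) :* (a :* f :- b :* f₂) :- c :* (a :- b) :* (a :* f :- c :* f₃)) ≈-refl y₁ y₂ y₃ f f₂ f₃ ⟩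
    y₂ ⊗ (y₁ ⊖ y₃) ⊗ (y₁ ⊗ f ⊖ y₂ ⊗ f₂) ⊖ y₃ ⊗ (y₁ ⊖ y₂) ⊗ (y₁ ⊗ f ⊖ y₃ ⊗ f₃)
      ≈⟨ ⊖-cong (⊗-congˡ (y₂ ⊗ (y₁ ⊖ y₃)) (quotient fg)) (⊗-congˡ (y₃ ⊗ (y₁ ⊖ y₂)) (quotient fg′)) ⟨
    y₂ ⊗ (y₁ ⊖ y₃) ⊗ ((y₁ ⊖ y₂) ⊗ g) ⊖ y₃ ⊗ (y₁ ⊖ y₂) ⊗ ((y₁ ⊖ y₃) ⊗ s q g)
      ≈⟨ solve 5 (λ a b c g k → b :* (a :- c) :* ((a :- b) :* g) :- c :* (a :- b) :* ((a :- c) :* k) := (a :- b) :* ((a :- c) :* (b :* g :- c :* k))) ≈-refl y₁ y₂ y₃ g (s q g) ⟩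
    (y₁ ⊖ y₂) ⊗ ((y₁ ⊖ y₃) ⊗ (y₂ ⊗ g ⊖ y₃ ⊗ s q g))
      ≈⟨ ⊗-congˡ (y₁ ⊖ y₂) (⊗-congˡ (y₁ ⊖ y₃) (quotient gh)) ⟨
    (y₁ ⊖ y₂) ⊗ ((y₁ ⊖ y₃) ⊗ ((y₂ ⊖ y₃) ⊗ h)) ∎)
    where
    open ≈-Reasoning
    y₁ = y i₁
    y₂ = y i₂
    y₃ = y i₃
    f₂ = s p f
    f₃ = s q f₂
    fg′ : Divided y₁ y₃ (s q g) f f₃
    fg′ = s-Divided q (σ-next-low pq) σq-i₂ sqf≈f ≈-refl fg
    fg″ : Divided y₂ y₃ (s p (s q g)) f₂ f₃
    fg″ = s-Divided p (σ-low p) (σ-next-high pq) ≈-refl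
      (≈-trans (s-braid pq f) (hom-cong (s-hom q) (hom-cong (s-hom p) sqf≈f))) fg′
    gh′ : Divided y₁ y₃ (s p h) g (s p (s q g))
    gh′ = s-Divided p (σ-high p) (σ-next-high pq) (Divided-invariant p fg) ≈-refl gh

  -- The braid argument with p and q exchanged.
  Divided-Divided-invariant′ : ∀ {f g h : Laurent k n} → s p f ≈ f →
    Divided (y i₂) (y i₃) g f (s q f) → Divided (y i₁) (y i₂) h g (s p g) → s q h ≈ h
  Divided-Divided-invariant′ {f = f} {g} {h} spf≈f fg gh = cancel-vandermonde (begin
    (y₁ ⊖ y₂) ⊗ ((y₁ ⊖ y₃) ⊗ ((y₂ ⊖ y₃) ⊗ s q h))
      ≈⟨ solve 4 (λ a b c h → (a :- b) :* ((a :- c) :* ((b :- c) :* h)) := (a :- b) :* (b :- c) :* ((a :- c) :* h)) ≈-refl y₁ y₂ y₃ (s q h) ⟩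
    (y₁ ⊖ y₂) ⊗ (y₂ ⊖ y₃) ⊗ ((y₁ ⊖ y₃) ⊗ s q h)
      ≈⟨ ⊗-congˡ ((y₁ ⊖ y₂) ⊗ (y₂ ⊖ y₃)) (quotient gh′) ⟩
    (y₁ ⊖ y₂) ⊗ (y₂ ⊖ y₃) ⊗ (y₁ ⊗ g ⊖ y₃ ⊗ s q (s p g))
      ≈⟨ solve 5 (λ a b c g k → (a :- b) :* (b :- c) :* (a :* g :- c :* k) := a :* (a :- b) :* ((b :- c) :* g) :- c :* (b :- c) :* ((a :- b) :* k)) ≈-refl y₁ y₂ y₃ g (s q (s p g)) ⟩
    y₁ ⊗ (y₁ ⊖ y₂) ⊗ ((y₂ ⊖ y₃) ⊗ g) ⊖ y₃ ⊗ (y₂ ⊖ y₃) ⊗ ((y₁ ⊖ y₂) ⊗ s q (s p g))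
      ≈⟨ ⊖-cong (⊗-congˡ (y₁ ⊗ (y₁ ⊖ y₂)) (quotient fg)) (⊗-congˡ (y₃ ⊗ (y₂ ⊖ y₃)) (quotient fg″)) ⟩
    y₁ ⊗ (y₁ ⊖ y₂) ⊗ (y₂ ⊗ f ⊖ y₃ ⊗ f₂) ⊖ y₃ ⊗ (y₂ ⊖ y₃) ⊗ (y₁ ⊗ f₂ ⊖ y₂ ⊗ f₃)
      ≈⟨ solve 6 (λ a b c f f₂ f₃ → a :* (a :- b) :* (b :* f :- c :* f₂) :- c :* (b :- c) :* (a :* f₂ :- b :* f₃) :=
           a :* (a :- c) :* (b :* f :- c :* f₂) :- b :* (b :- c) :* (a :* f :- c :* f₃)) ≈-refl y₁ y₂ y₃ f f₂ f₃ ⟩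
    y₁ ⊗ (y₁ ⊖ y₃) ⊗ (y₂ ⊗ f ⊖ y₃ ⊗ f₂) ⊖ y₂ ⊗ (y₂ ⊖ y₃) ⊗ (y₁ ⊗ f ⊖ y₃ ⊗ f₃)
      ≈⟨ ⊖-cong (⊗-congˡ (y₁ ⊗ (y₁ ⊖ y₃)) (quotient fg)) (⊗-congˡ (y₂ ⊗ (y₂ ⊖ y₃)) (quotient fg′)) ⟨
    y₁ ⊗ (y₁ ⊖ y₃) ⊗ ((y₂ ⊖ y₃) ⊗ g) ⊖ y₂ ⊗ (y₂ ⊖ y₃) ⊗ ((y₁ ⊖ y₃) ⊗ s p g)
      ≈⟨ solve 5 (λ a b c g k → a :* (a :- c) :* ((b :- c) :* g) :- b :* (b :- c) :* ((a :- c) :* k) := (a :- c) :* ((b :- c) :* (a :* g :- b :* k))) ≈-refl y₁ y₂ y₃ g (s p g) ⟩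
    (y₁ ⊖ y₃) ⊗ ((y₂ ⊖ y₃) ⊗ (y₁ ⊗ g ⊖ y₂ ⊗ s p g))
      ≈⟨ ⊗-congˡ (y₁ ⊖ y₃) (⊗-congˡ (y₂ ⊖ y₃) (quotient gh)) ⟨
    (y₁ ⊖ y₃) ⊗ ((y₂ ⊖ y₃) ⊗ ((y₁ ⊖ y₂) ⊗ h))
      ≈⟨ solve 4 (λ a b c h → (a :- c) :* ((b :- c) :* ((a :- b) :* h)) := (a :- b) :* ((a :- c) :* ((b :- c) :* h))) ≈-refl y₁ y₂ y₃ h ⟩
    (y₁ ⊖ y₂) ⊗ ((y₁ ⊖ y₃) ⊗ ((y₂ ⊖ y₃) ⊗ h)) ∎)
    where
    open ≈-Reasoning
    y₁ = y i₁
    y₂ = y i₂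
    y₃ = y i₃
    f₂ = s q f
    f₃ = s p f₂
    fg′ : Divided y₁ y₃ (s p g) f f₃
    fg′ = s-Divided p (σ-high p) (σ-next-high pq) spf≈f ≈-refl fg
    fg″ : Divided y₁ y₂ (s q (s p g)) f₂ f₃
    fg″ = s-Divided q (σ-next-low pq) σq-i₃ ≈-refl
      (≈-trans (≈-sym (s-braid pq f)) (hom-cong (s-hom p) (hom-cong (s-hom q) spf≈f))) fg′
    gh′ : Divided y₁ y₃ (s q h) g (s q (s p g))
    gh′ = s-Divided q (σ-next-low pq) σq-i₂ (Divided-invariant′ fg) ≈-refl gh
      where
      Divided-invariant′ : Divided (y i₂) (y i₃) g f (s q f) → s q g ≈ g
      Divided-invariant′ = subst (λ i → Divided (y i) (y i₃) g f (s q f) → s q g ≈ g)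
        (sym (high≡low pq)) (Divided-invariant q)

-- Double Grothendieck polynomials

-- Free of the proof of the size, so that equations between subsets can be rewritten without
-- transporting that proof.
poly : ∀ k → Subset n → Laurent k n
poly {n} k S = descend (Vec.allFin n) S (grothendieckTop k n)

module _ {S : Subset n} (∣S∣≡k : ∣ S ∣ ≡ k) where

  poly-step : ∀ p → at p S ≡ (inside , outside) →
    Divided (y (low p)) (y (high p)) (poly k S) (poly k (swap p S)) (s p (poly k (swap p S)))
  poly-step p eq = divided (≈-trans
    (⊗-congˡ (y (low p) ⊖ y (high p)) (grothendieck-step μ λ′ covers))
    (D-correct (low≢high p) (grothendieck λ′)))
    where
    μ λ′ : Frame k n
    μ = frame S ∣S∣≡k
    λ′ = frame (swap p S) (trans (∣swap∣ p S) ∣S∣≡k)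
    swapped : at p (swap p S) ≡ (outside , inside)
    swapped = trans (at-swap p S) (cong Product.swap eq)
    covers : subset μ ⟨ low p ⋖ high p ⟩ subset λ′
    covers = toℕ-high p
      , trans (lookup-low p (swap p S)) (cong proj₁ swapped)
      , trans (lookup-high p (swap p S)) (cong proj₂ swapped)
      , trans (sym (swap-involutive p S)) (trans (sym (swap-≔ p (swap p S)))
          (cong₂ (λ a b → swap p S [ low p ]≔ a [ high p ]≔ b)
            (trans (lookup-high p (swap p S)) (cong proj₂ swapped))
            (trans (lookup-low p (swap p S)) (cong proj₁ swapped))))

factor : Subset n → Fin k → Fin n → Laurent k n
factor S i j = if lookup S j then 1ᴸ else 1ᴸ ⊖ x i ⊗ y⁻¹ j

-- For `top` this is `grothendieckTop`. With an arbitrary S in place of the last k positions the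
-- form is stable under transpositions and the reversal of y.
factors : ∀ k → Subset n → Laurent k n
factors {n} k S = ∏ (List.allFin k) λ i → ∏ (List.allFin n) (factor S i)

hom-factor : ∀ {F : Laurent k n → Laurent k n} → Hom F → (S : Subset n) → ∀ {i i′ j j′} →
  F (x i) ≈ x i′ → F (y⁻¹ j) ≈ y⁻¹ j′ →
  F (factor S i j) ≈ (if lookup S j then 1ᴸ else 1ᴸ ⊖ x i′ ⊗ y⁻¹ j′)
hom-factor H S {i} {i′} {j} {j′} eq eq′ with lookup S j
... | inside  = hom-1 H
... | outside = ≈-trans (hom-⊖ H 1ᴸ (x i ⊗ y⁻¹ j)) (⊖-cong (hom-1 H)
                  (≈-trans (hom-⊗ H (x i) (y⁻¹ j)) (⊗-cong eq eq′)))

hom-factors : ∀ {F : Laurent k n → Laurent k n} (H : Hom F) (S S′ : Subset n) (π : Permutation′ n) →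
  (∀ i → F (x i) ≈ x i) → (∀ j → F (y⁻¹ j) ≈ y⁻¹ (π ⟨$⟩ʳ j)) → (∀ j → lookup S j ≡ lookup S′ (π ⟨$⟩ʳ j)) →
  F (factors k S) ≈ factors k S′
hom-factors {k} {n} H S S′ π eq eq′ eq″ = ≈-trans (hom-∏ H (List.allFin k) λ i → ∏ (List.allFin n) (factor S i))
  (∏-cong (List.allFin k) λ i → ≈-trans (hom-∏ H (List.allFin n) (factor S i))
    (≈-trans (∏-cong (List.allFin n) λ j → ≈-trans (hom-factor H S (eq i) (eq′ j))
        (≈-reflexive (cong (if_then 1ᴸ else 1ᴸ ⊖ x i ⊗ y⁻¹ (π ⟨$⟩ʳ j)) (eq″ j))))
      (∏-permute π (factor S′ i))))

σ-permutation : Adjacent n → Permutation′ n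
σ-permutation p = permutation (σ p) (σ p) (σ-involutive p) (σ-involutive p)

s-factors : ∀ (p : Adjacent n) (S : Subset n) → s p (factors k S) ≈ factors k (swap p S)
s-factors p S = hom-factors (s-hom p) S (swap p S) (σ-permutation p) (s-x p) (s-y⁻¹ p)
  λ j → trans (cong (lookup S) (sym (σ-involutive p j))) (sym (lookup-swap p S (σ p j)))

reverseY-factors : ∀ (S : Subset n) → reverseY (factors k S) ≈ factors k (Vec.reverse S)
reverseY-factors S = hom-factors reverseY-hom S (Vec.reverse S) Perm.reverse reverseY-x reverseY-y⁻¹
  λ j → sym (lookup-reverse-opposite S j)

permuteX-factors : ∀ (π : Permutation′ k) (S : Subset n) → permuteX π (factors k S) ≈ factors k S
permuteX-factors {k} {n} π S = ≈-trans (hom-∏ H (List.allFin k) λ i → ∏ (List.allFin n) (factor S i))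
  (≈-trans (≈-sym (∏-permute π λ i → permuteX π (∏ (List.allFin n) (factor S i))))
    (∏-cong (List.allFin k) λ i → ≈-trans (hom-∏ H (List.allFin n) (factor S (π ⟨$⟩ʳ i)))
      (∏-cong (List.allFin n) λ j → hom-factor H S (permuteX-x π i)
        (permuteX-y-part π (zeros [ j ]≔ -1ℤ)))))
  where H = permuteX-hom π

-- The frame of the full rectangle. From here on n is written as ℓ + k, which makes this frame a
-- concatenation and avoids subtraction; the theorem is transported along n ∸ k + k ≡ n at the very
-- end.
top : ∀ ℓ k → Subset (ℓ ℕ.+ k)
top ℓ k = replicate ℓ outside Vec.++ replicate k inside

grothendieckTop-factors : ∀ ℓ k → grothendieckTop k (ℓ ℕ.+ k) ≈ factors k (top ℓ k)
grothendieckTop-factors ℓ k = ∏-cong (List.allFin k) λ i →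
  ≈-trans (∏-filter (λ j → toℕ j ℕ.<? ℓ ℕ.+ k ℕ.∸ k) (List.allFin (ℓ ℕ.+ k)) (λ j → 1ᴸ ⊖ x i ⊗ y⁻¹ j))
    (∏-cong (List.allFin (ℓ ℕ.+ k)) λ j → ≈-reflexive (trans
      (cong (if_then 1ᴸ ⊖ x i ⊗ y⁻¹ j else 1ᴸ) (trans (cong (λ m → does (toℕ j ℕ.<? m)) (ℕ.m+n∸n≡m ℓ k)) (outside-below ℓ j)))
      (Bool.if-not (lookup (top ℓ k) j))))
  where
  outside-below : ∀ ℓ (j : Fin (ℓ ℕ.+ k)) → does (toℕ j ℕ.<? ℓ) ≡ not (lookup (top ℓ k) j)
  outside-below zero    j       = cong not (sym (Vec.lookup-replicate j inside))
  outside-below (suc ℓ) zero    = refl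
  outside-below (suc ℓ) (suc j) = outside-below ℓ j

∣top∣ : ∀ ℓ k → ∣ top ℓ k ∣ ≡ k
∣top∣ zero    k = Subset.∣⊤∣≡n k
∣top∣ (suc ℓ) k = ∣top∣ ℓ k

poly-top : ∀ ℓ k → poly k (top ℓ k) ≡ grothendieckTop k (ℓ ℕ.+ k)
poly-top ℓ k = grothendieck-top {ℓ} (frame (top ℓ k) (∣top∣ ℓ k)) refl

find-descent : ∀ (S : Subset n) → ∣ S ∣ ℕ.< n → ∃ λ p → at p (inside ∷ S) ≡ (inside , outside)
find-descent (outside ∷ S) lt       = here , refl
find-descent (inside  ∷ S) (s≤s lt) with find-descent S lt
... | p , eq = there p , eq

top-or-descent : ∀ ℓ (S : Subset (ℓ ℕ.+ k)) → ∣ S ∣ ≡ k →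
                 S ≡ top ℓ k ⊎ ∃ λ p → at p S ≡ (inside , outside)
top-or-descent zero    S             eq = inj₁ (Subset.∣p∣≡n⇒p≡⊤ eq)
top-or-descent (suc ℓ) (outside ∷ S) eq with top-or-descent ℓ S eq
... | inj₁ S≡top   = inj₁ (cong (outside ∷_) S≡top)
... | inj₂ (p , d) = inj₂ (there p , d)
top-or-descent {k} (suc ℓ) (inside ∷ S) eq =
  inj₂ (find-descent S (ℕ.≤-trans (ℕ.≤-reflexive eq) (ℕ.m≤n+m k ℓ)))

swap-equal : ∀ (p : Adjacent n) (v : Vec A n) {a} → at p v ≡ (a , a) → swap p v ≡ v
swap-equal here      (a ∷ .a ∷ v) refl = refl
swap-equal (there p) (a ∷ v)      eq   = cong (a ∷_) (swap-equal p v eq)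

-- Induction towards the full rectangle: a corner of the diagram at q is
-- removed, and what happens at p depends on the position of q relative to p.
poly-invariant : ∀ ℓ k N (S : Subset (ℓ ℕ.+ k)) → ∣ S ∣ ≡ k → coheight S ℕ.< N →
  ∀ p a → at p S ≡ (a , a) → s p (poly k S) ≈ poly k S
poly-invariant ℓ k (suc N) S ∣S∣≡k (s≤s lt) p a eq with top-or-descent ℓ S ∣S∣≡k
... | inj₁ refl = begin
  s p (poly k S)     ≈⟨ hom-cong (s-hom p) top-factors ⟩
  s p (factors k S)  ≈⟨ s-factors p S ⟩
  factors k (swap p S) ≡⟨ cong (factors k) (swap-equal p S eq) ⟩
  factors k S        ≈⟨ top-factors ⟨
  poly k S           ∎
  where
  open ≈-Reasoning
  top-factors : poly k S ≈ factors k S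
  top-factors = ≈-trans (≈-reflexive (poly-top ℓ k)) (grothendieckTop-factors ℓ k)
... | inj₂ (q , descent) = cases (compare p q)
  where
  ∣swapS∣≡k : ∣ swap q S ∣ ≡ k
  ∣swapS∣≡k = trans (∣swap∣ q S) ∣S∣≡k
  step = poly-step ∣S∣≡k q descent
  smaller : coheight (swap q S) ℕ.< N
  smaller = ℕ.<-≤-trans (coheight-swap q S descent) lt
  cases : Comparison p q → s p (poly k S) ≈ poly k S
  cases same with trans (sym eq) descent
  ... | ()
  cases (far pq) = Divided-unique (low≢high q)
    (s-Divided p (σ-far-low pq) (σ-far-high pq) unchanged
      (≈-trans (s-far pq (poly k (swap q S))) (hom-cong (s-hom q) unchanged)) step) step
    where
    unchanged = poly-invariant ℓ k N (swap q S) ∣swapS∣≡k smaller p a (trans (at-far pq S) eq)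
  -- At the three positions S reads inside, inside, outside. Two steps up it reads outside, inside,
  -- inside, where the induction hypothesis applies at q.
  cases (before pq) = Divided-Divided-invariant pq
    (poly-invariant ℓ k N (swap p (swap q S)) (trans (∣swap∣ p (swap q S)) ∣swapS∣≡k)
      (ℕ.<-trans (coheight-swap p (swap q S) descent′) smaller) q a
      (trans (at-swap-swap pq S) eq))
    (poly-step ∣swapS∣≡k p descent′)
    (subst (λ i → Divided (y i) (y (high q)) (poly k S) (poly k (swap q S)) (s q (poly k (swap q S))))
      (sym (high≡low pq)) step)
    where
    descent′ : at p (swap q S) ≡ (inside , outside)
    descent′ = trans (at-next-swap pq S) (cong₂ _,_
      (trans (cong proj₁ eq) (trans (sym (cong proj₂ eq)) (trans (at-next pq S) (cong proj₁ descent))))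
      (cong proj₂ descent))
  -- Now S reads inside, outside, outside, and two steps up outside, outside, inside.
  cases (after qp) = Divided-Divided-invariant′ qp
    (poly-invariant ℓ k N (swap p (swap q S)) (trans (∣swap∣ p (swap q S)) ∣swapS∣≡k)
      (ℕ.<-trans (coheight-swap p (swap q S) descent′) smaller) q a
      (trans (at-swap-swap′ qp S) eq))
    (subst (λ i → Divided (y i) (y (high p)) (poly k (swap q S)) (poly k (swap p (swap q S))) (s p (poly k (swap p (swap q S)))))
      (sym (high≡low qp)) (poly-step ∣swapS∣≡k p descent′))
    step
    where
    descent′ : at p (swap q S) ≡ (inside , outside)
    descent′ = trans (at-swap-next qp S) (cong₂ _,_ (cong proj₁ descent)
      (trans (cong proj₂ eq) (trans (sym (cong proj₁ eq)) (trans (sym (at-next qp S)) (cong proj₂ descent)))))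

-- A permutation of the x fixes every y and commutes with s, so the permuted polynomial satisfies
-- the same `Divided` equation and equals the original by uniqueness.
poly-symmetric : ∀ ℓ k N (S : Subset (ℓ ℕ.+ k)) → ∣ S ∣ ≡ k → coheight S ℕ.< N → Symmetric (poly k S)
poly-symmetric ℓ k (suc N) S ∣S∣≡k (s≤s lt) π with top-or-descent ℓ S ∣S∣≡k
... | inj₁ refl = begin
  permuteX π (poly k S)    ≈⟨ hom-cong (permuteX-hom π) top-factors ⟩
  permuteX π (factors k S) ≈⟨ permuteX-factors π S ⟩
  factors k S              ≈⟨ top-factors ⟨
  poly k S                 ∎
  where
  open ≈-Reasoning
  top-factors : poly k S ≈ factors k S
  top-factors = ≈-trans (≈-reflexive (poly-top ℓ k)) (grothendieckTop-factors ℓ k)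
... | inj₂ (q , descent) = Divided-unique (low≢high q)
  (hom-Divided (permuteX-hom π) (permuteX-y-part π _) (permuteX-y-part π _) unchanged
    (≈-trans (permuteX-s π q (poly k (swap q S))) (hom-cong (s-hom q) unchanged)) step) step
  where
  step = poly-step ∣S∣≡k q descent
  unchanged = poly-symmetric ℓ k N (swap q S) (trans (∣swap∣ q S) ∣S∣≡k)
    (ℕ.<-≤-trans (coheight-swap q S descent) lt) π

-- Dual polynomials

-- Recursion on S, in place of a filtered list of indices, makes the effect of `swap` a matter of
-- commutativity.
product : Subset m → (Fin m → Laurent k n) → Laurent k n
product []      f = 1ᴸ
product (s ∷ S) f = (if s then f zero else 1ᴸ) ⊗ product S (f ∘ suc)

∏-product : ∀ (S : Subset m) (f : Fin m → Laurent k n) →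
            ∏ (List.filter (λ i → lookup S i Bool.≟ inside) (List.allFin m)) f ≈ product S f
∏-product {m} S f = ≈-trans (∏-filter (λ i → lookup S i Bool.≟ inside) (List.allFin m) f) (≈-trans
  (∏-cong (List.allFin m) λ i → ≈-reflexive (cong (if_then f i else 1ᴸ) (does-≟-inside (lookup S i))))
  (go S f))
  where
  does-≟-inside : ∀ b → does (b Bool.≟ inside) ≡ b
  does-≟-inside true  = refl
  does-≟-inside false = refl
  go : ∀ {m} (S : Subset m) (f : Fin m → Laurent k n) →
       ∏ (List.allFin m) (λ i → if lookup S i then f i else 1ᴸ) ≈ product S f
  go []      f = ≈-refl
  go (s ∷ S) f = ⊗-congˡ (if s then f zero else 1ᴸ)
    (≈-trans (≈-reflexive (∏-tabulate suc (λ i → if lookup (s ∷ S) i then f i else 1ᴸ))) (go S (f ∘ suc)))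

product-cong : ∀ (S : Subset m) {f g : Fin m → Laurent k n} → (∀ i → f i ≈ g i) → product S f ≈ product S g
product-cong []            eq = ≈-refl
product-cong (inside  ∷ S) eq = ⊗-cong (eq zero) (product-cong S (eq ∘ suc))
product-cong (outside ∷ S) eq = ⊗-congˡ 1ᴸ (product-cong S (eq ∘ suc))

hom-product : ∀ {F : Laurent k n → Laurent k′ n′} → Hom F → ∀ (S : Subset m) f →
              F (product S f) ≈ product S (F ∘ f)
hom-product H []      f = hom-1 H
hom-product {F = F} H (inside ∷ S) f = ≈-trans (hom-⊗ H (f zero) (product S (f ∘ suc)))
  (⊗-congˡ (F (f zero)) (hom-product H S (f ∘ suc)))
hom-product H (outside ∷ S) f = ≈-trans (hom-⊗ H 1ᴸ (product S (f ∘ suc)))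
  (⊗-cong (hom-1 H) (hom-product H S (f ∘ suc)))

product-σ : ∀ (p : Adjacent m) (S : Subset m) (f : Fin m → Laurent k n) →
            product S (f ∘ σ p) ≈ product (swap p S) f
product-σ here (a ∷ b ∷ S) f = solve 3 (λ u v w → u :* (v :* w) := v :* (u :* w)) ≈-refl
  (if a then f (suc zero) else 1ᴸ) (if b then f zero else 1ᴸ) (product S (λ i → f (suc (suc i))))
product-σ (there p) (a ∷ S) f = ⊗-congˡ (if a then f zero else 1ᴸ) (product-σ p S (f ∘ suc))

product-swap : ∀ (p : Adjacent m) (S : Subset m) (f : Fin m → Laurent k n) → at p S ≡ (inside , outside) →
               product (swap p S) f ⊗ f (low p) ≈ product S f ⊗ f (high p)
product-swap here (inside ∷ outside ∷ S) f refl =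
  solve 3 (λ u v w → con 1ℤ :* (v :* w) :* u := u :* (con 1ℤ :* w) :* v) ≈-refl
    (f zero) (f (suc zero)) (product S (λ i → f (suc (suc i))))
product-swap (there p) (a ∷ S) f eq = ≈-trans (⊗-assoc a′ (product (swap p S) (f ∘ suc)) (f (suc (low p))))
  (≈-trans (⊗-congˡ a′ (product-swap p S (f ∘ suc) eq)) (≈-sym (⊗-assoc a′ (product S (f ∘ suc)) (f (suc (high p))))))
  where a′ = if a then f zero else 1ᴸ

-- The parameter u at which the R-matrices will act at p.
ratio : Adjacent n → Laurent k n
ratio p = y (high p) ⊗ y⁻¹ (low p)

product-y⁻¹-swap : ∀ (p : Adjacent n) (S : Subset n) → at p S ≡ (inside , outside) →
                   product {k = k} (swap p S) y⁻¹ ⊗ ratio p ≈ product S y⁻¹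
product-y⁻¹-swap {k = k} p S eq = begin
  P′ ⊗ (y hi ⊗ y⁻¹ lo)     ≈⟨ solve 3 (λ a b c → a :* (b :* c) := b :* (a :* c)) ≈-refl P′ (y hi) (y⁻¹ lo) ⟩
  y hi ⊗ (P′ ⊗ y⁻¹ lo)     ≈⟨ ⊗-congˡ (y hi) (product-swap p S y⁻¹ eq) ⟩
  y hi ⊗ (P ⊗ y⁻¹ hi)      ≈⟨ solve 3 (λ a b c → b :* (a :* c) := a :* (b :* c)) ≈-refl P (y hi) (y⁻¹ hi) ⟩
  P ⊗ (y hi ⊗ y⁻¹ hi)      ≈⟨ ⊗-congˡ P (y⊗y⁻¹ hi) ⟩
  P ⊗ 1ᴸ                 ≈⟨ ⊗-identityʳ P ⟩
  P                      ∎
  where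
  open ≈-Reasoning
  hi = high p
  lo = low p
  P P′ : Laurent k _
  P = product S y⁻¹
  P′ = product (swap p S) y⁻¹

∏x : ∀ k → Laurent k n
∏x k = ∏ (List.allFin k) x

dual : ∀ k → Subset n → Laurent k n
dual {n} k S = ∏x k ⊗ ∏ (List.filter (λ i → lookup S i Bool.≟ inside) (List.allFin n)) y⁻¹ ⊗
               reverseY (poly k (Vec.reverse S))

dual-product : ∀ (S : Subset n) → dual k S ≈ ∏x k ⊗ product S y⁻¹ ⊗ reverseY (poly k (Vec.reverse S))
dual-product {k = k} S = ⊗-congʳ (reverseY (poly k (Vec.reverse S))) (⊗-congˡ (∏x k) (∏-product S y⁻¹))

s-∏x : ∀ (p : Adjacent n) → s p (∏x k) ≈ ∏x k
s-∏x {k = k} p = ≈-trans (hom-∏ (s-hom p) (List.allFin k) x) (∏-cong (List.allFin k) (s-x p))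

s-product-y⁻¹ : ∀ (p : Adjacent n) (S : Subset n) → s {k = k} p (product S y⁻¹) ≈ product (swap p S) y⁻¹
s-product-y⁻¹ p S = ≈-trans (hom-product (s-hom p) S y⁻¹)
  (≈-trans (product-cong S (s-y⁻¹ p)) (product-σ p S y⁻¹))

module _ {ℓ k} (S : Subset (ℓ ℕ.+ k)) (∣S∣≡k : ∣ S ∣ ≡ k) where
  private
    T = Vec.reverse S

    ∣T∣≡k : ∣ T ∣ ≡ k
    ∣T∣≡k = trans (∣reverse∣ S) ∣S∣≡k

    part : Laurent k (ℓ ℕ.+ k)
    part = reverseY (poly k T)

    s-dual-product : ∀ p → s p (dual k S) ≈ ∏x k ⊗ product (swap p S) y⁻¹ ⊗ s p part
    s-dual-product p = begin
      s p (dual k S)   ≈⟨ hom-cong (s-hom p) (dual-product S) ⟩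
      s p (∏x k ⊗ product S y⁻¹ ⊗ part)           ≈⟨ hom-⊗ (s-hom p) (∏x k ⊗ product S y⁻¹) part ⟩
      s p (∏x k ⊗ product S y⁻¹) ⊗ s p part       ≈⟨ ⊗-congʳ (s p part) (hom-⊗ (s-hom p) (∏x k) (product S y⁻¹)) ⟩
      s p (∏x k) ⊗ s p (product S y⁻¹) ⊗ s p part ≈⟨ ⊗-congʳ (s p part) (⊗-cong (s-∏x p) (s-product-y⁻¹ p S)) ⟩
      ∏x k ⊗ product (swap p S) y⁻¹ ⊗ s p part    ∎
      where open ≈-Reasoning

    s-part : ∀ p → s (proj₁ (mirror p)) (poly k T) ≈ poly k T → s p part ≈ part
    s-part p eq = ≈-trans (s-reverseY p (poly k T)) (hom-cong reverseY-hom eq)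

  -- This and the next two lemmas are the rows of `Rˢ` at u = `ratio p`: entry 1 for equal letters,
  -- u for (outside, inside), and 1 together with 1 - u for (inside, outside).
  dual-equal : ∀ p {a} → at p S ≡ (a , a) → s p (dual k S) ≈ dual k S
  dual-equal p {a} eq = ≈-trans (s-dual-product p) (≈-trans
    (⊗-cong (≈-reflexive (cong (λ S → ∏x k ⊗ product S y⁻¹) (swap-equal p S eq)))
      (s-part p (poly-invariant ℓ k _ T ∣T∣≡k ℕ.≤-refl (proj₁ (mirror p)) a
        (trans (at-reverse p S) (cong Product.swap eq)))))
    (≈-sym (dual-product S)))

  -- Reversal makes the ascent a descent of `T`, so `poly k T` is a divided difference and therefore
  -- invariant. Only the monomial factor changes, by `ratio p`.
  dual-ascent : ∀ p → at p S ≡ (outside , inside) → s p (dual k S) ≈ ratio p ⊗ dual k S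
  dual-ascent p eq = begin
    s p (dual k S)                               ≈⟨ s-dual-product p ⟩
    ∏x k ⊗ product (swap p S) y⁻¹ ⊗ s p part     ≈⟨ ⊗-cong (⊗-congˡ (∏x k) (≈-sym (product-y⁻¹-swap p (swap p S)
         (trans (at-swap p S) (cong Product.swap eq))))) (s-part p (Divided-invariant (proj₁ (mirror p))
           (poly-step ∣T∣≡k (proj₁ (mirror p)) (trans (at-reverse p S) (cong Product.swap eq))))) ⟩
    ∏x k ⊗ (product (swap p (swap p S)) y⁻¹ ⊗ ratio p) ⊗ part
      ≡⟨ cong (λ S → ∏x k ⊗ (product S y⁻¹ ⊗ ratio p) ⊗ part) (swap-involutive p S) ⟩
    ∏x k ⊗ (product S y⁻¹ ⊗ ratio p) ⊗ part
      ≈⟨ solve 4 (λ a b c d → a :* (b :* c) :* d := c :* (a :* b :* d)) ≈-refl (∏x k) (product S y⁻¹) (ratio p) part ⟩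
    ratio p ⊗ (∏x k ⊗ product S y⁻¹ ⊗ part)      ≈⟨ ⊗-congˡ (ratio p) (dual-product S) ⟨
    ratio p ⊗ dual k S                           ∎
    where
    open ≈-Reasoning

  -- Here `part′` is a divided difference of `part`. Its equation is solved for s p `part`, which
  -- requires dividing only by the unit y (`low p`).
  dual-descent : ∀ p → at p S ≡ (inside , outside) →
                 s p (dual k S) ≈ dual k S ⊕ (1ᴸ ⊖ ratio p) ⊗ dual k (swap p S)
  dual-descent p eq = begin
    s p (dual k S)                               ≈⟨ s-dual-product p ⟩
    ∏x k ⊗ P′ ⊗ s p part                         ≈⟨ ⊗-congˡ (∏x k ⊗ P′) s-part-descent ⟩
    ∏x k ⊗ P′ ⊗ (ratio p ⊗ part ⊕ (1ᴸ ⊖ ratio p) ⊗ part′)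
      ≈⟨ solve 5 (λ a b c d e → a :* b :* (c :* d :+ (con 1ℤ :- c) :* e) := a :* (b :* c) :* d :+ (con 1ℤ :- c) :* (a :* b :* e))
           ≈-refl (∏x k) P′ (ratio p) part part′ ⟩
    ∏x k ⊗ (P′ ⊗ ratio p) ⊗ part ⊕ (1ᴸ ⊖ ratio p) ⊗ (∏x k ⊗ P′ ⊗ part′)
      ≈⟨ ⊕-cong (≈-trans (⊗-congʳ part (⊗-congˡ (∏x k) (product-y⁻¹-swap p S eq))) (≈-sym (dual-product S)))
           (⊗-congˡ (1ᴸ ⊖ ratio p) (≈-sym (dual-product (swap p S)))) ⟩
    dual k S ⊕ (1ᴸ ⊖ ratio p) ⊗ dual k (swap p S) ∎
    where
    open ≈-Reasoning
    p′ = proj₁ (mirror p)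
    yˡ yʰ : Laurent k (ℓ ℕ.+ k)
    yˡ = y (low p)
    yʰ = y (high p)
    P′ part′ : Laurent k (ℓ ℕ.+ k)
    P′ = product (swap p S) y⁻¹
    part′ = reverseY (poly k (Vec.reverse (swap p S)))
    reversed : Vec.reverse (swap p S) ≡ swap p′ T
    reversed = reverse-swap p S
    step : Divided (y (low p′)) (y (high p′)) (poly k (Vec.reverse (swap p S))) (poly k T) (s p′ (poly k T))
    step = subst₂ (λ U V → Divided (y (low p′)) (y (high p′)) (poly k U) (poly k V) (s p′ (poly k V)))
      (sym reversed) (swap-involutive p′ T)
      (poly-step (trans (∣swap∣ p′ T) ∣T∣≡k) p′
        (trans (at-swap p′ T) (cong Product.swap (trans (at-reverse p S) (cong Product.swap eq)))))
    opposite-low : Fin.opposite (low p′) ≡ high p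
    opposite-low = trans (cong Fin.opposite (proj₁ (proj₂ (mirror p)))) (Fin.opposite-involutive (high p))
    opposite-high : Fin.opposite (high p′) ≡ low p
    opposite-high = trans (cong Fin.opposite (proj₂ (proj₂ (mirror p)))) (Fin.opposite-involutive (low p))
    dual-step : Divided yʰ yˡ part′ part (s p part)
    dual-step = hom-Divided reverseY-hom
      (≈-trans (reverseY-y (low p′)) (≈-reflexive (cong y opposite-low)))
      (≈-trans (reverseY-y (high p′)) (≈-reflexive (cong y opposite-high)))
      ≈-refl (≈-sym (s-reverseY p (poly k T))) step
    s-part-descent : s p part ≈ ratio p ⊗ part ⊕ (1ᴸ ⊖ ratio p) ⊗ part′
    s-part-descent = begin
      s p part                   ≈⟨ ⊗-identityˡ (s p part) ⟨
      1ᴸ ⊗ s p part              ≈⟨ ⊗-congʳ (s p part) (y⊗y⁻¹ (low p)) ⟨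
      yˡ ⊗ yˡ⁻¹ ⊗ s p part
        ≈⟨ solve 5 (λ h l l⁻¹ r s → l :* l⁻¹ :* s := h :* l⁻¹ :* r :- l⁻¹ :* (h :* r :- l :* s)) ≈-refl yʰ yˡ yˡ⁻¹ part (s p part) ⟩
      yʰ ⊗ yˡ⁻¹ ⊗ part ⊖ yˡ⁻¹ ⊗ (yʰ ⊗ part ⊖ yˡ ⊗ s p part)
        ≈⟨ ⊖-cong (≈-refl {x = yʰ ⊗ yˡ⁻¹ ⊗ part}) (⊗-congˡ yˡ⁻¹ (quotient dual-step)) ⟨
      yʰ ⊗ yˡ⁻¹ ⊗ part ⊖ yˡ⁻¹ ⊗ ((yʰ ⊖ yˡ) ⊗ part′)
        ≈⟨ solve 5 (λ h l l⁻¹ r r′ → h :* l⁻¹ :* r :- l⁻¹ :* ((h :- l) :* r′) := h :* l⁻¹ :* r :+ (l :* l⁻¹ :- h :* l⁻¹) :* r′) ≈-refl yʰ yˡ yˡ⁻¹ part part′ ⟩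
      yʰ ⊗ yˡ⁻¹ ⊗ part ⊕ (yˡ ⊗ yˡ⁻¹ ⊖ yʰ ⊗ yˡ⁻¹) ⊗ part′
        ≈⟨ ⊕-congˡ (yʰ ⊗ yˡ⁻¹ ⊗ part) (⊗-congʳ part′ (⊖-cong (y⊗y⁻¹ (low p)) (≈-refl {x = yʰ ⊗ yˡ⁻¹}))) ⟩
      yʰ ⊗ yˡ⁻¹ ⊗ part ⊕ (1ᴸ ⊖ yʰ ⊗ yˡ⁻¹) ⊗ part′ ∎
      where
      yˡ⁻¹ : Laurent k (ℓ ℕ.+ k)
      yˡ⁻¹ = y⁻¹ (low p)

  dual-symmetric : Symmetric (dual k S)
  dual-symmetric π = begin
    permuteX π (∏x k ⊗ Y ⊗ part)
      ≈⟨ ≈-trans (hom-⊗ H (∏x k ⊗ Y) part) (⊗-congʳ (permuteX π part) (hom-⊗ H (∏x k) Y)) ⟩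
    permuteX π (∏x k) ⊗ permuteX π Y ⊗ permuteX π part
      ≈⟨ ⊗-cong (⊗-cong
           (≈-trans (hom-∏ H (List.allFin k) x) (≈-trans (≈-sym (∏-permute π (λ i → permuteX π (x i))))
             (∏-cong (List.allFin k) (permuteX-x π))))
           (≈-trans (hom-∏ H js y⁻¹) (∏-cong js λ j → permuteX-y-part π (zeros [ j ]≔ -1ℤ))))
           (≈-trans (permuteX-reverseY π (poly k T)) (hom-cong reverseY-hom
             (poly-symmetric ℓ k _ T ∣T∣≡k ℕ.≤-refl π))) ⟩
    ∏x k ⊗ Y ⊗ part ∎
    where
    open ≈-Reasoning
    H = permuteX-hom π
    js = List.filter (λ i → lookup S i Bool.≟ inside) (List.allFin (ℓ ℕ.+ k))
    Y : Laurent k (ℓ ℕ.+ k)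
    Y = ∏ js y⁻¹

  dual-bottom : T ≡ top ℓ k → dual k S ≈ ∏x k ⊗ product S y⁻¹ ⊗ factors k S
  dual-bottom eq = ≈-trans (dual-product S) (⊗-congˡ (∏x k ⊗ product S y⁻¹) (begin
    reverseY (poly k T)                          ≡⟨ cong (reverseY ∘ poly k) eq ⟩
    reverseY (poly k (top ℓ k))                  ≈⟨ hom-cong reverseY-hom (≈-trans (≈-reflexive (poly-top ℓ k)) (grothendieckTop-factors ℓ k)) ⟩
    reverseY (factors k (top ℓ k))               ≈⟨ reverseY-factors (top ℓ k) ⟩
    factors k (Vec.reverse (top ℓ k))            ≡⟨ cong (factors k) (trans (cong Vec.reverse (sym eq)) (Vec.reverse-involutive S)) ⟩
    factors k S                                  ∎))
    where open ≈-Reasoning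

  bottom-or-ascent : T ≡ top ℓ k ⊎ ∃ λ p → at p S ≡ (outside , inside)
  bottom-or-ascent with top-or-descent ℓ T ∣T∣≡k
  ... | inj₁ eq           = inj₁ eq
  ... | inj₂ (p′ , descent) = inj₂ (proj₁ (mirror p′) ,
    trans (cong (at (proj₁ (mirror p′))) (sym (Vec.reverse-involutive S)))
      (trans (at-reverse p′ T) (cong Product.swap descent)))

-- Fixed points

-- I lists, in order, the entries of zs at the positions in S. With zs arbitrary, a transposition of
-- values can be traded for one of positions.
data Selects {A : Set} : Vec A m → Subset m → Vec A k → Set where
  []   : Selects [] [] []
  take : ∀ {z} {zs : Vec A m} {S} {I : Vec A k} → Selects zs S I → Selects (z ∷ zs) (inside ∷ S) (z ∷ I)
  skip : ∀ {z} {zs : Vec A m} {S} {I : Vec A k} → Selects zs S I → Selects (z ∷ zs) (outside ∷ S) I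

Selects-map : ∀ (φ : A → B) {zs : Vec A m} {S} {I : Vec A k} → Selects zs S I →
              Selects (Vec.map φ zs) S (Vec.map φ I)
Selects-map φ []       = []
Selects-map φ (take i) = take (Selects-map φ i)
Selects-map φ (skip i) = skip (Selects-map φ i)

-- By the hypothesis exactly one of the two positions is selected, so exchanging them does not
-- disturb the order of I.
Selects-swap : ∀ (p : Adjacent m) {zs : Vec A m} {S} {I : Vec A k} → proj₁ (at p S) ≢ proj₂ (at p S) →
               Selects (swap p zs) S I → Selects zs (swap p S) I
Selects-swap here {z ∷ z′ ∷ zs} a≢b (take (take i)) = ⊥-elim (a≢b refl)
Selects-swap here {z ∷ z′ ∷ zs} a≢b (take (skip i)) = skip (take i)
Selects-swap here {z ∷ z′ ∷ zs} a≢b (skip (take i)) = take (skip i)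
Selects-swap here {z ∷ z′ ∷ zs} a≢b (skip (skip i)) = ⊥-elim (a≢b refl)
Selects-swap (there p) {z ∷ zs} a≢b (take i) = take (Selects-swap p a≢b i)
Selects-swap (there p) {z ∷ zs} a≢b (skip i) = skip (Selects-swap p a≢b i)

Selects-σ : ∀ (p : Adjacent n) {S} {I : Vec (Fin n) k} → proj₁ (at p S) ≢ proj₂ (at p S) →
            Selects (Vec.allFin n) S I → Selects (Vec.allFin n) (swap p S) (Vec.map (σ p) I)
Selects-σ p {S} {I} a≢b i = Selects-swap p a≢b
  (subst (λ zs → Selects zs S (Vec.map (σ p) I)) (sym (swap-allFin p)) (Selects-map (σ p) i))

-- Weaker than `Selects`. In `localise-support` the transposition may exchange two elements of T,
-- which destroys the order of I but not the occurrence of each element.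
Occur : Subset n → Vec (Fin n) k → Set
Occur {n} {k} T I = ∀ j → lookup T j ≡ inside → ∃ λ a → lookup I a ≡ j

Selects⇒lookup : ∀ {zs : Vec A m} {S} {I : Vec A k} → Selects zs S I →
                 ∀ j → lookup S j ≡ inside → ∃ λ a → lookup I a ≡ lookup zs j
Selects⇒lookup (take i) zero    eq = zero , refl
Selects⇒lookup (take i) (suc j) eq = Product.map suc id (Selects⇒lookup i j eq)
Selects⇒lookup (skip i) (suc j) eq = Selects⇒lookup i j eq

Selects⇒Occur : ∀ {S} {I : Vec (Fin n) k} → Selects (Vec.allFin n) S I → Occur S I
Selects⇒Occur i j eq = Product.map₂ (λ eq′ → trans eq′ (Vec.lookup-allFin j)) (Selects⇒lookup i j eq)

Occur-σ : ∀ (p : Adjacent n) {T} {I : Vec (Fin n) k} → Occur T I → Occur (swap p T) (Vec.map (σ p) I)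
Occur-σ p {T} {I} occur j eq with occur (σ p j) (trans (sym (lookup-swap p T j)) eq)
... | a , eq′ = a , trans (Vec.lookup-map a (σ p) I) (trans (cong (σ p) eq′) (σ-involutive p j))

-- Some final segment contains more elements of T than of S.
infix 4 _≻_
data _≻_ : Subset m → Subset m → Set where
  here  : ∀ {T S : Subset m} → ∣ S ∣ ℕ.< ∣ T ∣ → T ≻ S
  there : ∀ {t s} {T S : Subset m} → T ≻ S → (t ∷ T) ≻ (s ∷ S)

∣∷∣-≤ : ∀ s (S : Subset m) → ∣ S ∣ ℕ.≤ ∣ s ∷ S ∣
∣∷∣-≤ inside  S = ℕ.n≤1+n ∣ S ∣
∣∷∣-≤ outside S = ℕ.≤-refl

∣∷∣-≤-suc : ∀ s (S : Subset m) → ∣ s ∷ S ∣ ℕ.≤ suc ∣ S ∣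
∣∷∣-≤-suc inside  S = ℕ.≤-refl
∣∷∣-≤-suc outside S = ℕ.n≤1+n ∣ S ∣

≻-witness : ∀ {T S : Subset m} → T ≻ S → ∃ λ j → lookup T j ≡ inside × lookup S j ≡ outside
≻-witness (there T≻S) = Product.map suc id (≻-witness T≻S)
≻-witness {T = inside  ∷ T} {outside ∷ S} (here lt) = zero , refl , refl
≻-witness {T = inside  ∷ T} {inside  ∷ S} (here lt) = Product.map suc id (≻-witness (here {T = T} {S} (ℕ.s<s⁻¹ lt)))
≻-witness {T = outside ∷ T} {s ∷ S}       (here lt) =
  Product.map suc id (≻-witness (here {T = T} {S} (ℕ.≤-<-trans (∣∷∣-≤ s S) lt)))

-- Only the final segment starting at `high p` is affected. There `swap p S` has one element less,
-- which gives the first claim. For the second, S has an element at `high p`, so an excess of T on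
-- this segment is still present on the segment after it, where neither swap matters.
≻-swap : ∀ (p : Adjacent m) {T S} → at p S ≡ (outside , inside) → T ≻ S → T ≻ swap p S × swap p T ≻ swap p S
≻-swap p {T} {S} eq (here lt) = here (subst (ℕ._< ∣ T ∣) (sym (∣swap∣ p S)) lt)
                              , here (subst₂ ℕ._<_ (sym (∣swap∣ p S)) (sym (∣swap∣ p T)) lt)
≻-swap (there p) eq (there T≻S) = Product.map there there (≻-swap p eq T≻S)
≻-swap here {t ∷ t′ ∷ T} {outside ∷ inside ∷ S} refl (there (here lt)) =
    there (here (ℕ.≤-trans (ℕ.n≤1+n (suc ∣ S ∣)) lt))
  , there (there (here (ℕ.s<s⁻¹ (ℕ.≤-trans lt (∣∷∣-≤-suc t′ T)))))
≻-swap here {t ∷ t′ ∷ T} {outside ∷ inside ∷ S} refl (there (there T≻S)) = there (there T≻S) , there (there T≻S)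

ascent-≻ : ∀ (p : Adjacent m) {S} → at p S ≡ (outside , inside) → S ≻ swap p S
ascent-≻ here      {outside ∷ inside ∷ S} refl = there (here ℕ.≤-refl)
ascent-≻ (there p) {s ∷ S}                eq   = there (ascent-≻ p eq)

top-≻ : ∀ ℓ (S : Subset (ℓ ℕ.+ k)) → ∣ S ∣ ≡ k → S ≢ top ℓ k → top ℓ k ≻ S
top-≻ zero    S             eq S≢top = ⊥-elim (S≢top (Subset.∣p∣≡n⇒p≡⊤ eq))
top-≻ (suc ℓ) (outside ∷ S) eq S≢top = there (top-≻ ℓ S eq (S≢top ∘ cong (outside ∷_)))
top-≻ {k} (suc ℓ) (inside ∷ S) eq S≢top =
  there (here (ℕ.≤-reflexive (trans eq (sym (∣top∣ ℓ k)))))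

localise : Vec (Fin n) k → Subset n → Laurent 0 n
localise {k = k} I S = specialise I (dual k S)

map-σ-involutive : ∀ (p : Adjacent n) (I : Vec (Fin n) k) → Vec.map (σ p) (Vec.map (σ p) I) ≡ I
map-σ-involutive p I = trans (sym (Vec.map-∘ (σ p) (σ p) I))
  (trans (Vec.map-cong (σ-involutive p) I) (Vec.map-id I))

s-localise : ∀ (p : Adjacent n) (I : Vec (Fin n) k) S →
             s p (localise (Vec.map (σ p) I) S) ≈ specialise I (s p (dual k S))
s-localise {k = k} p I S = ≈-trans (specialise-s p (Vec.map (σ p) I) (dual k S))
  (≈-reflexive (cong (λ I → specialise I (s p (dual k S))) (map-σ-involutive p I)))

specialise-ratio : ∀ (p : Adjacent n) (I : Vec (Fin n) k) → specialise I (ratio p) ≈ ratio p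
specialise-ratio p I = ≈-trans (hom-⊗ (specialise-hom I) (y (high p)) (y⁻¹ (low p)))
  (⊗-cong (specialise-y-part I _) (specialise-y-part I _))

1⊖y/y-nonZeroDivisor : ∀ {i j : Fin n} → i ≢ j → NonZeroDivisor {k} (1ᴸ ⊖ y j ⊗ y⁻¹ i)
1⊖y/y-nonZeroDivisor {i = i} {j} i≢j = nonZeroDivisor λ {f} eq → NonZeroDivisor.annihilator (y⊖y-nonZeroDivisor i≢j)
  (begin
    (y i ⊖ y j) ⊗ f
      ≈⟨ solve 3 (λ u v f → (u :- v) :* f := (u :- v :* con 1ℤ) :* f) ≈-refl (y i) (y j) f ⟩
    (y i ⊖ y j ⊗ 1ᴸ) ⊗ f
      ≈⟨ ⊗-congʳ f (⊖-cong (≈-refl {x = y i}) (⊗-congˡ (y j) (y⊗y⁻¹ i))) ⟨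
    (y i ⊖ y j ⊗ (y i ⊗ y⁻¹ i)) ⊗ f
      ≈⟨ solve 4 (λ u v u⁻¹ f → (u :- v :* (u :* u⁻¹)) :* f := u :* ((con 1ℤ :- v :* u⁻¹) :* f)) ≈-refl
           (y i) (y j) (y⁻¹ i) f ⟩
    y i ⊗ ((1ᴸ ⊖ y j ⊗ y⁻¹ i) ⊗ f)     ≈⟨ ⊗-congˡ (y i) eq ⟩
    y i ⊗ 0ᴸ                           ≈⟨ ⊗-zeroʳ (y i) ⟩
    0ᴸ                                 ∎)
  where
  open ≈-Reasoning

1⊖ratio-nonZeroDivisor : ∀ (p : Adjacent n) → NonZeroDivisor {k} (1ᴸ ⊖ ratio p)
1⊖ratio-nonZeroDivisor p = 1⊖y/y-nonZeroDivisor (low≢high p)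

module _ {ℓ k} (S : Subset (ℓ ℕ.+ k)) (∣S∣≡k : ∣ S ∣ ≡ k) (I : Vec (Fin (ℓ ℕ.+ k)) k) where

  localise-equal : ∀ p {a} → at p S ≡ (a , a) → s p (localise (Vec.map (σ p) I) S) ≈ localise I S
  localise-equal p eq = ≈-trans (s-localise p I S) (hom-cong (specialise-hom I) (dual-equal S ∣S∣≡k p eq))

  localise-ascent : ∀ p → at p S ≡ (outside , inside) →
    s p (localise (Vec.map (σ p) I) S) ≈ ratio p ⊗ localise I S
  localise-ascent p eq = ≈-trans (s-localise p I S)
    (≈-trans (hom-cong (specialise-hom I) (dual-ascent S ∣S∣≡k p eq))
    (≈-trans (hom-⊗ (specialise-hom I) (ratio p) (dual k S))
      (⊗-congʳ (localise I S) (specialise-ratio p I))))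

  localise-descent : ∀ p → at p S ≡ (inside , outside) →
    s p (localise (Vec.map (σ p) I) S) ≈ localise I S ⊕ (1ᴸ ⊖ ratio p) ⊗ localise I (swap p S)
  localise-descent p eq = ≈-trans (s-localise p I S)
    (≈-trans (hom-cong H (dual-descent S ∣S∣≡k p eq))
    (≈-trans (hom-⊕ H (dual k S) ((1ᴸ ⊖ ratio p) ⊗ dual k (swap p S)))
    (⊕-congˡ (localise I S) (≈-trans (hom-⊗ H (1ᴸ ⊖ ratio p) (dual k (swap p S)))
      (⊗-congʳ (localise I (swap p S)) (≈-trans (hom-⊖ H 1ᴸ (ratio p))
        (⊖-cong (hom-1 H) (specialise-ratio p I))))))))
    where H = specialise-hom I

module _ {ℓ k : ℕ} where

  -- Induction on `height` down to the empty diagram, whose product formula contains the factor 1 -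
  -- yⱼ/yⱼ for some j in T and not in S. Otherwise the descent relation at S′ = `swap p S` expresses
  -- (1 - `ratio p`) times the value of S through values of S′ at I and at its transpose, and
  -- `≻-swap` makes both vanish.
  localise-support : ∀ N (S : Subset (ℓ ℕ.+ k)) → ∣ S ∣ ≡ k → height S ℕ.< N →
    ∀ T (I : Vec (Fin (ℓ ℕ.+ k)) k) → Occur T I → T ≻ S → localise I S ≈ 0ᴸ
  localise-support (suc N) S ∣S∣≡k (s≤s lt) T I occur T≻S with bottom-or-ascent S ∣S∣≡k | ≻-witness T≻S
  ... | inj₁ bottom | j , T∋j , S∌j with occur j T∋j
  ...   | i , refl = begin
    specialise I (dual k S)                              ≈⟨ hom-cong H (dual-bottom S ∣S∣≡k bottom) ⟩
    specialise I (∏x k ⊗ product S y⁻¹ ⊗ factors k S)    ≈⟨ hom-⊗ H (∏x k ⊗ product S y⁻¹) (factors k S) ⟩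
    c ⊗ specialise I (factors k S)                       ≈⟨ ⊗-congˡ c (hom-∏ H (List.allFin k) λ i → ∏ (List.allFin ℓ+k) (factor S i)) ⟩
    c ⊗ ∏ (List.allFin k) (λ i → specialise I (∏ (List.allFin ℓ+k) (factor S i)))
      ≈⟨ ⊗-congˡ c (∏-zero i (λ i → specialise I (∏ (List.allFin ℓ+k) (factor S i)))
             (≈-trans (hom-∏ H (List.allFin ℓ+k) (factor S i)) (∏-zero j (specialise I ∘ factor S i) factor-zero))) ⟩
    c ⊗ 0ᴸ                                               ≈⟨ ⊗-zeroʳ c ⟩
    0ᴸ                                                   ∎
    where
    open ≈-Reasoning
    ℓ+k = ℓ ℕ.+ k
    H = specialise-hom I
    c : Laurent 0 ℓ+k
    c = specialise I (∏x k ⊗ product S y⁻¹)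
    factor-zero : specialise I (factor S i j) ≈ 0ᴸ
    factor-zero = begin
      specialise I (factor S i j)          ≡⟨ cong (λ b → specialise I (if b then 1ᴸ else 1ᴸ ⊖ x i ⊗ y⁻¹ j)) S∌j ⟩
      specialise I (1ᴸ ⊖ x i ⊗ y⁻¹ j)      ≈⟨ hom-⊖ H 1ᴸ (x i ⊗ y⁻¹ j) ⟩
      specialise I 1ᴸ ⊖ specialise I (x i ⊗ y⁻¹ j)
        ≈⟨ ⊖-cong (hom-1 H) (≈-trans (hom-⊗ H (x i) (y⁻¹ j)) (⊗-cong (specialise-x I i) (specialise-y-part I _))) ⟩
      1ᴸ ⊖ y j ⊗ y⁻¹ j                     ≈⟨ ⊖-cong (≈-refl {x = 1ᴸ}) (y⊗y⁻¹ j) ⟩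
      1ᴸ ⊖ 1ᴸ                              ≈⟨ ⊝-inverseʳ 1ᴸ ⟩
      0ᴸ                                   ∎
  localise-support (suc N) S ∣S∣≡k (s≤s lt) T I occur T≻S | inj₂ (p , ascent) | _ =
    NonZeroDivisor.annihilator (1⊖ratio-nonZeroDivisor p) (begin
      (1ᴸ ⊖ ratio p) ⊗ localise I S
        ≡⟨ cong (λ S → (1ᴸ ⊖ ratio p) ⊗ localise I S) (swap-involutive p S) ⟨
      (1ᴸ ⊖ ratio p) ⊗ localise I (swap p S′)
        ≈⟨ ⊕-congʳ ((1ᴸ ⊖ ratio p) ⊗ localise I (swap p S′))
             (vanishes T I occur (proj₁ (≻-swap p ascent T≻S))) ⟨
      localise I S′ ⊕ (1ᴸ ⊖ ratio p) ⊗ localise I (swap p S′)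
        ≈⟨ localise-descent S′ ∣S′∣≡k I p (trans (at-swap p S) (cong Product.swap ascent)) ⟨
      s p (localise (Vec.map (σ p) I) S′)
        ≈⟨ hom-cong (s-hom p) (vanishes (swap p T) (Vec.map (σ p) I) (Occur-σ p {T} {I} occur) (proj₂ (≻-swap p ascent T≻S))) ⟩
      s p 0ᴸ ≈⟨ hom-0 (s-hom p) ⟩
      0ᴸ ∎)
    where
    open ≈-Reasoning
    S′ = swap p S
    ∣S′∣≡k = trans (∣swap∣ p S) ∣S∣≡k
    vanishes = localise-support N S′ ∣S′∣≡k (ℕ.<-≤-trans (height-swap p S ascent) lt)

-- The value of a dual polynomial at its own fixed point

∏row : Fin n → Vec (Fin n) m → Subset m → Laurent 0 n
∏row i []       []            = 1ᴸ
∏row i (j ∷ js) (inside  ∷ S) = ∏row i js S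
∏row i (j ∷ js) (outside ∷ S) = (1ᴸ ⊖ y i ⊗ y⁻¹ j) ⊗ ∏row i js S

-- With is listing all indices: the product of 1 - yᵢ/yⱼ over the pairs i < j with i in S and j not
-- in S.
diagonal : Vec (Fin n) m → Subset m → Laurent 0 n
diagonal []       []            = 1ᴸ
diagonal (i ∷ is) (inside  ∷ S) = ∏row i is S ⊗ diagonal is S
diagonal (i ∷ is) (outside ∷ S) = diagonal is S

row-swap : ∀ i (p : Adjacent m) (js : Vec (Fin n) m) S → ∏row i (swap p js) S ≈ ∏row i js (swap p S)
row-swap i here (j ∷ j′ ∷ js) (inside  ∷ inside  ∷ S) = ≈-refl
row-swap i here (j ∷ j′ ∷ js) (inside  ∷ outside ∷ S) = ≈-refl
row-swap i here (j ∷ j′ ∷ js) (outside ∷ inside  ∷ S) = ≈-refl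
row-swap i here (j ∷ j′ ∷ js) (outside ∷ outside ∷ S) =
  solve 3 (λ a b c → a :* (b :* c) := b :* (a :* c)) ≈-refl (1ᴸ ⊖ y i ⊗ y⁻¹ j′) (1ᴸ ⊖ y i ⊗ y⁻¹ j) (∏row i js S)
row-swap i (there p) (j ∷ js) (inside  ∷ S) = row-swap i p js S
row-swap i (there p) (j ∷ js) (outside ∷ S) = ⊗-congˡ (1ᴸ ⊖ y i ⊗ y⁻¹ j) (row-swap i p js S)

diagonal-swap : ∀ (p : Adjacent m) (js : Vec (Fin n) m) S → at p S ≡ (inside , outside) →
  diagonal (swap p js) S ≈ (1ᴸ ⊖ y (lookup js (high p)) ⊗ y⁻¹ (lookup js (low p))) ⊗ diagonal js (swap p S)
diagonal-swap here (j ∷ j′ ∷ js) (inside ∷ outside ∷ S) refl = ⊗-assoc (1ᴸ ⊖ y j′ ⊗ y⁻¹ j) (∏row j′ js S) (diagonal js S)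
diagonal-swap (there p) (j ∷ js) (outside ∷ S) eq = diagonal-swap p js S eq
diagonal-swap (there p) (j ∷ js) (inside ∷ S) eq = begin
  ∏row j (swap p js) S ⊗ diagonal (swap p js) S
    ≈⟨ ⊗-cong (row-swap j p js S) (diagonal-swap p js S eq) ⟩
  ∏row j js (swap p S) ⊗ (c ⊗ diagonal js (swap p S))
    ≈⟨ solve 3 (λ a b c → a :* (b :* c) := b :* (a :* c)) ≈-refl (∏row j js (swap p S)) c (diagonal js (swap p S)) ⟩
  c ⊗ (∏row j js (swap p S) ⊗ diagonal js (swap p S)) ∎
  where
  open ≈-Reasoning
  c : Laurent 0 _
  c = 1ᴸ ⊖ y (lookup js (high p)) ⊗ y⁻¹ (lookup js (low p))

s-row : ∀ (p : Adjacent n) i (js : Vec (Fin n) m) S → s p (∏row i js S) ≈ ∏row (σ p i) (Vec.map (σ p) js) S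
s-row p i []       []            = hom-1 (s-hom p)
s-row p i (j ∷ js) (inside  ∷ S) = s-row p i js S
s-row p i (j ∷ js) (outside ∷ S) = ≈-trans (hom-⊗ (s-hom p) (1ᴸ ⊖ y i ⊗ y⁻¹ j) (∏row i js S)) (⊗-cong
  (≈-trans (hom-⊖ (s-hom p) 1ᴸ (y i ⊗ y⁻¹ j)) (⊖-cong (hom-1 (s-hom p))
    (≈-trans (hom-⊗ (s-hom p) (y i) (y⁻¹ j)) (⊗-cong (s-y p i) (s-y⁻¹ p j)))))
  (s-row p i js S))

s-diagonal : ∀ (p : Adjacent n) (js : Vec (Fin n) m) S → s p (diagonal js S) ≈ diagonal (Vec.map (σ p) js) S
s-diagonal p []       []            = hom-1 (s-hom p)
s-diagonal p (j ∷ js) (inside  ∷ S) = ≈-trans (hom-⊗ (s-hom p) (∏row j js S) (diagonal js S))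
  (⊗-cong (s-row p j js S) (s-diagonal p js S))
s-diagonal p (j ∷ js) (outside ∷ S) = s-diagonal p js S

top-no-descent : ∀ ℓ k (p : Adjacent (ℓ ℕ.+ k)) → at p (top ℓ k) ≢ (inside , outside)
top-no-descent zero    k p eq = Bool.not-¬ (cong proj₂ eq)
  (trans (sym (lookup-high p (replicate k inside))) (Vec.lookup-replicate (high p) inside))
top-no-descent (suc zero)    zero    (there ()) eq
top-no-descent (suc zero)    (suc k) (there p) eq = top-no-descent zero (suc k) p eq
top-no-descent (suc (suc ℓ)) k       (there p) eq = top-no-descent (suc ℓ) k p eq

row-factors : ∀ i (zs : Vec (Fin n) m) S →
              ∏ (List.allFin m) (λ j → if lookup S j then 1ᴸ else 1ᴸ ⊖ y i ⊗ y⁻¹ (lookup zs j)) ≈ ∏row i zs S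
row-factors i []       []            = ≈-refl
row-factors i (z ∷ zs) (s ∷ S) = ≈-trans
  (⊗-congˡ c (≈-trans (≈-reflexive (∏-tabulate suc (λ j → if lookup (s ∷ S) j then 1ᴸ else 1ᴸ ⊖ y i ⊗ y⁻¹ (lookup (z ∷ zs) j)))) (row-factors i zs S)))
  (absorb s)
  where
  c : Laurent 0 _
  c = if s then 1ᴸ else 1ᴸ ⊖ y i ⊗ y⁻¹ z
  absorb : ∀ s → (if s then 1ᴸ else 1ᴸ ⊖ y i ⊗ y⁻¹ z) ⊗ ∏row i zs S ≈ ∏row i (z ∷ zs) (s ∷ S)
  absorb inside  = ⊗-identityˡ (∏row i zs S)
  absorb outside = ≈-refl

-- After a position outside, the first selected position would create an ascent.
none-selected : ∀ {zs : Vec (Fin n) m} {S} {I : Vec (Fin n) k} → Selects zs S I →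
                (∀ p → at p (outside ∷ S) ≢ (outside , inside)) → k ≡ 0 × diagonal zs S ≡ 1ᴸ
none-selected []       no-ascent = refl , refl
none-selected (take i) no-ascent = ⊥-elim (no-ascent here refl)
none-selected (skip i) no-ascent = none-selected i (no-ascent ∘ there)

-- Without an ascent all of S precedes its complement, so restricting each product to the later
-- positions, as `diagonal` does, loses no factor.
rows : ∀ {zs : Vec (Fin n) m} {S} {I : Vec (Fin n) k} → Selects zs S I →
       (∀ p → at p S ≢ (outside , inside)) →
       ∏ (List.allFin k) (λ a → ∏row (lookup I a) zs S) ≈ diagonal zs S
rows [] no-ascent = ≈-refl
rows {zs = z ∷ zs} {inside ∷ S} (take {I = I} i) no-ascent = ⊗-congˡ (∏row z zs S)
  (≈-trans (≈-reflexive (∏-tabulate suc (λ a → ∏row (lookup (z ∷ I) a) (z ∷ zs) (inside ∷ S))))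
    (rows i (no-ascent ∘ there)))
rows (skip i) no-ascent with none-selected i no-ascent
... | refl , eq = ≈-reflexive (sym eq)

-- The monomial factor of the dual polynomial is normalised to become 1 at its own fixed point.
selected-units : ∀ {zs : Vec (Fin n) m} {S} {I : Vec (Fin n) k} → Selects zs S I →
  ∏ (List.allFin k) (λ a → y (lookup I a)) ⊗ product {k = 0} S (λ j → y⁻¹ (lookup zs j)) ≈ 1ᴸ
selected-units [] = ⊗-identityˡ 1ᴸ
selected-units {zs = z ∷ zs} {inside ∷ S} (take {I = I} i) = begin
  y z ⊗ ∏ (List.tabulate suc) (λ a → y (lookup (z ∷ I) a)) ⊗ (y⁻¹ z ⊗ ∏y⁻¹)
    ≡⟨ cong (λ ∏y → y z ⊗ ∏y ⊗ (y⁻¹ z ⊗ ∏y⁻¹)) (∏-tabulate suc (λ a → y (lookup (z ∷ I) a))) ⟩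
  y z ⊗ ∏y ⊗ (y⁻¹ z ⊗ ∏y⁻¹)
    ≈⟨ solve 4 (λ a b c d → a :* b :* (c :* d) := (a :* c) :* (b :* d)) ≈-refl (y z) ∏y (y⁻¹ z) ∏y⁻¹ ⟩
  y z ⊗ y⁻¹ z ⊗ (∏y ⊗ ∏y⁻¹)  ≈⟨ ⊗-cong (y⊗y⁻¹ z) (selected-units i) ⟩
  1ᴸ ⊗ 1ᴸ                ≈⟨ ⊗-identityˡ 1ᴸ ⟩
  1ᴸ                     ∎
  where
  open ≈-Reasoning
  ∏y ∏y⁻¹ : Laurent 0 _
  ∏y = ∏ (List.allFin _) (λ a → y (lookup I a))
  ∏y⁻¹ = product S (λ j → y⁻¹ (lookup zs j))
selected-units {zs = z ∷ zs} {outside ∷ S} (skip {I = I} i) =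
  ≈-trans (⊗-congˡ ∏y (⊗-identityˡ (product S (λ j → y⁻¹ (lookup zs j))))) (selected-units i)
  where
  ∏y : Laurent 0 _
  ∏y = ∏ (List.allFin _) (λ a → y (lookup I a))

module _ {ℓ k : ℕ} where

  localise-bottom : ∀ (S : Subset (ℓ ℕ.+ k)) → ∣ S ∣ ≡ k → Vec.reverse S ≡ top ℓ k →
    ∀ (I : Vec (Fin (ℓ ℕ.+ k)) k) → Selects (Vec.allFin (ℓ ℕ.+ k)) S I → localise I S ≈ diagonal (Vec.allFin (ℓ ℕ.+ k)) S
  localise-bottom S ∣S∣≡k bottom I selects = begin
    specialise I (dual k S)                              ≈⟨ hom-cong H (dual-bottom S ∣S∣≡k bottom) ⟩
    specialise I (∏x k ⊗ product S y⁻¹ ⊗ factors k S)    ≈⟨ hom-⊗ H (∏x k ⊗ product S y⁻¹) (factors k S) ⟩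
    specialise I (∏x k ⊗ product S y⁻¹) ⊗ specialise I (factors k S)
      ≈⟨ ⊗-cong (≈-trans (hom-⊗ H (∏x k) (product S y⁻¹)) (⊗-cong specialise-∏x specialise-y⁻¹)) specialise-factors ⟩
    ∏ (List.allFin k) (λ a → y (lookup I a)) ⊗ product S (λ j → y⁻¹ (lookup (Vec.allFin ℓ+k) j)) ⊗ diagonal (Vec.allFin ℓ+k) S
      ≈⟨ ⊗-congʳ (diagonal (Vec.allFin ℓ+k) S) (selected-units selects) ⟩
    1ᴸ ⊗ diagonal (Vec.allFin ℓ+k) S                       ≈⟨ ⊗-identityˡ (diagonal (Vec.allFin ℓ+k) S) ⟩
    diagonal (Vec.allFin ℓ+k) S ∎
    where
    open ≈-Reasoning
    ℓ+k = ℓ ℕ.+ k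
    H = specialise-hom I
    specialise-∏x : specialise I (∏x k) ≈ ∏ (List.allFin k) (λ a → y (lookup I a))
    specialise-∏x = ≈-trans (hom-∏ H (List.allFin k) x) (∏-cong (List.allFin k) (specialise-x I))
    specialise-y⁻¹ : specialise I (product S y⁻¹) ≈ product S (λ j → y⁻¹ (lookup (Vec.allFin ℓ+k) j))
    specialise-y⁻¹ = ≈-trans (hom-product H S y⁻¹) (product-cong S λ j →
      ≈-trans (specialise-y-part I _) (≈-reflexive (cong y⁻¹ (sym (Vec.lookup-allFin j)))))
    specialise-factor : ∀ a j → specialise I (factor S a j) ≈
      (if lookup S j then 1ᴸ else 1ᴸ ⊖ y (lookup I a) ⊗ y⁻¹ (lookup (Vec.allFin ℓ+k) j))
    specialise-factor a j rewrite Vec.lookup-allFin j with lookup S j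
    ... | inside  = hom-1 H
    ... | outside = ≈-trans (hom-⊖ H 1ᴸ (x a ⊗ y⁻¹ j)) (⊖-cong (hom-1 H)
      (≈-trans (hom-⊗ H (x a) (y⁻¹ j)) (⊗-cong (specialise-x I a) (specialise-y-part I _))))
    no-ascent : ∀ p → at p S ≢ (outside , inside)
    no-ascent p eq = top-no-descent ℓ k (proj₁ (mirror p)) (trans (cong (at (proj₁ (mirror p))) (sym bottom))
      (trans (at-reverse p S) (cong Product.swap eq)))
    specialise-factors : specialise I (factors k S) ≈ diagonal (Vec.allFin ℓ+k) S
    specialise-factors = ≈-trans (hom-∏ H (List.allFin k) λ a → ∏ (List.allFin ℓ+k) (factor S a))
      (≈-trans (∏-cong (List.allFin k) λ a → ≈-trans (hom-∏ H (List.allFin ℓ+k) (factor S a))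
          (≈-trans (∏-cong (List.allFin ℓ+k) (specialise-factor a)) (row-factors (lookup I a) (Vec.allFin ℓ+k) S)))
        (rows selects no-ascent))

  -- In the descent relation at S′ = `swap p S` the term of S′ vanishes, because I is the fixed
  -- point of S and S ≻ S′. What is left transports the known value of S′ by s p, and
  -- `diagonal-swap` produces the same factor 1 - `ratio p`, which is cancelled.
  localise-diagonal : ∀ N (S : Subset (ℓ ℕ.+ k)) → ∣ S ∣ ≡ k → height S ℕ.< N →
    ∀ (I : Vec (Fin (ℓ ℕ.+ k)) k) → Selects (Vec.allFin (ℓ ℕ.+ k)) S I → localise I S ≈ diagonal (Vec.allFin (ℓ ℕ.+ k)) S
  localise-diagonal (suc N) S ∣S∣≡k (s≤s lt) I selects with bottom-or-ascent S ∣S∣≡k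
  ... | inj₁ bottom = localise-bottom S ∣S∣≡k bottom I selects
  ... | inj₂ (p , ascent) = cancelˡ (1⊖ratio-nonZeroDivisor p) (begin
    (1ᴸ ⊖ ratio p) ⊗ localise I S
      ≡⟨ cong (λ S → (1ᴸ ⊖ ratio p) ⊗ localise I S) (swap-involutive p S) ⟨
    (1ᴸ ⊖ ratio p) ⊗ localise I (swap p S′)
      ≈⟨ ⊕-congʳ ((1ᴸ ⊖ ratio p) ⊗ localise I (swap p S′))
           (localise-support {ℓ} {k} _ S′ ∣S′∣≡k ℕ.≤-refl S I (Selects⇒Occur selects) (ascent-≻ p ascent)) ⟨
    localise I S′ ⊕ (1ᴸ ⊖ ratio p) ⊗ localise I (swap p S′)
      ≈⟨ localise-descent S′ ∣S′∣≡k I p descent ⟨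
    s p (localise (Vec.map (σ p) I) S′)
      ≈⟨ hom-cong (s-hom p) (localise-diagonal N S′ ∣S′∣≡k (ℕ.<-≤-trans (height-swap p S ascent) lt)
           (Vec.map (σ p) I) (Selects-σ p distinct selects)) ⟩
    s p (diagonal js S′)                      ≈⟨ s-diagonal p js S′ ⟩
    diagonal (Vec.map (σ p) js) S′            ≡⟨ cong (λ js → diagonal js S′) (swap-allFin p) ⟨
    diagonal (swap p js) S′                   ≈⟨ diagonal-swap p js S′ descent ⟩
    (1ᴸ ⊖ y (lookup js (high p)) ⊗ y⁻¹ (lookup js (low p))) ⊗ diagonal js (swap p S′)
      ≡⟨ cong₂ (λ c S → (1ᴸ ⊖ c) ⊗ diagonal js S)
           (cong₂ (λ i j → y i ⊗ y⁻¹ j) (Vec.lookup-allFin (high p)) (Vec.lookup-allFin (low p))) (swap-involutive p S) ⟩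
    (1ᴸ ⊖ ratio p) ⊗ diagonal js S            ∎)
    where
    open ≈-Reasoning
    js = Vec.allFin (ℓ ℕ.+ k)
    S′ = swap p S
    ∣S′∣≡k = trans (∣swap∣ p S) ∣S∣≡k
    descent : at p S′ ≡ (inside , outside)
    descent = trans (at-swap p S) (cong Product.swap ascent)
    distinct : proj₁ (at p S) ≢ proj₂ (at p S)
    distinct eq with trans (sym (cong proj₁ ascent)) (trans eq (cong proj₂ ascent))
    ... | ()

  diagonal-top : ∀ ℓ (js : Vec (Fin n) (ℓ ℕ.+ k)) → diagonal js (top ℓ k) ≈ 1ᴸ
  diagonal-top (suc ℓ) (j ∷ js) = diagonal-top ℓ js
  diagonal-top zero    js       = all-inside js
    where
    row-inside : ∀ {m} j (js : Vec (Fin n) m) → ∏row j js (replicate m inside) ≈ 1ᴸ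
    row-inside j []        = ≈-refl
    row-inside j (j′ ∷ js) = row-inside j js
    all-inside : ∀ {m} (js : Vec (Fin n) m) → diagonal js (replicate m inside) ≈ 1ᴸ
    all-inside []       = ≈-refl
    all-inside (j ∷ js) = ≈-trans (⊗-cong (row-inside j js) (all-inside js)) (⊗-identityˡ 1ᴸ)

  localise-top : ∀ (I : Vec (Fin (ℓ ℕ.+ k)) k) → Selects (Vec.allFin (ℓ ℕ.+ k)) (top ℓ k) I → localise I (top ℓ k) ≈ 1ᴸ
  localise-top I selects = ≈-trans (localise-diagonal _ (top ℓ k) (∣top∣ ℓ k) ℕ.≤-refl I selects)
    (diagonal-top ℓ (Vec.allFin (ℓ ℕ.+ k)))

  localise-not-top : ∀ (I : Vec (Fin (ℓ ℕ.+ k)) k) → Selects (Vec.allFin (ℓ ℕ.+ k)) (top ℓ k) I →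
    ∀ S → ∣ S ∣ ≡ k → S ≢ top ℓ k → localise I S ≈ 0ᴸ
  localise-not-top I selects S ∣S∣≡k S≢top = localise-support {ℓ} {k} _ S ∣S∣≡k ℕ.≤-refl (top ℓ k) I
    (Selects⇒Occur selects) (top-≻ ℓ S ∣S∣≡k S≢top)

-- The states ∅, G, RG of an edge in direction 60°, and ∅, R, RG of an edge in
-- direction 120°.
data Edge : Set where
  e₀ e₁ e₂ : Edge

aEdge bEdge : ∀ {o} → Tile o → Edge
aEdge E  = e₀
aEdge G₁ = e₁
aEdge G₂ = e₂
aEdge R₁ = e₀
aEdge R₂ = e₁
aEdge Q  = e₁
aEdge K  = e₂
bEdge E  = e₀
bEdge G₁ = e₀
bEdge G₂ = e₁
bEdge R₁ = e₁
bEdge R₂ = e₂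
bEdge Q  = e₁
bEdge K  = e₂

_≟ₑ_ : DecidableEquality Edge
e₀ ≟ₑ e₀ = yes refl
e₀ ≟ₑ e₁ = no λ ()
e₀ ≟ₑ e₂ = no λ ()
e₁ ≟ₑ e₀ = no λ ()
e₁ ≟ₑ e₁ = yes refl
e₁ ≟ₑ e₂ = no λ ()
e₂ ≟ₑ e₀ = no λ ()
e₂ ≟ₑ e₁ = no λ ()
e₂ ≟ₑ e₂ = yes refl

_≟ₕ_ : DecidableEquality State
_≟ₕ_ = Vec.≡-dec Bool._≟_

edges : List Edge
edges = e₀ ∷ e₁ ∷ e₂ ∷ []

-- The crossing of the line i, entering through an edge α in direction 60° and
-- leaving through α′, and the line j, from β to β′ in direction 120°.
cross : Fin n → Fin n → (α β β′ α′ : Edge) → Laurent 0 n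
cross i j α β β′ α′ =
  ∑ (tiles △) λ t → does (aEdge t ≟ₑ α) ⇒ does (bEdge t ≟ₑ β) ⇒
  ∑ (tiles ▽) λ t′ → does (h t ≟ₕ h t′) ⇒ does (bEdge t′ ≟ₑ β′) ⇒ does (aEdge t′ ≟ₑ α′) ⇒
  lozengeWeight (y i ⊗ y⁻¹ j) t t′

-- R-matrices

-- Entries are symbols, so one matrix serves in every Laurent ring, and a homomorphism commutes with
-- evaluation by cases on the symbol.
data Entry : Set where
  ⟨0⟩ ⟨1⟩ ⟨u⟩ ⟨1-u⟩ : Entry

⟦_⟧ : Entry → Laurent k n → Laurent k n
⟦ ⟨0⟩ ⟧   u = 0ᴸ
⟦ ⟨1⟩ ⟧   u = 1ᴸ
⟦ ⟨u⟩ ⟧   u = u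
⟦ ⟨1-u⟩ ⟧ u = 1ᴸ ⊖ u

Matrix : Set → Set
Matrix A = (a₁ a₂ b₁ b₂ : A) → Entry

infix 9 _ᵀ
_ᵀ : Matrix A → Matrix A
(M ᵀ) a₁ a₂ b₁ b₂ = M b₁ b₂ a₁ a₂

module _ (_≟_ : DecidableEquality A) (diagonal? off-diagonal? : A → A → Bool) where
  vertex : Matrix A
  vertex a₁ a₂ b₁ b₂ =
    if does (a₁ ≟ b₁) ∧ does (a₂ ≟ b₂) then (if diagonal? a₁ a₂ then ⟨u⟩ else ⟨1⟩) else
    if does (a₁ ≟ b₂) ∧ does (a₂ ≟ b₁) ∧ off-diagonal? a₁ a₂ then ⟨1-u⟩ else ⟨0⟩

-- Extensions of `Rˢ` to the three edge states: on e₀ and e₁, read as letters through `aSide` and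
-- `bSide`, both restrict to it. The entries involving e₂ are those for which the Yang-Baxter and
-- corner equations below hold; the two matrices treat the pair e₁, e₂ in different ways.
Rᵃ Rᵇ : Matrix Edge
Rᵃ = vertex _≟ₑ_ diagonal? off-diagonal?
  where
  diagonal? off-diagonal? : Edge → Edge → Bool
  diagonal? e₀ e₁ = true
  diagonal? e₀ e₂ = true
  diagonal? e₁ e₂ = true
  diagonal? _  _  = false
  off-diagonal? e₁ e₀ = true
  off-diagonal? e₂ e₀ = true
  off-diagonal? e₁ e₂ = true
  off-diagonal? _  _  = false
Rᵇ = vertex _≟ₑ_ diagonal? off-diagonal?
  where
  diagonal? off-diagonal? : Edge → Edge → Bool
  diagonal? e₁ e₀ = true
  diagonal? e₂ e₀ = true
  diagonal? e₂ e₁ = true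
  diagonal? _  _  = false
  off-diagonal? e₀ e₁ = true
  off-diagonal? e₀ e₂ = true
  off-diagonal? e₂ e₁ = true
  off-diagonal? _  _  = false

Rˢ : Matrix Side
Rˢ = vertex Bool._≟_ (λ s t → not s ∧ t) (λ s t → s ∧ not t)

-- Deciding identities in a Laurent ring with finitely many variables

-- A coefficient can be nonzero only at a monomial listed in f, so it suffices to test these.
zero? : ∀ (f : Laurent k n) → Dec (f ≈ 0ᴸ)
zero? f = map′ (λ all → mk≈ (vanish all)) (λ (mk≈ eq) → ListAll.universal (λ (z , d) → eq d) f)
  (ListAll.all? (λ (z , d) → coeff f d ℤ.≟ 0ℤ) f)
  where
  absent : ∀ g e → All (λ (z , d) → d ≢ e) g → coeff g e ≡ 0ℤ
  absent []            e []           = refl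
  absent ((z , d) ∷ g) e (d≢e ∷ rest) with d ≟ₘ e
  ... | yes d≡e = ⊥-elim (d≢e d≡e)
  ... | no _    = trans (ℤ.+-identityˡ _) (absent g e rest)
  search : ∀ g → All (λ (z , d) → coeff f d ≡ 0ℤ) g → ∀ e → coeff f e ≡ 0ℤ ⊎ All (λ (z , d) → d ≢ e) g
  search []            []              e = inj₂ []
  search ((z , d) ∷ g) (zero-d ∷ rest) e with d ≟ₘ e | search g rest e
  ... | yes refl | _           = inj₁ zero-d
  ... | no _     | inj₁ zero-e = inj₁ zero-e
  ... | no d≢e   | inj₂ others = inj₂ (d≢e ∷ others)
  vanish : All (λ (z , d) → coeff f d ≡ 0ℤ) f → ∀ e → coeff f e ≡ 0ℤ
  vanish all e with search f all e
  ... | inj₁ zero-e = zero-e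
  ... | inj₂ others = absent f e others

_≈?_ : ∀ (f g : Laurent k n) → Dec (f ≈ g)
f ≈? g = map′ ⊖≈0 ≈⇒⊖≈0 (zero? (f ⊖ g))

∀ₑ? : ∀ {P : Edge → Set} → (∀ e → Dec (P e)) → Dec (∀ e → P e)
∀ₑ? P? = map′ (λ { (p₀ , p₁ , p₂) → λ { e₀ → p₀ ; e₁ → p₁ ; e₂ → p₂ } }) (λ p → p e₀ , p e₁ , p e₂)
  (P? e₀ ×-dec P? e₁ ×-dec P? e₂)

∀ₛ? : ∀ {P : Side → Set} → (∀ s → Dec (P s)) → Dec (∀ s → P s)
∀ₛ? P? = map′ (λ { (p , p′) → λ { true → p ; false → p′ } }) (λ p → p true , p false) (P? true ×-dec P? false)

does⇒ : ∀ {P : Set} (d : Dec P) → does d ≡ true → P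
does⇒ (yes p) eq = p

act : List A → Matrix A → Laurent k n → (A → A → Laurent k n) → A → A → Laurent k n
act as M u f a₁ a₂ = ∑ as λ b₁ → ∑ as λ b₂ → ⟦ M a₁ a₂ b₁ b₂ ⟧ u ⊗ f b₁ b₂

act-cong : ∀ (as : List A) M u {f g : A → A → Laurent k n} → (∀ a b → f a b ≈ g a b) →
           ∀ a₁ a₂ → act as M u f a₁ a₂ ≈ act as M u g a₁ a₂
act-cong as M u eq a₁ a₂ = ∑-cong as λ b₁ → ∑-cong as λ b₂ → ⊗-congˡ (⟦ M a₁ a₂ b₁ b₂ ⟧ u) (eq b₁ b₂)

-- Yang-Baxter and corner equations

-- The superscript tells on which kind of edges an R-matrix will act. In `crossᵇ` the line i meets j
-- and then j′; in `crossᵃ` the line j meets i′ and then i.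
crossᵇ : (i j j′ : Fin n) (α β₁ β₂ l₁ l₂ α″ : Edge) → Laurent 0 n
crossᵇ i j j′ α β₁ β₂ l₁ l₂ α″ = ∑ edges λ α′ → cross i j α β₁ l₁ α′ ⊗ cross i j′ α′ β₂ l₂ α″

crossᵃ : (i i′ j : Fin n) (α₁ α₂ β l r₁ r₂ : Edge) → Laurent 0 n
crossᵃ i i′ j α₁ α₂ β l r₁ r₂ = ∑ edges λ κ → cross i j α₁ κ l r₁ ⊗ cross i′ j α₂ β κ r₂

-- The first two lines, up to where they meet the others.
corner : (i i′ : Fin n) (s₁ s₂ : Side) (l₁ l₂ α₁ α₂ : Edge) → Laurent 0 n
corner i i′ s₁ s₂ l₁ l₂ α₁ α₂ =
  ∑ (tiles ▽) λ t₁ → does (h t₁ ≟ₕ hState s₁) ⇒ does (bEdge t₁ ≟ₑ l₁) ⇒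
  ∑ (tiles ▽) λ t₂ → does (h t₂ ≟ₕ hState s₂) ⇒ does (aEdge t₂ ≟ₑ α₂) ⇒
  cross i i′ (aEdge t₁) (bEdge t₂) l₂ α₁

sides : List Side
sides = inside ∷ outside ∷ []

module _ {n} (i j j′ : Fin n) where
  private
    u : Laurent 0 n
    u = y j′ ⊗ y⁻¹ j

  YangBaxterᵇ : (α β₁ β₂ l₁ l₂ α″ : Edge) → Laurent 0 n × Laurent 0 n
  YangBaxterᵇ α β₁ β₂ l₁ l₂ α″ =
    act edges Rᵇ u (λ l₁′ l₂′ → crossᵇ i j j′ α β₁ β₂ l₁′ l₂′ α″) l₁ l₂ ,
    act edges (Rᵇ ᵀ) u (λ β₁′ β₂′ → crossᵇ i j′ j α β₁′ β₂′ l₁ l₂ α″) β₁ β₂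

module _ {n} (i i′ : Fin n) where
  private
    u : Laurent 0 n
    u = y i′ ⊗ y⁻¹ i

  YangBaxterᵃ : Fin n → (α₁ α₂ β l r₁ r₂ : Edge) → Laurent 0 n × Laurent 0 n
  YangBaxterᵃ j α₁ α₂ β l r₁ r₂ =
    act edges Rᵃ u (λ r₁′ r₂′ → crossᵃ i i′ j α₁ α₂ β l r₁′ r₂′) r₁ r₂ ,
    act edges (Rᵃ ᵀ) u (λ α₁′ α₂′ → crossᵃ i′ i j α₁′ α₂′ β l r₁ r₂) α₁ α₂

  CornerExchange : (s₁ s₂ : Side) (l₁ l₂ α₁ α₂ : Edge) → Laurent 0 n × Laurent 0 n
  CornerExchange s₁ s₂ l₁ l₂ α₁ α₂ =
    act edges Rᵇ u (λ l₁′ l₂′ → act edges Rᵃ u (λ α₁′ α₂′ → corner i i′ s₁ s₂ l₁′ l₂′ α₁′ α₂′) α₁ α₂) l₁ l₂ ,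
    act sides (Rˢ ᵀ) u (λ s₁′ s₂′ → corner i′ i s₁′ s₂′ l₁ l₂ α₁ α₂) s₁ s₂

Equal : Laurent k n × Laurent k n → Set
Equal (f , g) = f ≈ g

equal? : ∀ (fg : Laurent k n × Laurent k n) → Dec (Equal fg)
equal? (f , g) = f ≈? g

-- Decided by evaluation for all 3⁶ choices of edges, with one variable for each of the three lines;
-- `yang-baxterᵇ` substitutes arbitrary lines.
yang-baxterᵇ-012 : ∀ α β₁ β₂ l₁ l₂ α″ → Equal (YangBaxterᵇ {3} 0F 1F 2F α β₁ β₂ l₁ l₂ α″)
yang-baxterᵇ-012 = does⇒ (∀ₑ? λ α → ∀ₑ? λ β₁ → ∀ₑ? λ β₂ → ∀ₑ? λ l₁ → ∀ₑ? λ l₂ → ∀ₑ? λ α″ →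
  equal? (YangBaxterᵇ 0F 1F 2F α β₁ β₂ l₁ l₂ α″)) refl

yang-baxterᵃ-012 : ∀ α₁ α₂ β l r₁ r₂ → Equal (YangBaxterᵃ {3} 0F 1F 2F α₁ α₂ β l r₁ r₂)
yang-baxterᵃ-012 = does⇒ (∀ₑ? λ α₁ → ∀ₑ? λ α₂ → ∀ₑ? λ β → ∀ₑ? λ l → ∀ₑ? λ r₁ → ∀ₑ? λ r₂ →
  equal? (YangBaxterᵃ 0F 1F 2F α₁ α₂ β l r₁ r₂)) refl

corner-exchange-01 : ∀ s₁ s₂ l₁ l₂ α₁ α₂ → Equal (CornerExchange {3} 0F 1F s₁ s₂ l₁ l₂ α₁ α₂)
corner-exchange-01 = does⇒ (∀ₛ? λ s₁ → ∀ₛ? λ s₂ → ∀ₑ? λ l₁ → ∀ₑ? λ l₂ → ∀ₑ? λ α₁ → ∀ₑ? λ α₂ →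
  equal? (CornerExchange 0F 1F s₁ s₂ l₁ l₂ α₁ α₂)) refl

-- Transport to other lines

-- Exactly what carries sums over crossings of lines i to those of lines τ i. It covers both the
-- substitution `rename` and the exchange s p, and τ may identify lines.
record Renaming (F : Laurent 0 n → Laurent 0 n′) (τ : Fin n → Fin n′) : Set where
  field
    hom  : Hom F
    F-y  : ∀ i → F (y i) ≈ y (τ i)
    F-y⁻¹ : ∀ i → F (y⁻¹ i) ≈ y⁻¹ (τ i)

  F-ratio : ∀ i j → F (y i ⊗ y⁻¹ j) ≈ y (τ i) ⊗ y⁻¹ (τ j)
  F-ratio i j = ≈-trans (hom-⊗ hom (y i) (y⁻¹ j)) (⊗-cong (F-y i) (F-y⁻¹ j))

  F-⟦⟧ : ∀ e {u u′} → F u ≈ u′ → F (⟦ e ⟧ u) ≈ ⟦ e ⟧ u′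
  F-⟦⟧ ⟨0⟩   eq = hom-0 hom
  F-⟦⟧ ⟨1⟩   eq = hom-1 hom
  F-⟦⟧ ⟨u⟩   eq = eq
  F-⟦⟧ ⟨1-u⟩ {u} eq = ≈-trans (hom-⊖ hom 1ᴸ u) (⊖-cong (hom-1 hom) eq)

  F-weight : ∀ {w w′} → F w ≈ w′ → ∀ t t′ → F (lozengeWeight w t t′) ≈ lozengeWeight w′ t t′
  F-weight eq E  t  = hom-1 hom
  F-weight eq G₁ t  = hom-1 hom
  F-weight eq R₁ t  = hom-1 hom
  F-weight eq G₂ E  = hom-1 hom
  F-weight eq G₂ G₁ = eq
  F-weight eq G₂ G₂ = hom-1 hom
  F-weight eq G₂ R₁ = hom-1 hom
  F-weight eq G₂ R₂ = hom-1 hom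
  F-weight eq G₂ Q  = hom-1 hom
  F-weight eq R₂ E  = hom-1 hom
  F-weight eq R₂ G₁ = hom-1 hom
  F-weight eq R₂ G₂ = hom-1 hom
  F-weight eq R₂ R₁ = eq
  F-weight eq R₂ R₂ = hom-1 hom
  F-weight eq R₂ Q  = hom-1 hom
  F-weight eq Q  E  = hom-1 hom
  F-weight eq Q  G₁ = hom-1 hom
  F-weight eq Q  G₂ = hom-1 hom
  F-weight eq Q  R₁ = hom-1 hom
  F-weight eq Q  R₂ = hom-1 hom
  F-weight {w} eq Q  Q  = ≈-trans (hom-⊖ hom 1ᴸ w) (⊖-cong (hom-1 hom) eq)
  F-weight {w} eq K  E  = ≈-trans (hom-⊖ hom 0ᴸ w) (⊖-cong (hom-0 hom) eq)
  F-weight eq K  G₁ = hom-1 hom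
  F-weight eq K  G₂ = hom-1 hom
  F-weight eq K  R₁ = hom-1 hom
  F-weight eq K  R₂ = hom-1 hom
  F-weight eq K  Q  = hom-1 hom

  F-⇒ : ∀ c {f g} → F f ≈ g → F (c ⇒ f) ≈ c ⇒ g
  F-⇒ c {f} eq = ≈-trans (hom-⇒ hom c f) (⇒-cong c eq)

  F-∑ : ∀ (as : List A) {f : A → Laurent 0 n} {g} → (∀ a → F (f a) ≈ g a) → F (∑ as f) ≈ ∑ as g
  F-∑ as {f} eq = ≈-trans (hom-∑ hom as f) (∑-cong as eq)

  F-⊗ : ∀ {f f′ g g′} → F f ≈ f′ → F g ≈ g′ → F (f ⊗ g) ≈ f′ ⊗ g′
  F-⊗ {f} {f′} {g} eq eq′ = ≈-trans (hom-⊗ hom f g) (⊗-cong eq eq′)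

  F-cross : ∀ i j α β β′ α′ → F (cross i j α β β′ α′) ≈ cross (τ i) (τ j) α β β′ α′
  F-cross i j α β β′ α′ =
    F-∑ (tiles △) λ t → F-⇒ (does (aEdge t ≟ₑ α)) (F-⇒ (does (bEdge t ≟ₑ β))
    (F-∑ (tiles ▽) λ t′ → F-⇒ (does (Defs.h t ≟ₕ Defs.h t′)) (F-⇒ (does (bEdge t′ ≟ₑ β′)) (F-⇒ (does (aEdge t′ ≟ₑ α′))
    (F-weight (F-ratio i j) t t′)))))

  F-crossᵇ : ∀ i j j′ α β₁ β₂ l₁ l₂ α″ →
             F (crossᵇ i j j′ α β₁ β₂ l₁ l₂ α″) ≈ crossᵇ (τ i) (τ j) (τ j′) α β₁ β₂ l₁ l₂ α″
  F-crossᵇ i j j′ α β₁ β₂ l₁ l₂ α″ = F-∑ edges λ α′ → F-⊗ (F-cross i j α β₁ l₁ α′) (F-cross i j′ α′ β₂ l₂ α″)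

  F-crossᵃ : ∀ i i′ j α₁ α₂ β l r₁ r₂ →
             F (crossᵃ i i′ j α₁ α₂ β l r₁ r₂) ≈ crossᵃ (τ i) (τ i′) (τ j) α₁ α₂ β l r₁ r₂
  F-crossᵃ i i′ j α₁ α₂ β l r₁ r₂ = F-∑ edges λ κ → F-⊗ (F-cross i j α₁ κ l r₁) (F-cross i′ j α₂ β κ r₂)

  F-corner : ∀ i i′ s₁ s₂ l₁ l₂ α₁ α₂ →
             F (corner i i′ s₁ s₂ l₁ l₂ α₁ α₂) ≈ corner (τ i) (τ i′) s₁ s₂ l₁ l₂ α₁ α₂
  F-corner i i′ s₁ s₂ l₁ l₂ α₁ α₂ =
    F-∑ (tiles ▽) λ t₁ → F-⇒ (does (Defs.h t₁ ≟ₕ hState s₁)) (F-⇒ (does (bEdge t₁ ≟ₑ l₁))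
    (F-∑ (tiles ▽) λ t₂ → F-⇒ (does (Defs.h t₂ ≟ₕ hState s₂)) (F-⇒ (does (aEdge t₂ ≟ₑ α₂))
    (F-cross i i′ (aEdge t₁) (bEdge t₂) l₂ α₁))))

  F-act : ∀ (as : List A) M {u u′} → F u ≈ u′ → ∀ (f : A → A → Laurent 0 n) {g : A → A → Laurent 0 n′} →
          (∀ a b → F (f a b) ≈ g a b) → ∀ a₁ a₂ → F (act as M u f a₁ a₂) ≈ act as M u′ g a₁ a₂
  F-act as M {u} equ f eq a₁ a₂ = F-∑ as {λ b₁ → ∑ as λ b₂ → ⟦ M a₁ a₂ b₁ b₂ ⟧ u ⊗ f b₁ b₂} λ b₁ →
    F-∑ as {λ b₂ → ⟦ M a₁ a₂ b₁ b₂ ⟧ u ⊗ f b₁ b₂} λ b₂ →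
    F-⊗ {⟦ M a₁ a₂ b₁ b₂ ⟧ u} {g = f b₁ b₂} (F-⟦⟧ (M a₁ a₂ b₁ b₂) equ) (eq b₁ b₂)

s-renaming : ∀ (p : Adjacent n) → Renaming (s p) (σ p)
s-renaming p = record { hom = s-hom p ; F-y = s-y p ; F-y⁻¹ = s-y⁻¹ p }

-- The exponents of y are passed to `substitute` in the place of exponents of x, so that the
-- variable i becomes y at the i-th entry of I.
rename : Vec (Fin n) m → Laurent 0 m → Laurent 0 n
rename I = linear λ (_ , b) → single ([] , substitute I b zeros)

rename-renaming : ∀ (I : Vec (Fin n) m) → Renaming (rename I) (lookup I)
rename-renaming I = record
  { hom   = monomialHom _ λ (_ , b) (_ , b′) → cong ([] ,_)
      (trans (cong (substitute I (zipWith _+_ b b′)) (sym (Vec.zipWith-identityˡ ℤ.+-identityˡ zeros)))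
        (substitute-· I b b′ zeros zeros))
  ; F-y   = λ i → ≈-reflexive (cong (λ b → single ([] , b)) (substitute-unit I i 1ℤ))
  ; F-y⁻¹ = λ i → ≈-reflexive (cong (λ b → single ([] , b)) (substitute-unit I i -1ℤ))
  }

transport : ∀ {F : Laurent 0 n → Laurent 0 n′} → Hom F → ∀ {f g f′ g′} → f ≈ g → F f ≈ f′ → F g ≈ g′ → f′ ≈ g′
transport H f≈g eq eq′ = ≈-trans (≈-sym eq) (≈-trans (hom-cong H f≈g) eq′)

yang-baxterᵇ : ∀ (i j j′ : Fin n) α β₁ β₂ l₁ l₂ α″ → Equal (YangBaxterᵇ i j j′ α β₁ β₂ l₁ l₂ α″)
yang-baxterᵇ i j j′ α β₁ β₂ l₁ l₂ α″ = transport hom (yang-baxterᵇ-012 α β₁ β₂ l₁ l₂ α″)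
  (F-act edges Rᵇ (F-ratio 2F 1F) (λ l₁′ l₂′ → crossᵇ 0F 1F 2F α β₁ β₂ l₁′ l₂′ α″)
    (λ l₁′ l₂′ → F-crossᵇ 0F 1F 2F α β₁ β₂ l₁′ l₂′ α″) l₁ l₂)
  (F-act edges (Rᵇ ᵀ) (F-ratio 2F 1F) (λ β₁′ β₂′ → crossᵇ 0F 2F 1F α β₁′ β₂′ l₁ l₂ α″)
    (λ β₁′ β₂′ → F-crossᵇ 0F 2F 1F α β₁′ β₂′ l₁ l₂ α″) β₁ β₂)
  where open Renaming (rename-renaming (i ∷ j ∷ j′ ∷ []))

yang-baxterᵃ : ∀ (i i′ j : Fin n) α₁ α₂ β l r₁ r₂ → Equal (YangBaxterᵃ i i′ j α₁ α₂ β l r₁ r₂)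
yang-baxterᵃ i i′ j α₁ α₂ β l r₁ r₂ = transport hom (yang-baxterᵃ-012 α₁ α₂ β l r₁ r₂)
  (F-act edges Rᵃ (F-ratio 1F 0F) (λ r₁′ r₂′ → crossᵃ 0F 1F 2F α₁ α₂ β l r₁′ r₂′)
    (λ r₁′ r₂′ → F-crossᵃ 0F 1F 2F α₁ α₂ β l r₁′ r₂′) r₁ r₂)
  (F-act edges (Rᵃ ᵀ) (F-ratio 1F 0F) (λ α₁′ α₂′ → crossᵃ 1F 0F 2F α₁′ α₂′ β l r₁ r₂)
    (λ α₁′ α₂′ → F-crossᵃ 1F 0F 2F α₁′ α₂′ β l r₁ r₂) α₁ α₂)
  where open Renaming (rename-renaming (i ∷ i′ ∷ j ∷ []))

corner-exchange : ∀ (i i′ : Fin n) s₁ s₂ l₁ l₂ α₁ α₂ → Equal (CornerExchange i i′ s₁ s₂ l₁ l₂ α₁ α₂)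
corner-exchange i i′ s₁ s₂ l₁ l₂ α₁ α₂ = transport hom (corner-exchange-01 s₁ s₂ l₁ l₂ α₁ α₂)
  (F-act edges Rᵇ (F-ratio 1F 0F)
    (λ l₁′ l₂′ → act edges Rᵃ (y 1F ⊗ y⁻¹ 0F) (λ α₁′ α₂′ → corner 0F 1F s₁ s₂ l₁′ l₂′ α₁′ α₂′) α₁ α₂)
    (λ l₁′ l₂′ → F-act edges Rᵃ (F-ratio 1F 0F) (λ α₁′ α₂′ → corner 0F 1F s₁ s₂ l₁′ l₂′ α₁′ α₂′)
      (λ α₁′ α₂′ → F-corner 0F 1F s₁ s₂ l₁′ l₂′ α₁′ α₂′) α₁ α₂) l₁ l₂)
  (F-act sides (Rˢ ᵀ) (F-ratio 1F 0F) (λ s₁′ s₂′ → corner 1F 0F s₁′ s₂′ l₁ l₂ α₁ α₂)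
    (λ s₁′ s₂′ → F-corner 1F 0F s₁′ s₂′ l₁ l₂ α₁ α₂) s₁ s₂)
  -- The last entry is a filler for the third variable: a corner involves two lines.
  where open Renaming (rename-renaming (i ∷ i′ ∷ i ∷ []))

-- Operators at two adjacent positions

-- The properties by which an R-matrix is pulled through sums, conditions and factors that do not
-- involve its two positions.
record Linear {V : Set} (T : (V → Laurent k n) → Laurent k n) : Set₁ where
  field
    T-cong : ∀ {f g} → (∀ v → f v ≈ g v) → T f ≈ T g
    T-∑    : ∀ {B : Set} (bs : List B) (f : B → V → Laurent k n) → T (λ v → ∑ bs (λ b → f b v)) ≈ ∑ bs (λ b → T (f b))
    T-⊗ʳ   : ∀ (f : V → Laurent k n) c → T (λ v → f v ⊗ c) ≈ T f ⊗ c

  T-⊗ˡ : ∀ c f → T (λ v → c ⊗ f v) ≈ c ⊗ T f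
  T-⊗ˡ c f = ≈-trans (T-cong λ v → ⊗-comm c (f v)) (≈-trans (T-⊗ʳ f c) (⊗-comm (T f) c))

  T-⇒ : ∀ c f → T (λ v → c ⇒ f v) ≈ c ⇒ T f
  T-⇒ true  f = ≈-refl
  -- The empty sum serves as the statement that T preserves 0.
  T-⇒ false f = T-∑ {B = ℕ} [] (λ _ → f)

open Linear public

act-linear : ∀ (as : List A) M u a₁ a₂ → Linear {k} {n} {A × A} (λ f → act as M u (λ b₁ b₂ → f (b₁ , b₂)) a₁ a₂)
act-linear as M u a₁ a₂ = record
  { T-cong = λ eq → act-cong as M u (λ b₁ b₂ → eq (b₁ , b₂)) a₁ a₂
  ; T-∑ = λ bs f → ≈-trans
      (∑-cong as λ b₁ → ≈-trans (∑-cong as λ b₂ → ∑-⊗ˡ bs (⟦ M a₁ a₂ b₁ b₂ ⟧ u) (λ b → f b (b₁ , b₂)))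
        (∑-swap as bs λ b₂ b → ⟦ M a₁ a₂ b₁ b₂ ⟧ u ⊗ f b (b₁ , b₂)))
      (∑-swap as bs λ b₁ b → ∑ as λ b₂ → ⟦ M a₁ a₂ b₁ b₂ ⟧ u ⊗ f b (b₁ , b₂))
  ; T-⊗ʳ = λ f c → ≈-sym (≈-trans (∑-⊗ʳ as c (λ b₁ → ∑ as λ b₂ → ⟦ M a₁ a₂ b₁ b₂ ⟧ u ⊗ f (b₁ , b₂)))
      (∑-cong as λ b₁ → ≈-trans (∑-⊗ʳ as c (λ b₂ → ⟦ M a₁ a₂ b₁ b₂ ⟧ u ⊗ f (b₁ , b₂)))
        (∑-cong as λ b₂ → ⊗-assoc (⟦ M a₁ a₂ b₁ b₂ ⟧ u) (f (b₁ , b₂)) c)))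
  }

actAt : Adjacent m → List A → Matrix A → Laurent k n → (Vec A m → Laurent k n) → Vec A m → Laurent k n
actAt here      as M u f (a₁ ∷ a₂ ∷ v) = act as M u (λ b₁ b₂ → f (b₁ ∷ b₂ ∷ v)) a₁ a₂
actAt (there p) as M u f (a ∷ v)       = actAt p as M u (λ w → f (a ∷ w)) v

actAt-linear : ∀ (p : Adjacent m) (as : List A) M u v → Linear {k} {n} (λ f → actAt p as M u f v)
actAt-linear here as M u (a₁ ∷ a₂ ∷ v) = record
  { T-cong = λ eq → T-cong L λ (b₁ , b₂) → eq (b₁ ∷ b₂ ∷ v)
  ; T-∑ = λ bs f → T-∑ L bs λ b (b₁ , b₂) → f b (b₁ ∷ b₂ ∷ v)
  ; T-⊗ʳ = λ f c → T-⊗ʳ L (λ (b₁ , b₂) → f (b₁ ∷ b₂ ∷ v)) c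
  }
  where L = act-linear as M u a₁ a₂
actAt-linear (there p) as M u (a ∷ v) = record
  { T-cong = λ eq → T-cong L λ w → eq (a ∷ w)
  ; T-∑ = λ bs f → T-∑ L bs λ b w → f b (a ∷ w)
  ; T-⊗ʳ = λ f c → T-⊗ʳ L (λ w → f (a ∷ w)) c
  }
  where L = actAt-linear p as M u v

-- An R-matrix moves, transposed, to the other factor across edges that are summed over. All
-- exchange arguments below use this adjunction.
act-transpose : ∀ (as : List A) M u (f g : A → A → Laurent k n) →
  ∑ as (λ a → ∑ as λ b → g a b ⊗ act as M u f a b) ≈ ∑ as (λ a → ∑ as λ b → act as (M ᵀ) u g a b ⊗ f a b)
act-transpose as M u f g = begin
  ∑ as (λ a → ∑ as λ b → g a b ⊗ act as M u f a b)
    ≈⟨ (∑-cong as λ a → ∑-cong as λ b → ≈-trans (∑-⊗ˡ as (g a b) _) (∑-cong as λ a′ → ∑-⊗ˡ as (g a b) _)) ⟩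
  ∑ as (λ a → ∑ as λ b → ∑ as λ a′ → ∑ as λ b′ → term a b a′ b′)
    ≈⟨ (∑-cong as λ a → ∑-swap as as λ b a′ → ∑ as λ b′ → term a b a′ b′) ⟩
  ∑ as (λ a → ∑ as λ a′ → ∑ as λ b → ∑ as λ b′ → term a b a′ b′)
    ≈⟨ (∑-swap as as λ a a′ → ∑ as λ b → ∑ as λ b′ → term a b a′ b′) ⟩
  ∑ as (λ a′ → ∑ as λ a → ∑ as λ b → ∑ as λ b′ → term a b a′ b′)
    ≈⟨ (∑-cong as λ a′ → ∑-cong as λ a → ∑-swap as as λ b b′ → term a b a′ b′) ⟩
  ∑ as (λ a′ → ∑ as λ a → ∑ as λ b′ → ∑ as λ b → term a b a′ b′)
    ≈⟨ (∑-cong as λ a′ → ∑-swap as as λ a b′ → ∑ as λ b → term a b a′ b′) ⟩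
  ∑ as (λ a′ → ∑ as λ b′ → ∑ as λ a → ∑ as λ b → term a b a′ b′)
    ≈⟨ (∑-cong as λ a′ → ∑-cong as λ b′ → ≈-trans
         (∑-cong as λ a → ≈-trans (∑-cong as λ b → rearrange (g a b) (⟦ M a b a′ b′ ⟧ u) (f a′ b′))
           (≈-sym (∑-⊗ʳ as (f a′ b′) λ b → ⟦ M a b a′ b′ ⟧ u ⊗ g a b)))
         (≈-sym (∑-⊗ʳ as (f a′ b′) λ a → ∑ as λ b → ⟦ M a b a′ b′ ⟧ u ⊗ g a b))) ⟩
  ∑ as (λ a → ∑ as λ b → act as (M ᵀ) u g a b ⊗ f a b) ∎
  where
  open ≈-Reasoning
  term : _ → _ → _ → _ → Laurent _ _
  term a b a′ b′ = g a b ⊗ (⟦ M a b a′ b′ ⟧ u ⊗ f a′ b′)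
  rearrange : ∀ (x y z : Laurent k n) → x ⊗ (y ⊗ z) ≈ y ⊗ x ⊗ z
  rearrange = solve 3 (λ x y z → x :* (y :* z) := y :* x :* z) ≈-refl

∑-vecs : ∀ (as : List A) m (f : Vec A (suc m) → Laurent k n) →
         ∑ (vecs as (suc m)) f ≈ ∑ as (λ a → ∑ (vecs as m) λ v → f (a ∷ v))
∑-vecs as m f = ∑-cartesian _∷_ as (vecs as m) f

actAt-transpose : ∀ (p : Adjacent m) (as : List A) M u (f g : Vec A m → Laurent k n) →
  ∑ (vecs as m) (λ v → g v ⊗ actAt p as M u f v) ≈ ∑ (vecs as m) (λ v → actAt p as (M ᵀ) u g v ⊗ f v)
actAt-transpose {m = suc (suc m)} here as M u f g = begin
  ∑ (vecs as (suc (suc m))) (λ v → g v ⊗ actAt here as M u f v)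
    ≈⟨ split (λ v → g v ⊗ actAt here as M u f v) ⟩
  ∑ (vecs as m) (λ v → ∑ as λ a → ∑ as λ b → g (a ∷ b ∷ v) ⊗ act as M u (λ a′ b′ → f (a′ ∷ b′ ∷ v)) a b)
    ≈⟨ (∑-cong (vecs as m) λ v → act-transpose as M u (λ a b → f (a ∷ b ∷ v)) (λ a b → g (a ∷ b ∷ v))) ⟩
  ∑ (vecs as m) (λ v → ∑ as λ a → ∑ as λ b → act as (M ᵀ) u (λ a′ b′ → g (a′ ∷ b′ ∷ v)) a b ⊗ f (a ∷ b ∷ v))
    ≈⟨ split (λ v → actAt here as (M ᵀ) u g v ⊗ f v) ⟨
  ∑ (vecs as (suc (suc m))) (λ v → actAt here as (M ᵀ) u g v ⊗ f v) ∎
  where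
  open ≈-Reasoning
  split : ∀ φ → ∑ (vecs as (suc (suc m))) φ ≈ ∑ (vecs as m) (λ v → ∑ as λ a → ∑ as λ b → φ (a ∷ b ∷ v))
  split φ = ≈-trans (∑-vecs as (suc m) φ) (≈-trans (∑-cong as λ a → ≈-trans (∑-vecs as m λ v → φ (a ∷ v))
    (∑-swap as (vecs as m) λ b v → φ (a ∷ b ∷ v))) (∑-swap as (vecs as m) λ a v → ∑ as λ b → φ (a ∷ b ∷ v)))
actAt-transpose {m = suc m} (there p) as M u f g = ≈-trans (∑-vecs as m (λ v → g v ⊗ actAt (there p) as M u f v))
  (≈-trans (∑-cong as λ a → actAt-transpose p as M u (λ v → f (a ∷ v)) (λ v → g (a ∷ v)))
    (≈-sym (∑-vecs as m (λ v → actAt (there p) as (M ᵀ) u g v ⊗ f v))))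

-- Strips, lines and the passage of R-matrices

∑-select : ∀ e (f : Edge → Laurent k n) → ∑ edges (λ e′ → does (e ≟ₑ e′) ⇒ f e′) ≈ f e
∑-select e₀ f = ⊕-identityʳ (f e₀)
∑-select e₁ f = ⊕-identityʳ (f e₁)
∑-select e₂ f = ⊕-identityʳ (f e₂)

-- The line i, in direction 120°, crosses the lines J, in direction 60°.
strip : Fin n → Vec (Fin n) m → Edge → Vec Edge m → Vec Edge m → Edge → Laurent 0 n
strip i []      α []       []       r = does (α ≟ₑ r) ⇒ 1ᴸ
strip i (j ∷ J) α (κ ∷ κs) (l ∷ ls) r = ∑ edges λ α′ → cross i j α κ l α′ ⊗ strip i J α′ κs ls r

-- The strip along the left side is split off: the tile t in the top-left corner sends the line i
-- across all later lines, and κ becomes the left side of the remaining triangle.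
lines : Vec (Fin n) m → Vec Edge m → Vec Edge m → Vec Side m → Laurent 0 n
lines         []      []       []       []      = 1ᴸ
lines {m = suc m} (i ∷ I) (l ∷ ls) (r ∷ rs) (s ∷ ν) =
  ∑ (tiles ▽) λ t → does (Defs.h t ≟ₕ hState s) ⇒ does (bEdge t ≟ₑ l) ⇒
  ∑ (vecs edges m) λ κ → strip i I (aEdge t) κ ls r ⊗ lines I κ rs ν

u[_,_] : Fin n → Fin n → Laurent 0 n
u[ i , i′ ] = y i′ ⊗ y⁻¹ i

strip-strip : ∀ i j j′ (J : Vec (Fin n) m) α κ₁ κ₂ κs l₁ l₂ ls r →
  strip i (j ∷ j′ ∷ J) α (κ₁ ∷ κ₂ ∷ κs) (l₁ ∷ l₂ ∷ ls) r ≈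
  ∑ edges λ α″ → crossᵇ i j j′ α κ₁ κ₂ l₁ l₂ α″ ⊗ strip i J α″ κs ls r
strip-strip i j j′ J α κ₁ κ₂ κs l₁ l₂ ls r = begin
  ∑ edges (λ α′ → c α′ ⊗ ∑ edges λ α″ → c′ α′ α″ ⊗ S α″)
    ≈⟨ (∑-cong edges λ α′ → ∑-⊗ˡ edges (c α′) λ α″ → c′ α′ α″ ⊗ S α″) ⟩
  ∑ edges (λ α′ → ∑ edges λ α″ → c α′ ⊗ (c′ α′ α″ ⊗ S α″))
    ≈⟨ (∑-swap edges edges λ α′ α″ → c α′ ⊗ (c′ α′ α″ ⊗ S α″)) ⟩
  ∑ edges (λ α″ → ∑ edges λ α′ → c α′ ⊗ (c′ α′ α″ ⊗ S α″))
    ≈⟨ (∑-cong edges λ α″ → ≈-trans (∑-cong edges λ α′ → ≈-sym (⊗-assoc (c α′) (c′ α′ α″) (S α″)))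
         (≈-sym (∑-⊗ʳ edges (S α″) λ α′ → c α′ ⊗ c′ α′ α″))) ⟩
  ∑ edges (λ α″ → crossᵇ i j j′ α κ₁ κ₂ l₁ l₂ α″ ⊗ S α″) ∎
  where
  open ≈-Reasoning
  c : Edge → Laurent 0 _
  c α′ = cross i j α κ₁ l₁ α′
  c′ : Edge → Edge → Laurent 0 _
  c′ α′ α″ = cross i j′ α′ κ₂ l₂ α″
  S : Edge → Laurent 0 _
  S α″ = strip i J α″ κs ls r

-- The Yang-Baxter equation is applied where i meets the two lines at p; the crossings before and
-- after these are constant factors.
strip-exchange : ∀ i (p : Adjacent m) (J : Vec (Fin n) m) α κ l r →
  actAt p edges (Rᵇ ᵀ) u[ lookup J (low p) , lookup J (high p) ] (λ κ′ → strip i (swap p J) α κ′ l r) κ ≈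
  actAt p edges Rᵇ u[ lookup J (low p) , lookup J (high p) ] (λ l′ → strip i J α κ l′ r) l
strip-exchange i here (j ∷ j′ ∷ J) α (κ₁ ∷ κ₂ ∷ κ) (l₁ ∷ l₂ ∷ l) r = begin
  act edges (Rᵇ ᵀ) u (λ κ₁′ κ₂′ → strip i (j′ ∷ j ∷ J) α (κ₁′ ∷ κ₂′ ∷ κ) (l₁ ∷ l₂ ∷ l) r) κ₁ κ₂
    ≈⟨ act-cong edges (Rᵇ ᵀ) u (λ κ₁′ κ₂′ → strip-strip i j′ j J α κ₁′ κ₂′ κ l₁ l₂ l r) κ₁ κ₂ ⟩
  act edges (Rᵇ ᵀ) u (λ κ₁′ κ₂′ → ∑ edges λ α″ → crossᵇ i j′ j α κ₁′ κ₂′ l₁ l₂ α″ ⊗ S α″) κ₁ κ₂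
    ≈⟨ pull (Rᵇ ᵀ) (λ α″ κ₁′ κ₂′ → crossᵇ i j′ j α κ₁′ κ₂′ l₁ l₂ α″) κ₁ κ₂ ⟩
  ∑ edges (λ α″ → act edges (Rᵇ ᵀ) u (λ κ₁′ κ₂′ → crossᵇ i j′ j α κ₁′ κ₂′ l₁ l₂ α″) κ₁ κ₂ ⊗ S α″)
    ≈⟨ (∑-cong edges λ α″ → ⊗-congʳ (S α″) (yang-baxterᵇ i j j′ α κ₁ κ₂ l₁ l₂ α″)) ⟨
  ∑ edges (λ α″ → act edges Rᵇ u (λ l₁′ l₂′ → crossᵇ i j j′ α κ₁ κ₂ l₁′ l₂′ α″) l₁ l₂ ⊗ S α″)
    ≈⟨ pull Rᵇ (λ α″ l₁′ l₂′ → crossᵇ i j j′ α κ₁ κ₂ l₁′ l₂′ α″) l₁ l₂ ⟨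
  act edges Rᵇ u (λ l₁′ l₂′ → ∑ edges λ α″ → crossᵇ i j j′ α κ₁ κ₂ l₁′ l₂′ α″ ⊗ S α″) l₁ l₂
    ≈⟨ act-cong edges Rᵇ u (λ l₁′ l₂′ → strip-strip i j j′ J α κ₁ κ₂ κ l₁′ l₂′ l r) l₁ l₂ ⟨
  act edges Rᵇ u (λ l₁′ l₂′ → strip i (j ∷ j′ ∷ J) α (κ₁ ∷ κ₂ ∷ κ) (l₁′ ∷ l₂′ ∷ l) r) l₁ l₂ ∎
  where
  open ≈-Reasoning
  u : Laurent 0 _
  u = u[ j , j′ ]
  S : Edge → Laurent 0 _
  S α″ = strip i J α″ κ l r
  pull : ∀ M (f : Edge → Edge → Edge → Laurent 0 _) a₁ a₂ →
         act edges M u (λ a b → ∑ edges λ α″ → f α″ a b ⊗ S α″) a₁ a₂ ≈ ∑ edges (λ α″ → act edges M u (f α″) a₁ a₂ ⊗ S α″)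
  pull M f a₁ a₂ = ≈-trans (T-∑ T edges λ α″ (a , b) → f α″ a b ⊗ S α″)
    (∑-cong edges λ α″ → T-⊗ʳ T (λ (a , b) → f α″ a b) (S α″))
    where T = act-linear edges M u a₁ a₂
strip-exchange i (there p) (j ∷ J) α (κ₀ ∷ κ) (l₀ ∷ l) r = ≈-trans
  (pull (Rᵇ ᵀ) κ (λ α′ κ → strip i (swap p J) α′ κ l r))
  (≈-trans (∑-cong edges λ α′ → ⊗-congˡ (cross i j α κ₀ l₀ α′) (strip-exchange i p J α′ κ l r))
    (≈-sym (pull Rᵇ l (λ α′ l → strip i J α′ κ l r))))
  where
  u : Laurent 0 _
  u = u[ lookup J (low p) , lookup J (high p) ]
  pull : ∀ M v (f : Edge → Vec Edge _ → Laurent 0 _) →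
         actAt p edges M u (λ w → ∑ edges λ α′ → cross i j α κ₀ l₀ α′ ⊗ f α′ w) v ≈
         ∑ edges (λ α′ → cross i j α κ₀ l₀ α′ ⊗ actAt p edges M u (f α′) v)
  pull M v f = ≈-trans (T-∑ T edges λ α′ w → cross i j α κ₀ l₀ α′ ⊗ f α′ w)
    (∑-cong edges λ α′ → T-⊗ˡ T (cross i j α κ₀ l₀ α′) (f α′))
    where T = actAt-linear p edges M u v

∑-select′ : ∀ e (f : Edge → Laurent k n) → ∑ edges (λ e′ → does (e′ ≟ₑ e) ⇒ f e′) ≈ f e
∑-select′ e₀ f = ⊕-identityʳ (f e₀)
∑-select′ e₁ f = ⊕-identityʳ (f e₁)
∑-select′ e₂ f = ⊕-identityʳ (f e₂)

∑-⊗-∑ : ∀ (as : List A) (bs : List B) (f : A → Laurent k n) (g : B → Laurent k n) →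
        ∑ as f ⊗ ∑ bs g ≈ ∑ as (λ a → ∑ bs λ b → f a ⊗ g b)
∑-⊗-∑ as bs f g = ≈-trans (∑-⊗ʳ as (∑ bs g) f) (∑-cong as λ a → ∑-⊗ˡ bs (f a) g)

module _ (i i′ : Fin n) where

  strips : Vec (Fin n) m → (α₁ α₂ : Edge) (κ l : Vec Edge m) (r₁ r₂ : Edge) → Laurent 0 n
  strips {m} J α₁ α₂ κ l r₁ r₂ = ∑ (vecs edges m) λ κ′ → strip i J α₁ κ′ l r₁ ⊗ strip i′ J α₂ κ κ′ r₂

  strips-[] : ∀ α₁ α₂ r₁ r₂ → strips [] α₁ α₂ [] [] r₁ r₂ ≈ does (α₁ ≟ₑ r₁) ⇒ does (α₂ ≟ₑ r₂) ⇒ 1ᴸ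
  strips-[] α₁ α₂ r₁ r₂ = ≈-trans (⊕-identityʳ (δ₁ ⊗ δ₂)) (≈-trans (⇒-⊗ˡ (does (α₁ ≟ₑ r₁)) 1ᴸ δ₂)
    (⇒-cong (does (α₁ ≟ₑ r₁)) (⊗-identityˡ δ₂)))
    where
    δ₁ δ₂ : Laurent 0 n
    δ₁ = does (α₁ ≟ₑ r₁) ⇒ 1ᴸ
    δ₂ = does (α₂ ≟ₑ r₂) ⇒ 1ᴸ

  -- Sorting the sums by the crossed line instead of by strip exhibits two neighbouring strips as a
  -- product of `crossᵃ`, the form in which Yang-Baxter applies.
  strips-∷ : ∀ j (J : Vec (Fin n) m) α₁ α₂ β κ l₀ l r₁ r₂ →
    strips (j ∷ J) α₁ α₂ (β ∷ κ) (l₀ ∷ l) r₁ r₂ ≈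
    ∑ edges λ α₁′ → ∑ edges λ α₂′ → crossᵃ i i′ j α₁ α₂ β l₀ α₁′ α₂′ ⊗ strips J α₁′ α₂′ κ l r₁ r₂
  strips-∷ {m} j J α₁ α₂ β κ l₀ l r₁ r₂ = begin
    strips (j ∷ J) α₁ α₂ (β ∷ κ) (l₀ ∷ l) r₁ r₂
      ≈⟨ ∑-vecs edges m (λ κ′ → strip i (j ∷ J) α₁ κ′ (l₀ ∷ l) r₁ ⊗ strip i′ (j ∷ J) α₂ (β ∷ κ) κ′ r₂) ⟩
    ∑ edges (λ κ₀ → ∑ (vecs edges m) λ κ′ → ∑ edges (λ a → c κ₀ a ⊗ S a κ′) ⊗ ∑ edges (λ b → c′ κ₀ b ⊗ S′ b κ′))
      ≈⟨ (∑-cong edges λ κ₀ → ∑-cong (vecs edges m) λ κ′ →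
           ≈-trans (∑-⊗-∑ edges edges (λ a → c κ₀ a ⊗ S a κ′) (λ b → c′ κ₀ b ⊗ S′ b κ′))
             (∑-cong edges λ a → ∑-cong edges λ b → rearrange (c κ₀ a) (S a κ′) (c′ κ₀ b) (S′ b κ′))) ⟩
    ∑ edges (λ κ₀ → ∑ (vecs edges m) λ κ′ → ∑ edges λ a → ∑ edges λ b → term a b κ₀ κ′)
      ≈⟨ (∑-cong edges λ κ₀ → ∑-swap (vecs edges m) edges λ κ′ a → ∑ edges λ b → term a b κ₀ κ′) ⟩
    ∑ edges (λ κ₀ → ∑ edges λ a → ∑ (vecs edges m) λ κ′ → ∑ edges λ b → term a b κ₀ κ′)
      ≈⟨ (∑-swap edges edges λ κ₀ a → ∑ (vecs edges m) λ κ′ → ∑ edges λ b → term a b κ₀ κ′) ⟩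
    ∑ edges (λ a → ∑ edges λ κ₀ → ∑ (vecs edges m) λ κ′ → ∑ edges λ b → term a b κ₀ κ′)
      ≈⟨ (∑-cong edges λ a → ≈-trans (∑-cong edges λ κ₀ → ∑-swap (vecs edges m) edges λ κ′ b → term a b κ₀ κ′)
           (∑-swap edges edges λ κ₀ b → ∑ (vecs edges m) λ κ′ → term a b κ₀ κ′)) ⟩
    ∑ edges (λ a → ∑ edges λ b → ∑ edges λ κ₀ → ∑ (vecs edges m) λ κ′ → term a b κ₀ κ′)
      ≈⟨ (∑-cong edges λ a → ∑-cong edges λ b →
           ∑-⊗-∑ edges (vecs edges m) (λ κ₀ → c κ₀ a ⊗ c′ κ₀ b) (λ κ′ → S a κ′ ⊗ S′ b κ′)) ⟨
    ∑ edges (λ a → ∑ edges λ b → crossᵃ i i′ j α₁ α₂ β l₀ a b ⊗ strips J a b κ l r₁ r₂) ∎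
    where
    open ≈-Reasoning
    c c′ : Edge → Edge → Laurent 0 n
    c κ₀ a = cross i j α₁ κ₀ l₀ a
    c′ κ₀ b = cross i′ j α₂ β κ₀ b
    S S′ : Edge → Vec Edge m → Laurent 0 n
    S a κ′ = strip i J a κ′ l r₁
    S′ b κ′ = strip i′ J b κ κ′ r₂
    term : Edge → Edge → Edge → Vec Edge m → Laurent 0 n
    term a b κ₀ κ′ = c κ₀ a ⊗ c′ κ₀ b ⊗ (S a κ′ ⊗ S′ b κ′)
    rearrange : ∀ (x y z w : Laurent 0 n) → x ⊗ y ⊗ (z ⊗ w) ≈ x ⊗ z ⊗ (y ⊗ w)
    rearrange = solve 4 (λ x y z w → x :* y :* (z :* w) := x :* z :* (y :* w)) ≈-refl

act-⊗ʳ : ∀ (as : List A) (bs : List B) M u (f : B → B → A → A → Laurent k n) (g : B → B → Laurent k n) a b →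
  act as M u (λ c d → ∑ bs λ a′ → ∑ bs λ b′ → f a′ b′ c d ⊗ g a′ b′) a b ≈
  ∑ bs (λ a′ → ∑ bs λ b′ → act as M u (f a′ b′) a b ⊗ g a′ b′)
act-⊗ʳ as bs M u f g a b = ≈-trans (T-∑ T bs λ a′ (c , d) → ∑ bs λ b′ → f a′ b′ c d ⊗ g a′ b′)
  (∑-cong bs λ a′ → ≈-trans (T-∑ T bs λ b′ (c , d) → f a′ b′ c d ⊗ g a′ b′)
    (∑-cong bs λ b′ → T-⊗ʳ T (λ (c , d) → f a′ b′ c d) (g a′ b′)))
  where T = act-linear as M u a b

act-⊗ˡ : ∀ (as : List A) (bs : List B) M u (f : B → B → A → A → Laurent k n) (g : B → B → Laurent k n) a b →
  act as M u (λ c d → ∑ bs λ a′ → ∑ bs λ b′ → g a′ b′ ⊗ f a′ b′ c d) a b ≈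
  ∑ bs (λ a′ → ∑ bs λ b′ → g a′ b′ ⊗ act as M u (f a′ b′) a b)
act-⊗ˡ as bs M u f g a b = ≈-trans (T-∑ T bs λ a′ (c , d) → ∑ bs λ b′ → g a′ b′ ⊗ f a′ b′ c d)
  (∑-cong bs λ a′ → ≈-trans (T-∑ T bs λ b′ (c , d) → g a′ b′ ⊗ f a′ b′ c d)
    (∑-cong bs λ b′ → T-⊗ˡ T (g a′ b′) (λ (c , d) → f a′ b′ c d)))
  where T = act-linear as M u a b

-- X and S are operators from pairs of edges to pairs of edges. If each can be passed by the
-- R-matrix, turning the primed version into the unprimed one, so can their composite; transposition
-- takes the R-matrix from the output of X to the input of S′.
act-intertwine : ∀ (as : List A) M u (X X′ S S′ : A → A → A → A → Laurent k n) →
  (∀ a b a′ b′ → act as (M ᵀ) u (λ c d → X′ c d a′ b′) a b ≈ act as M u (X a b) a′ b′) →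
  (∀ a b a′ b′ → act as (M ᵀ) u (λ c d → S′ c d a′ b′) a b ≈ act as M u (S a b) a′ b′) →
  ∀ a b r t →
  act as (M ᵀ) u (λ c d → ∑ as λ a′ → ∑ as λ b′ → X′ c d a′ b′ ⊗ S′ a′ b′ r t) a b ≈
  act as M u (λ r t → ∑ as λ a′ → ∑ as λ b′ → X a b a′ b′ ⊗ S a′ b′ r t) r t
act-intertwine {k = k} {n} as M u X X′ S S′ X-law S-law a b r t = begin
  act as (M ᵀ) u (λ c d → ∑ as λ a′ → ∑ as λ b′ → X′ c d a′ b′ ⊗ S′ a′ b′ r t) a b
    ≈⟨ act-⊗ʳ as as (M ᵀ) u (λ a′ b′ c d → X′ c d a′ b′) (λ a′ b′ → S′ a′ b′ r t) a b ⟩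
  ∑ as (λ a′ → ∑ as λ b′ → act as (M ᵀ) u (λ c d → X′ c d a′ b′) a b ⊗ S′ a′ b′ r t)
    ≈⟨ (∑-cong as λ a′ → ∑-cong as λ b′ → ≈-trans (⊗-congʳ (S′ a′ b′ r t) (X-law a b a′ b′))
         (⊗-comm (act as M u (X a b) a′ b′) (S′ a′ b′ r t))) ⟩
  ∑ as (λ a′ → ∑ as λ b′ → S′ a′ b′ r t ⊗ act as M u (X a b) a′ b′)
    ≈⟨ act-transpose as M u (X a b) (λ a′ b′ → S′ a′ b′ r t) ⟩
  ∑ as (λ a′ → ∑ as λ b′ → act as (M ᵀ) u (λ c d → S′ c d r t) a′ b′ ⊗ X a b a′ b′)
    ≈⟨ (∑-cong as λ a′ → ∑-cong as λ b′ → ≈-trans (⊗-comm (act as (M ᵀ) u (λ c d → S′ c d r t) a′ b′) (X a b a′ b′))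
         (⊗-congˡ (X a b a′ b′) (S-law a′ b′ r t))) ⟩
  ∑ as (λ a′ → ∑ as λ b′ → X a b a′ b′ ⊗ act as M u (S a′ b′) r t)
    ≈⟨ act-⊗ˡ as as M u S (X a b) r t ⟨
  act as M u (λ r t → ∑ as λ a′ → ∑ as λ b′ → X a b a′ b′ ⊗ S a′ b′ r t) r t ∎
  where
  open ≈-Reasoning

module _ (i i′ : Fin n) where
  private
    u : Laurent 0 n
    u = u[ i , i′ ]

  act-select : ∀ (M : Matrix Edge) a₁ a₂ b₁ b₂ →
    act edges M u (λ a b → does (b₁ ≟ₑ a) ⇒ does (b₂ ≟ₑ b) ⇒ 1ᴸ) a₁ a₂ ≈ ⟦ M a₁ a₂ b₁ b₂ ⟧ u
  act-select M a₁ a₂ b₁ b₂ = ≈-trans (∑-cong edges λ a → ≈-trans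
      (∑-cong edges λ b → ≈-trans (⇒-⊗ʳ (does (b₁ ≟ₑ a)) (⟦ M a₁ a₂ a b ⟧ u) (does (b₂ ≟ₑ b) ⇒ 1ᴸ))
        (⇒-cong (does (b₁ ≟ₑ a)) (≈-trans (⇒-⊗ʳ (does (b₂ ≟ₑ b)) (⟦ M a₁ a₂ a b ⟧ u) 1ᴸ)
          (⇒-cong (does (b₂ ≟ₑ b)) (⊗-identityʳ (⟦ M a₁ a₂ a b ⟧ u))))))
      (≈-sym (⇒-∑ (does (b₁ ≟ₑ a)) edges λ b → does (b₂ ≟ₑ b) ⇒ ⟦ M a₁ a₂ a b ⟧ u)))
    (≈-trans (∑-select b₁ λ a → ∑ edges λ b → does (b₂ ≟ₑ b) ⇒ ⟦ M a₁ a₂ a b ⟧ u)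
      (∑-select b₂ λ b → ⟦ M a₁ a₂ b₁ b ⟧ u))

  ≟ₑ-sym : ∀ a b → does (a ≟ₑ b) ≡ does (b ≟ₑ a)
  ≟ₑ-sym a b = does-⇔ (mk⇔ sym sym) (a ≟ₑ b) (b ≟ₑ a)

  -- Induction along the crossed lines by `act-intertwine`. When none is left, both sides are one
  -- and the same entry of `Rᵃ`.
  strips-exchange : ∀ (J : Vec (Fin n) m) α₁ α₂ κ l r₁ r₂ →
    act edges (Rᵃ ᵀ) u (λ a b → strips i′ i J a b κ l r₁ r₂) α₁ α₂ ≈
    act edges Rᵃ u (λ a b → strips i i′ J α₁ α₂ κ l a b) r₁ r₂
  strips-exchange [] α₁ α₂ [] [] r₁ r₂ = ≈-trans
    (act-cong edges (Rᵃ ᵀ) u (λ a b → ≈-trans (strips-[] i′ i a b r₁ r₂) (≈-reflexive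
      (cong₂ (λ c c′ → c ⇒ c′ ⇒ 1ᴸ) (≟ₑ-sym a r₁) (≟ₑ-sym b r₂)))) α₁ α₂)
    (≈-trans (act-select (Rᵃ ᵀ) α₁ α₂ r₁ r₂) (≈-sym (≈-trans
      (act-cong edges Rᵃ u (λ a b → strips-[] i i′ α₁ α₂ a b) r₁ r₂) (act-select Rᵃ r₁ r₂ α₁ α₂))))
  strips-exchange (j ∷ J) α₁ α₂ (β ∷ κ) (l₀ ∷ l) r₁ r₂ =
    ≈-trans (act-cong edges (Rᵃ ᵀ) u (λ a b → strips-∷ i′ i j J a b β κ l₀ l r₁ r₂) α₁ α₂)
    (≈-trans (act-intertwine edges Rᵃ u
        (λ a b a′ b′ → crossᵃ i i′ j a b β l₀ a′ b′) (λ a b a′ b′ → crossᵃ i′ i j a b β l₀ a′ b′)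
        (λ a b r t → strips i i′ J a b κ l r t) (λ a b r t → strips i′ i J a b κ l r t)
        (λ a b a′ b′ → ≈-sym (yang-baxterᵃ i i′ j a b β l₀ a′ b′))
        (λ a b r t → strips-exchange J a b κ l r t) α₁ α₂ r₁ r₂)
      (≈-sym (act-cong edges Rᵃ u (λ a b → strips-∷ i i′ j J α₁ α₂ β κ l₀ l a b) r₁ r₂)))

∑-⇒-cong : ∀ (as : List A) (c : A → Bool) {f g : A → Laurent k n} → (∀ a → f a ≈ g a) →
           ∑ as (λ a → c a ⇒ f a) ≈ ∑ as (λ a → c a ⇒ g a)
∑-⇒-cong as c eq = ∑-cong as λ a → ⇒-cong (c a) (eq a)

∑-⇒-∑ : ∀ (as : List A) (bs : List B) (c : A → Bool) (f : A → B → Laurent k n) →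
        ∑ bs (λ b → ∑ as (λ a → c a ⇒ f a b)) ≈ ∑ as (λ a → c a ⇒ ∑ bs (f a))
∑-⇒-∑ as bs c f = ≈-trans (∑-swap bs as λ b a → c a ⇒ f a b)
  (∑-cong as λ a → ≈-sym (⇒-∑ (c a) bs (f a)))

∑-⇒-⊗ʳ : ∀ (as : List A) (c : A → Bool) (f : A → Laurent k n) g →
         ∑ as (λ a → c a ⇒ f a) ⊗ g ≈ ∑ as (λ a → c a ⇒ f a ⊗ g)
∑-⇒-⊗ʳ as c f g = ≈-trans (∑-⊗ʳ as g (λ a → c a ⇒ f a)) (∑-cong as λ a → ⇒-⊗ˡ (c a) (f a) g)

∑-⇒-⊗ˡ : ∀ (as : List A) (c : A → Bool) f (g : A → Laurent k n) →
         f ⊗ ∑ as (λ a → c a ⇒ g a) ≈ ∑ as (λ a → c a ⇒ f ⊗ g a)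
∑-⇒-⊗ˡ as c f g = ≈-trans (∑-⊗ˡ as f (λ a → c a ⇒ g a)) (∑-cong as λ a → ⇒-⊗ʳ (c a) f (g a))

-- The edges κ₁ and α₂ are determined by the tiles t₂ that they belong to.
module _ {T : Set} (ts : List T) (vs : List V) (c c′ d : T → Bool) (a b : T → Edge)
         (X : Edge → Edge → Edge → Laurent k n) (S : Edge → V → Laurent k n)
         (S′ : Edge → V → V → Laurent k n) (F : V → Laurent k n) where

  private
    H : T → V → Laurent k n
    H t₂ κ = ∑ vs λ κ″ → S′ (a t₂) κ″ κ ⊗ F κ″

    base : Edge → Edge → Laurent k n
    base α₁ α₂ = ∑ vs λ κ″ → (∑ vs λ κ → S α₁ κ ⊗ S′ α₂ κ″ κ) ⊗ F κ″

    top-line : T → Edge → V → Laurent k n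
    top-line t₁ κ₁ κ = ∑ edges λ α₁ → X (a t₁) κ₁ α₁ ⊗ S α₁ κ

    regroup : ∀ t₁ t₂ → ∑ vs (λ κ → top-line t₁ (b t₂) κ ⊗ H t₂ κ) ≈
                        ∑ edges (λ α₁ → X (a t₁) (b t₂) α₁ ⊗ base α₁ (a t₂))
    regroup t₁ t₂ = begin
      ∑ vs (λ κ → top-line t₁ (b t₂) κ ⊗ H t₂ κ)
        ≈⟨ (∑-cong vs λ κ → ∑-⊗-∑ edges vs (λ α₁ → X′ α₁ ⊗ S α₁ κ) (λ κ″ → S′ (a t₂) κ″ κ ⊗ F κ″)) ⟩
      ∑ vs (λ κ → ∑ edges λ α₁ → ∑ vs λ κ″ → X′ α₁ ⊗ S α₁ κ ⊗ (S′ (a t₂) κ″ κ ⊗ F κ″))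
        ≈⟨ (∑-swap vs edges λ κ α₁ → ∑ vs λ κ″ → X′ α₁ ⊗ S α₁ κ ⊗ (S′ (a t₂) κ″ κ ⊗ F κ″)) ⟩
      ∑ edges (λ α₁ → ∑ vs λ κ → ∑ vs λ κ″ → X′ α₁ ⊗ S α₁ κ ⊗ (S′ (a t₂) κ″ κ ⊗ F κ″))
        ≈⟨ (∑-cong edges λ α₁ → ∑-swap vs vs λ κ κ″ → X′ α₁ ⊗ S α₁ κ ⊗ (S′ (a t₂) κ″ κ ⊗ F κ″)) ⟩
      ∑ edges (λ α₁ → ∑ vs λ κ″ → ∑ vs λ κ → X′ α₁ ⊗ S α₁ κ ⊗ (S′ (a t₂) κ″ κ ⊗ F κ″))
        ≈⟨ (∑-cong edges λ α₁ → ∑-cong vs λ κ″ → collect α₁ κ″) ⟩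
      ∑ edges (λ α₁ → ∑ vs λ κ″ → X′ α₁ ⊗ (∑ vs (λ κ → S α₁ κ ⊗ S′ (a t₂) κ″ κ) ⊗ F κ″))
        ≈⟨ (∑-cong edges λ α₁ → ∑-⊗ˡ vs (X′ α₁) λ κ″ → ∑ vs (λ κ → S α₁ κ ⊗ S′ (a t₂) κ″ κ) ⊗ F κ″) ⟨
      ∑ edges (λ α₁ → X′ α₁ ⊗ base α₁ (a t₂)) ∎
      where
      open ≈-Reasoning
      X′ : Edge → Laurent k n
      X′ α₁ = X (a t₁) (b t₂) α₁
      rearrange : ∀ (p q r s : Laurent k n) → p ⊗ q ⊗ (r ⊗ s) ≈ p ⊗ (q ⊗ r ⊗ s)
      rearrange = solve 4 (λ p q r s → p :* q :* (r :* s) := p :* (q :* r :* s)) ≈-refl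
      collect : ∀ α₁ κ″ → ∑ vs (λ κ → X′ α₁ ⊗ S α₁ κ ⊗ (S′ (a t₂) κ″ κ ⊗ F κ″)) ≈
                X′ α₁ ⊗ (∑ vs (λ κ → S α₁ κ ⊗ S′ (a t₂) κ″ κ) ⊗ F κ″)
      collect α₁ κ″ = ≈-trans (∑-cong vs λ κ → rearrange (X′ α₁) (S α₁ κ) (S′ (a t₂) κ″ κ) (F κ″))
        (≈-trans (≈-sym (∑-⊗ˡ vs (X′ α₁) λ κ → S α₁ κ ⊗ S′ (a t₂) κ″ κ ⊗ F κ″))
          (⊗-congˡ (X′ α₁) (≈-sym (∑-⊗ʳ vs (F κ″) λ κ → S α₁ κ ⊗ S′ (a t₂) κ″ κ))))

    middle : T → Laurent k n
    middle t₁ = ∑ ts λ t₂ → d t₂ ⇒ ∑ edges λ α₁ → X (a t₁) (b t₂) α₁ ⊗ base α₁ (a t₂)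

    from-lines : ∀ t₁ → ∑ edges (λ κ₁ → ∑ vs λ κ → top-line t₁ κ₁ κ ⊗
      ∑ ts (λ t₂ → d t₂ ⇒ does (b t₂ ≟ₑ κ₁) ⇒ H t₂ κ)) ≈ middle t₁
    from-lines t₁ = begin
      ∑ edges (λ κ₁ → ∑ vs λ κ → top-line t₁ κ₁ κ ⊗ ∑ ts (λ t₂ → d t₂ ⇒ does (b t₂ ≟ₑ κ₁) ⇒ H t₂ κ))
        ≈⟨ (∑-cong edges λ κ₁ → ∑-cong vs λ κ → ≈-trans
             (∑-⇒-⊗ˡ ts d (top-line t₁ κ₁ κ) λ t₂ → does (b t₂ ≟ₑ κ₁) ⇒ H t₂ κ)
             (∑-⇒-cong ts d λ t₂ → ⇒-⊗ʳ (does (b t₂ ≟ₑ κ₁)) (top-line t₁ κ₁ κ) (H t₂ κ))) ⟩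
      ∑ edges (λ κ₁ → ∑ vs λ κ → ∑ ts λ t₂ → d t₂ ⇒ does (b t₂ ≟ₑ κ₁) ⇒ top-line t₁ κ₁ κ ⊗ H t₂ κ)
        ≈⟨ (∑-cong edges λ κ₁ → ≈-trans
             (∑-⇒-∑ ts vs d λ t₂ κ → does (b t₂ ≟ₑ κ₁) ⇒ top-line t₁ κ₁ κ ⊗ H t₂ κ)
             (∑-⇒-cong ts d λ t₂ → ≈-sym (⇒-∑ (does (b t₂ ≟ₑ κ₁)) vs λ κ → top-line t₁ κ₁ κ ⊗ H t₂ κ))) ⟩
      ∑ edges (λ κ₁ → ∑ ts λ t₂ → d t₂ ⇒ does (b t₂ ≟ₑ κ₁) ⇒ ∑ vs λ κ → top-line t₁ κ₁ κ ⊗ H t₂ κ)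
        ≈⟨ (∑-⇒-∑ ts edges d λ t₂ κ₁ → does (b t₂ ≟ₑ κ₁) ⇒ ∑ vs λ κ → top-line t₁ κ₁ κ ⊗ H t₂ κ) ⟩
      ∑ ts (λ t₂ → d t₂ ⇒ ∑ edges λ κ₁ → does (b t₂ ≟ₑ κ₁) ⇒ ∑ vs λ κ → top-line t₁ κ₁ κ ⊗ H t₂ κ)
        ≈⟨ (∑-⇒-cong ts d λ t₂ → ≈-trans (∑-select (b t₂) λ κ₁ → ∑ vs λ κ → top-line t₁ κ₁ κ ⊗ H t₂ κ) (regroup t₁ t₂)) ⟩
      middle t₁ ∎
      where open ≈-Reasoning

    to-corner : ∑ edges (λ α₁ → ∑ edges λ α₂ →
      ∑ ts (λ t₁ → c t₁ ⇒ c′ t₁ ⇒ ∑ ts λ t₂ → d t₂ ⇒ does (a t₂ ≟ₑ α₂) ⇒ X (a t₁) (b t₂) α₁) ⊗ base α₁ α₂) ≈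
      ∑ ts (λ t₁ → c t₁ ⇒ c′ t₁ ⇒ middle t₁)
    to-corner = begin
      ∑ edges (λ α₁ → ∑ edges λ α₂ → ∑ ts (λ t₁ → c t₁ ⇒ c′ t₁ ⇒ inner t₁ α₁ α₂) ⊗ base α₁ α₂)
        ≈⟨ (∑-cong edges λ α₁ → ∑-cong edges λ α₂ → ≈-trans (∑-⇒-⊗ʳ ts c (λ t₁ → c′ t₁ ⇒ inner t₁ α₁ α₂) (base α₁ α₂))
             (∑-⇒-cong ts c λ t₁ → ⇒-⊗ˡ (c′ t₁) (inner t₁ α₁ α₂) (base α₁ α₂))) ⟩
      ∑ edges (λ α₁ → ∑ edges λ α₂ → ∑ ts λ t₁ → c t₁ ⇒ c′ t₁ ⇒ inner t₁ α₁ α₂ ⊗ base α₁ α₂)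
        ≈⟨ (∑-cong edges λ α₁ → ≈-trans (∑-⇒-∑ ts edges c λ t₁ α₂ → c′ t₁ ⇒ inner t₁ α₁ α₂ ⊗ base α₁ α₂)
             (∑-⇒-cong ts c λ t₁ → ≈-sym (⇒-∑ (c′ t₁) edges λ α₂ → inner t₁ α₁ α₂ ⊗ base α₁ α₂))) ⟩
      ∑ edges (λ α₁ → ∑ ts λ t₁ → c t₁ ⇒ c′ t₁ ⇒ ∑ edges λ α₂ → inner t₁ α₁ α₂ ⊗ base α₁ α₂)
        ≈⟨ ≈-trans (∑-⇒-∑ ts edges c λ t₁ α₁ → c′ t₁ ⇒ ∑ edges λ α₂ → inner t₁ α₁ α₂ ⊗ base α₁ α₂)
             (∑-⇒-cong ts c λ t₁ → ≈-sym (⇒-∑ (c′ t₁) edges λ α₁ → ∑ edges λ α₂ → inner t₁ α₁ α₂ ⊗ base α₁ α₂)) ⟩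
      ∑ ts (λ t₁ → c t₁ ⇒ c′ t₁ ⇒ ∑ edges λ α₁ → ∑ edges λ α₂ → inner t₁ α₁ α₂ ⊗ base α₁ α₂)
        ≈⟨ (∑-⇒-cong ts c λ t₁ → ⇒-cong (c′ t₁) (select t₁)) ⟩
      ∑ ts (λ t₁ → c t₁ ⇒ c′ t₁ ⇒ middle t₁) ∎
      where
      open ≈-Reasoning
      inner : T → Edge → Edge → Laurent k n
      inner t₁ α₁ α₂ = ∑ ts λ t₂ → d t₂ ⇒ does (a t₂ ≟ₑ α₂) ⇒ X (a t₁) (b t₂) α₁
      select : ∀ t₁ → ∑ edges (λ α₁ → ∑ edges λ α₂ → inner t₁ α₁ α₂ ⊗ base α₁ α₂) ≈ middle t₁
      select t₁ = begin
        ∑ edges (λ α₁ → ∑ edges λ α₂ → inner t₁ α₁ α₂ ⊗ base α₁ α₂)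
          ≈⟨ (∑-cong edges λ α₁ → ∑-cong edges λ α₂ → ≈-trans
               (∑-⇒-⊗ʳ ts d (λ t₂ → does (a t₂ ≟ₑ α₂) ⇒ X (a t₁) (b t₂) α₁) (base α₁ α₂))
               (∑-⇒-cong ts d λ t₂ → ⇒-⊗ˡ (does (a t₂ ≟ₑ α₂)) (X (a t₁) (b t₂) α₁) (base α₁ α₂))) ⟩
        ∑ edges (λ α₁ → ∑ edges λ α₂ → ∑ ts λ t₂ → d t₂ ⇒ does (a t₂ ≟ₑ α₂) ⇒ X (a t₁) (b t₂) α₁ ⊗ base α₁ α₂)
          ≈⟨ (∑-cong edges λ α₁ → ≈-trans
               (∑-⇒-∑ ts edges d λ t₂ α₂ → does (a t₂ ≟ₑ α₂) ⇒ X (a t₁) (b t₂) α₁ ⊗ base α₁ α₂)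
               (∑-⇒-cong ts d λ t₂ → ∑-select (a t₂) λ α₂ → X (a t₁) (b t₂) α₁ ⊗ base α₁ α₂)) ⟩
        ∑ edges (λ α₁ → ∑ ts λ t₂ → d t₂ ⇒ X (a t₁) (b t₂) α₁ ⊗ base α₁ (a t₂))
          ≈⟨ (∑-⇒-∑ ts edges d λ t₂ α₁ → X (a t₁) (b t₂) α₁ ⊗ base α₁ (a t₂)) ⟩
        middle t₁ ∎

  split-corner :
    ∑ ts (λ t₁ → c t₁ ⇒ c′ t₁ ⇒ ∑ edges λ κ₁ → ∑ vs λ κ → (∑ edges λ α₁ → X (a t₁) κ₁ α₁ ⊗ S α₁ κ) ⊗
      (∑ ts λ t₂ → d t₂ ⇒ does (b t₂ ≟ₑ κ₁) ⇒ ∑ vs λ κ″ → S′ (a t₂) κ″ κ ⊗ F κ″)) ≈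
    ∑ edges (λ α₁ → ∑ edges λ α₂ →
      (∑ ts λ t₁ → c t₁ ⇒ c′ t₁ ⇒ ∑ ts λ t₂ → d t₂ ⇒ does (a t₂ ≟ₑ α₂) ⇒ X (a t₁) (b t₂) α₁) ⊗
      (∑ vs λ κ″ → (∑ vs λ κ → S α₁ κ ⊗ S′ α₂ κ″ κ) ⊗ F κ″))
  split-corner = ≈-trans (∑-⇒-cong ts c λ t₁ → ⇒-cong (c′ t₁) (from-lines t₁)) (≈-sym to-corner)

-- What lies behind the corner: the lines i and i′ cross the other lines, and below their strips is
-- a triangle formed by the other lines alone.
remainder : (i i′ : Fin n) → Vec (Fin n) m → (α₁ α₂ : Edge) (l : Vec Edge m) (r₁ r₂ : Edge) (r : Vec Edge m) →
            Vec Side m → Laurent 0 n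
remainder {m = m} i i′ I α₁ α₂ l r₁ r₂ r ν = ∑ (vecs edges m) λ κ → strips i i′ I α₁ α₂ κ l r₁ r₂ ⊗ lines I κ r ν

lines-corner : ∀ i i′ (I : Vec (Fin n) m) l₁ l₂ l r₁ r₂ r s₁ s₂ ν →
  lines (i ∷ i′ ∷ I) (l₁ ∷ l₂ ∷ l) (r₁ ∷ r₂ ∷ r) (s₁ ∷ s₂ ∷ ν) ≈
  ∑ edges λ α₁ → ∑ edges λ α₂ → corner i i′ s₁ s₂ l₁ l₂ α₁ α₂ ⊗ remainder i i′ I α₁ α₂ l r₁ r₂ r ν
lines-corner {m = m} i i′ I l₁ l₂ l r₁ r₂ r s₁ s₂ ν = ≈-trans
  (∑-⇒-cong (tiles ▽) (λ t → does (Defs.h t ≟ₕ hState s₁)) λ t → ⇒-cong (does (bEdge t ≟ₑ l₁))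
    (∑-vecs edges m λ κ → strip i (i′ ∷ I) (aEdge t) κ (l₂ ∷ l) r₁ ⊗ lines (i′ ∷ I) κ (r₂ ∷ r) (s₂ ∷ ν)))
  (split-corner (tiles ▽) (vecs edges m)
    (λ t → does (Defs.h t ≟ₕ hState s₁)) (λ t → does (bEdge t ≟ₑ l₁)) (λ t → does (Defs.h t ≟ₕ hState s₂)) aEdge bEdge
    (λ α κ α₁ → cross i i′ α κ l₂ α₁) (λ α₁ κ → strip i I α₁ κ l r₁) (λ α₂ κ″ κ → strip i′ I α₂ κ″ κ r₂)
    (λ κ → lines I κ r ν))

remainder-exchange : ∀ i i′ (I : Vec (Fin n) m) α₁ α₂ l r₁ r₂ r ν →
  act edges (Rᵃ ᵀ) u[ i , i′ ] (λ a b → remainder i′ i I a b l r₁ r₂ r ν) α₁ α₂ ≈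
  act edges Rᵃ u[ i , i′ ] (λ a b → remainder i i′ I α₁ α₂ l a b r ν) r₁ r₂
remainder-exchange {m = m} i i′ I α₁ α₂ l r₁ r₂ r ν = ≈-trans
  (pull (Rᵃ ᵀ) α₁ α₂ (λ κ a b → strips i′ i I a b κ l r₁ r₂))
  (≈-trans (∑-cong (vecs edges m) λ κ → ⊗-congʳ (lines I κ r ν) (strips-exchange i i′ I α₁ α₂ κ l r₁ r₂))
    (≈-sym (pull Rᵃ r₁ r₂ (λ κ a b → strips i i′ I α₁ α₂ κ l a b))))
  where
  pull : ∀ M a₁ a₂ (f : Vec Edge m → Edge → Edge → Laurent 0 _) →
    act edges M u[ i , i′ ] (λ a b → ∑ (vecs edges m) λ κ → f κ a b ⊗ lines I κ r ν) a₁ a₂ ≈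
    ∑ (vecs edges m) (λ κ → act edges M u[ i , i′ ] (f κ) a₁ a₂ ⊗ lines I κ r ν)
  pull M a₁ a₂ f = ≈-trans (T-∑ T (vecs edges m) λ κ (a , b) → f κ a b ⊗ lines I κ r ν)
    (∑-cong (vecs edges m) λ κ → T-⊗ʳ T (λ (a , b) → f κ a b) (lines I κ r ν))
    where T = act-linear edges M u[ i , i′ ] a₁ a₂

-- At the corner the R-matrix of the top side splits into one on the left edges and one on the edges
-- leaving the corner. The latter is transposed into the remainder and leaves it on the right side.
corner-remainder-exchange : ∀ (as : List A) (bs : List B) (cs : List C) Mᵃ Mᵇ Mᶜ u
  (X X′ : C → C → B → B → A → A → Laurent k n) (Y Y′ : A → A → A → A → Laurent k n) →
  (∀ s₁ s₂ l₁ l₂ a₁ a₂ → act bs Mᵇ u (λ l₁ l₂ → act as Mᵃ u (X s₁ s₂ l₁ l₂) a₁ a₂) l₁ l₂ ≈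
                         act cs (Mᶜ ᵀ) u (λ s₁ s₂ → X′ s₁ s₂ l₁ l₂ a₁ a₂) s₁ s₂) →
  (∀ a₁ a₂ r₁ r₂ → act as (Mᵃ ᵀ) u (λ a₁ a₂ → Y′ a₁ a₂ r₁ r₂) a₁ a₂ ≈ act as Mᵃ u (Y a₁ a₂) r₁ r₂) →
  ∀ s₁ s₂ l₁ l₂ r₁ r₂ →
  act cs (Mᶜ ᵀ) u (λ s₁ s₂ → ∑ as λ a₁ → ∑ as λ a₂ → X′ s₁ s₂ l₁ l₂ a₁ a₂ ⊗ Y′ a₁ a₂ r₁ r₂) s₁ s₂ ≈
  act bs Mᵇ u (λ l₁ l₂ → act as Mᵃ u (λ r₁ r₂ → ∑ as λ a₁ → ∑ as λ a₂ → X s₁ s₂ l₁ l₂ a₁ a₂ ⊗ Y a₁ a₂ r₁ r₂) r₁ r₂) l₁ l₂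
corner-remainder-exchange as bs cs Mᵃ Mᵇ Mᶜ u X X′ Y Y′ X-law Y-law s₁ s₂ l₁ l₂ r₁ r₂ = begin
  act cs (Mᶜ ᵀ) u (λ s₁ s₂ → ∑ as λ a₁ → ∑ as λ a₂ → X′ s₁ s₂ l₁ l₂ a₁ a₂ ⊗ Y′ a₁ a₂ r₁ r₂) s₁ s₂
    ≈⟨ act-⊗ʳ cs as (Mᶜ ᵀ) u (λ a₁ a₂ s₁ s₂ → X′ s₁ s₂ l₁ l₂ a₁ a₂) (λ a₁ a₂ → Y′ a₁ a₂ r₁ r₂) s₁ s₂ ⟩
  ∑ as (λ a₁ → ∑ as λ a₂ → act cs (Mᶜ ᵀ) u (λ s₁ s₂ → X′ s₁ s₂ l₁ l₂ a₁ a₂) s₁ s₂ ⊗ Y′ a₁ a₂ r₁ r₂)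
    ≈⟨ (∑-cong as λ a₁ → ∑-cong as λ a₂ → ⊗-congʳ (Y′ a₁ a₂ r₁ r₂) (X-law s₁ s₂ l₁ l₂ a₁ a₂)) ⟨
  ∑ as (λ a₁ → ∑ as λ a₂ → act bs Mᵇ u (λ l₁ l₂ → act as Mᵃ u (X s₁ s₂ l₁ l₂) a₁ a₂) l₁ l₂ ⊗ Y′ a₁ a₂ r₁ r₂)
    ≈⟨ act-⊗ʳ bs as Mᵇ u (λ a₁ a₂ l₁ l₂ → act as Mᵃ u (X s₁ s₂ l₁ l₂) a₁ a₂) (λ a₁ a₂ → Y′ a₁ a₂ r₁ r₂) l₁ l₂ ⟨
  act bs Mᵇ u (λ l₁ l₂ → ∑ as λ a₁ → ∑ as λ a₂ → act as Mᵃ u (X s₁ s₂ l₁ l₂) a₁ a₂ ⊗ Y′ a₁ a₂ r₁ r₂) l₁ l₂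
    ≈⟨ act-cong bs Mᵇ u inner l₁ l₂ ⟩
  act bs Mᵇ u (λ l₁ l₂ → act as Mᵃ u (λ r₁ r₂ → ∑ as λ a₁ → ∑ as λ a₂ → X s₁ s₂ l₁ l₂ a₁ a₂ ⊗ Y a₁ a₂ r₁ r₂) r₁ r₂) l₁ l₂ ∎
  where
  open ≈-Reasoning
  inner : ∀ l₁ l₂ → ∑ as (λ a₁ → ∑ as λ a₂ → act as Mᵃ u (X s₁ s₂ l₁ l₂) a₁ a₂ ⊗ Y′ a₁ a₂ r₁ r₂) ≈
          act as Mᵃ u (λ r₁ r₂ → ∑ as λ a₁ → ∑ as λ a₂ → X s₁ s₂ l₁ l₂ a₁ a₂ ⊗ Y a₁ a₂ r₁ r₂) r₁ r₂
  inner l₁ l₂ = begin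
    ∑ as (λ a₁ → ∑ as λ a₂ → act as Mᵃ u (X s₁ s₂ l₁ l₂) a₁ a₂ ⊗ Y′ a₁ a₂ r₁ r₂)
      ≈⟨ (∑-cong as λ a₁ → ∑-cong as λ a₂ → ⊗-comm (act as Mᵃ u (X s₁ s₂ l₁ l₂) a₁ a₂) (Y′ a₁ a₂ r₁ r₂)) ⟩
    ∑ as (λ a₁ → ∑ as λ a₂ → Y′ a₁ a₂ r₁ r₂ ⊗ act as Mᵃ u (X s₁ s₂ l₁ l₂) a₁ a₂)
      ≈⟨ act-transpose as Mᵃ u (X s₁ s₂ l₁ l₂) (λ a₁ a₂ → Y′ a₁ a₂ r₁ r₂) ⟩
    ∑ as (λ a₁ → ∑ as λ a₂ → act as (Mᵃ ᵀ) u (λ a₁ a₂ → Y′ a₁ a₂ r₁ r₂) a₁ a₂ ⊗ X s₁ s₂ l₁ l₂ a₁ a₂)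
      ≈⟨ (∑-cong as λ a₁ → ∑-cong as λ a₂ → ≈-trans (⊗-comm (act as (Mᵃ ᵀ) u (λ a₁ a₂ → Y′ a₁ a₂ r₁ r₂) a₁ a₂) (X s₁ s₂ l₁ l₂ a₁ a₂))
           (⊗-congˡ (X s₁ s₂ l₁ l₂ a₁ a₂) (Y-law a₁ a₂ r₁ r₂))) ⟩
    ∑ as (λ a₁ → ∑ as λ a₂ → X s₁ s₂ l₁ l₂ a₁ a₂ ⊗ act as Mᵃ u (Y a₁ a₂) r₁ r₂)
      ≈⟨ act-⊗ˡ as as Mᵃ u Y (X s₁ s₂ l₁ l₂) r₁ r₂ ⟨
    act as Mᵃ u (λ r₁ r₂ → ∑ as λ a₁ → ∑ as λ a₂ → X s₁ s₂ l₁ l₂ a₁ a₂ ⊗ Y a₁ a₂ r₁ r₂) r₁ r₂ ∎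

T-tiles : ∀ {T : (V → Laurent k n) → Laurent k n} → Linear T → ∀ (ts : List A) (vs : List B) (c c′ : A → Bool)
  (f : A → B → V → Laurent k n) →
  T (λ v → ∑ ts λ t → c t ⇒ c′ t ⇒ ∑ vs λ κ → f t κ v) ≈ ∑ ts λ t → c t ⇒ c′ t ⇒ ∑ vs λ κ → T (f t κ)
T-tiles L ts vs c c′ f = ≈-trans (T-∑ L ts λ t v → c t ⇒ c′ t ⇒ ∑ vs λ κ → f t κ v)
  (∑-cong ts λ t → ≈-trans (T-⇒ L (c t) λ v → c′ t ⇒ ∑ vs λ κ → f t κ v) (⇒-cong (c t)
    (≈-trans (T-⇒ L (c′ t) λ v → ∑ vs λ κ → f t κ v) (⇒-cong (c′ t) (T-∑ L vs (f t))))))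

module _ (p : Adjacent m) (as : List A) (cs : List C) (Mᵃ Mᵇ : Matrix A) (Mᶜ : Matrix C) (u : Laurent k n)
         {T : Set} (ts : List T) (c c′ : T → Bool) (S S′ : T → Vec A m → Vec A m → Laurent k n)
         (F F′ : Vec A m → Vec A m → Vec C m → Laurent k n)
         (S-law : ∀ t κ l → actAt p as (Mᵇ ᵀ) u (λ κ → S′ t κ l) κ ≈ actAt p as Mᵇ u (λ l → S t κ l) l)
         (F-law : ∀ κ r ν → actAt p cs (Mᶜ ᵀ) u (λ ν → F′ κ r ν) ν ≈
                            actAt p as Mᵇ u (λ κ → actAt p as Mᵃ u (λ r → F κ r ν) r) κ) where

  -- `F-law` takes the R-matrix from the top to the right side and to the edges κ behind the first
  -- strip. It is then transposed from F to S, and `S-law` takes it across the strip to the left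
  -- side.
  strip-lines-exchange : ∀ l r ν →
    actAt p cs (Mᶜ ᵀ) u (λ ν → ∑ ts λ t → c t ⇒ c′ t ⇒ ∑ (vecs as m) λ κ → S′ t κ l ⊗ F′ κ r ν) ν ≈
    actAt p as Mᵇ u (λ l → actAt p as Mᵃ u (λ r → ∑ ts λ t → c t ⇒ c′ t ⇒ ∑ (vecs as m) λ κ → S t κ l ⊗ F κ r ν) r) l
  strip-lines-exchange l r ν = begin
    actAt p cs (Mᶜ ᵀ) u (λ ν → ∑ ts λ t → c t ⇒ c′ t ⇒ ∑ vs λ κ → S′ t κ l ⊗ F′ κ r ν) ν
      ≈⟨ T-tiles (actAt-linear p cs (Mᶜ ᵀ) u ν) ts vs c c′ (λ t κ ν → S′ t κ l ⊗ F′ κ r ν) ⟩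
    ∑ ts (λ t → c t ⇒ c′ t ⇒ ∑ vs λ κ → actAt p cs (Mᶜ ᵀ) u (λ ν → S′ t κ l ⊗ F′ κ r ν) ν)
      ≈⟨ (∑-⇒-cong ts c λ t → ⇒-cong (c′ t) (begin
           ∑ vs (λ κ → actAt p cs (Mᶜ ᵀ) u (λ ν → S′ t κ l ⊗ F′ κ r ν) ν)
             ≈⟨ (∑-cong vs λ κ → ≈-trans (T-⊗ˡ (actAt-linear p cs (Mᶜ ᵀ) u ν) (S′ t κ l) (F′ κ r))
                  (⊗-congˡ (S′ t κ l) (F-law κ r ν))) ⟩
           ∑ vs (λ κ → S′ t κ l ⊗ actAt p as Mᵇ u F″ κ)
             ≈⟨ actAt-transpose p as Mᵇ u F″ (λ κ → S′ t κ l) ⟩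
           ∑ vs (λ κ → actAt p as (Mᵇ ᵀ) u (λ κ → S′ t κ l) κ ⊗ F″ κ)
             ≈⟨ (∑-cong vs λ κ → ⊗-congʳ (F″ κ) (S-law t κ l)) ⟩
           ∑ vs (λ κ → actAt p as Mᵇ u (λ l → S t κ l) l ⊗ F″ κ)
             ≈⟨ (∑-cong vs λ κ → T-⊗ʳ (actAt-linear p as Mᵇ u l) (λ l → S t κ l) (F″ κ)) ⟨
           ∑ vs (λ κ → actAt p as Mᵇ u (λ l → S t κ l ⊗ F″ κ) l) ∎)) ⟩
    ∑ ts (λ t → c t ⇒ c′ t ⇒ ∑ vs λ κ → actAt p as Mᵇ u (λ l → S t κ l ⊗ F″ κ) l)
      ≈⟨ T-tiles (actAt-linear p as Mᵇ u l) ts vs c c′ (λ t κ l → S t κ l ⊗ F″ κ) ⟨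
    actAt p as Mᵇ u (λ l → ∑ ts λ t → c t ⇒ c′ t ⇒ ∑ vs λ κ → S t κ l ⊗ F″ κ) l
      ≈⟨ (T-cong (actAt-linear p as Mᵇ u l) λ l → ≈-trans
           (∑-⇒-cong ts c λ t → ⇒-cong (c′ t) (∑-cong vs λ κ → ≈-sym (T-⊗ˡ (actAt-linear p as Mᵃ u r) (S t κ l) (λ r → F κ r ν))))
           (≈-sym (T-tiles (actAt-linear p as Mᵃ u r) ts vs c c′ (λ t κ r → S t κ l ⊗ F κ r ν)))) ⟩
    actAt p as Mᵇ u (λ l → actAt p as Mᵃ u (λ r → ∑ ts λ t → c t ⇒ c′ t ⇒ ∑ vs λ κ → S t κ l ⊗ F κ r ν) r) l ∎
    where
    open ≈-Reasoning
    vs = vecs as m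
    F″ : Vec A m → Laurent k n
    F″ κ = actAt p as Mᵃ u (λ r → F κ r ν) r

-- If the first two lines are exchanged, their common corner splits the R-matrix; otherwise the
-- first strip is passed after the smaller triangle.
lines-exchange : ∀ (p : Adjacent m) (I : Vec (Fin n) m) l r ν →
  actAt p sides (Rˢ ᵀ) u[ lookup I (low p) , lookup I (high p) ] (λ ν → lines (swap p I) l r ν) ν ≈
  actAt p edges Rᵇ u[ lookup I (low p) , lookup I (high p) ] (λ l →
    actAt p edges Rᵃ u[ lookup I (low p) , lookup I (high p) ] (λ r → lines I l r ν) r) l
lines-exchange here (i ∷ i′ ∷ I) (l₁ ∷ l₂ ∷ l) (r₁ ∷ r₂ ∷ r) (s₁ ∷ s₂ ∷ ν) = ≈-trans
  (act-cong sides (Rˢ ᵀ) u[ i , i′ ] (λ s₁ s₂ → lines-corner i′ i I l₁ l₂ l r₁ r₂ r s₁ s₂ ν) s₁ s₂)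
  (≈-trans (corner-remainder-exchange edges edges sides Rᵃ Rᵇ Rˢ u[ i , i′ ]
      (corner i i′) (corner i′ i) (λ a₁ a₂ r₁ r₂ → remainder i i′ I a₁ a₂ l r₁ r₂ r ν) (λ a₁ a₂ r₁ r₂ → remainder i′ i I a₁ a₂ l r₁ r₂ r ν)
      (corner-exchange i i′) (λ a₁ a₂ r₁ r₂ → remainder-exchange i i′ I a₁ a₂ l r₁ r₂ r ν) s₁ s₂ l₁ l₂ r₁ r₂)
    (≈-sym (act-cong edges Rᵇ u[ i , i′ ] (λ l₁ l₂ → act-cong edges Rᵃ u[ i , i′ ]
      (λ r₁ r₂ → lines-corner i i′ I l₁ l₂ l r₁ r₂ r s₁ s₂ ν) r₁ r₂) l₁ l₂)))
lines-exchange (there p) (i ∷ I) (l₀ ∷ l) (r₀ ∷ r) (s₀ ∷ ν) =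
  strip-lines-exchange p edges sides Rᵃ Rᵇ Rˢ u[ lookup I (low p) , lookup I (high p) ]
    (tiles ▽) (λ t → does (Defs.h t ≟ₕ hState s₀)) (λ t → does (bEdge t ≟ₑ l₀))
    (λ t κ l → strip i I (aEdge t) κ l r₀) (λ t κ l → strip i (swap p I) (aEdge t) κ l r₀)
    (lines I) (lines (swap p I))
    (λ t κ l → strip-exchange i p I (aEdge t) κ l r₀)
    (lines-exchange p I) l r ν

-- Sums over puzzles

lozenge : Fin n → Fin n → Edge → Edge → Tile ▽ → Laurent 0 n
lozenge i j α β t′ = ∑ (tiles △) λ t → does (aEdge t ≟ₑ α) ⇒ does (bEdge t ≟ₑ β) ⇒ does (Defs.h t ≟ₕ Defs.h t′) ⇒
                     lozengeWeight (y i ⊗ y⁻¹ j) t t′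

rowWeight : Vec (Fin n) m → Vec (Fin n) m → Vec (Tile ▽) (suc m) → Vec (Tile ▽) m → Laurent 0 n
rowWeight []      []      (t ∷ [])      []       = 1ᴸ
rowWeight (i ∷ I) (j ∷ J) (t ∷ t′ ∷ ts) (e ∷ es) = lozenge i j (aEdge t) (bEdge t′) e ⊗ rowWeight I J (t′ ∷ ts) es

-- The weighted sum over matching tilings with top row d and sides l and r. Each row of tiles △ is
-- already summed out, which leaves `rowWeight` between consecutive rows of tiles ▽.
rows-sum : Vec (Fin n) m → Vec (Fin n) m → Vec (Tile ▽) m → Vec Edge m → Vec Edge m → Laurent 0 n
rows-sum {m = zero}  I J d l r = 1ᴸ
rows-sum {m = suc m} I J d l r = does (bEdge (Vec.head d) ≟ₑ Vec.head l) ⇒ does (aEdge (Vec.last d) ≟ₑ Vec.last r) ⇒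
  ∑ (vecs (tiles ▽) m) λ d′ →
    rowWeight (Vec.init I) (Vec.tail J) d d′ ⊗ rows-sum (Vec.init I) (Vec.tail J) d′ (Vec.tail l) (Vec.init r)

cross-lozenge : ∀ (i j : Fin n) α β β′ (f : Edge → Laurent 0 n) →
  ∑ edges (λ α′ → cross i j α β β′ α′ ⊗ f α′) ≈
  ∑ (tiles ▽) (λ t′ → does (bEdge t′ ≟ₑ β′) ⇒ lozenge i j α β t′ ⊗ f (aEdge t′))
cross-lozenge i j α β β′ f = collect (tiles △) (tiles ▽)
  (λ t → does (aEdge t ≟ₑ α)) (λ t → does (bEdge t ≟ₑ β)) (λ t t′ → does (Defs.h t ≟ₕ Defs.h t′))
  (λ t′ → does (bEdge t′ ≟ₑ β′)) aEdge (lozengeWeight (y i ⊗ y⁻¹ j))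
  where
  collect : ∀ {T T′ : Set} (ts : List T) (ts′ : List T′) (c₁ c₂ : T → Bool) (c₃ : T → T′ → Bool) (c₄ : T′ → Bool)
    (a : T′ → Edge) (w : T → T′ → Laurent 0 _) →
    ∑ edges (λ α′ → ∑ ts (λ t → c₁ t ⇒ c₂ t ⇒ ∑ ts′ λ t′ → c₃ t t′ ⇒ c₄ t′ ⇒ does (a t′ ≟ₑ α′) ⇒ w t t′) ⊗ f α′) ≈
    ∑ ts′ (λ t′ → c₄ t′ ⇒ ∑ ts (λ t → c₁ t ⇒ c₂ t ⇒ c₃ t t′ ⇒ w t t′) ⊗ f (a t′))
  collect ts ts′ c₁ c₂ c₃ c₄ a w = begin
    ∑ edges (λ α′ → ∑ ts (λ t → c₁ t ⇒ c₂ t ⇒ ∑ ts′ λ t′ → c₃ t t′ ⇒ c₄ t′ ⇒ does (a t′ ≟ₑ α′) ⇒ w t t′) ⊗ f α′)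
      ≈⟨ (∑-cong edges λ α′ → ⊗-congʳ (f α′) (≈-trans
           (∑-cong ts λ t → ≈-trans (⇒-cong (c₁ t) (⇒-∑ (c₂ t) ts′ λ t′ → c₃ t t′ ⇒ c₄ t′ ⇒ does (a t′ ≟ₑ α′) ⇒ w t t′))
             (≈-trans (⇒-∑ (c₁ t) ts′ λ t′ → c₂ t ⇒ c₃ t t′ ⇒ c₄ t′ ⇒ does (a t′ ≟ₑ α′) ⇒ w t t′)
               (∑-cong ts′ λ t′ → move (c₁ t) (c₂ t) (c₃ t t′) (c₄ t′) (does (a t′ ≟ₑ α′)) (w t t′))))
           (∑-swap ts ts′ λ t t′ → c₄ t′ ⇒ does (a t′ ≟ₑ α′) ⇒ c₁ t ⇒ c₂ t ⇒ c₃ t t′ ⇒ w t t′))) ⟩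
    ∑ edges (λ α′ → ∑ ts′ (λ t′ → ∑ ts λ t → c₄ t′ ⇒ does (a t′ ≟ₑ α′) ⇒ c₁ t ⇒ c₂ t ⇒ c₃ t t′ ⇒ w t t′) ⊗ f α′)
      ≈⟨ (∑-cong edges λ α′ → ≈-trans (⊗-congʳ (f α′) (∑-cong ts′ λ t′ → ≈-trans
             (≈-sym (⇒-∑ (c₄ t′) ts λ t → does (a t′ ≟ₑ α′) ⇒ c₁ t ⇒ c₂ t ⇒ c₃ t t′ ⇒ w t t′))
             (⇒-cong (c₄ t′) (≈-sym (⇒-∑ (does (a t′ ≟ₑ α′)) ts λ t → c₁ t ⇒ c₂ t ⇒ c₃ t t′ ⇒ w t t′)))))
           (≈-trans (∑-⇒-⊗ʳ ts′ c₄ (λ t′ → does (a t′ ≟ₑ α′) ⇒ W t′) (f α′))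
             (∑-⇒-cong ts′ c₄ λ t′ → ⇒-⊗ˡ (does (a t′ ≟ₑ α′)) (W t′) (f α′)))) ⟩
    ∑ edges (λ α′ → ∑ ts′ λ t′ → c₄ t′ ⇒ does (a t′ ≟ₑ α′) ⇒ W t′ ⊗ f α′)
      ≈⟨ (∑-⇒-∑ ts′ edges c₄ λ t′ α′ → does (a t′ ≟ₑ α′) ⇒ W t′ ⊗ f α′) ⟩
    ∑ ts′ (λ t′ → c₄ t′ ⇒ ∑ edges λ α′ → does (a t′ ≟ₑ α′) ⇒ W t′ ⊗ f α′)
      ≈⟨ (∑-⇒-cong ts′ c₄ λ t′ → ∑-select (a t′) λ α′ → W t′ ⊗ f α′) ⟩
    ∑ ts′ (λ t′ → c₄ t′ ⇒ W t′ ⊗ f (a t′)) ∎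
    where
    open ≈-Reasoning
    W : _ → Laurent 0 _
    W t′ = ∑ ts λ t → c₁ t ⇒ c₂ t ⇒ c₃ t t′ ⇒ w t t′
    move : ∀ p q r s t (v : Laurent 0 _) → p ⇒ q ⇒ r ⇒ s ⇒ t ⇒ v ≈ s ⇒ t ⇒ p ⇒ q ⇒ r ⇒ v
    move p q r s t v = ≈-trans (⇒-cong p (≈-trans (⇒-cong q (⇒-comm r s (t ⇒ v))) (⇒-comm q s (r ⇒ t ⇒ v))))
      (≈-trans (⇒-comm p s (q ⇒ r ⇒ t ⇒ v)) (⇒-cong s
        (≈-trans (⇒-cong p (≈-trans (⇒-cong q (⇒-comm r t v)) (⇒-comm q t (r ⇒ v)))) (⇒-comm p t (q ⇒ r ⇒ v)))))

-- The edge β of the second tile in the top row is turned into the summation variable κ₀, the first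
-- of the edges that separate the strip from the rest.
peel : ∀ {T : Set} (ts : List T) (ds : List A) (vs : List B) (β : Edge) (c₁ : Bool) (c : T → Bool)
  (g : Edge → T → Laurent k n) (W : A → Laurent k n) (S : T → B → Laurent k n) (Z : A → B → Laurent k n) →
  c₁ ⇒ ∑ ts (λ t → ∑ ds λ d → g β t ⊗ W d ⊗ (c t ⇒ ∑ vs λ κ → S t κ ⊗ Z d κ)) ≈
  ∑ edges (λ κ₀ → ∑ vs λ κ → ∑ ts (λ t → c t ⇒ g κ₀ t ⊗ S t κ) ⊗
    (does (β ≟ₑ κ₀) ⇒ c₁ ⇒ ∑ ds λ d → W d ⊗ Z d κ))
peel {k = k} {n} ts ds vs β c₁ c g W S Z = ≈-sym (begin
  ∑ edges (λ κ₀ → ∑ vs λ κ → ∑ ts (λ t → c t ⇒ g κ₀ t ⊗ S t κ) ⊗ (does (β ≟ₑ κ₀) ⇒ c₁ ⇒ ∑ ds λ d → W d ⊗ Z d κ))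
    ≈⟨ (∑-cong edges λ κ₀ → ≈-trans (∑-cong vs λ κ →
           ⇒-⊗ʳ (does (β ≟ₑ κ₀)) (∑ ts (λ t → c t ⇒ g κ₀ t ⊗ S t κ)) (c₁ ⇒ ∑ ds λ d → W d ⊗ Z d κ))
         (≈-sym (⇒-∑ (does (β ≟ₑ κ₀)) vs λ κ → ∑ ts (λ t → c t ⇒ g κ₀ t ⊗ S t κ) ⊗ (c₁ ⇒ ∑ ds λ d → W d ⊗ Z d κ)))) ⟩
  ∑ edges (λ κ₀ → does (β ≟ₑ κ₀) ⇒ ∑ vs λ κ → ∑ ts (λ t → c t ⇒ g κ₀ t ⊗ S t κ) ⊗ (c₁ ⇒ ∑ ds λ d → W d ⊗ Z d κ))
    ≈⟨ (∑-select β λ κ₀ → ∑ vs λ κ → ∑ ts (λ t → c t ⇒ g κ₀ t ⊗ S t κ) ⊗ (c₁ ⇒ ∑ ds λ d → W d ⊗ Z d κ)) ⟩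
  ∑ vs (λ κ → ∑ ts (λ t → c t ⇒ g β t ⊗ S t κ) ⊗ (c₁ ⇒ ∑ ds λ d → W d ⊗ Z d κ))
    ≈⟨ (∑-cong vs λ κ → ⇒-⊗ʳ c₁ (∑ ts (λ t → c t ⇒ g β t ⊗ S t κ)) (∑ ds λ d → W d ⊗ Z d κ)) ⟩
  ∑ vs (λ κ → c₁ ⇒ ∑ ts (λ t → c t ⇒ g β t ⊗ S t κ) ⊗ ∑ ds (λ d → W d ⊗ Z d κ))
    ≈⟨ ⇒-∑ c₁ vs (λ κ → ∑ ts (λ t → c t ⇒ g β t ⊗ S t κ) ⊗ ∑ ds (λ d → W d ⊗ Z d κ)) ⟨
  c₁ ⇒ ∑ vs (λ κ → ∑ ts (λ t → c t ⇒ g β t ⊗ S t κ) ⊗ ∑ ds (λ d → W d ⊗ Z d κ))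
    ≈⟨ ⇒-cong c₁ (begin
       ∑ vs (λ κ → ∑ ts (λ t → c t ⇒ g β t ⊗ S t κ) ⊗ ∑ ds (λ d → W d ⊗ Z d κ))
         ≈⟨ (∑-cong vs λ κ → ≈-trans (∑-⇒-⊗ʳ ts c (λ t → g β t ⊗ S t κ) (∑ ds λ d → W d ⊗ Z d κ))
              (∑-⇒-cong ts c λ t → ∑-⊗ˡ ds (g β t ⊗ S t κ) λ d → W d ⊗ Z d κ)) ⟩
       ∑ vs (λ κ → ∑ ts λ t → c t ⇒ ∑ ds λ d → g β t ⊗ S t κ ⊗ (W d ⊗ Z d κ))
         ≈⟨ (∑-⇒-∑ ts vs c λ t κ → ∑ ds λ d → g β t ⊗ S t κ ⊗ (W d ⊗ Z d κ)) ⟩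
       ∑ ts (λ t → c t ⇒ ∑ vs λ κ → ∑ ds λ d → g β t ⊗ S t κ ⊗ (W d ⊗ Z d κ))
         ≈⟨ (∑-⇒-cong ts c λ t → ≈-trans (∑-swap vs ds λ κ d → g β t ⊗ S t κ ⊗ (W d ⊗ Z d κ))
              (∑-cong ds λ d → ≈-trans (∑-cong vs λ κ → rearrange (g β t) (S t κ) (W d) (Z d κ))
                (≈-sym (∑-⊗ˡ vs (g β t ⊗ W d) λ κ → S t κ ⊗ Z d κ)))) ⟩
       ∑ ts (λ t → c t ⇒ ∑ ds λ d → g β t ⊗ W d ⊗ ∑ vs (λ κ → S t κ ⊗ Z d κ))
         ≈⟨ (∑-cong ts λ t → ≈-trans (⇒-∑ (c t) ds λ d → g β t ⊗ W d ⊗ ∑ vs (λ κ → S t κ ⊗ Z d κ))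
              (∑-cong ds λ d → ≈-sym (⇒-⊗ʳ (c t) (g β t ⊗ W d) (∑ vs λ κ → S t κ ⊗ Z d κ)))) ⟩
       ∑ ts (λ t → ∑ ds λ d → g β t ⊗ W d ⊗ (c t ⇒ ∑ vs λ κ → S t κ ⊗ Z d κ)) ∎) ⟩
  c₁ ⇒ ∑ ts (λ t → ∑ ds λ d → g β t ⊗ W d ⊗ (c t ⇒ ∑ vs λ κ → S t κ ⊗ Z d κ)) ∎)
  where
  open ≈-Reasoning
  rearrange : ∀ (p q r s : Laurent k n) → p ⊗ q ⊗ (r ⊗ s) ≈ p ⊗ r ⊗ (q ⊗ s)
  rearrange = solve 4 (λ p q r s → p :* q :* (r :* s) := p :* r :* (q :* s)) ≈-refl

-- This passes from rows to strips: the leftmost tiles of all rows form the strip of i. The vectors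
-- I and J are independent because the next row continues with `init` of one and `tail` of the
-- other.
rows-sum-peel : ∀ i j (I J : Vec (Fin n) m) e d l₀ l r₀ r →
  rows-sum (i ∷ I) (j ∷ J) (e ∷ d) (l₀ ∷ l) (r₀ ∷ r) ≈
  does (bEdge e ≟ₑ l₀) ⇒ ∑ (vecs edges m) λ κ → strip i J (aEdge e) κ l r₀ ⊗ rows-sum I J d κ r
rows-sum-peel i j [] [] e [] l₀ [] r₀ [] = ⇒-cong (does (bEdge e ≟ₑ l₀)) (begin
  does (aEdge e ≟ₑ r₀) ⇒ 1ᴸ ⊗ 1ᴸ ⊕ 0ᴸ  ≈⟨ ⇒-cong (does (aEdge e ≟ₑ r₀)) (⊕-identityʳ (1ᴸ ⊗ 1ᴸ)) ⟩
  does (aEdge e ≟ₑ r₀) ⇒ 1ᴸ ⊗ 1ᴸ       ≈⟨ ⇒-⊗ˡ (does (aEdge e ≟ₑ r₀)) 1ᴸ 1ᴸ ⟨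
  δ ⊗ 1ᴸ                               ≈⟨ ⊕-identityʳ (δ ⊗ 1ᴸ) ⟨
  δ ⊗ 1ᴸ ⊕ 0ᴸ                          ∎)
  where
  open ≈-Reasoning
  δ : Laurent 0 _
  δ = does (aEdge e ≟ₑ r₀) ⇒ 1ᴸ
rows-sum-peel {m = suc m} i j I@(_ ∷ _) (j₁ ∷ J) e d@(t ∷ ts) l₀ (l₁ ∷ l) r₀ r@(_ ∷ _) =
  ⇒-cong (does (bEdge e ≟ₑ l₀)) (begin
  c ⇒ ∑ (vecs (tiles ▽) (suc m)) (λ d′ → rowWeight (i ∷ Vec.init I) (j₁ ∷ J) (e ∷ d) d′ ⊗
        rows-sum (i ∷ Vec.init I) (j₁ ∷ J) d′ (l₁ ∷ l) (r₀ ∷ Vec.init r))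
    ≈⟨ ⇒-cong c (≈-trans (∑-vecs (tiles ▽) m (λ d′ → rowWeight (i ∷ Vec.init I) (j₁ ∷ J) (e ∷ d) d′ ⊗
        rows-sum (i ∷ Vec.init I) (j₁ ∷ J) d′ (l₁ ∷ l) (r₀ ∷ Vec.init r)))
        (∑-cong (tiles ▽) λ e′ → ∑-cong (vecs (tiles ▽) m) λ d′ →
          ⊗-congˡ (lozenge i j₁ (aEdge e) (bEdge t) e′ ⊗ rowWeight (Vec.init I) J d d′)
            (rows-sum-peel i j₁ (Vec.init I) J e′ d′ l₁ l r₀ (Vec.init r)))) ⟩
  c ⇒ ∑ (tiles ▽) (λ e′ → ∑ (vecs (tiles ▽) m) λ d′ →
        lozenge i j₁ (aEdge e) (bEdge t) e′ ⊗ rowWeight (Vec.init I) J d d′ ⊗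
        (does (bEdge e′ ≟ₑ l₁) ⇒ ∑ (vecs edges m) λ κ → strip i J (aEdge e′) κ l r₀ ⊗ Z d′ κ))
    ≈⟨ peel (tiles ▽) (vecs (tiles ▽) m) (vecs edges m) (bEdge t) c (λ e′ → does (bEdge e′ ≟ₑ l₁))
         (lozenge i j₁ (aEdge e)) (rowWeight (Vec.init I) J d) (λ e′ κ → strip i J (aEdge e′) κ l r₀) Z ⟩
  ∑ edges (λ κ₀ → ∑ (vecs edges m) λ κ →
    ∑ (tiles ▽) (λ e′ → does (bEdge e′ ≟ₑ l₁) ⇒ lozenge i j₁ (aEdge e) κ₀ e′ ⊗ strip i J (aEdge e′) κ l r₀) ⊗ Y κ₀ κ)
    ≈⟨ (∑-cong edges λ κ₀ → ∑-cong (vecs edges m) λ κ → ⊗-congʳ (Y κ₀ κ)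
         (cross-lozenge i j₁ (aEdge e) κ₀ l₁ λ α′ → strip i J α′ κ l r₀)) ⟨
  ∑ edges (λ κ₀ → ∑ (vecs edges m) λ κ → strip i (j₁ ∷ J) (aEdge e) (κ₀ ∷ κ) (l₁ ∷ l) r₀ ⊗ Y κ₀ κ)
    ≈⟨ ∑-vecs edges m (λ κ → strip i (j₁ ∷ J) (aEdge e) κ (l₁ ∷ l) r₀ ⊗ rows-sum I (j₁ ∷ J) d κ r) ⟨
  ∑ (vecs edges (suc m)) (λ κ → strip i (j₁ ∷ J) (aEdge e) κ (l₁ ∷ l) r₀ ⊗ rows-sum I (j₁ ∷ J) d κ r) ∎)
  where
  open ≈-Reasoning
  c : Bool
  c = does (aEdge (Vec.last d) ≟ₑ Vec.last r)
  Z : Vec (Tile ▽) m → Vec Edge m → Laurent 0 _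
  Z d′ κ = rows-sum (Vec.init I) J d′ κ (Vec.init r)
  Y : Edge → Vec Edge m → Laurent 0 _
  Y κ₀ κ = does (bEdge t ≟ₑ κ₀) ⇒ c ⇒ ∑ (vecs (tiles ▽) m) λ d′ → rowWeight (Vec.init I) J d d′ ⊗ Z d′ κ

∧-⇒ : ∀ c c′ (f : Laurent k n) → (c ∧ c′) ⇒ f ≈ c ⇒ c′ ⇒ f
∧-⇒ true  c′ f = ≈-refl
∧-⇒ false c′ f = ≈-refl

aStateOf bStateOf : Edge → State
aStateOf e₀ = ∅
aStateOf e₁ = G
aStateOf e₂ = RG
bStateOf e₀ = ∅
bStateOf e₁ = R
bStateOf e₂ = RG

aStateOf-aEdge : ∀ {o} (t : Tile o) → aStateOf (aEdge t) ≡ a t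
aStateOf-aEdge E  = refl
aStateOf-aEdge G₁ = refl
aStateOf-aEdge G₂ = refl
aStateOf-aEdge R₁ = refl
aStateOf-aEdge R₂ = refl
aStateOf-aEdge Q  = refl
aStateOf-aEdge K  = refl

bStateOf-bEdge : ∀ {o} (t : Tile o) → bStateOf (bEdge t) ≡ b t
bStateOf-bEdge E  = refl
bStateOf-bEdge G₁ = refl
bStateOf-bEdge G₂ = refl
bStateOf-bEdge R₁ = refl
bStateOf-bEdge R₂ = refl
bStateOf-bEdge Q  = refl
bStateOf-bEdge K  = refl

aStateOf-injective : ∀ {e e′} → aStateOf e ≡ aStateOf e′ → e ≡ e′
aStateOf-injective {e₀} {e₀} eq = refl
aStateOf-injective {e₁} {e₁} eq = refl
aStateOf-injective {e₂} {e₂} eq = refl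

bStateOf-injective : ∀ {e e′} → bStateOf e ≡ bStateOf e′ → e ≡ e′
bStateOf-injective {e₀} {e₀} eq = refl
bStateOf-injective {e₁} {e₁} eq = refl
bStateOf-injective {e₂} {e₂} eq = refl

a≡⇒aEdge≡ : ∀ {o o′} (t : Tile o) (t′ : Tile o′) → a t ≡ a t′ → aEdge t′ ≡ aEdge t
a≡⇒aEdge≡ t t′ eq = aStateOf-injective (trans (aStateOf-aEdge t′) (trans (sym eq) (sym (aStateOf-aEdge t))))

b≡⇒bEdge≡ : ∀ {o o′} (t : Tile o) (t′ : Tile o′) → b t ≡ b t′ → bEdge t′ ≡ bEdge t
b≡⇒bEdge≡ t t′ eq = bStateOf-injective (trans (bStateOf-bEdge t′) (trans (sym eq) (sym (bStateOf-bEdge t))))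

aEdge≡⇒a≡ : ∀ {o o′} (t : Tile o) (t′ : Tile o′) → aEdge t′ ≡ aEdge t → a t ≡ a t′
aEdge≡⇒a≡ t t′ eq = trans (sym (aStateOf-aEdge t)) (trans (cong aStateOf (sym eq)) (aStateOf-aEdge t′))

bEdge≡⇒b≡ : ∀ {o o′} (t : Tile o) (t′ : Tile o′) → bEdge t′ ≡ bEdge t → b t ≡ b t′
bEdge≡⇒b≡ t t′ eq = trans (sym (bStateOf-bEdge t)) (trans (cong bStateOf (sym eq)) (bStateOf-bEdge t′))

fits? : ∀ (d : Vec (Tile ▽) (suc m)) (u : Vec (Tile △) m) (d′ : Vec (Tile ▽) m) → Dec (Matching-row d u d′)
fits? d u d′ = map′ (λ (p , q , r) → matching-row p q r) (λ (matching-row p q r) → p , q , r)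
  (Vec.map a (Vec.init d) ≟ₛ Vec.map a u ×-dec Vec.map b (Vec.tail d) ≟ₛ Vec.map b u ×-dec
   Vec.map Defs.h u ≟ₛ Vec.map Defs.h d′)

does-fits?-∷ : ∀ t t′ (ts : Vec (Tile ▽) m) u us e es → does (fits? (t ∷ t′ ∷ ts) (u ∷ us) (e ∷ es)) ≡
  does (aEdge u ≟ₑ aEdge t) ∧ does (bEdge u ≟ₑ bEdge t′) ∧ does (Defs.h u ≟ₕ Defs.h e) ∧ does (fits? (t′ ∷ ts) us es)
does-fits?-∷ t t′ ts u us e es = does-⇔ (mk⇔
  (λ (matching-row p q r) → a≡⇒aEdge≡ t u (Vec.∷-injectiveˡ p) , b≡⇒bEdge≡ t′ u (Vec.∷-injectiveˡ q) , Vec.∷-injectiveˡ r ,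
     matching-row (Vec.∷-injectiveʳ p) (Vec.∷-injectiveʳ q) (Vec.∷-injectiveʳ r))
  (λ (p , q , r , matching-row p′ q′ r′) →
     matching-row (cong₂ _∷_ (aEdge≡⇒a≡ t u p) p′) (cong₂ _∷_ (bEdge≡⇒b≡ t′ u q) q′) (cong₂ _∷_ r r′)))
  (fits? (t ∷ t′ ∷ ts) (u ∷ us) (e ∷ es))
  (aEdge u ≟ₑ aEdge t ×-dec bEdge u ≟ₑ bEdge t′ ×-dec Defs.h u ≟ₕ Defs.h e ×-dec fits? (t′ ∷ ts) us es)

weights : Vec (Fin n) m → Vec (Fin n) m → Vec (Tile △) m → Vec (Tile ▽) m → Laurent 0 n
weights {m = m} I J u d′ = ∏ (List.allFin m) λ c →
  lozengeWeight (y (lookup I c) ⊗ y⁻¹ (lookup J c)) (lookup u c) (lookup d′ c)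

-- Once the rows of tiles ▽ above and below are fixed, the conditions on the tiles △ between them
-- are independent, so the sum factors.
∑-weights : ∀ (I J : Vec (Fin n) m) d d′ →
  ∑ (vecs (tiles △) m) (λ u → does (fits? d u d′) ⇒ weights I J u d′) ≈ rowWeight I J d d′
∑-weights [] [] (t ∷ []) [] = ⊕-identityʳ 1ᴸ
∑-weights {m = suc m} (i ∷ I) (j ∷ J) (t ∷ t′ ∷ ts) (e ∷ es) = begin
  ∑ (vecs (tiles △) (suc m)) (λ u → does (fits? (t ∷ t′ ∷ ts) u (e ∷ es)) ⇒ weights (i ∷ I) (j ∷ J) u (e ∷ es))
    ≈⟨ ∑-vecs (tiles △) m (λ u → does (fits? (t ∷ t′ ∷ ts) u (e ∷ es)) ⇒ weights (i ∷ I) (j ∷ J) u (e ∷ es)) ⟩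
  ∑ (tiles △) (λ u → ∑ (vecs (tiles △) m) λ us →
    does (fits? (t ∷ t′ ∷ ts) (u ∷ us) (e ∷ es)) ⇒ weights (i ∷ I) (j ∷ J) (u ∷ us) (e ∷ es))
    ≈⟨ (∑-cong (tiles △) λ u → ∑-cong (vecs (tiles △) m) λ us → ≈-trans
         (≈-reflexive (cong₂ _⇒_ (does-fits?-∷ t t′ ts u us e es)
           (cong (w u ⊗_) (∏-tabulate suc λ c → lozengeWeight (y (lookup (i ∷ I) c) ⊗ y⁻¹ (lookup (j ∷ J) c)) (lookup (u ∷ us) c) (lookup (e ∷ es) c)))))
         (separate (does (aEdge u ≟ₑ aEdge t)) (does (bEdge u ≟ₑ bEdge t′)) (does (Defs.h u ≟ₕ Defs.h e)) (does (fits? (t′ ∷ ts) us es))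
           (w u) (weights I J us es))) ⟩
  ∑ (tiles △) (λ u → ∑ (vecs (tiles △) m) λ us →
    (does (aEdge u ≟ₑ aEdge t) ⇒ does (bEdge u ≟ₑ bEdge t′) ⇒ does (Defs.h u ≟ₕ Defs.h e) ⇒ w u) ⊗
    (does (fits? (t′ ∷ ts) us es) ⇒ weights I J us es))
    ≈⟨ ∑-⊗-∑ (tiles △) (vecs (tiles △) m)
         (λ u → does (aEdge u ≟ₑ aEdge t) ⇒ does (bEdge u ≟ₑ bEdge t′) ⇒ does (Defs.h u ≟ₕ Defs.h e) ⇒ w u)
         (λ us → does (fits? (t′ ∷ ts) us es) ⇒ weights I J us es) ⟨
  lozenge i j (aEdge t) (bEdge t′) e ⊗ ∑ (vecs (tiles △) m) (λ us → does (fits? (t′ ∷ ts) us es) ⇒ weights I J us es)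
    ≈⟨ ⊗-congˡ (lozenge i j (aEdge t) (bEdge t′) e) (∑-weights I J (t′ ∷ ts) es) ⟩
  lozenge i j (aEdge t) (bEdge t′) e ⊗ rowWeight I J (t′ ∷ ts) es ∎
  where
  open ≈-Reasoning
  w : Tile △ → Laurent 0 _
  w u = lozengeWeight (y i ⊗ y⁻¹ j) u e
  separate : ∀ c₁ c₂ c₃ c₄ (f g : Laurent 0 _) → (c₁ ∧ c₂ ∧ c₃ ∧ c₄) ⇒ f ⊗ g ≈ (c₁ ⇒ c₂ ⇒ c₃ ⇒ f) ⊗ (c₄ ⇒ g)
  separate false c₂    c₃    c₄ f g = ≈-sym (⊗-zeroˡ (c₄ ⇒ g))
  separate true  false c₃    c₄ f g = ≈-sym (⊗-zeroˡ (c₄ ⇒ g))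
  separate true  true  false c₄ f g = ≈-sym (⊗-zeroˡ (c₄ ⇒ g))
  separate true  true  true  c₄ f g = ≈-sym (⇒-⊗ʳ c₄ f g)

good? : ∀ (t : Tiling m) (l r : Vec Edge m) →
        Dec (Matching t × leftSide t ≡ Vec.map bStateOf l × rightSide t ≡ Vec.map aStateOf r)
good? t l r = matching? t ×-dec leftSide t ≟ₛ Vec.map bStateOf l ×-dec rightSide t ≟ₛ Vec.map aStateOf r

does-good?-row : ∀ (d : Vec (Tile ▽) (suc m)) u t l r → does (good? (row d u t) l r) ≡
  does (bEdge (Vec.head d) ≟ₑ Vec.head l) ∧ does (aEdge (Vec.last d) ≟ₑ Vec.last r) ∧
  does (fits? d u (topRow t)) ∧ does (good? t (Vec.tail l) (Vec.init r))
does-good?-row d u t (l₀ ∷ l) r = does-⇔ (mk⇔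
  (λ { (row fit match , left , right) → let right′ = trans right map-init-last in
       bStateOf-injective (trans (bStateOf-bEdge (Vec.head d)) (Vec.∷-injectiveˡ left)) ,
       aStateOf-injective (trans (aStateOf-aEdge (Vec.last d)) (Vec.∷ʳ-injectiveʳ (rightSide t) _ right′)) ,
       fit , match , Vec.∷-injectiveʳ left , Vec.∷ʳ-injectiveˡ (rightSide t) _ right′ })
  (λ (eq , eq′ , fit , match , left , right) → row fit match ,
       cong₂ _∷_ (trans (sym (bStateOf-bEdge (Vec.head d))) (cong bStateOf eq)) left ,
       trans (cong₂ Vec._∷ʳ_ right (trans (sym (aStateOf-aEdge (Vec.last d))) (cong aStateOf eq′))) (sym map-init-last)))
  (good? (row d u t) (l₀ ∷ l) r)
  (bEdge (Vec.head d) ≟ₑ l₀ ×-dec aEdge (Vec.last d) ≟ₑ Vec.last r ×-dec fits? d u (topRow t) ×-dec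
   good? t l (Vec.init r))
  where
  map-init-last : Vec.map aStateOf r ≡ Vec.map aStateOf (Vec.init r) Vec.∷ʳ aStateOf (Vec.last r)
  map-init-last = trans (cong (Vec.map aStateOf) (proj₂ (proj₂ (Vec.initLast r)))) (Vec.map-∷ʳ aStateOf (Vec.last r) (Vec.init r))

-- The arbitrary factor Φ of the top row absorbs the interaction with the row above; in the
-- induction it becomes `rowWeight`.
∑-tilings : ∀ (I J : Vec (Fin n) m) l r (Φ : Vec (Tile ▽) m → Laurent 0 n) →
  ∑ (tilings m) (λ t → Φ (topRow t) ⊗ (does (good? t l r) ⇒ weightFrom I J t)) ≈
  ∑ (vecs (tiles ▽) m) (λ d → Φ d ⊗ rows-sum I J d l r)
∑-tilings {m = zero}  []  []  []  []  Φ = ≈-refl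
∑-tilings {n = n} {m = suc m} I J l r Φ = begin
  ∑ (tilings (suc m)) (λ t → Φ (topRow t) ⊗ (does (good? t l r) ⇒ weightFrom I J t))
    ≈⟨ ∑-cartesian (λ (d , u) → row d u) (List.cartesianProductWith _,_ ds us) (tilings m)
         (λ t → Φ (topRow t) ⊗ (does (good? t l r) ⇒ weightFrom I J t)) ⟩
  ∑ (List.cartesianProductWith _,_ ds us) (λ (d , u) → ∑ (tilings m) λ t →
    Φ d ⊗ (does (good? (row d u t) l r) ⇒ P u t ⊗ w t))
    ≈⟨ ∑-cartesian _,_ ds us (λ (d , u) → ∑ (tilings m) λ t → Φ d ⊗ (does (good? (row d u t) l r) ⇒ P u t ⊗ w t)) ⟩
  ∑ ds (λ d → ∑ us λ u → ∑ (tilings m) λ t → Φ d ⊗ (does (good? (row d u t) l r) ⇒ P u t ⊗ w t))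
    ≈⟨ (∑-cong ds λ d → ≈-trans
         (∑-cong us λ u → ∑-cong (tilings m) λ t → ⊗-congˡ (Φ d) (≈-reflexive (cong (_⇒ P u t ⊗ w t) (does-good?-row d u t l r))))
         (regroup us (tilings m) (Φ d) (cb d) (ca d) (λ u t → does (fits? d u (topRow t))) (λ t → does (good? t (Vec.tail l) (Vec.init r))) P w)) ⟩
  ∑ ds (λ d → Φ d ⊗ (cb d ⇒ ca d ⇒ ∑ (tilings m) λ t →
    ∑ us (λ u → does (fits? d u (topRow t)) ⇒ P u t) ⊗ (does (good? t (Vec.tail l) (Vec.init r)) ⇒ w t)))
    ≈⟨ (∑-cong ds λ d → ⊗-congˡ (Φ d) (⇒-cong (cb d) (⇒-cong (ca d) (≈-trans
         (∑-cong (tilings m) λ t → ⊗-congʳ (does (good? t (Vec.tail l) (Vec.init r)) ⇒ w t) (∑-weights (Vec.init I) (Vec.tail J) d (topRow t)))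
         (∑-tilings (Vec.init I) (Vec.tail J) (Vec.tail l) (Vec.init r) (rowWeight (Vec.init I) (Vec.tail J) d)))))) ⟩
  ∑ ds (λ d → Φ d ⊗ rows-sum I J d l r) ∎
  where
  open ≈-Reasoning
  ds = vecs (tiles ▽) (suc m)
  us = vecs (tiles △) m
  P : Vec (Tile △) m → Tiling m → Laurent 0 n
  P u t = weights (Vec.init I) (Vec.tail J) u (topRow t)
  w : Tiling m → Laurent 0 n
  w t = weightFrom (Vec.init I) (Vec.tail J) t
  cb ca : Vec (Tile ▽) (suc m) → Bool
  cb d = does (bEdge (Vec.head d) ≟ₑ Vec.head l)
  ca d = does (aEdge (Vec.last d) ≟ₑ Vec.last r)
  separate : ∀ c₁ c₂ (f g : Laurent 0 n) → (c₁ ∧ c₂) ⇒ f ⊗ g ≈ (c₁ ⇒ f) ⊗ (c₂ ⇒ g)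
  separate false c₂ f g = ≈-sym (⊗-zeroˡ (c₂ ⇒ g))
  separate true  c₂ f g = ≈-sym (⇒-⊗ʳ c₂ f g)
  regroup : ∀ {U T : Set} (us : List U) (ts : List T) φ c c′ (F : U → T → Bool) (H : T → Bool)
    (P : U → T → Laurent 0 n) (w : T → Laurent 0 n) →
    ∑ us (λ u → ∑ ts λ t → φ ⊗ ((c ∧ c′ ∧ F u t ∧ H t) ⇒ P u t ⊗ w t)) ≈
    φ ⊗ (c ⇒ c′ ⇒ ∑ ts λ t → ∑ us (λ u → F u t ⇒ P u t) ⊗ (H t ⇒ w t))
  regroup us ts φ false c′ F H P w =
    ≈-trans (∑-zero us λ u → ∑-zero ts λ t → ⊗-zeroʳ φ) (≈-sym (⊗-zeroʳ φ))
  regroup us ts φ true false F H P w =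
    ≈-trans (∑-zero us λ u → ∑-zero ts λ t → ⊗-zeroʳ φ) (≈-sym (⊗-zeroʳ φ))
  regroup us ts φ true true F H P w = ≈-trans
    (∑-cong us λ u → ≈-trans (≈-sym (∑-⊗ˡ ts φ λ t → (F u t ∧ H t) ⇒ P u t ⊗ w t))
      (⊗-congˡ φ (∑-cong ts λ t → separate (F u t) (H t) (P u t) (w t))))
    (≈-trans (≈-sym (∑-⊗ˡ us φ λ u → ∑ ts λ t → (F u t ⇒ P u t) ⊗ (H t ⇒ w t)))
      (⊗-congˡ φ (≈-trans (∑-swap us ts λ u t → (F u t ⇒ P u t) ⊗ (H t ⇒ w t))
        (∑-cong ts λ t → ≈-sym (∑-⊗ʳ us (H t ⇒ w t) λ u → F u t ⇒ P u t)))))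

does-≟ₛ-∷ : ∀ s s′ (v v′ : Vec State m) → does ((s ∷ v) ≟ₛ (s′ ∷ v′)) ≡ does (s ≟ₕ s′) ∧ does (v ≟ₛ v′)
does-≟ₛ-∷ s s′ v v′ = does-⇔ (mk⇔ (λ eq → Vec.∷-injectiveˡ eq , Vec.∷-injectiveʳ eq) (λ (p , q) → cong₂ _∷_ p q))
  ((s ∷ v) ≟ₛ (s′ ∷ v′)) (s ≟ₕ s′ ×-dec v ≟ₛ v′)

lines-rows : ∀ (I : Vec (Fin n) m) l r ν →
  ∑ (vecs (tiles ▽) m) (λ d → does (Vec.map Defs.h d ≟ₛ Vec.map hState ν) ⇒ rows-sum I I d l r) ≈ lines I l r ν
lines-rows []      []       []       []      = ⊕-identityʳ 1ᴸ
lines-rows {m = suc m} (i ∷ I) (l₀ ∷ l) (r₀ ∷ r) (s₀ ∷ ν) = begin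
  ∑ (vecs (tiles ▽) (suc m)) (λ d → does (Vec.map Defs.h d ≟ₛ Vec.map hState (s₀ ∷ ν)) ⇒ rows-sum (i ∷ I) (i ∷ I) d (l₀ ∷ l) (r₀ ∷ r))
    ≈⟨ ∑-vecs (tiles ▽) m (λ d → does (Vec.map Defs.h d ≟ₛ Vec.map hState (s₀ ∷ ν)) ⇒ rows-sum (i ∷ I) (i ∷ I) d (l₀ ∷ l) (r₀ ∷ r)) ⟩
  ∑ (tiles ▽) (λ e → ∑ ds λ d → does (Vec.map Defs.h (e ∷ d) ≟ₛ Vec.map hState (s₀ ∷ ν)) ⇒ rows-sum (i ∷ I) (i ∷ I) (e ∷ d) (l₀ ∷ l) (r₀ ∷ r))
    ≈⟨ (∑-cong (tiles ▽) λ e → ∑-cong ds λ d → ≈-trans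
         (≈-reflexive (cong (_⇒ rows-sum (i ∷ I) (i ∷ I) (e ∷ d) (l₀ ∷ l) (r₀ ∷ r)) (does-≟ₛ-∷ (Defs.h e) (hState s₀) (Vec.map Defs.h d) (Vec.map hState ν))))
         (≈-trans (∧-⇒ (ch e) (cν d) (rows-sum (i ∷ I) (i ∷ I) (e ∷ d) (l₀ ∷ l) (r₀ ∷ r)))
           (⇒-cong (ch e) (⇒-cong (cν d) (rows-sum-peel i i I I e d l₀ l r₀ r))))) ⟩
  ∑ (tiles ▽) (λ e → ∑ ds λ d → ch e ⇒ cν d ⇒ cl e ⇒ ∑ vs λ κ → S e κ ⊗ rows-sum I I d κ r)
    ≈⟨ (∑-cong (tiles ▽) λ e → ≈-trans (≈-sym (⇒-∑ (ch e) ds λ d → cν d ⇒ cl e ⇒ ∑ vs λ κ → S e κ ⊗ rows-sum I I d κ r))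
         (⇒-cong (ch e) (inner e))) ⟩
  ∑ (tiles ▽) (λ e → ch e ⇒ cl e ⇒ ∑ vs λ κ → S e κ ⊗ lines I κ r ν) ∎
  where
  open ≈-Reasoning
  ds = vecs (tiles ▽) m
  vs = vecs edges m
  ch cl : Tile ▽ → Bool
  ch e = does (Defs.h e ≟ₕ hState s₀)
  cl e = does (bEdge e ≟ₑ l₀)
  cν : Vec (Tile ▽) m → Bool
  cν d = does (Vec.map Defs.h d ≟ₛ Vec.map hState ν)
  S : Tile ▽ → Vec Edge m → Laurent 0 _
  S e κ = strip i I (aEdge e) κ l r₀
  inner : ∀ e → ∑ ds (λ d → cν d ⇒ cl e ⇒ ∑ vs λ κ → S e κ ⊗ rows-sum I I d κ r) ≈ cl e ⇒ ∑ vs λ κ → S e κ ⊗ lines I κ r ν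
  inner e = begin
    ∑ ds (λ d → cν d ⇒ cl e ⇒ ∑ vs λ κ → S e κ ⊗ rows-sum I I d κ r)
      ≈⟨ (∑-cong ds λ d → ≈-trans (⇒-comm (cν d) (cl e) (∑ vs λ κ → S e κ ⊗ rows-sum I I d κ r))
           (⇒-cong (cl e) (≈-trans (⇒-∑ (cν d) vs λ κ → S e κ ⊗ rows-sum I I d κ r)
             (∑-cong vs λ κ → ≈-sym (⇒-⊗ʳ (cν d) (S e κ) (rows-sum I I d κ r)))))) ⟩
    ∑ ds (λ d → cl e ⇒ ∑ vs λ κ → S e κ ⊗ (cν d ⇒ rows-sum I I d κ r))
      ≈⟨ ⇒-∑ (cl e) ds (λ d → ∑ vs λ κ → S e κ ⊗ (cν d ⇒ rows-sum I I d κ r)) ⟨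
    cl e ⇒ ∑ ds (λ d → ∑ vs λ κ → S e κ ⊗ (cν d ⇒ rows-sum I I d κ r))
      ≈⟨ ⇒-cong (cl e) (≈-trans (∑-swap ds vs λ d κ → S e κ ⊗ (cν d ⇒ rows-sum I I d κ r))
           (∑-cong vs λ κ → ≈-trans (≈-sym (∑-⊗ˡ ds (S e κ) λ d → cν d ⇒ rows-sum I I d κ r))
             (⊗-congˡ (S e κ) (lines-rows I κ r ν)))) ⟩
    cl e ⇒ ∑ vs (λ κ → S e κ ⊗ lines I κ r ν) ∎

aSide bSide : Side → Edge
aSide inside  = e₁
aSide outside = e₀
bSide inside  = e₀
bSide outside = e₁

puzzleSum-lines : ∀ (λ′ μ ν : Frame k n) →
  puzzleSum λ′ μ ν ≈ lines (Vec.allFin n) (Vec.map bSide (subset λ′)) (Vec.map aSide (subset μ)) (subset ν)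
puzzleSum-lines {n = n} λ′ μ ν = begin
  ∑ (List.filter (isPuzzle? λ′ μ ν) (tilings n)) weight
    ≈⟨ ∑-filter (isPuzzle? λ′ μ ν) (tilings n) weight ⟩
  ∑ (tilings n) (λ t → does (isPuzzle? λ′ μ ν t) ⇒ weight t)
    ≈⟨ (∑-cong (tilings n) λ t → ≈-trans (≈-reflexive (cong (_⇒ weight t) (does-isPuzzle? t)))
         (≈-trans (∧-⇒ (cν (topRow t)) (does (good? t l r)) (weight t)) (indicator-⊗ (cν (topRow t)) (does (good? t l r) ⇒ weight t)))) ⟩
  ∑ (tilings n) (λ t → (cν (topRow t) ⇒ 1ᴸ) ⊗ (does (good? t l r) ⇒ weight t))
    ≈⟨ ∑-tilings (Vec.allFin n) (Vec.allFin n) l r (λ d → cν d ⇒ 1ᴸ) ⟩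
  ∑ (vecs (tiles ▽) n) (λ d → (cν d ⇒ 1ᴸ) ⊗ rows-sum (Vec.allFin n) (Vec.allFin n) d l r)
    ≈⟨ (∑-cong (vecs (tiles ▽) n) λ d → indicator-⊗ (cν d) (rows-sum (Vec.allFin n) (Vec.allFin n) d l r)) ⟨
  ∑ (vecs (tiles ▽) n) (λ d → cν d ⇒ rows-sum (Vec.allFin n) (Vec.allFin n) d l r)
    ≈⟨ lines-rows (Vec.allFin n) l r (subset ν) ⟩
  lines (Vec.allFin n) l r (subset ν) ∎
  where
  open ≈-Reasoning
  l r : Vec Edge n
  l = Vec.map bSide (subset λ′)
  r = Vec.map aSide (subset μ)
  cν : Vec (Tile ▽) n → Bool
  cν d = does (Vec.map Defs.h d ≟ₛ Vec.map hState (subset ν))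
  indicator-⊗ : ∀ c (f : Laurent 0 n) → c ⇒ f ≈ (c ⇒ 1ᴸ) ⊗ f
  indicator-⊗ c f = ≈-sym (≈-trans (⇒-⊗ˡ c 1ᴸ f) (⇒-cong c (⊗-identityˡ f)))
  bState-bSide : ∀ s → bStateOf (bSide s) ≡ bState s
  bState-bSide inside  = refl
  bState-bSide outside = refl
  aState-aSide : ∀ s → aStateOf (aSide s) ≡ aState s
  aState-aSide inside  = refl
  aState-aSide outside = refl
  left-≡ : Vec.map bStateOf l ≡ Vec.map bState (subset λ′)
  left-≡ = trans (sym (Vec.map-∘ bStateOf bSide (subset λ′))) (Vec.map-cong bState-bSide (subset λ′))
  right-≡ : Vec.map aStateOf r ≡ Vec.map aState (subset μ)
  right-≡ = trans (sym (Vec.map-∘ aStateOf aSide (subset μ))) (Vec.map-cong aState-aSide (subset μ))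
  does-isPuzzle? : ∀ t → does (isPuzzle? λ′ μ ν t) ≡ cν (topRow t) ∧ does (good? t l r)
  does-isPuzzle? t = does-⇔ (mk⇔
    (λ (isPuzzle match left right top) → top , match , trans left (sym left-≡) , trans right (sym right-≡))
    (λ (top , match , left , right) → isPuzzle match (trans left left-≡) (trans right right-≡) top))
    (isPuzzle? λ′ μ ν t) (topSide t ≟ₛ Vec.map hState (subset ν) ×-dec good? t l r)

-- The puzzle sum under the exchange of adjacent y

module _ {F : Laurent 0 n → Laurent 0 n′} {τ : Fin n → Fin n′} (renaming′ : Renaming F τ) where
  open Renaming renaming′

  F-strip : ∀ i (J : Vec (Fin n) m) α κ l r → F (strip i J α κ l r) ≈ strip (τ i) (Vec.map τ J) α κ l r
  F-strip i []      α []      []      r = F-⇒ (does (α ≟ₑ r)) (hom-1 hom)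
  F-strip i (j ∷ J) α (κ ∷ κs) (l ∷ ls) r = F-∑ edges λ α′ →
    F-⊗ {cross i j α κ l α′} {g = strip i J α′ κs ls r} (F-cross i j α κ l α′) (F-strip i J α′ κs ls r)

  F-lines : ∀ (I : Vec (Fin n) m) l r ν → F (lines I l r ν) ≈ lines (Vec.map τ I) l r ν
  F-lines []      []       []       []      = hom-1 hom
  F-lines {m = suc m} (i ∷ I) (l ∷ ls) (r ∷ rs) (s ∷ ν) =
    F-∑ (tiles ▽) λ t → F-⇒ (does (Defs.h t ≟ₕ hState s)) (F-⇒ (does (bEdge t ≟ₑ l))
    (F-∑ (vecs edges m) λ κ → F-⊗ {strip i I (aEdge t) κ ls r} {g = lines I κ rs ν}
      (F-strip i I (aEdge t) κ ls r) (F-lines I κ rs ν)))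

-- A nonzero entry keeps or exchanges its two labels, so boundary states lead to boundary states
-- only and the state RG never enters.
restrictᵇ : ∀ (u : Laurent k n) (f : Edge → Edge → Laurent k n) s t →
  act edges Rᵇ u f (bSide s) (bSide t) ≈ act sides Rˢ u (λ s t → f (bSide s) (bSide t)) s t
restrictᵇ u f inside  inside  = ≈-refl
restrictᵇ u f inside  outside = ≈-refl
restrictᵇ u f outside inside  = ≈-refl
restrictᵇ u f outside outside = ≈-refl

restrictᵃ : ∀ (u : Laurent k n) (f : Edge → Edge → Laurent k n) s t →
  act edges Rᵃ u f (aSide s) (aSide t) ≈ act sides Rˢ u (λ s t → f (aSide s) (aSide t)) s t
restrictᵃ u f inside  inside  = ≈-refl
-- `edges` begins with e₀, the image of outside, whereas `sides` begins with inside; the two nonzero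
-- terms therefore appear in opposite orders.
restrictᵃ u f inside  outside = exchange ((1ᴸ ⊖ u) ⊗ f e₀ e₁) (1ᴸ ⊗ f e₁ e₀)
  where
  pad : ∀ (p q : Laurent _ _) → (p ⊕ 0ᴸ) ⊕ ((q ⊕ 0ᴸ) ⊕ 0ᴸ) ≈ p ⊕ q
  pad p q = ⊕-cong (⊕-identityʳ p) (≈-trans (⊕-identityʳ (q ⊕ 0ᴸ)) (⊕-identityʳ q))
  exchange : ∀ (p q : Laurent _ _) → (p ⊕ 0ᴸ) ⊕ ((q ⊕ 0ᴸ) ⊕ 0ᴸ) ≈ (q ⊕ 0ᴸ) ⊕ ((p ⊕ 0ᴸ) ⊕ 0ᴸ)
  exchange p q = ≈-trans (pad p q) (≈-trans (⊕-comm p q) (≈-sym (pad q p)))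
restrictᵃ u f outside inside  = ≈-refl
restrictᵃ u f outside outside = ≈-refl

restrictAt : ∀ (φ : Side → Edge) M →
  (∀ (u : Laurent k n) (f : Edge → Edge → Laurent k n) s t →
    act edges M u f (φ s) (φ t) ≈ act sides Rˢ u (λ s t → f (φ s) (φ t)) s t) →
  ∀ (p : Adjacent m) u (f : Vec Edge m → Laurent k n) S →
  actAt p edges M u f (Vec.map φ S) ≈ actAt p sides Rˢ u (λ S → f (Vec.map φ S)) S
restrictAt φ M restrict here      u f (s ∷ t ∷ S) = restrict u (λ e e′ → f (e ∷ e′ ∷ Vec.map φ S)) s t
restrictAt φ M restrict (there p) u f (s ∷ S)     = restrictAt φ M restrict p u (λ v → f (φ s ∷ v)) S

puzzles-sum : Subset n → Subset n → Subset n → Laurent 0 n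
puzzles-sum λ′ μ ν = lines (Vec.allFin _) (Vec.map bSide λ′) (Vec.map aSide μ) ν

-- The exchange s p renumbers the lines, which is `swap p` on their list; `lines-exchange` then
-- moves the R-matrix of the top side to the two other sides.
puzzles-exchange : ∀ (p : Adjacent n) λ′ μ ν →
  actAt p sides (Rˢ ᵀ) (ratio p) (λ ν → s p (puzzles-sum λ′ μ ν)) ν ≈
  actAt p sides Rˢ (ratio p) (λ λ′ → actAt p sides Rˢ (ratio p) (λ μ → puzzles-sum λ′ μ ν) μ) λ′
puzzles-exchange {n} p λ′ μ ν = begin
  actAt p sides (Rˢ ᵀ) (ratio p) (λ ν → s p (puzzles-sum λ′ μ ν)) ν
    ≈⟨ (T-cong (actAt-linear p sides (Rˢ ᵀ) (ratio p) ν) λ ν → ≈-trans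
         (F-lines (s-renaming p) I (Vec.map bSide λ′) (Vec.map aSide μ) ν)
         (≈-reflexive (cong (λ I → lines I (Vec.map bSide λ′) (Vec.map aSide μ) ν) (sym (swap-allFin p))))) ⟩
  actAt p sides (Rˢ ᵀ) (ratio p) (λ ν → lines (swap p I) (Vec.map bSide λ′) (Vec.map aSide μ) ν) ν
    ≈⟨ subst (λ u → actAt p sides (Rˢ ᵀ) u (λ ν → lines (swap p I) (Vec.map bSide λ′) (Vec.map aSide μ) ν) ν ≈
                    actAt p edges Rᵇ u (λ l → actAt p edges Rᵃ u (λ r → lines I l r ν) (Vec.map aSide μ)) (Vec.map bSide λ′))
         (cong₂ u[_,_] (Vec.lookup-allFin (low p)) (Vec.lookup-allFin (high p)))
         (lines-exchange p I (Vec.map bSide λ′) (Vec.map aSide μ) ν) ⟩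
  actAt p edges Rᵇ (ratio p) (λ l → actAt p edges Rᵃ (ratio p) (λ r → lines I l r ν) (Vec.map aSide μ)) (Vec.map bSide λ′)
    ≈⟨ restrictAt bSide Rᵇ restrictᵇ p (ratio p) (λ l → actAt p edges Rᵃ (ratio p) (λ r → lines I l r ν) (Vec.map aSide μ)) λ′ ⟩
  actAt p sides Rˢ (ratio p) (λ λ′ → actAt p edges Rᵃ (ratio p) (λ r → lines I (Vec.map bSide λ′) r ν) (Vec.map aSide μ)) λ′
    ≈⟨ (T-cong (actAt-linear p sides Rˢ (ratio p) λ′) λ λ′ →
         restrictAt aSide Rᵃ restrictᵃ p (ratio p) (λ r → lines I (Vec.map bSide λ′) r ν) μ) ⟩
  actAt p sides Rˢ (ratio p) (λ λ′ → actAt p sides Rˢ (ratio p) (λ μ → puzzles-sum λ′ μ ν) μ) λ′ ∎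
  where
  open ≈-Reasoning
  I = Vec.allFin n

act-equal : ∀ (u : Laurent k n) f s → act sides Rˢ u f s s ≈ f s s
act-equal u f inside  = ≈-trans (⊕-identityʳ _) (≈-trans (⊕-identityʳ (1ᴸ ⊗ f inside inside)) (⊗-identityˡ (f inside inside)))
act-equal u f outside = ≈-trans (⊕-identityʳ _) (≈-trans (⊕-identityʳ (1ᴸ ⊗ f outside outside)) (⊗-identityˡ (f outside outside)))

actAt-equal : ∀ (p : Adjacent m) (u : Laurent k n) f S {s} → at p S ≡ (s , s) → actAt p sides Rˢ u f S ≈ f S
actAt-equal here      u f (s ∷ .s ∷ S) refl = act-equal u (λ a b → f (a ∷ b ∷ S)) s
actAt-equal (there p) u f (s ∷ S)      eq   = actAt-equal p u (λ S → f (s ∷ S)) S eq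

actAt-ascent : ∀ (p : Adjacent m) (u : Laurent k n) f S → at p S ≡ (outside , inside) →
               actAt p sides Rˢ u f S ≈ u ⊗ f S
actAt-ascent here      u f (outside ∷ inside ∷ S) refl =
  ≈-trans (⊕-identityʳ (u ⊗ f (outside ∷ inside ∷ S) ⊕ 0ᴸ)) (⊕-identityʳ (u ⊗ f (outside ∷ inside ∷ S)))
actAt-ascent (there p) u f (s ∷ S)                eq   = actAt-ascent p u (λ S → f (s ∷ S)) S eq

actAt-descent : ∀ (p : Adjacent m) (u : Laurent k n) f S → at p S ≡ (inside , outside) →
                actAt p sides Rˢ u f S ≈ f S ⊕ (1ᴸ ⊖ u) ⊗ f (swap p S)
actAt-descent here      u f (inside ∷ outside ∷ S) refl = ⊕-cong
  (≈-trans (⊕-identityʳ (1ᴸ ⊗ f (inside ∷ outside ∷ S))) (⊗-identityˡ (f (inside ∷ outside ∷ S))))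
  (≈-trans (⊕-identityʳ ((1ᴸ ⊖ u) ⊗ f (outside ∷ inside ∷ S) ⊕ 0ᴸ)) (⊕-identityʳ ((1ᴸ ⊖ u) ⊗ f (outside ∷ inside ∷ S))))
actAt-descent (there p) u f (s ∷ S) eq = actAt-descent p u (λ S → f (s ∷ S)) S eq

-- Puzzles whose top side is the full rectangle

-- A line in state ∅ meets only pairs of tiles (E, E), (R₁, R₁) and (R₁, R₂). The last is excluded
-- because a boundary state is never RG, and the others change nothing and have weight 1.
cross-e₀ : ∀ (i j : Fin n) κ s α′ → cross i j e₀ κ (bSide s) α′ ≈ does (κ ≟ₑ bSide s) ⇒ does (e₀ ≟ₑ α′) ⇒ 1ᴸ
cross-e₀ i j e₀ inside  e₀ = ≈-refl
cross-e₀ i j e₀ inside  e₁ = ≈-refl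
cross-e₀ i j e₀ inside  e₂ = ≈-refl
cross-e₀ i j e₀ outside e₀ = ≈-refl
cross-e₀ i j e₀ outside e₁ = ≈-refl
cross-e₀ i j e₀ outside e₂ = ≈-refl
cross-e₀ i j e₁ inside  e₀ = ≈-refl
cross-e₀ i j e₁ inside  e₁ = ≈-refl
cross-e₀ i j e₁ inside  e₂ = ≈-refl
cross-e₀ i j e₁ outside e₀ = ≈-refl
cross-e₀ i j e₁ outside e₁ = ≈-refl
cross-e₀ i j e₁ outside e₂ = ≈-refl
cross-e₀ i j e₂ inside  e₀ = ≈-refl
cross-e₀ i j e₂ inside  e₁ = ≈-refl
cross-e₀ i j e₂ inside  e₂ = ≈-refl
cross-e₀ i j e₂ outside e₀ = ≈-refl
cross-e₀ i j e₂ outside e₁ = ≈-refl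
cross-e₀ i j e₂ outside e₂ = ≈-refl

_≟ᵥ_ : DecidableEquality (Vec Edge m)
_≟ᵥ_ = Vec.≡-dec _≟ₑ_

does-≟ᵥ-∷ : ∀ e e′ (v v′ : Vec Edge m) → does ((e ∷ v) ≟ᵥ (e′ ∷ v′)) ≡ does (e ≟ₑ e′) ∧ does (v ≟ᵥ v′)
does-≟ᵥ-∷ e e′ v v′ = does-⇔ (mk⇔ (λ eq → Vec.∷-injectiveˡ eq , Vec.∷-injectiveʳ eq) (λ (p , q) → cong₂ _∷_ p q))
  ((e ∷ v) ≟ᵥ (e′ ∷ v′)) (e ≟ₑ e′ ×-dec v ≟ᵥ v′)

∑-vecs-select : ∀ (v : Vec Edge m) (f : Vec Edge m → Laurent k n) →
                ∑ (vecs edges m) (λ w → does (w ≟ᵥ v) ⇒ f w) ≈ f v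
∑-vecs-select []      f = ⊕-identityʳ (f [])
∑-vecs-select {m = suc m} (e ∷ v) f = ≈-trans (∑-vecs edges m (λ w → does (w ≟ᵥ (e ∷ v)) ⇒ f w))
  (≈-trans (∑-cong edges λ e′ → ≈-trans (∑-cong (vecs edges m) λ w → ≈-trans
      (≈-reflexive (cong (_⇒ f (e′ ∷ w)) (does-≟ᵥ-∷ e′ e w v))) (∧-⇒ (does (e′ ≟ₑ e)) (does (w ≟ᵥ v)) (f (e′ ∷ w))))
      (≈-trans (≈-sym (⇒-∑ (does (e′ ≟ₑ e)) (vecs edges m) λ w → does (w ≟ᵥ v) ⇒ f (e′ ∷ w)))
        (⇒-cong (does (e′ ≟ₑ e)) (∑-vecs-select v λ w → f (e′ ∷ w)))))
    (∑-select′ e λ e′ → f (e′ ∷ v)))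

strip-e₀ : ∀ i (J : Vec (Fin n) m) κ l r →
           strip i J e₀ κ (Vec.map bSide l) r ≈ does (κ ≟ᵥ Vec.map bSide l) ⇒ does (e₀ ≟ₑ r) ⇒ 1ᴸ
strip-e₀ i []      []      []      r = ≈-refl
strip-e₀ i (j ∷ J) (κ ∷ κs) (s ∷ l) r = begin
  ∑ edges (λ α′ → cross i j e₀ κ (bSide s) α′ ⊗ strip i J α′ κs (Vec.map bSide l) r)
    ≈⟨ (∑-cong edges λ α′ → ≈-trans (⊗-congʳ (X α′) (cross-e₀ i j κ s α′))
         (≈-trans (⇒-⊗ˡ c (does (e₀ ≟ₑ α′) ⇒ 1ᴸ) (X α′)) (⇒-cong c
           (≈-trans (⇒-⊗ˡ (does (e₀ ≟ₑ α′)) 1ᴸ (X α′)) (⇒-cong (does (e₀ ≟ₑ α′)) (⊗-identityˡ (X α′))))))) ⟩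
  ∑ edges (λ α′ → c ⇒ does (e₀ ≟ₑ α′) ⇒ X α′)      ≈⟨ ⇒-∑ c edges (λ α′ → does (e₀ ≟ₑ α′) ⇒ X α′) ⟨
  c ⇒ ∑ edges (λ α′ → does (e₀ ≟ₑ α′) ⇒ X α′)      ≈⟨ ⇒-cong c (∑-select e₀ X) ⟩
  c ⇒ X e₀                                         ≈⟨ ⇒-cong c (strip-e₀ i J κs l r) ⟩
  c ⇒ does (κs ≟ᵥ Vec.map bSide l) ⇒ does (e₀ ≟ₑ r) ⇒ 1ᴸ
    ≈⟨ ∧-⇒ c (does (κs ≟ᵥ Vec.map bSide l)) (does (e₀ ≟ₑ r) ⇒ 1ᴸ) ⟨
  (c ∧ does (κs ≟ᵥ Vec.map bSide l)) ⇒ does (e₀ ≟ₑ r) ⇒ 1ᴸ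
    ≡⟨ cong (_⇒ does (e₀ ≟ₑ r) ⇒ 1ᴸ) (does-≟ᵥ-∷ κ (bSide s) κs (Vec.map bSide l)) ⟨
  does ((κ ∷ κs) ≟ᵥ Vec.map bSide (s ∷ l)) ⇒ does (e₀ ≟ₑ r) ⇒ 1ᴸ ∎
  where
  open ≈-Reasoning
  c : Bool
  c = does (κ ≟ₑ bSide s)
  X : Edge → Laurent 0 _
  X α′ = strip i J α′ κs (Vec.map bSide l) r

-- No tile △ has RG on its left edge and ∅ on its right edge, and RG is not a boundary state either.
strip-e₂ : ∀ i (J : Vec (Fin n) m) l s → strip i J e₂ (replicate m e₀) l (aSide s) ≈ 0ᴸ
strip-e₂ i []      []        inside  = ≈-refl
strip-e₂ i []      []        outside = ≈-refl
strip-e₂ i (j ∷ J) (e₀ ∷ l)  s = ≈-refl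
strip-e₂ i (j ∷ J) (e₁ ∷ l)  s = ≈-refl
strip-e₂ i (j ∷ J) (e₂ ∷ l)  s = ≈-refl

-- A line in state G meeting ∅ uses the tile G₁. Below it G₁ continues in state G; G₂ would continue
-- in state RG, which `strip-e₂` excludes.
strip-e₁ : ∀ i (J : Vec (Fin n) m) l s →
           strip i J e₁ (replicate m e₀) l (aSide s) ≈ does (l ≟ᵥ replicate m e₀) ⇒ s ⇒ 1ᴸ
strip-e₁ i []      []       inside  = ≈-refl
strip-e₁ i []      []       outside = ≈-refl
strip-e₁ {m = suc m} i (j ∷ J) (e₀ ∷ l) s = ≈-trans (⊕-identityʳ (1ᴸ ⊗ X)) (≈-trans (⊗-identityˡ X)
  (≈-trans (strip-e₁ i J l s) (≈-reflexive (cong (_⇒ s ⇒ 1ᴸ) (sym (does-≟ᵥ-∷ e₀ e₀ l (replicate m e₀)))))))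
  where
  X : Laurent 0 _
  X = strip i J e₁ (replicate m e₀) l (aSide s)
strip-e₁ {m = suc m} i (j ∷ J) (e₁ ∷ l) s = ≈-trans (⊕-identityʳ (1ᴸ ⊗ X)) (≈-trans (⊗-identityˡ X)
  (≈-trans (strip-e₂ i J l s) (≈-reflexive (cong (_⇒ s ⇒ 1ᴸ) (sym (does-≟ᵥ-∷ e₁ e₀ l (replicate m e₀)))))))
  where
  X : Laurent 0 _
  X = strip i J e₂ (replicate m e₀) l (aSide s)
strip-e₁ {m = suc m} i (j ∷ J) (e₂ ∷ l) s =
  ≈-reflexive (cong (_⇒ s ⇒ 1ᴸ) (sym (does-≟ᵥ-∷ e₂ e₀ l (replicate m e₀))))

_≟ᵇ_ : DecidableEquality (Subset m)
_≟ᵇ_ = Vec.≡-dec Bool._≟_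

does-≟ᵇ-∷ : ∀ e e′ (v v′ : Subset m) → does ((e ∷ v) ≟ᵇ (e′ ∷ v′)) ≡ does (e Bool.≟ e′) ∧ does (v ≟ᵇ v′)
does-≟ᵇ-∷ e e′ v v′ = does-⇔ (mk⇔ (λ eq → Vec.∷-injectiveˡ eq , Vec.∷-injectiveʳ eq) (λ (p , q) → cong₂ _∷_ p q))
  ((e ∷ v) ≟ᵇ (e′ ∷ v′)) (e Bool.≟ e′ ×-dec v ≟ᵇ v′)

lines-inside : ∀ (I : Vec (Fin n) m) l μ → lines I l (Vec.map aSide μ) (replicate m inside) ≈
               does (l ≟ᵥ replicate m e₀) ⇒ does (μ ≟ᵇ replicate m inside) ⇒ 1ᴸ
lines-inside []      []       []      = ≈-refl
lines-inside {n = n} {m = suc m} (i ∷ I) (l₀ ∷ l) (s ∷ μ) = first l₀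
  where
  open ≈-Reasoning
  δ : Laurent 0 n
  δ = does (μ ≟ᵇ replicate m inside) ⇒ 1ᴸ
  rest : Edge → Laurent 0 n
  rest α = ∑ (vecs edges m) λ κ → strip i I α κ l (aSide s) ⊗ lines I κ (Vec.map aSide μ) (replicate m inside)
  rest-δ : ∀ α → rest α ≈ strip i I α (replicate m e₀) l (aSide s) ⊗ δ
  rest-δ α = ≈-trans (∑-cong (vecs edges m) λ κ → ≈-trans
      (⊗-congˡ (strip i I α κ l (aSide s)) (lines-inside I κ μ))
      (⇒-⊗ʳ (does (κ ≟ᵥ replicate m e₀)) (strip i I α κ l (aSide s)) δ))
    (∑-vecs-select (replicate m e₀) λ κ → strip i I α κ l (aSide s) ⊗ δ)
  goal : Edge → Laurent 0 n
  goal e = does ((e ∷ l) ≟ᵥ (e₀ ∷ replicate m e₀)) ⇒ does ((s ∷ μ) ≟ᵇ (inside ∷ replicate m inside)) ⇒ 1ᴸ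
  goal-≡ : ∀ e → (does (e ≟ₑ e₀) ∧ does (l ≟ᵥ replicate m e₀)) ⇒ (does (s Bool.≟ inside) ∧ does (μ ≟ᵇ replicate m inside)) ⇒ 1ᴸ ≡ goal e
  goal-≡ e = sym (cong₂ (λ c c′ → c ⇒ c′ ⇒ 1ᴸ) (does-≟ᵥ-∷ e e₀ l (replicate m e₀)) (does-≟ᵇ-∷ s inside μ (replicate m inside)))
  merge : ∀ s → (s ⇒ 1ᴸ) ⊗ δ ≈ (does (s Bool.≟ inside) ∧ does (μ ≟ᵇ replicate m inside)) ⇒ 1ᴸ
  merge true  = ⊗-identityˡ δ
  merge false = ≈-refl
  first : ∀ e → lines (i ∷ I) (e ∷ l) (Vec.map aSide (s ∷ μ)) (replicate (suc m) inside) ≈ goal e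
  first e₀ = begin
    rest e₁ ⊕ 0ᴸ                                         ≈⟨ ⊕-identityʳ (rest e₁) ⟩
    rest e₁                                              ≈⟨ rest-δ e₁ ⟩
    strip i I e₁ (replicate m e₀) l (aSide s) ⊗ δ        ≈⟨ ⊗-congʳ δ (strip-e₁ i I l s) ⟩
    (does (l ≟ᵥ replicate m e₀) ⇒ s ⇒ 1ᴸ) ⊗ δ            ≈⟨ ⇒-⊗ˡ (does (l ≟ᵥ replicate m e₀)) (s ⇒ 1ᴸ) δ ⟩
    does (l ≟ᵥ replicate m e₀) ⇒ (s ⇒ 1ᴸ) ⊗ δ            ≈⟨ ⇒-cong (does (l ≟ᵥ replicate m e₀)) (merge s) ⟩
    does (l ≟ᵥ replicate m e₀) ⇒ (does (s Bool.≟ inside) ∧ does (μ ≟ᵇ replicate m inside)) ⇒ 1ᴸ ≡⟨ goal-≡ e₀ ⟩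
    goal e₀ ∎
  first e₁ = begin
    rest e₂ ⊕ 0ᴸ                                         ≈⟨ ⊕-identityʳ (rest e₂) ⟩
    rest e₂                                              ≈⟨ rest-δ e₂ ⟩
    strip i I e₂ (replicate m e₀) l (aSide s) ⊗ δ        ≈⟨ ⊗-congʳ δ (strip-e₂ i I l s) ⟩
    0ᴸ ⊗ δ                                               ≡⟨ goal-≡ e₁ ⟩
    goal e₁ ∎
  first e₂ = ≈-reflexive (goal-≡ e₂)

does-bSide : ∀ (S : Subset m) → does (Vec.map bSide S ≟ᵥ replicate m e₀) ≡ does (S ≟ᵇ replicate m inside)
does-bSide []            = refl
does-bSide {suc m} (inside  ∷ S) = trans (does-≟ᵥ-∷ e₀ e₀ (Vec.map bSide S) (replicate m e₀))
  (trans (does-bSide S) (sym (does-≟ᵇ-∷ inside inside S (replicate m inside))))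
does-bSide {suc m} (outside ∷ S) = trans (does-≟ᵥ-∷ e₁ e₀ (Vec.map bSide S) (replicate m e₀))
  (sym (does-≟ᵇ-∷ outside inside S (replicate m inside)))

-- The letters outside at the beginning start lines in state ∅, which pass everything unchanged;
-- after them only letters inside remain. So there is a single puzzle, of weight 1, and only when
-- both other sides are also `top`.
lines-top : ∀ ℓ (I : Vec (Fin n) (ℓ ℕ.+ k)) λ′ μ → lines I (Vec.map bSide λ′) (Vec.map aSide μ) (top ℓ k) ≈
            does (λ′ ≟ᵇ top ℓ k) ⇒ does (μ ≟ᵇ top ℓ k) ⇒ 1ᴸ
lines-top {k = k} zero I λ′ μ = ≈-trans (lines-inside I (Vec.map bSide λ′) μ)
  (≈-reflexive (cong (_⇒ does (μ ≟ᵇ replicate k inside) ⇒ 1ᴸ) (does-bSide λ′)))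
lines-top {k = k} (suc ℓ) (i ∷ I) (inside  ∷ λ′) (t ∷ μ) =
  ≈-reflexive (cong (_⇒ does ((t ∷ μ) ≟ᵇ top (suc ℓ) k) ⇒ 1ᴸ) (sym (does-≟ᵇ-∷ inside outside λ′ (top ℓ k))))
lines-top {n = n} {k = k} (suc ℓ) (i ∷ I) (outside ∷ λ′) (t ∷ μ) = begin
  ∑ vs (λ κ → strip i I e₀ κ (Vec.map bSide λ′) (aSide t) ⊗ Z κ) ⊕ 0ᴸ
    ≈⟨ ⊕-identityʳ (∑ vs (λ κ → strip i I e₀ κ (Vec.map bSide λ′) (aSide t) ⊗ Z κ)) ⟩
  ∑ vs (λ κ → strip i I e₀ κ (Vec.map bSide λ′) (aSide t) ⊗ Z κ)
    ≈⟨ (∑-cong vs λ κ → ≈-trans (⊗-congʳ (Z κ) (strip-e₀ i I κ λ′ (aSide t)))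
         (⇒-⊗ˡ (does (κ ≟ᵥ Vec.map bSide λ′)) δ (Z κ))) ⟩
  ∑ vs (λ κ → does (κ ≟ᵥ Vec.map bSide λ′) ⇒ δ ⊗ Z κ)   ≈⟨ ∑-vecs-select (Vec.map bSide λ′) (λ κ → δ ⊗ Z κ) ⟩
  δ ⊗ Z (Vec.map bSide λ′)                              ≈⟨ ⊗-congˡ δ (lines-top ℓ I λ′ μ) ⟩
  δ ⊗ (cλ ⇒ cμ ⇒ 1ᴸ)                                    ≈⟨ ⇒-⊗ʳ cλ δ (cμ ⇒ 1ᴸ) ⟩
  cλ ⇒ δ ⊗ (cμ ⇒ 1ᴸ)                                    ≈⟨ ⇒-cong cλ (merge t) ⟩
  cλ ⇒ (does (t Bool.≟ outside) ∧ cμ) ⇒ 1ᴸ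
    ≡⟨ cong₂ (λ c c′ → c ⇒ c′ ⇒ 1ᴸ) (does-≟ᵇ-∷ outside outside λ′ (top ℓ k)) (does-≟ᵇ-∷ t outside μ (top ℓ k)) ⟨
  does ((outside ∷ λ′) ≟ᵇ top (suc ℓ) k) ⇒ does ((t ∷ μ) ≟ᵇ top (suc ℓ) k) ⇒ 1ᴸ ∎
  where
  open ≈-Reasoning
  vs = vecs edges (ℓ ℕ.+ k)
  Z : Vec Edge (ℓ ℕ.+ k) → Laurent 0 n
  Z κ = lines I κ (Vec.map aSide μ) (top ℓ k)
  δ : Laurent 0 n
  δ = does (e₀ ≟ₑ aSide t) ⇒ 1ᴸ
  cλ cμ : Bool
  cλ = does (λ′ ≟ᵇ top ℓ k)
  cμ = does (μ ≟ᵇ top ℓ k)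
  merge : ∀ t → (does (e₀ ≟ₑ aSide t) ⇒ 1ᴸ) ⊗ (cμ ⇒ 1ᴸ) ≈ (does (t Bool.≟ outside) ∧ cμ) ⇒ 1ᴸ
  merge true  = ≈-refl
  merge false = ⊗-identityˡ (cμ ⇒ 1ᴸ)

-- Localised expansions

subsets : ∀ n → List (Subset n)
subsets = vecs sides

∑-subsets-single : ∀ (S : Subset m) (f : Subset m → Laurent k n) → (∀ T → T ≢ S → f T ≈ 0ᴸ) →
                   ∑ (subsets m) f ≈ f S
∑-subsets-single []      f eq = ⊕-identityʳ (f [])
∑-subsets-single {m = suc m} (s ∷ S) f eq = ≈-trans (∑-vecs sides m f) (split s S eq)
  where
  split : ∀ s S → (∀ T → T ≢ s ∷ S → f T ≈ 0ᴸ) → ∑ sides (λ t → ∑ (subsets m) λ T → f (t ∷ T)) ≈ f (s ∷ S)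
  split inside S eq = ≈-trans (⊕-cong (∑-subsets-single S (λ T → f (inside ∷ T)) λ T T≢S → eq (inside ∷ T) (T≢S ∘ Vec.∷-injectiveʳ))
      (≈-trans (⊕-identityʳ (∑ (subsets m) λ T → f (outside ∷ T))) (∑-zero (subsets m) λ T → eq (outside ∷ T) λ ())))
    (⊕-identityʳ (f (inside ∷ S)))
  split outside S eq = ⊕-cong (∑-zero (subsets m) λ T → eq (inside ∷ T) λ ())
    (≈-trans (⊕-identityʳ (∑ (subsets m) λ T → f (outside ∷ T)))
      (∑-subsets-single S (λ T → f (outside ∷ T)) λ T T≢S → eq (outside ∷ T) (T≢S ∘ Vec.∷-injectiveʳ)))

⇒-cong-does : ∀ {P : Set} (d : Dec P) {f g : Laurent k n} → (P → f ≈ g) → does d ⇒ f ≈ does d ⇒ g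
⇒-cong-does (yes p) eq = eq p
⇒-cong-does (no _)  eq = ≈-refl

≈-does : ∀ {P : Set} (d : Dec P) {f : Laurent k n} → (P → f ≈ 1ᴸ) → (¬ P → f ≈ 0ᴸ) → f ≈ does d ⇒ 1ᴸ
≈-does (yes p) eq eq′ = eq p
≈-does (no ¬p) eq eq′ = eq′ ¬p

⇒-⊕ : ∀ c (f g : Laurent k n) → (c ⇒ f) ⊕ (c ⇒ g) ≈ c ⇒ f ⊕ g
⇒-⊕ true  f g = ≈-refl
⇒-⊕ false f g = ≈-refl

⊕-cancelʳ : ∀ {f g h h′ : Laurent k n} → h ≈ h′ → f ⊕ h ≈ g ⊕ h′ → f ≈ g
⊕-cancelʳ {f = f} {g} {h} {h′} h≈h′ eq = ≈-trans (solve 2 (λ f h → f := f :+ h :- h) ≈-refl f h)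
  (≈-trans (⊖-cong eq h≈h′) (solve 2 (λ g h → g :+ h :- h := g) ≈-refl g h′))

ratio-nonZeroDivisor : ∀ (p : Adjacent n) → NonZeroDivisor {k} (ratio p)
ratio-nonZeroDivisor p = nonZeroDivisor λ {f} eq → begin
  f                                        ≈⟨ ≈-trans (⊗-congʳ f (⊗-identityˡ 1ᴸ)) (⊗-identityˡ f) ⟨
  1ᴸ ⊗ 1ᴸ ⊗ f                              ≈⟨ ⊗-congʳ f (⊗-cong (y⊗y⁻¹ (high p)) (y⊗y⁻¹ (low p))) ⟨
  y (high p) ⊗ y⁻¹ (high p) ⊗ (y (low p) ⊗ y⁻¹ (low p)) ⊗ f
    ≈⟨ solve 5 (λ h h⁻¹ l l⁻¹ f → h :* h⁻¹ :* (l :* l⁻¹) :* f := h⁻¹ :* l :* (h :* l⁻¹ :* f)) ≈-refl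
         (y (high p)) (y⁻¹ (high p)) (y (low p)) (y⁻¹ (low p)) f ⟩
  y⁻¹ (high p) ⊗ y (low p) ⊗ (ratio p ⊗ f) ≈⟨ ⊗-congˡ (y⁻¹ (high p) ⊗ y (low p)) eq ⟩
  y⁻¹ (high p) ⊗ y (low p) ⊗ 0ᴸ            ≈⟨ ⊗-zeroʳ (y⁻¹ (high p) ⊗ y (low p)) ⟩
  0ᴸ                                       ∎
  where
  open ≈-Reasoning

-- On each exchanged pair `Rˢ` is triangular: the ascent is multiplied by the unit `ratio p`, and
-- the descent has diagonal entry 1 once the ascent is known.
actAt-injective : ∀ (p : Adjacent n) (f g : Subset n → Laurent k n) →
  (∀ S → ∣ S ∣ ≡ m → actAt p sides Rˢ (ratio p) f S ≈ actAt p sides Rˢ (ratio p) g S) →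
  ∀ S → ∣ S ∣ ≡ m → f S ≈ g S
actAt-injective p f g eq S ∣S∣≡m = cases (at p S) refl
  where
  ascent : ∀ S → ∣ S ∣ ≡ _ → at p S ≡ (outside , inside) → f S ≈ g S
  ascent S ∣S∣≡m at-S = cancelˡ (ratio-nonZeroDivisor p)
    (≈-trans (≈-sym (actAt-ascent p (ratio p) f S at-S)) (≈-trans (eq S ∣S∣≡m) (actAt-ascent p (ratio p) g S at-S)))
  equal : ∀ s → at p S ≡ (s , s) → f S ≈ g S
  equal s at-S = ≈-trans (≈-sym (actAt-equal p (ratio p) f S at-S)) (≈-trans (eq S ∣S∣≡m) (actAt-equal p (ratio p) g S at-S))
  cases : ∀ st → at p S ≡ st → f S ≈ g S
  cases (inside  , inside)  at-S = equal inside at-S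
  cases (outside , outside) at-S = equal outside at-S
  cases (outside , inside)  at-S = ascent S ∣S∣≡m at-S
  cases (inside  , outside) at-S = ⊕-cancelʳ
    (⊗-congˡ (1ᴸ ⊖ ratio p) (ascent (swap p S) (trans (∣swap∣ p S) ∣S∣≡m) (trans (at-swap p S) (cong Product.swap at-S))))
    (≈-trans (≈-sym (actAt-descent p (ratio p) f S at-S)) (≈-trans (eq S ∣S∣≡m) (actAt-descent p (ratio p) g S at-S)))

module _ {ℓ k : ℕ} where

  -- Extended by zero to subsets of other sizes, so that `actAt` applies; this is consistent because
  -- `swap` preserves the size.
  point : Vec (Fin (ℓ ℕ.+ k)) k → Subset (ℓ ℕ.+ k) → Laurent 0 (ℓ ℕ.+ k)
  point I S = does (∣ S ∣ ℕ.≟ k) ⇒ localise I S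

  point-size : ∀ I S → ∣ S ∣ ≡ k → point I S ≈ localise I S
  point-size I S ∣S∣≡k = ≈-reflexive (cong (_⇒ localise I S) (dec-true (∣ S ∣ ℕ.≟ k) ∣S∣≡k))

  -- The localised forms of the three cases of the exchange relation, put together as one matrix.
  s-point : ∀ p I S → s p (point (Vec.map (σ p) I) S) ≈ actAt p sides Rˢ (ratio p) (point I) S
  s-point p I S = ≈-trans (hom-⇒ (s-hom p) c (localise (Vec.map (σ p) I) S)) (cases (at p S) refl)
    where
    c = does (∣ S ∣ ℕ.≟ k)
    cases : ∀ st → at p S ≡ st → c ⇒ s p (localise (Vec.map (σ p) I) S) ≈ actAt p sides Rˢ (ratio p) (point I) S
    equal : ∀ s′ → at p S ≡ (s′ , s′) → c ⇒ s p (localise (Vec.map (σ p) I) S) ≈ actAt p sides Rˢ (ratio p) (point I) S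
    equal s′ at-S = ≈-trans (⇒-cong-does (∣ S ∣ ℕ.≟ k) λ ∣S∣≡k → localise-equal {ℓ} S ∣S∣≡k I p at-S)
      (≈-sym (actAt-equal p (ratio p) (point I) S at-S))
    cases (inside  , inside)  at-S = equal inside at-S
    cases (outside , outside) at-S = equal outside at-S
    cases (outside , inside)  at-S = ≈-trans (⇒-cong-does (∣ S ∣ ℕ.≟ k) λ ∣S∣≡k → localise-ascent {ℓ} S ∣S∣≡k I p at-S)
      (≈-trans (≈-sym (⇒-⊗ʳ c (ratio p) (localise I S))) (≈-sym (actAt-ascent p (ratio p) (point I) S at-S)))
    cases (inside  , outside) at-S = ≈-trans (⇒-cong-does (∣ S ∣ ℕ.≟ k) λ ∣S∣≡k → localise-descent {ℓ} S ∣S∣≡k I p at-S)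
      (≈-trans (≈-sym (⇒-⊕ c (localise I S) ((1ᴸ ⊖ ratio p) ⊗ localise I (swap p S))))
      (≈-trans (⊕-congˡ (point I S) (≈-trans (≈-sym (⇒-⊗ʳ c (1ᴸ ⊖ ratio p) (localise I (swap p S))))
          (≈-reflexive (cong (λ m → (1ᴸ ⊖ ratio p) ⊗ (does (m ℕ.≟ k) ⇒ localise I (swap p S))) (sym (∣swap∣ p S))))))
        (≈-sym (actAt-descent p (ratio p) (point I) S at-S))))

  Expansion : Vec (Fin (ℓ ℕ.+ k)) k → Set
  Expansion I = ∀ λ′ μ → ∣ λ′ ∣ ≡ k → ∣ μ ∣ ≡ k →
    point I λ′ ⊗ point I μ ≈ ∑ (subsets (ℓ ℕ.+ k)) (λ ν → puzzles-sum λ′ μ ν ⊗ point I ν)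

  point-top : ∀ I → Selects (Vec.allFin (ℓ ℕ.+ k)) (top ℓ k) I →
              ∀ S → ∣ S ∣ ≡ k → point I S ≈ does (S ≟ᵇ top ℓ k) ⇒ 1ᴸ
  point-top I selects S ∣S∣≡k = ≈-trans (point-size I S ∣S∣≡k) (≈-does (S ≟ᵇ top ℓ k)
    (λ { refl → localise-top {ℓ} I selects }) (localise-not-top {ℓ} I selects S ∣S∣≡k))

  -- Only the polynomial of the full rectangle is nonzero at this point, with value 1, so the right
  -- side reduces to the puzzle sum computed in `lines-top`.
  expansion-top : ∀ I → Selects (Vec.allFin (ℓ ℕ.+ k)) (top ℓ k) I → Expansion I
  expansion-top I selects λ′ μ ∣λ∣≡k ∣μ∣≡k = begin
    point I λ′ ⊗ point I μ
      ≈⟨ ⊗-cong (point-top I selects λ′ ∣λ∣≡k) (point-top I selects μ ∣μ∣≡k) ⟩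
    (cλ ⇒ 1ᴸ) ⊗ (cμ ⇒ 1ᴸ)
      ≈⟨ ≈-trans (⇒-⊗ˡ cλ 1ᴸ (cμ ⇒ 1ᴸ)) (⇒-cong cλ (⊗-identityˡ (cμ ⇒ 1ᴸ))) ⟩
    cλ ⇒ cμ ⇒ 1ᴸ                      ≈⟨ lines-top ℓ (Vec.allFin (ℓ ℕ.+ k)) λ′ μ ⟨
    puzzles-sum λ′ μ (top ℓ k)        ≈⟨ ⊗-identityʳ (puzzles-sum λ′ μ (top ℓ k)) ⟨
    puzzles-sum λ′ μ (top ℓ k) ⊗ 1ᴸ
      ≈⟨ ⊗-congˡ (puzzles-sum λ′ μ (top ℓ k)) (≈-trans (point-size I (top ℓ k) (∣top∣ ℓ k)) (localise-top {ℓ} I selects)) ⟨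
    puzzles-sum λ′ μ (top ℓ k) ⊗ point I (top ℓ k)
      ≈⟨ ∑-subsets-single (top ℓ k) (λ ν → puzzles-sum λ′ μ ν ⊗ point I ν) (λ ν ν≢top →
           ≈-trans (⊗-congˡ (puzzles-sum λ′ μ ν) (≈-trans
             (⇒-cong-does (∣ ν ∣ ℕ.≟ k) λ ∣ν∣≡k → localise-not-top {ℓ} I selects ν ∣ν∣≡k ν≢top)
             (≈-reflexive (Bool.if-eta (does (∣ ν ∣ ℕ.≟ k)))))) (⊗-zeroʳ (puzzles-sum λ′ μ ν))) ⟨
    ∑ (subsets (ℓ ℕ.+ k)) (λ ν → puzzles-sum λ′ μ ν ⊗ point I ν) ∎
    where
    open ≈-Reasoning
    cλ cμ : Bool
    cλ = does (λ′ ≟ᵇ top ℓ k)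
    cμ = does (μ ≟ᵇ top ℓ k)

  -- Both sides are transformed by the same pair of R-matrices, which are invertible.
  expansion-step : ∀ p I → Expansion (Vec.map (σ p) I) → Expansion I
  expansion-step p I expansion λ′ μ ∣λ∣≡k ∣μ∣≡k =
    actAt-injective p (λ μ → v λ′ ⊗ v μ) (λ μ → sum λ′ μ) (λ μ ∣μ∣≡k →
      actAt-injective p (λ λ′ → act′ (λ μ → v λ′ ⊗ v μ) μ) (λ λ′ → act′ (λ μ → sum λ′ μ) μ) (λ λ′ ∣λ∣≡k → both λ′ μ ∣λ∣≡k ∣μ∣≡k)
        λ′ ∣λ∣≡k) μ ∣μ∣≡k
    where
    open ≈-Reasoning
    v w : Subset (ℓ ℕ.+ k) → Laurent 0 (ℓ ℕ.+ k)
    v = point I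
    w = point (Vec.map (σ p) I)
    νs = subsets (ℓ ℕ.+ k)
    act′ : (Subset (ℓ ℕ.+ k) → Laurent 0 (ℓ ℕ.+ k)) → Subset (ℓ ℕ.+ k) → Laurent 0 (ℓ ℕ.+ k)
    act′ = actAt p sides Rˢ (ratio p)
    sum : Subset (ℓ ℕ.+ k) → Subset (ℓ ℕ.+ k) → Laurent 0 (ℓ ℕ.+ k)
    sum λ′ μ = ∑ νs λ ν → puzzles-sum λ′ μ ν ⊗ v ν
    linear′ : ∀ S → Linear (λ f → act′ f S)
    linear′ = actAt-linear p sides Rˢ (ratio p)
    both : ∀ λ′ μ → ∣ λ′ ∣ ≡ k → ∣ μ ∣ ≡ k →
           act′ (λ λ′ → act′ (λ μ → v λ′ ⊗ v μ) μ) λ′ ≈ act′ (λ λ′ → act′ (λ μ → sum λ′ μ) μ) λ′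
    both λ′ μ ∣λ∣≡k ∣μ∣≡k = begin
      act′ (λ λ′ → act′ (λ μ → v λ′ ⊗ v μ) μ) λ′
        ≈⟨ (T-cong (linear′ λ′) λ λ′ → T-⊗ˡ (linear′ μ) (v λ′) v) ⟩
      act′ (λ λ′ → v λ′ ⊗ act′ v μ) λ′      ≈⟨ T-⊗ʳ (linear′ λ′) v (act′ v μ) ⟩
      act′ v λ′ ⊗ act′ v μ                  ≈⟨ ⊗-cong (s-point p I λ′) (s-point p I μ) ⟨
      s p (w λ′) ⊗ s p (w μ)                ≈⟨ hom-⊗ (s-hom p) (w λ′) (w μ) ⟨
      s p (w λ′ ⊗ w μ)                      ≈⟨ hom-cong (s-hom p) (expansion λ′ μ ∣λ∣≡k ∣μ∣≡k) ⟩
      s p (∑ νs λ ν → puzzles-sum λ′ μ ν ⊗ w ν)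
        ≈⟨ hom-∑ (s-hom p) νs (λ ν → puzzles-sum λ′ μ ν ⊗ w ν) ⟩
      ∑ νs (λ ν → s p (puzzles-sum λ′ μ ν ⊗ w ν))
        ≈⟨ (∑-cong νs λ ν → ≈-trans (hom-⊗ (s-hom p) (puzzles-sum λ′ μ ν) (w ν))
             (⊗-congˡ (s p (puzzles-sum λ′ μ ν)) (s-point p I ν))) ⟩
      -- Transposition moves the R-matrix from the values onto the coefficients, where it becomes
      -- one R-matrix for λ and one for μ.
      ∑ νs (λ ν → s p (puzzles-sum λ′ μ ν) ⊗ act′ v ν)
        ≈⟨ actAt-transpose p sides Rˢ (ratio p) v (λ ν → s p (puzzles-sum λ′ μ ν)) ⟩
      ∑ νs (λ ν → actAt p sides (Rˢ ᵀ) (ratio p) (λ ν → s p (puzzles-sum λ′ μ ν)) ν ⊗ v ν)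
        ≈⟨ (∑-cong νs λ ν → ⊗-congʳ (v ν) (puzzles-exchange p λ′ μ ν)) ⟩
      ∑ νs (λ ν → act′ (λ λ′ → act′ (λ μ → puzzles-sum λ′ μ ν) μ) λ′ ⊗ v ν)
        ≈⟨ (∑-cong νs λ ν → T-⊗ʳ (linear′ λ′) (λ λ′ → act′ (λ μ → puzzles-sum λ′ μ ν) μ) (v ν)) ⟨
      ∑ νs (λ ν → act′ (λ λ′ → act′ (λ μ → puzzles-sum λ′ μ ν) μ ⊗ v ν) λ′)
        ≈⟨ T-∑ (linear′ λ′) νs (λ ν λ′ → act′ (λ μ → puzzles-sum λ′ μ ν) μ ⊗ v ν) ⟨
      act′ (λ λ′ → ∑ νs λ ν → act′ (λ μ → puzzles-sum λ′ μ ν) μ ⊗ v ν) λ′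
        ≈⟨ (T-cong (linear′ λ′) λ λ′ → ≈-trans
             (∑-cong νs λ ν → ≈-sym (T-⊗ʳ (linear′ μ) (λ μ → puzzles-sum λ′ μ ν) (v ν)))
             (≈-sym (T-∑ (linear′ μ) νs (λ ν μ → puzzles-sum λ′ μ ν ⊗ v ν)))) ⟩
      act′ (λ λ′ → act′ (λ μ → sum λ′ μ) μ) λ′ ∎

  -- The fixed point is moved upwards at a descent of T until it is that of the full rectangle;
  -- `coheight` measures the distance.
  expansion : ∀ N T → ∣ T ∣ ≡ k → coheight T ℕ.< N → ∀ I → Selects (Vec.allFin (ℓ ℕ.+ k)) T I → Expansion I
  expansion (suc N) T ∣T∣≡k (s≤s lt) I selects with top-or-descent ℓ T ∣T∣≡k
  ... | inj₁ refl          = expansion-top I selects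
  ... | inj₂ (p , descent) = expansion-step p I (expansion N (swap p T) (trans (∣swap∣ p T) ∣T∣≡k)
    (ℕ.<-≤-trans (coheight-swap p T descent) lt) (Vec.map (σ p) I) (Selects-σ p distinct selects))
    where
    distinct : proj₁ (at p T) ≢ proj₂ (at p T)
    distinct eq with trans (sym (cong proj₁ descent)) (trans eq (cong proj₂ descent))
    ... | ()

-- Sums over frames as sums over subsets

-- The decision is a separate argument so that decisions of different but equivalent statements, as
-- in ∣ S ∣ ≡ k and suc ∣ S ∣ ≡ suc k, can be compared by cases.
extend : (Frame k n → Laurent k′ n′) → ∀ S → Dec (∣ S ∣ ≡ k) → Laurent k′ n′
extend f S (yes eq) = f (frame S eq)
extend f S (no _)   = 0ᴸ

extend-yes : ∀ (f : Frame k n → Laurent k′ n′) S d eq → extend f S d ≡ f (frame S eq)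
extend-yes f S (yes eq′) eq = cong (f ∘ frame S) (ℕ.≡-irrelevant eq′ eq)
extend-yes f S (no neq)  eq = ⊥-elim (neq eq)

extend-no : ∀ (f : Frame k n → Laurent k′ n′) S d → ∣ S ∣ ≢ k → extend f S d ≡ 0ᴸ
extend-no f S (yes eq) neq = ⊥-elim (neq eq)
extend-no f S (no _)   neq = refl

ext : (Frame k n → Laurent k′ n′) → Subset n → Laurent k′ n′
ext {k = k} f S = extend f S (∣ S ∣ ℕ.≟ k)

∑-frames : ∀ k n (f : Frame k n → Laurent k′ n′) → ∑ (frames k n) f ≈ ∑ (subsets n) (ext f)
∑-frames zero    zero    f = ≈-reflexive (cong (_⊕ 0ᴸ) (sym (extend-yes f [] (0 ℕ.≟ 0) refl)))
∑-frames (suc k) zero    f = ≈-reflexive (cong (_⊕ 0ᴸ) (sym (extend-no f [] (0 ℕ.≟ suc k) λ ())))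
∑-frames zero    (suc n) f = begin
  ∑ (List.map out (frames zero n)) f     ≈⟨ ∑-map out (frames zero n) f ⟩
  ∑ (frames zero n) (f ∘ out)            ≈⟨ ∑-frames zero n (f ∘ out) ⟩
  ∑ (subsets n) (ext (f ∘ out))          ≈⟨ ⊕-identityʳ (∑ (subsets n) (ext (f ∘ out))) ⟨
  ∑ (subsets n) (ext (f ∘ out)) ⊕ 0ᴸ
    ≈⟨ ⊕-cong (∑-zero (subsets n) λ S → ≈-reflexive (extend-no f (inside ∷ S) (suc ∣ S ∣ ℕ.≟ 0) λ ()))
         (⊕-congʳ 0ᴸ (∑-cong (subsets n) λ S → ≈-reflexive (outside-≡ S (∣ S ∣ ℕ.≟ 0)))) ⟨
  ∑ (subsets n) (λ S → ext f (inside ∷ S)) ⊕ (∑ (subsets n) (λ S → ext f (outside ∷ S)) ⊕ 0ᴸ)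
    ≈⟨ ∑-vecs sides n (ext f) ⟨
  ∑ (subsets (suc n)) (ext f)            ∎
  where
  open ≈-Reasoning
  out : Frame zero n → Frame zero (suc n)
  out (frame S p) = frame (outside ∷ S) p
  outside-≡ : ∀ S (d : Dec (∣ S ∣ ≡ 0)) → extend f (outside ∷ S) d ≡ extend (f ∘ out) S d
  outside-≡ S (yes _) = refl
  outside-≡ S (no _)  = refl
∑-frames (suc k) (suc n) f = begin
  ∑ (List.map in′ (frames k n) ++ List.map out (frames (suc k) n)) f
    ≈⟨ ∑-++ (List.map in′ (frames k n)) (List.map out (frames (suc k) n)) f ⟩
  ∑ (List.map in′ (frames k n)) f ⊕ ∑ (List.map out (frames (suc k) n)) f
    ≈⟨ ⊕-cong (≈-trans (∑-map in′ (frames k n) f) (∑-frames k n (f ∘ in′)))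
         (≈-trans (∑-map out (frames (suc k) n) f) (∑-frames (suc k) n (f ∘ out))) ⟩
  ∑ (subsets n) (ext (f ∘ in′)) ⊕ ∑ (subsets n) (ext (f ∘ out))
    ≈⟨ ⊕-cong (∑-cong (subsets n) λ S → ≈-reflexive (inside-≡ S (suc ∣ S ∣ ℕ.≟ suc k) (∣ S ∣ ℕ.≟ k)))
         (≈-trans (⊕-identityʳ (∑ (subsets n) λ S → ext f (outside ∷ S)))
           (∑-cong (subsets n) λ S → ≈-reflexive (outside-≡ S (∣ S ∣ ℕ.≟ suc k)))) ⟨
  ∑ (subsets n) (λ S → ext f (inside ∷ S)) ⊕ (∑ (subsets n) (λ S → ext f (outside ∷ S)) ⊕ 0ᴸ)
    ≈⟨ ∑-vecs sides n (ext f) ⟨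
  ∑ (subsets (suc n)) (ext f)            ∎
  where
  open ≈-Reasoning
  in′ : Frame k n → Frame (suc k) (suc n)
  in′ (frame S p) = frame (inside ∷ S) (cong suc p)
  out : Frame (suc k) n → Frame (suc k) (suc n)
  out (frame S p) = frame (outside ∷ S) p
  inside-≡ : ∀ S (d : Dec (suc ∣ S ∣ ≡ suc k)) (d′ : Dec (∣ S ∣ ≡ k)) → extend f (inside ∷ S) d ≡ extend (f ∘ in′) S d′
  inside-≡ S d (yes eq) = extend-yes f (inside ∷ S) d (cong suc eq)
  inside-≡ S d (no neq) = extend-no f (inside ∷ S) d (neq ∘ ℕ.suc-injective)
  outside-≡ : ∀ S (d : Dec (∣ S ∣ ≡ suc k)) → extend f (outside ∷ S) d ≡ extend (f ∘ out) S d
  outside-≡ S (yes _) = refl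
  outside-≡ S (no _)  = refl

-- Increasing sequences as selections

Increasing : Vec (Fin n) k → Set
Increasing = AllPairs Fin._<_

Selects-All : ∀ {P : A → Set} {zs : Vec A m} {S} {I : Vec A k} → Selects zs S I → VecAll.All P zs → VecAll.All P I
Selects-All []       []       = []
Selects-All (take i) (p ∷ ps) = p ∷ Selects-All i ps
Selects-All (skip i) (p ∷ ps) = Selects-All i ps

Selects-AllPairs : ∀ {_∼_ : A → A → Set} {zs : Vec A m} {S} {I : Vec A k} → Selects zs S I →
                   AllPairs _∼_ zs → AllPairs _∼_ I
Selects-AllPairs []       []       = []
Selects-AllPairs (take i) (p ∷ ps) = Selects-All i p ∷ Selects-AllPairs i ps
Selects-AllPairs (skip i) (p ∷ ps) = Selects-AllPairs i ps

allFin-suc : ∀ n → Vec.allFin (suc n) ≡ zero ∷ Vec.map suc (Vec.allFin n)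
allFin-suc n = cong (zero ∷_) (Vec.tabulate-∘ suc id)

zero<suc : ∀ (zs : Vec (Fin n) m) → VecAll.All (Fin.zero {n} Fin.<_) (Vec.map suc zs)
zero<suc []       = []
zero<suc (z ∷ zs) = ℕ.z<s ∷ zero<suc zs

suc-< : ∀ {i : Fin n} {zs : Vec (Fin n) m} → VecAll.All (i Fin.<_) zs → VecAll.All (suc i Fin.<_) (Vec.map suc zs)
suc-< []       = []
suc-< (p ∷ ps) = s≤s p ∷ suc-< ps

increasing-suc : ∀ {zs : Vec (Fin n) m} → Increasing zs → Increasing (Vec.map suc zs)
increasing-suc []       = []
increasing-suc (p ∷ ps) = suc-< p ∷ increasing-suc ps

increasing-allFin : ∀ n → Increasing (Vec.allFin n)
increasing-allFin zero    = []
increasing-allFin (suc n) = subst Increasing (sym (allFin-suc n))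
  (zero<suc (Vec.allFin n) ∷ increasing-suc (increasing-allFin n))

suc<⇒ : ∀ {i : Fin n} {zs : Vec (Fin n) m} → VecAll.All (suc i Fin.<_) (Vec.map suc zs) → VecAll.All (i Fin.<_) zs
suc<⇒ {zs = []}     []             = []
suc<⇒ {zs = z ∷ zs} (s≤s p ∷ ps) = p ∷ suc<⇒ ps

increasing-suc⁻ : ∀ {zs : Vec (Fin n) m} → Increasing (Vec.map suc zs) → Increasing zs
increasing-suc⁻ {zs = []}     []       = []
increasing-suc⁻ {zs = z ∷ zs} (p ∷ ps) = suc<⇒ p ∷ increasing-suc⁻ ps

above : ∀ {i : Fin (suc n)} {I : Vec (Fin (suc n)) k} → VecAll.All (i Fin.<_) I → ∃ λ I′ → I ≡ Vec.map suc I′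
above {I = []}        []       = [] , refl
above {I = suc j ∷ I} (p ∷ ps) with above ps
... | I′ , refl = j ∷ I′ , refl

increasing⇒Selects : ∀ n (I : Vec (Fin n) k) → Increasing I → ∃ λ S → ∣ S ∣ ≡ k × Selects (Vec.allFin n) S I
increasing⇒Selects-suc : ∀ n (I : Vec (Fin n) k) → Increasing (Vec.map suc I) →
  ∃ λ S → ∣ S ∣ ≡ k × Selects (Vec.map suc (Vec.allFin n)) S (Vec.map suc I)
increasing⇒Selects-suc n I increasing with increasing⇒Selects n I (increasing-suc⁻ increasing)
... | S , ∣S∣≡k , selects = S , ∣S∣≡k , Selects-map suc selects
increasing⇒Selects zero    []            []       = [] , refl , []
increasing⇒Selects (suc n) []            []       with increasing⇒Selects-suc n [] []
... | S , ∣S∣≡k , selects = outside ∷ S , ∣S∣≡k ,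
  subst (λ zs → Selects zs (outside ∷ S) []) (sym (allFin-suc n)) (skip selects)
increasing⇒Selects (suc n) (zero ∷ I)    (p ∷ ps) with above p
... | I′ , refl with increasing⇒Selects-suc n I′ ps
...   | S , ∣S∣≡k , selects = inside ∷ S , cong suc ∣S∣≡k ,
  subst (λ zs → Selects zs (inside ∷ S) (zero ∷ Vec.map suc I′)) (sym (allFin-suc n)) (take selects)
increasing⇒Selects (suc n) (suc i ∷ I)   (p ∷ ps) with above p
... | I′ , refl with increasing⇒Selects-suc n (i ∷ I′) (p ∷ ps)
...   | S , ∣S∣≡k , selects = outside ∷ S , ∣S∣≡k ,
  subst (λ zs → Selects zs (outside ∷ S) (suc i ∷ Vec.map suc I′)) (sym (allFin-suc n)) (skip selects)

selection : ∀ (zs : Vec A m) (S : Subset m) → ∣ S ∣ ≡ k → ∃ λ (I : Vec A k) → Selects zs S I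
selection []       []            refl = [] , []
selection (z ∷ zs) (inside  ∷ S) refl = Product.map (z ∷_) take (selection zs S refl)
selection (z ∷ zs) (outside ∷ S) eq   = Product.map id skip (selection zs S eq)

-- Uniqueness of expansions

-- The quantity ∣ S ∣ + `height` S is the sum of the positions counted from 1; in this form it
-- equals the `height` of S with a letter put in front.
data Order (S T : Subset m) : Set where
  exceeds : S ≻ T → Order S T
  equal   : S ≡ T → Order S T
  lower   : ∣ S ∣ ℕ.+ height S ℕ.< ∣ T ∣ ℕ.+ height T → Order S T

-- If no final segment contains more elements of S than of T, adding up the inequalities over all
-- final segments compares the sums of positions, strictly unless S and T agree.
order : ∀ (S T : Subset m) → Order S T
order [] [] = equal refl
order (s ∷ S) (t ∷ T) with ∣ t ∷ T ∣ ℕ.<? ∣ s ∷ S ∣ | order S T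
... | yes lt | _            = exceeds (here lt)
... | no _   | exceeds S≻T  = exceeds (there S≻T)
... | no ≮   | lower lt     = lower (ℕ.+-mono-≤-< (ℕ.≮⇒≥ ≮) lt)
... | no ≮   | equal refl   = same-tail s t ≮
  where
  same-tail : ∀ s t → ¬ ∣ t ∷ S ∣ ℕ.< ∣ s ∷ S ∣ → Order (s ∷ S) (t ∷ S)
  same-tail inside  inside  ≮ = equal refl
  same-tail outside outside ≮ = equal refl
  same-tail outside inside  ≮ = lower (ℕ.n<1+n _)
  same-tail inside  outside ≮ = ⊥-elim (≮ (ℕ.n<1+n _))

height-bound : ∀ (S : Subset m) → height S ℕ.≤ m ℕ.* m
height-bound []      = z≤n
height-bound {suc m} (s ∷ S) = ℕ.+-mono-≤ (ℕ.m≤n⇒m≤1+n (Subset.∣p∣≤n S))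
  (ℕ.≤-trans (height-bound S) (ℕ.*-monoʳ-≤ m (ℕ.n≤1+n m)))

⊗-nonZeroDivisor : ∀ {c d : Laurent k n} → NonZeroDivisor c → NonZeroDivisor d → NonZeroDivisor (c ⊗ d)
⊗-nonZeroDivisor {c = c} {d} (nonZeroDivisor c-nzd) (nonZeroDivisor d-nzd) =
  nonZeroDivisor λ {f} eq → d-nzd (c-nzd (≈-trans (≈-sym (⊗-assoc c d f)) eq))

1-nonZeroDivisor : NonZeroDivisor (1ᴸ {k} {n})
1-nonZeroDivisor = nonZeroDivisor λ {f} eq → ≈-trans (≈-sym (⊗-identityˡ f)) eq

∏row-nonZeroDivisor : ∀ {i : Fin n} {js : Vec (Fin n) m} S → VecAll.All (i Fin.<_) js → NonZeroDivisor (∏row i js S)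
∏row-nonZeroDivisor []            []       = 1-nonZeroDivisor
∏row-nonZeroDivisor (inside  ∷ S) (p ∷ ps) = ∏row-nonZeroDivisor S ps
∏row-nonZeroDivisor (outside ∷ S) (p ∷ ps) =
  ⊗-nonZeroDivisor (1⊖y/y-nonZeroDivisor (Fin.<⇒≢ p ∘ sym)) (∏row-nonZeroDivisor S ps)

diagonal-nonZeroDivisor : ∀ {js : Vec (Fin n) m} S → Increasing js → NonZeroDivisor (diagonal js S)
diagonal-nonZeroDivisor []            []       = 1-nonZeroDivisor
diagonal-nonZeroDivisor (inside  ∷ S) (p ∷ ps) = ⊗-nonZeroDivisor (∏row-nonZeroDivisor S p) (diagonal-nonZeroDivisor S ps)
diagonal-nonZeroDivisor (outside ∷ S) (p ∷ ps) = diagonal-nonZeroDivisor S ps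

-- At the fixed point of S, only the diagrams below S contribute.
relation-trivial : ∀ {ℓ k} (c : Subset (ℓ ℕ.+ k) → Laurent 0 (ℓ ℕ.+ k)) →
  (∀ I → Increasing I → ∑ (subsets (ℓ ℕ.+ k)) (λ S → c S ⊗ point {ℓ} {k} I S) ≈ 0ᴸ) →
  ∀ N S → ∣ S ∣ ≡ k → (ℓ ℕ.+ k) ℕ.* (ℓ ℕ.+ k) ℕ.< height S ℕ.+ N → c S ≈ 0ᴸ
relation-trivial c relation zero    S ∣S∣≡k lt = ⊥-elim (ℕ.<⇒≱ lt (ℕ.≤-trans (ℕ.≤-reflexive (ℕ.+-identityʳ (height S))) (height-bound S)))
relation-trivial {ℓ} {k} c relation (suc N) S ∣S∣≡k lt with selection (Vec.allFin (ℓ ℕ.+ k)) S ∣S∣≡k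
... | I , selects = NonZeroDivisor.annihilator (diagonal-nonZeroDivisor S (increasing-allFin (ℓ ℕ.+ k))) (begin
  diagonal (Vec.allFin (ℓ ℕ.+ k)) S ⊗ c S
    ≈⟨ ⊗-comm (diagonal (Vec.allFin (ℓ ℕ.+ k)) S) (c S) ⟩
  c S ⊗ diagonal (Vec.allFin (ℓ ℕ.+ k)) S
    ≈⟨ ⊗-congˡ (c S) (≈-trans (point-size {ℓ} I S ∣S∣≡k) (localise-diagonal {ℓ} {k} _ S ∣S∣≡k ℕ.≤-refl I selects)) ⟨
  c S ⊗ point {ℓ} I S
    ≈⟨ ∑-subsets-single S (λ T → c T ⊗ point {ℓ} I T) others ⟨
  ∑ (subsets (ℓ ℕ.+ k)) (λ T → c T ⊗ point {ℓ} I T)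
    ≈⟨ relation I (Selects-AllPairs selects (increasing-allFin (ℓ ℕ.+ k))) ⟩
  0ᴸ ∎)
  where
  open ≈-Reasoning
  others : ∀ T → T ≢ S → c T ⊗ point {ℓ} I T ≈ 0ᴸ
  others T T≢S = vanish (∣ T ∣ ℕ.≟ k)
    where
    vanish : (d : Dec (∣ T ∣ ≡ k)) → c T ⊗ (does d ⇒ localise I T) ≈ 0ᴸ
    vanish (no _) = ⊗-zeroʳ (c T)
    vanish (yes ∣T∣≡k) with order S T
    ... | exceeds S≻T = ≈-trans (⊗-congˡ (c T)
            (localise-support {ℓ} {k} _ T ∣T∣≡k ℕ.≤-refl S I (Selects⇒Occur selects) S≻T)) (⊗-zeroʳ (c T))
    ... | equal S≡T = ⊥-elim (T≢S (sym S≡T))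
    -- As the sizes agree, T has the greater height, and its coefficient vanishes by the induction
    -- hypothesis.
    ... | lower lower-lt = ≈-trans (⊗-congʳ (localise I T) (relation-trivial {ℓ} c relation N T ∣T∣≡k
            (ℕ.<-≤-trans lt (ℕ.≤-trans (ℕ.≤-reflexive (ℕ.+-suc (height S) N)) (ℕ.+-monoˡ-≤ N
              (ℕ.+-cancelˡ-< k (height S) (height T) (subst₂ (λ a b → a ℕ.+ height S ℕ.< b ℕ.+ height T) ∣S∣≡k ∣T∣≡k lower-lt)))))))
            (⊗-zeroˡ (localise I T))

-- Puzzle sums as the unique coefficients

symmetric-⊗ : Symmetric f → Symmetric g → Symmetric (f ⊗ g)
symmetric-⊗ {f = f} {g} sym-f sym-g π = ≈-trans (hom-⊗ (permuteX-hom π) f g) (⊗-cong (sym-f π) (sym-g π))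

module _ {ℓ k : ℕ} (λ′ μ : Frame k (ℓ ℕ.+ k)) (c : Frame k (ℓ ℕ.+ k) → Laurent 0 (ℓ ℕ.+ k)) where
  private
    n₀ = ℓ ℕ.+ k

    product-side expansion-side : Laurent k n₀
    product-side = dualGrothendieck λ′ ⊗ dualGrothendieck μ
    expansion-side = ∑ (frames k n₀) (λ ν → ι (c ν) ⊗ dualGrothendieck ν)

    dualGrothendieck-symmetric : ∀ (ν : Frame k n₀) → Symmetric (dualGrothendieck ν)
    dualGrothendieck-symmetric (frame S ∣S∣≡k) = dual-symmetric {ℓ} S ∣S∣≡k

    expansion-symmetric : Symmetric expansion-side
    expansion-symmetric π = ≈-trans (hom-∑ (permuteX-hom π) (frames k n₀) (λ ν → ι (c ν) ⊗ dualGrothendieck ν))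
      (∑-cong (frames k n₀) λ ν → symmetric-⊗ {f = ι (c ν)} {dualGrothendieck ν}
        (λ π → permuteX-ι π (c ν)) (dualGrothendieck-symmetric ν) π)

    module _ (I : Vec (Fin n₀) k) where
      specialise-product : specialise I product-side ≈ point {ℓ} I (subset λ′) ⊗ point {ℓ} I (subset μ)
      specialise-product = ≈-trans (hom-⊗ (specialise-hom I) (dualGrothendieck λ′) (dualGrothendieck μ))
        (≈-sym (⊗-cong (point-size {ℓ} I (subset λ′) (size λ′)) (point-size {ℓ} I (subset μ) (size μ))))

      specialise-expansion : specialise I expansion-side ≈ ∑ (subsets n₀) (λ S → ext c S ⊗ point {ℓ} I S)
      specialise-expansion = begin
        specialise I expansion-side
          ≈⟨ hom-∑ (specialise-hom I) (frames k n₀) (λ ν → ι (c ν) ⊗ dualGrothendieck ν) ⟩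
        ∑ (frames k n₀) (λ ν → specialise I (ι (c ν) ⊗ dualGrothendieck ν))
          ≈⟨ (∑-cong (frames k n₀) λ ν → ≈-trans (hom-⊗ (specialise-hom I) (ι (c ν)) (dualGrothendieck ν))
               (⊗-congʳ (specialise I (dualGrothendieck ν)) (specialise-ι I (c ν)))) ⟩
        ∑ (frames k n₀) (λ ν → c ν ⊗ localise I (subset ν))
          ≈⟨ ∑-frames k n₀ (λ ν → c ν ⊗ localise I (subset ν)) ⟩
        ∑ (subsets n₀) (ext (λ ν → c ν ⊗ localise I (subset ν)))
          ≈⟨ (∑-cong (subsets n₀) λ S → split S (∣ S ∣ ℕ.≟ k)) ⟩
        ∑ (subsets n₀) (λ S → ext c S ⊗ point {ℓ} I S) ∎
        where
        open ≈-Reasoning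
        split : ∀ S d → extend (λ ν → c ν ⊗ localise I (subset ν)) S d ≈ extend c S d ⊗ (does d ⇒ localise I S)
        split S (yes _) = ≈-refl
        split S (no _)  = ≈-refl

    puzzle-expansion : ∀ I → Increasing I →
      point {ℓ} I (subset λ′) ⊗ point {ℓ} I (subset μ) ≈
      ∑ (subsets n₀) (λ ν → puzzles-sum (subset λ′) (subset μ) ν ⊗ point {ℓ} I ν)
    puzzle-expansion I increasing with increasing⇒Selects n₀ I increasing
    ... | T , ∣T∣≡k , selects = expansion {ℓ} _ T ∣T∣≡k ℕ.≤-refl I selects (subset λ′) (subset μ) (size λ′) (size μ)

  IsExpansion⇔puzzleSum : IsExpansion λ′ μ c ⇔ (∀ ν → c ν ≈ puzzleSum λ′ μ ν)
  IsExpansion⇔puzzleSum = mk⇔ unique exists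
    where
    open ≈-Reasoning

    unique : IsExpansion λ′ μ c → ∀ ν → c ν ≈ puzzleSum λ′ μ ν
    unique (mk≈ᴷ _ _ vanishes) ν = begin
      c ν                                        ≡⟨ extend-yes c (subset ν) (∣ subset ν ∣ ℕ.≟ k) (size ν) ⟨
      ext c (subset ν)
        ≈⟨ ⊖≈0 {f = ext c (subset ν)} {puzzles-sum (subset λ′) (subset μ) (subset ν)}
             (relation-trivial {ℓ} (λ S → ext c S ⊖ puzzles-sum (subset λ′) (subset μ) S) relation
               -- One more than the bound on heights, so the induction may start from any frame.
               (suc (n₀ ℕ.* n₀)) (subset ν) (size ν) (ℕ.m≤n+m (suc (n₀ ℕ.* n₀)) (height (subset ν)))) ⟩
      puzzles-sum (subset λ′) (subset μ) (subset ν) ≈⟨ puzzleSum-lines λ′ μ ν ⟨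
      puzzleSum λ′ μ ν                           ∎
      where
      relation : ∀ I → Increasing I →
        ∑ (subsets n₀) (λ S → (ext c S ⊖ puzzles-sum (subset λ′) (subset μ) S) ⊗ point {ℓ} I S) ≈ 0ᴸ
      -- Adding P to both sides turns the relation between differences into the equality of two
      -- expansions of the same product at I.
      relation I increasing = ⊕-cancelʳ {h = P} (≈-refl {x = P}) (begin
        ∑ (subsets n₀) (λ S → (ext c S ⊖ puzzles-sum (subset λ′) (subset μ) S) ⊗ point {ℓ} I S) ⊕ P
          ≈⟨ ∑-⊕ (subsets n₀) (λ S → (ext c S ⊖ puzzles-sum (subset λ′) (subset μ) S) ⊗ point {ℓ} I S)
               (λ S → puzzles-sum (subset λ′) (subset μ) S ⊗ point {ℓ} I S) ⟨
        ∑ (subsets n₀) (λ S → (ext c S ⊖ puzzles-sum (subset λ′) (subset μ) S) ⊗ point {ℓ} I S ⊕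
                              puzzles-sum (subset λ′) (subset μ) S ⊗ point {ℓ} I S)
          ≈⟨ (∑-cong (subsets n₀) λ S → collect (ext c S) (puzzles-sum (subset λ′) (subset μ) S) (point {ℓ} I S)) ⟩
        ∑ (subsets n₀) (λ S → ext c S ⊗ point {ℓ} I S)   ≈⟨ specialise-expansion I ⟨
        specialise I expansion-side
          ≈⟨ ⊖≈0 {f = specialise I product-side} {specialise I expansion-side}
               (≈-trans (≈-sym (hom-⊖ (specialise-hom I) product-side expansion-side)) (vanishes I increasing)) ⟨
        specialise I product-side                        ≈⟨ specialise-product I ⟩
        point {ℓ} I (subset λ′) ⊗ point {ℓ} I (subset μ) ≈⟨ puzzle-expansion I increasing ⟩
        0ᴸ ⊕ P                                           ∎)
        where
        P : Laurent 0 n₀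
        P = ∑ (subsets n₀) (λ S → puzzles-sum (subset λ′) (subset μ) S ⊗ point {ℓ} I S)
        collect : ∀ (a b c : Laurent 0 n₀) → (a ⊖ b) ⊗ c ⊕ b ⊗ c ≈ a ⊗ c
        collect = solve 3 (λ a b c → (a :- b) :* c :+ b :* c := a :* c) ≈-refl

    exists : (∀ ν → c ν ≈ puzzleSum λ′ μ ν) → IsExpansion λ′ μ c
    exists eq = mk≈ᴷ
      (symmetric-⊗ {f = dualGrothendieck λ′} {dualGrothendieck μ} (dualGrothendieck-symmetric λ′) (dualGrothendieck-symmetric μ))
      expansion-symmetric
      λ I increasing → ≈-trans (hom-⊖ (specialise-hom I) product-side expansion-side) (≈⇒⊖≈0 (begin
        specialise I product-side                        ≈⟨ specialise-product I ⟩
        point {ℓ} I (subset λ′) ⊗ point {ℓ} I (subset μ) ≈⟨ puzzle-expansion I increasing ⟩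
        ∑ (subsets n₀) (λ S → puzzles-sum (subset λ′) (subset μ) S ⊗ point {ℓ} I S)
          ≈⟨ (∑-cong (subsets n₀) λ S → replace I S (∣ S ∣ ℕ.≟ k)) ⟩
        ∑ (subsets n₀) (λ S → ext c S ⊗ point {ℓ} I S)   ≈⟨ specialise-expansion I ⟨
        specialise I expansion-side                      ∎))
      where
      replace : ∀ I S d → puzzles-sum (subset λ′) (subset μ) S ⊗ (does d ⇒ localise I S) ≈
                          extend c S d ⊗ (does d ⇒ localise I S)
      replace I S (yes ∣S∣≡k) = ⊗-congʳ (localise I S)
        (≈-sym (≈-trans (eq (frame S ∣S∣≡k)) (puzzleSum-lines λ′ μ (frame S ∣S∣≡k))))
      replace I S (no _) = ⊗-zeroʳ (puzzles-sum (subset λ′) (subset μ) S)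

theorem2 : ∀ (k n : ℕ) → k ≤ n → 1 ≤ n →
    (λ′ μ : Frame k n) (c : Frame k n → Laurent 0 n) →
    IsExpansion λ′ μ c ⇔ (∀ ν → c ν ≈ puzzleSum λ′ μ ν)
theorem2 k n k≤n _ = subst
  (λ n → ∀ (λ′ μ : Frame k n) (c : Frame k n → Laurent 0 n) → IsExpansion λ′ μ c ⇔ (∀ ν → c ν ≈ puzzleSum λ′ μ ν))
  (ℕ.m∸n+n≡m k≤n) (IsExpansion⇔puzzleSum {n ℕ.∸ k})
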